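{- Fix an integer $d\ge 1$. There exist $k_d$ and $\beta_d>0$ such that for every constant integer $k\ge k_d$, \[\lim_{n\to\infty}\mathbb{P}\big(\mathfrak{h}(K_{n,d,k})\ge \beta_d\big)=1,\] where $K_{n,d,k}=\bigcup_{i=1}^k T^i_{n,d}$ is the union of $k$ independent $d$-dimensional determinantal hypertrees on the vertex set $[n]$.
   Context: A $d$-dimensional simplicial complex $T$ on vertex set $[n]=\{1,\dots,n\}$ is a hypertree if it has complete $(d-1)$-skeleton, has exactly $\binom{n-1}{d}$ faces of dimension $d$, and its integral homology group $H_{d-1}(T)$ is finite. By Kalai's formula $\sum_T |H_{d-1}(T)|^2=n^{\binom{n-2}{d}}$ (sum over all hypertrees on $[n]$). The determinantal hypertree $T_{n,d}$ is the random hypertree with $\mathbb{P}(T_{n,d}=T)=|H_{d-1}(T)|^2/n^{\binom{n-2}{d}}$. $T^1_{n,d},\dots,T^k_{n,d}$ are i.i.d. copies of $T_{n,d}$, and $K_{n,d,k}$ is the complex with complete $(d-1)$-skeleton on $[n]$ whose $d$-faces are the union of the $d$-faces of the $T^i_{n,d}$. Coboundary expansion: for a $d$-dimensional complex $K$ and $0\le i\le d$, let $K(i)$ be its set of $i$-faces, $C^i(K,\mathbb{F}_2)$ the $\mathbb{F}_2$-valued functions on $K(i)$, $\delta_i:C^i(K,\mathbb{F}_2)\to C^{i+1}(K,\mathbb{F}_2)$ the usual coboundary map, and $B^i(K,\mathbb{F}_2)=\operatorname{Im}\delta_{i-1}$. The weight of an $i$-face $\sigma$ is $w(\sigma)=\frac{|\{\tau\in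 K(d):\sigma\subset\tau\}|}{\binom{d+1}{i+1}|K(d)|}$; for $f\in C^i(K,\mathbb{F}_2)$, $\|f\|=\sum_{\sigma\in\operatorname{supp} f}w(\sigma)$, and $\|f+B^i\|=\min_{g\in f+B^i(K,\mathbb{F}_2)}\|g\|$. For $0\le i\le d-1$, $\mathfrak{h}_i(K)=\min_{f\in C^i(K,\mathbb{F}_2)\setminus B^i(K,\mathbb{F}_2)}\frac{\|\delta_i f\|}{\|f+B^i(K,\mathbb{F}_2)\|}$, and $\mathfrak{h}(K)=\min_{0\le i\le d-1}\mathfrak{h}_i(K)$. -}

module Defs where

open import Data.Bool using (Bool; true; false; _∧_; _∨_; not; if_then_else_; _xor_)
open import Data.Nat using (ℕ; zero; suc; _+_; _*_; _^_; _≤_; _∸_; _⊓_; _≡ᵇ_; _≤ᵇ_; _%_)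
open import Data.Nat.Combinatorics using (_C_)
open import Data.List using (List; []; _∷_; map; _++_; foldr; length; null; upTo)
open import Data.Bool.ListAction using (all; any)
open import Data.Nat.ListAction using (sum)
open import Data.List.Membership.Propositional using (_∈_)
open import Data.Vec using (Vec; []; _∷_; lookup)
import Data.Vec.Properties as VecP
open import Data.Fin using (Fin)
open import Data.Fin.Subset using (Subset; ∣_∣)
open import Data.Fin.Subset.Properties using (_⊆?_)
open import Data.Integer as ℤ using (ℤ)
import Data.Bool.Properties as BoolP
open import Data.Product using (Σ; _×_; ∃)
open import Data.Sum using (_⊎_)
open import Relation.Nullary using (¬_)
open import Relation.Nullary.Decidable using (⌊_⌋)
open import Relation.Binary.PropositionalEquality using (_≡_; _≢_)

-- Generic finite-set helpers.
-- Vertex set [n] is Fin n; a face with s vertices is a Subset n of size s.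
-- The unique subset of size 0 (the empty face) plays the role of the
-- (-1)-face, so chains/cochains are the augmented ones.

bfilter : {A : Set} → (A → Bool) → List A → List A
bfilter p [] = []
bfilter p (x ∷ xs) = if p x then x ∷ bfilter p xs else bfilter p xs

countB : {A : Set} → (A → Bool) → List A → ℕ
countB p xs = length (bfilter p xs)

sublists : {A : Set} → List A → List (List A)
sublists [] = [] ∷ []
sublists (x ∷ xs) = map (x ∷_) (sublists xs) ++ sublists xs

allSubsets : (n : ℕ) → List (Subset n)
allSubsets zero = [] ∷ []
allSubsets (suc n) = map (true ∷_) (allSubsets n) ++ map (false ∷_) (allSubsets n)

sizeLevel : (n s : ℕ) → List (Subset n)
sizeLevel n s = bfilter (λ σ → ∣ σ ∣ ≡ᵇ s) (allSubsets n)

_≟ₛ_ : {n : ℕ} → (σ τ : Subset n) → Bool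
σ ≟ₛ τ = ⌊ VecP.≡-dec BoolP._≟_ σ τ ⌋

_⊆ᵇ_ : {n : ℕ} → Subset n → Subset n → Bool
σ ⊆ᵇ τ = ⌊ σ ⊆? τ ⌋

memb : {n : ℕ} → Subset n → List (Subset n) → Bool
memb σ F = any (λ τ → σ ≟ₛ τ) F

oddB : ℕ → Bool
oddB m = (m % 2) ≡ᵇ 1

-- A d-complex with complete (d-1)-skeleton on [n] is given by its list
-- Kd of d-faces (subsets of size d+1).  Its faces with s vertices:

level : (n d : ℕ) → List (Subset n) → ℕ → List (Subset n)
level n d Kd s = if s ≡ᵇ suc d then Kd else sizeLevel n s

-- F₂-cochains, represented by their supports (a sublist of a level).

-- coboundary: T is the target level (faces with one more vertex)
δ : {n : ℕ} → List (Subset n) → List (Subset n) → List (Subset n)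
δ T F = bfilter (λ τ → oddB (countB (λ σ → σ ⊆ᵇ τ) F)) T

plusC : {n : ℕ} → List (Subset n) → List (Subset n) → List (Subset n) → List (Subset n)
plusC L F G = bfilter (λ σ → memb σ F xor memb σ G) L

degK : {n : ℕ} → List (Subset n) → Subset n → ℕ
degK Kd σ = countB (λ τ → σ ⊆ᵇ τ) Kd

-- D(F) = Σ_{σ ∈ supp F} deg σ.  For an i-cochain f (s = i+1 vertices),
-- ‖f‖ = D(f) / (C(d+1, s) · |K(d)|).
Dsum : {n : ℕ} → List (Subset n) → List (Subset n) → ℕ
Dsum Kd F = sum (map (degK Kd) F)

module Expansion (n d : ℕ) (Kd : List (Subset n)) (p q : ℕ) where
  lev : ℕ → List (Subset n)
  lev = level n d Kd

  -- the coset f + B^i, where i = s-1 and B^i = Im δ_{i-1}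
  -- (augmented: C^{-1} = F₂ on the empty face, so B^0 = {0, 1})
  coset : ℕ → List (Subset n) → List (List (Subset n))
  coset s F = map (λ g → plusC (lev s) F (δ (lev s) g)) (sublists (lev (s ∸ 1)))

  inB : ℕ → List (Subset n) → Bool
  inB s F = any null (coset s F)

  -- min_{g ∈ f + B^i} D(g)   (f itself lies in the coset)
  minD : ℕ → List (Subset n) → ℕ
  minD s F = foldr _⊓_ (Dsum Kd F) (map (Dsum Kd) (coset s F))

  -- ‖δ f‖ ≥ (p/q) ‖f + B^i‖, cleared of the (common, positive) denominators:
  -- D(δf)/(C(d+1,s+1)M) ≥ (p/q) · minD/(C(d+1,s)M)
  okC : ℕ → List (Subset n) → Bool
  okC s F = inB s F ∨
    ((p * ((suc d) C (suc s)) * minD s F) ≤ᵇ (q * ((suc d) C s) * Dsum Kd (δ (lev (suc s)) F)))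

  -- 𝔥(K) ≥ p/q : for every 0 ≤ i ≤ d-1 (s = i+1 ∈ {1..d}) and every
  -- f ∈ C^i ∖ B^i, ‖δ_i f‖ ≥ (p/q)‖f + B^i‖.
  expands : Bool
  expands = all (λ s → all (okC s) (sublists (lev s))) (map suc (upTo d))

-- exponent of the sign of the face ρ = σ ∖ {v} in ∂σ : #{u ∈ σ : u < v}
signExp : {n : ℕ} → Subset n → Subset n → ℕ
signExp [] [] = 0
signExp (true ∷ σ) (true ∷ ρ) = suc (signExp σ ρ)
signExp (true ∷ σ) (false ∷ ρ) = 0
signExp (false ∷ σ) (_ ∷ ρ) = signExp σ ρ

sgn : {n : ℕ} → Subset n → Subset n → ℤ
sgn σ ρ = if oddB (signExp σ ρ) then ℤ.-1ℤ else ℤ.1ℤ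

Chain : ℕ → Set
Chain n = Subset n → ℤ

-- boundary of a chain supported on level L (faces with s vertices),
-- evaluated at a face ρ with s-1 vertices
∂ : {n : ℕ} → List (Subset n) → Chain n → Chain n
∂ L c ρ = foldr ℤ._+_ ℤ.0ℤ (map (λ σ → if ρ ⊆ᵇ σ then sgn σ ρ ℤ.* c σ else ℤ.0ℤ) L)

IsCycle : {n : ℕ} → List (Subset n) → List (Subset n) → Chain n → Set
IsCycle L Lb c = ∀ ρ → ρ ∈ Lb → ∂ L c ρ ≡ ℤ.0ℤ

Homologous : {n : ℕ} → List (Subset n) → List (Subset n) → Chain n → Chain n → Set
Homologous {n} Lu L c c' = ∃ λ (a : Chain n) → ∀ σ → σ ∈ L → ∂ Lu a σ ≡ c σ ℤ.- c' σ

-- the homology group (cycles on L)/(boundaries from Lu) is finite of order m: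
-- there is a complete system of m pairwise non-homologous representatives
HasOrder : {n : ℕ} → List (Subset n) → List (Subset n) → List (Subset n) → ℕ → Set
HasOrder {n} Lb L Lu m = Σ (Vec (Chain n) m) λ cs →
  (∀ i → IsCycle L Lb (lookup cs i)) ×
  (∀ i j → i ≢ j → ¬ Homologous Lu L (lookup cs i) (lookup cs j)) ×
  (∀ c → IsCycle L Lb c → ∃ λ i → Homologous Lu L c (lookup cs i))

HomologyOrder : (n d : ℕ) → List (Subset n) → ℕ → Set
HomologyOrder n d Kd m = HasOrder (sizeLevel n (d ∸ 1)) (sizeLevel n d) Kd m

IsHypertree : (n d : ℕ) → List (Subset n) → Set
IsHypertree n d Kd = (length Kd ≡ (n ∸ 1) C d) × ∃ λ m → HomologyOrder n d Kd m

dComplexes : (n d : ℕ) → List (List (Subset n))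
dComplexes n d = sublists (sizeLevel n (suc d))

IsDetWeight : (n d : ℕ) → (List (Subset n) → ℕ) → Set
IsDetWeight n d w = ∀ Kd → Kd ∈ dComplexes n d →
  (Σ ℕ λ m → (length Kd ≡ (n ∸ 1) C d) × HomologyOrder n d Kd m × (w Kd ≡ m * m))
  ⊎ (¬ IsHypertree n d Kd × (w Kd ≡ 0))

unionD : (n d : ℕ) → List (Subset n) → List (Subset n) → List (Subset n)
unionD n d A B = bfilter (λ σ → memb σ A ∨ memb σ B) (sizeLevel n (suc d))

goodWeight : (n d p q : ℕ) → (List (Subset n) → ℕ) → ℕ → List (Subset n) → ℕ
goodWeight n d p q w zero acc = if Expansion.expands n d acc p q then 1 else 0
goodWeight n d p q w (suc k) acc =
  sum (map (λ T → w T * goodWeight n d p q w k (unionD n d acc T)) (dComplexes n d))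

-- P(𝔥(K_{n,d,k}) ≥ p/q) = probNum / probDen
probNum : (n d p q : ℕ) → (List (Subset n) → ℕ) → ℕ → ℕ
probNum n d p q w k = goodWeight n d p q w k []

probDen : (n d k : ℕ) → ℕ
probDen n d k = n ^ (k * ((n ∸ 2) C d))

{-# OPTIONS --safe #-}
{-
The weight |H(T)|² is the square of a maximal minor of the reduced boundary
matrix, i.e. of a coefficient of the wedge ω of its rows in a fermionic Fock
space whose modes are the d-faces.  The canonical anticommutation relations give
Kalai's formula (a triangular Gram matrix) and, since n times the projection onto
the row space is ∂ᵗ∂, the bounds P(S ⊆ T) ≤ p^|S| and P(S ∩ T = ∅) ≤ (1-p)^|S|
with p = (d+1)/n, hence Chernoff bounds in both directions.

With high probability no face lies in more than d+1 of the trees and all faces of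
dimension below d-1 have degree of the expected order; coning then gives expansion
in dimensions below d-1.  In dimension d-1 replace the cochain by a representative
S of least cardinality in its coset, which has at least n|S|/(d+1) odd faces in the
full simplex.  If S violates expansion, delete members that lie in few even faces:
this keeps S violating and of least cardinality, and in the end every member of S
lies in at least k/3 even faces of the trees.  For one S this has probability at
most (ε^|S| ∏ deg_S(σ)/n)^{ck}, the degrees being taken inside S in the adjacency
graph of (d-1)-faces, because an even face through σ contains a neighbour of σ in S.
The union bound over S converges since ∑_{|S|=a} ∏ (deg_S(σ)/Cn)^d is at most (d+1)^a:
deleting a random member of S and the arithmetic–geometric mean inequality give a
recursion in a.
-}

module Submission where

open import Defs
open import Data.Bool using (Bool; true; false; _∧_; _∨_; not; if_then_else_; _xor_)
open import Data.Nat
open import Data.Nat.Properties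
open import Data.Integer as ℤ using (ℤ; 0ℤ; 1ℤ; -1ℤ) renaming (+_ to pos; _+_ to _+ᶻ_; _*_ to _*ᶻ_; -_ to -ᶻ_; _-_ to _-ᶻ_; ∣_∣ to ∣_∣ᶻ)
import Data.Integer.Properties as ℤP
open import Data.Integer.Tactic.RingSolver using () renaming (solve-∀ to ringℤ)
open import Data.Nat.Tactic.RingSolver using () renaming (solve-∀ to ringℕ)
open import Data.List using (List; []; _∷_; map; _++_; foldr; length; upTo)
import Data.List.Properties as ListP
open import Data.Nat.ListAction using (sum)
open import Data.Vec using (Vec; []; _∷_; lookup)
open import Data.Fin using (Fin)
open import Data.Fin.Subset using (Subset; ∣_∣)
open import Data.Nat.Combinatorics using (_C_; nCk+nC[k+1]≡[n+1]C[k+1])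
open import Data.Product using (Σ; _×_; ∃; _,_; proj₁; proj₂)
open import Data.Sum using (_⊎_; inj₁; inj₂)
open import Data.Empty using (⊥; ⊥-elim)
open import Function using (_∘_; id)
open import Relation.Nullary using (¬_; Dec; yes; no)
open import Relation.Nullary.Decidable using (does; isYes≗does; _×-dec_)
open import Relation.Binary.PropositionalEquality
open import Data.List.Relation.Unary.Any using (here; there)
open import Data.List.Membership.Propositional using (_∈_; _∉_)
import Data.List.Relation.Unary.All as All
open All using (All; []; _∷_)
open import Data.List.Relation.Unary.AllPairs using (AllPairs; []; _∷_)
open import Data.List.Relation.Unary.Unique.Propositional using (Unique)
import Data.List.Membership.Propositional.Properties as MemP
import Data.List.Relation.Unary.Unique.Propositional.Properties as UniqueP
import Data.Vec.Properties as VecP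
import Data.Bool.Properties as BoolP
import Data.Integer.DivMod as ℤD
import Data.Fin as Fin
import Data.Fin.Properties as FinP
import Data.Vec as Vec
open import Data.Unit using (⊤; tt)
open import Induction.WellFounded using (Acc; acc)
open import Data.Nat.Induction using (<-wellFounded)
open import Data.Nat.DivMod using ([m+n]%n≡m%n; m≡m%n+[m/n]*n; m%n<n; m/n*n≤m; m≥n⇒m/n>0)
open import Data.Fin.Subset.Properties using (_⊆?_)
open import Data.Bool.ListAction using (all)

-- The obstacle is the number of sets `S`. For small a there are roughly n^(d·a) sets of a faces of
-- dimension d-1, while a Chernoff bound for one `S` is only exponential in k·a and contains no
-- power of n, so with k fixed a plain union bound diverges. What rescues it is that most sets are
-- spread out: a member with few neighbours in `S` can hardly lie in even faces, and the resulting
-- small factor pays for the freedom of choosing that member. The gain must come from every member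
-- at once, hence the deletions before the union bound; they must not destroy minimality in the
-- coset, the only source of odd faces.
--
-- All estimates live in ℕ and ℤ. Probabilities carry the denominator Z^k, where Z is the total
-- weight, fractional exponents are cleared by raising inequalities to powers, and roots are
-- replaced by least integers. The Fock space fits this style: its relations are polynomial
-- identities proved one mode at a time, so that no minor has to be expanded and no orthonormal
-- basis or real eigenvalue occurs.

∑ : {A : Set} → List A → (A → ℕ) → ℕ
∑ [] f = 0
∑ (x ∷ xs) f = f x + ∑ xs f

∑ᶻ : {A : Set} → List A → (A → ℤ) → ℤ
∑ᶻ xs f = foldr _+ᶻ_ 0ℤ (map f xs)

∑ᶻ-cong : {A : Set} (xs : List A) {f g : A → ℤ} → (∀ x → f x ≡ g x) → ∑ᶻ xs f ≡ ∑ᶻ xs g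
∑ᶻ-cong [] h = refl
∑ᶻ-cong (x ∷ xs) h = cong₂ _+ᶻ_ (h x) (∑ᶻ-cong xs h)

∑ᶻ-cong∈ : {A : Set} (xs : List A) {f g : A → ℤ} → (∀ x → x ∈ xs → f x ≡ g x) → ∑ᶻ xs f ≡ ∑ᶻ xs g
∑ᶻ-cong∈ [] h = refl
∑ᶻ-cong∈ (x ∷ xs) h = cong₂ _+ᶻ_ (h x (here refl)) (∑ᶻ-cong∈ xs (λ y m → h y (there m)))

∑ᶻ-zero : {A : Set} (xs : List A) {f : A → ℤ} → (∀ x → x ∈ xs → f x ≡ 0ℤ) → ∑ᶻ xs f ≡ 0ℤ
∑ᶻ-zero [] h = refl
∑ᶻ-zero (x ∷ xs) h = cong₂ _+ᶻ_ (h x (here refl)) (∑ᶻ-zero xs (λ y m → h y (there m)))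

∑ᶻ-++ : {A : Set} (xs ys : List A) (f : A → ℤ) → ∑ᶻ (xs ++ ys) f ≡ ∑ᶻ xs f +ᶻ ∑ᶻ ys f
∑ᶻ-++ [] ys f = sym (ℤP.+-identityˡ _)
∑ᶻ-++ (x ∷ xs) ys f = trans (cong (f x +ᶻ_) (∑ᶻ-++ xs ys f)) (sym (ℤP.+-assoc (f x) _ _))

∑ᶻ-map : {A B : Set} (g : A → B) (xs : List A) (f : B → ℤ) → ∑ᶻ (map g xs) f ≡ ∑ᶻ xs (f ∘ g)
∑ᶻ-map g [] f = refl
∑ᶻ-map g (x ∷ xs) f = cong (f (g x) +ᶻ_) (∑ᶻ-map g xs f)

∑ᶻ-+ : {A : Set} (xs : List A) (f g : A → ℤ) → ∑ᶻ xs (λ x → f x +ᶻ g x) ≡ ∑ᶻ xs f +ᶻ ∑ᶻ xs g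
∑ᶻ-+ [] f g = refl
∑ᶻ-+ (x ∷ xs) f g = trans (cong ((f x +ᶻ g x) +ᶻ_) (∑ᶻ-+ xs f g)) (lem (f x) (g x) _ _)
  where lem : ∀ a b c d → (a +ᶻ b) +ᶻ (c +ᶻ d) ≡ (a +ᶻ c) +ᶻ (b +ᶻ d)
        lem = ringℤ

∑ᶻ-* : {A : Set} (xs : List A) (k : ℤ) (f : A → ℤ) → ∑ᶻ xs (λ x → k *ᶻ f x) ≡ k *ᶻ ∑ᶻ xs f
∑ᶻ-* [] k f = sym (ℤP.*-zeroʳ k)
∑ᶻ-* (x ∷ xs) k f = trans (cong ((k *ᶻ f x) +ᶻ_) (∑ᶻ-* xs k f)) (sym (ℤP.*-distribˡ-+ k (f x) _))

-- Faces with a given number of vertices.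

lv : (n s : ℕ) → List (Subset n)
lv zero zero = [] ∷ []
lv zero (suc s) = []
lv (suc n) zero = map (false ∷_) (lv n zero)
lv (suc n) (suc s) = map (true ∷_) (lv n s) ++ map (false ∷_) (lv n (suc s))

bfilter-++ : {A : Set} (p : A → Bool) (xs ys : List A) → bfilter p (xs ++ ys) ≡ bfilter p xs ++ bfilter p ys
bfilter-++ p [] ys = refl
bfilter-++ p (x ∷ xs) ys with p x
... | true = cong (x ∷_) (bfilter-++ p xs ys)
... | false = bfilter-++ p xs ys

bfilter-map : {A B : Set} (p : B → Bool) (g : A → B) (xs : List A) → bfilter p (map g xs) ≡ map g (bfilter (p ∘ g) xs)
bfilter-map p g [] = refl
bfilter-map p g (x ∷ xs) with p (g x)
... | true = cong (g x ∷_) (bfilter-map p g xs)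
... | false = bfilter-map p g xs

bfilter-none : {A : Set} (xs : List A) → bfilter (λ _ → false) xs ≡ []
bfilter-none [] = refl
bfilter-none (x ∷ xs) = bfilter-none xs

-- `lv` recurses on the first vertex instead of filtering all subsets, so a sum over a level splits
-- by whether vertex 0 belongs to the face. Most inductions on faces below use that split.
sizeLevel≡lv : ∀ n s → sizeLevel n s ≡ lv n s
sizeLevel≡lv zero zero = refl
sizeLevel≡lv zero (suc s) = refl
sizeLevel≡lv (suc n) zero =
  trans (bfilter-++ _ (map (true ∷_) (allSubsets n)) _)
  (trans (cong₂ _++_ (trans (bfilter-map _ _ (allSubsets n)) (cong (map _) (bfilter-none (allSubsets n))))
                     (bfilter-map _ _ (allSubsets n)))
         (cong (map (false ∷_)) (sizeLevel≡lv n zero)))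
sizeLevel≡lv (suc n) (suc s) =
  trans (bfilter-++ _ (map (true ∷_) (allSubsets n)) _)
  (cong₂ _++_ (trans (bfilter-map _ _ (allSubsets n)) (cong (map (true ∷_)) (sizeLevel≡lv n s)))
              (trans (bfilter-map _ _ (allSubsets n)) (cong (map (false ∷_)) (sizeLevel≡lv n (suc s)))))

length-lv : ∀ n s → length (lv n s) ≡ n C s
length-lv zero zero = refl
length-lv zero (suc s) = refl
length-lv (suc n) zero = trans (ListP.length-map _ (lv n zero)) (length-lv n zero)
length-lv (suc n) (suc s) =
  trans (ListP.length-++ (map (true ∷_) (lv n s)))
  (trans (cong₂ _+_ (trans (ListP.length-map _ (lv n s)) (length-lv n s))
                    (trans (ListP.length-map _ (lv n (suc s))) (length-lv n (suc s))))
         (nCk+nC[k+1]≡[n+1]C[k+1] n s))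

-- Integral boundary and coboundary on ungraded functions; vertex 0 is the head of the vector.

Fn : ℕ → Set
Fn n = Subset n → ℤ

infix 30 _ᵗ _ᶠ

_ᵗ _ᶠ : ∀ {n} {A : Set} → (Subset (suc n) → A) → Subset n → A
(f ᵗ) σ = f (true ∷ σ)
(f ᶠ) σ = f (false ∷ σ)

bd : ∀ {n} → Fn n → Fn n
bd c [] = 0ℤ
bd c (true ∷ ρ) = -ᶻ bd (c ᵗ) ρ
bd c (false ∷ ρ) = c (true ∷ ρ) +ᶻ bd (c ᶠ) ρ

cobd : ∀ {n} → Fn n → Fn n
cobd c [] = 0ℤ
cobd c (true ∷ τ) = c (false ∷ τ) +ᶻ -ᶻ cobd (c ᵗ) τ
cobd c (false ∷ τ) = cobd (c ᶠ) τ

bd-cong : ∀ {n} {c c' : Fn n} → (∀ σ → c σ ≡ c' σ) → ∀ ρ → bd c ρ ≡ bd c' ρ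
bd-cong h [] = refl
bd-cong h (true ∷ ρ) = cong -ᶻ_ (bd-cong (λ σ → h (true ∷ σ)) ρ)
bd-cong h (false ∷ ρ) = cong₂ _+ᶻ_ (h (true ∷ ρ)) (bd-cong (λ σ → h (false ∷ σ)) ρ)

cobd-cong : ∀ {n} {c c' : Fn n} → (∀ σ → c σ ≡ c' σ) → ∀ ρ → cobd c ρ ≡ cobd c' ρ
cobd-cong h [] = refl
cobd-cong h (true ∷ ρ) = cong₂ (λ x y → x +ᶻ -ᶻ y) (h (false ∷ ρ)) (cobd-cong (λ σ → h (true ∷ σ)) ρ)
cobd-cong h (false ∷ ρ) = cobd-cong (λ σ → h (false ∷ σ)) ρ

private
  l1 : ∀ k a b → k *ᶻ -ᶻ a +ᶻ -ᶻ b ≡ -ᶻ (k *ᶻ a +ᶻ b)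
  l1 = ringℤ
  l2 : ∀ k a b c d → (k *ᶻ a +ᶻ b) +ᶻ (k *ᶻ c +ᶻ d) ≡ k *ᶻ (a +ᶻ c) +ᶻ (b +ᶻ d)
  l2 = ringℤ
  l3 : ∀ k a b c d → (k *ᶻ a +ᶻ b) +ᶻ -ᶻ (k *ᶻ c +ᶻ d) ≡ k *ᶻ (a +ᶻ -ᶻ c) +ᶻ (b +ᶻ -ᶻ d)
  l3 = ringℤ
  l4 : ∀ k → k *ᶻ 0ℤ +ᶻ 0ℤ ≡ 0ℤ
  l4 = ringℤ

bd-lin : ∀ {n} k (c c' : Fn n) ρ → bd (λ σ → k *ᶻ c σ +ᶻ c' σ) ρ ≡ k *ᶻ bd c ρ +ᶻ bd c' ρ
bd-lin k c c' [] = sym (l4 k)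
bd-lin k c c' (true ∷ ρ) = trans (cong -ᶻ_ (bd-lin k _ _ ρ)) (sym (l1 k _ _))
bd-lin k c c' (false ∷ ρ) = trans (cong ((k *ᶻ c (true ∷ ρ) +ᶻ c' (true ∷ ρ)) +ᶻ_) (bd-lin k (c ᶠ) (c' ᶠ) ρ))
  (l2 k (c (true ∷ ρ)) (c' (true ∷ ρ)) (bd (c ᶠ) ρ) (bd (c' ᶠ) ρ))

cobd-lin : ∀ {n} k (c c' : Fn n) ρ → cobd (λ σ → k *ᶻ c σ +ᶻ c' σ) ρ ≡ k *ᶻ cobd c ρ +ᶻ cobd c' ρ
cobd-lin k c c' [] = sym (l4 k)
cobd-lin k c c' (true ∷ ρ) = trans (cong (λ z → (k *ᶻ c (false ∷ ρ) +ᶻ c' (false ∷ ρ)) +ᶻ -ᶻ z) (cobd-lin k (c ᵗ) (c' ᵗ) ρ))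
  (l3 k (c (false ∷ ρ)) (c' (false ∷ ρ)) (cobd (c ᵗ) ρ) (cobd (c' ᵗ) ρ))
cobd-lin k c c' (false ∷ ρ) = cobd-lin k _ _ ρ

bd-0 : ∀ {n} (c : Fn n) → (∀ σ → c σ ≡ 0ℤ) → ∀ ρ → bd c ρ ≡ 0ℤ
bd-0 c h [] = refl
bd-0 c h (true ∷ ρ) = cong -ᶻ_ (bd-0 _ (λ σ → h (true ∷ σ)) ρ)
bd-0 c h (false ∷ ρ) = cong₂ _+ᶻ_ (h (true ∷ ρ)) (bd-0 _ (λ σ → h (false ∷ σ)) ρ)

cobd-0 : ∀ {n} (c : Fn n) → (∀ σ → c σ ≡ 0ℤ) → ∀ ρ → cobd c ρ ≡ 0ℤ
cobd-0 c h [] = refl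
cobd-0 c h (true ∷ ρ) = cong₂ (λ x y → x +ᶻ -ᶻ y) (h (false ∷ ρ)) (cobd-0 _ (λ σ → h (true ∷ σ)) ρ)
cobd-0 c h (false ∷ ρ) = cobd-0 _ (λ σ → h (false ∷ σ)) ρ

bd-neg : ∀ {n} (c : Fn n) ρ → bd (λ σ → -ᶻ c σ) ρ ≡ -ᶻ bd c ρ
bd-neg c [] = refl
bd-neg c (true ∷ ρ) = cong -ᶻ_ (bd-neg (c ᵗ) ρ)
bd-neg c (false ∷ ρ) = trans (cong (-ᶻ c (true ∷ ρ) +ᶻ_) (bd-neg (c ᶠ) ρ)) (sym (ℤP.neg-distrib-+ (c (true ∷ ρ)) _))

bd-+ : ∀ {n} (c c' : Fn n) ρ → bd (λ σ → c σ +ᶻ c' σ) ρ ≡ bd c ρ +ᶻ bd c' ρ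
bd-+ c c' ρ = trans (bd-cong (λ σ → cong (_+ᶻ c' σ) (sym (ℤP.*-identityˡ (c σ)))) ρ)
  (trans (bd-lin 1ℤ c c' ρ) (cong (_+ᶻ bd c' ρ) (ℤP.*-identityˡ (bd c ρ))))

cobd-neg : ∀ {n} (c : Fn n) ρ → cobd (λ σ → -ᶻ c σ) ρ ≡ -ᶻ cobd c ρ
cobd-neg c [] = refl
cobd-neg c (true ∷ ρ) = trans (cong (λ z → -ᶻ c (false ∷ ρ) +ᶻ -ᶻ z) (cobd-neg (c ᵗ) ρ)) (sym (ℤP.neg-distrib-+ (c (false ∷ ρ)) _))
cobd-neg c (false ∷ ρ) = cobd-neg (c ᶠ) ρ

cobd-+ : ∀ {n} (c c' : Fn n) ρ → cobd (λ σ → c σ +ᶻ c' σ) ρ ≡ cobd c ρ +ᶻ cobd c' ρ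
cobd-+ c c' ρ = trans (cobd-cong (λ σ → cong (_+ᶻ c' σ) (sym (ℤP.*-identityˡ (c σ)))) ρ)
  (trans (cobd-lin 1ℤ c c' ρ) (cong (_+ᶻ cobd c' ρ) (ℤP.*-identityˡ (cobd c ρ))))

bd-bd : ∀ {n} (c : Fn n) ρ → bd (bd c) ρ ≡ 0ℤ
bd-bd c [] = refl
bd-bd c (true ∷ ρ) = cong -ᶻ_ (trans (bd-neg (bd (c ᵗ)) ρ) (cong -ᶻ_ (bd-bd (c ᵗ) ρ)))
bd-bd c (false ∷ ρ) = trans (cong (-ᶻ bd (c ᵗ) ρ +ᶻ_)
   (trans (bd-+ (c ᵗ) (bd (c ᶠ)) ρ) (cong (bd (c ᵗ) ρ +ᶻ_) (bd-bd (c ᶠ) ρ))))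
   (lem (bd (c ᵗ) ρ))
  where lem : ∀ a → -ᶻ a +ᶻ (a +ᶻ 0ℤ) ≡ 0ℤ
        lem = ringℤ

cobd-cobd : ∀ {n} (c : Fn n) ρ → cobd (cobd c) ρ ≡ 0ℤ
cobd-cobd c [] = refl
cobd-cobd c (true ∷ ρ) = trans (cong (λ z → cobd (c ᶠ) ρ +ᶻ -ᶻ z)
   (trans (cobd-+ (c ᶠ) _ ρ) (cong (cobd (c ᶠ) ρ +ᶻ_)
      (trans (cobd-neg (cobd (c ᵗ)) ρ) (cong -ᶻ_ (cobd-cobd (c ᵗ) ρ))))))
   (lem (cobd (c ᶠ) ρ))
  where lem : ∀ a → a +ᶻ -ᶻ (a +ᶻ -ᶻ 0ℤ) ≡ 0ℤ
        lem = ringℤ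
cobd-cobd c (false ∷ ρ) = cobd-cobd (c ᶠ) ρ

-- The Laplacian of the full augmented simplex: removing and restoring a vertex of ρ, or adding and
-- removing one outside it, gives `c ρ` once for each of the n vertices, and exchanges of two
-- vertices cancel. In the induction vertex 0 supplies one copy of `c`.
bd-cobd : ∀ {n} (c : Fn n) ρ → bd (cobd c) ρ +ᶻ cobd (bd c) ρ ≡ pos n *ᶻ c ρ
bd-cobd c [] = refl
bd-cobd {suc n} c (true ∷ ρ) = trans
  (cong₂ (λ x y → -ᶻ x +ᶻ (c (true ∷ ρ) +ᶻ bd (c ᶠ) ρ +ᶻ -ᶻ y))
    (trans (bd-+ (c ᶠ) _ ρ) (cong (bd (c ᶠ) ρ +ᶻ_) (bd-neg (cobd (c ᵗ)) ρ)))
    (cobd-neg (bd (c ᵗ)) ρ))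
  (trans (lem (bd (c ᶠ) ρ) (bd (cobd (c ᵗ)) ρ) (c (true ∷ ρ)) (cobd (bd (c ᵗ)) ρ))
  (trans (cong (c (true ∷ ρ) +ᶻ_) (bd-cobd (c ᵗ) ρ)) (lem2 (c (true ∷ ρ)) (pos n))))
  where lem : ∀ a b x y → -ᶻ (a +ᶻ -ᶻ b) +ᶻ (x +ᶻ a +ᶻ -ᶻ (-ᶻ y)) ≡ x +ᶻ (b +ᶻ y)
        lem = ringℤ
        lem2 : ∀ x m → x +ᶻ m *ᶻ x ≡ (1ℤ +ᶻ m) *ᶻ x
        lem2 = ringℤ
bd-cobd {suc n} c (false ∷ ρ) = trans
  (cong (λ y → c (false ∷ ρ) +ᶻ -ᶻ cobd (c ᵗ) ρ +ᶻ bd (cobd (c ᶠ)) ρ +ᶻ y)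
     (cobd-+ (c ᵗ) (bd (c ᶠ)) ρ))
  (trans (lem (c (false ∷ ρ)) (cobd (c ᵗ) ρ) (bd (cobd (c ᶠ)) ρ) (cobd (bd (c ᶠ)) ρ))
  (trans (cong (c (false ∷ ρ) +ᶻ_) (bd-cobd (c ᶠ) ρ)) (lem2 (c (false ∷ ρ)) (pos n))))
  where lem : ∀ x a b y → x +ᶻ -ᶻ a +ᶻ b +ᶻ (a +ᶻ y) ≡ x +ᶻ (b +ᶻ y)
        lem = ringℤ
        lem2 : ∀ x m → x +ᶻ m *ᶻ x ≡ (1ℤ +ᶻ m) *ᶻ x
        lem2 = ringℤ

-- Hence `cobd ∘ bd` divided by n is idempotent. Together with `adjoint` this makes it an orthogonal
-- projection, which is where the face density D/n comes from.
bd-cobd-bd : ∀ {n} (c : Fn n) ρ → bd (cobd (bd c)) ρ ≡ pos n *ᶻ bd c ρ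
bd-cobd-bd c ρ = trans (sym (ℤP.+-identityʳ _)) (trans (cong (bd (cobd (bd c)) ρ +ᶻ_)
  (sym (cobd-0 (bd (bd c)) (bd-bd c) ρ))) (bd-cobd (bd c) ρ))

ipA : ∀ {n} → Fn n → Fn n → ℤ
ipA {zero} f g = f [] *ᶻ g []
ipA {suc n} f g = ipA (f ᵗ) (g ᵗ) +ᶻ ipA (f ᶠ) (g ᶠ)

ipA-congˡ : ∀ {n} {f f' : Fn n} (g : Fn n) → (∀ σ → f σ ≡ f' σ) → ipA f g ≡ ipA f' g
ipA-congˡ {zero} g h = cong (_*ᶻ g []) (h [])
ipA-congˡ {suc n} g h = cong₂ _+ᶻ_ (ipA-congˡ _ (λ σ → h (true ∷ σ))) (ipA-congˡ _ (λ σ → h (false ∷ σ)))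

ipA-comm : ∀ {n} (f g : Fn n) → ipA f g ≡ ipA g f
ipA-comm {zero} f g = ℤP.*-comm (f []) (g [])
ipA-comm {suc n} f g = cong₂ _+ᶻ_ (ipA-comm (f ᵗ) _) (ipA-comm (f ᶠ) _)

ipA-lin : ∀ {n} k (f f' g : Fn n) → ipA (λ σ → k *ᶻ f σ +ᶻ f' σ) g ≡ k *ᶻ ipA f g +ᶻ ipA f' g
ipA-lin {zero} k f f' g = lem k (f []) (f' []) (g [])
  where lem : ∀ k a b c → (k *ᶻ a +ᶻ b) *ᶻ c ≡ k *ᶻ (a *ᶻ c) +ᶻ b *ᶻ c
        lem = ringℤ
ipA-lin {suc n} k f f' g = trans (cong₂ _+ᶻ_ (ipA-lin k (f ᵗ) _ _) (ipA-lin k (f ᶠ) _ _)) (l2 k _ _ _ _)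

ipA-+ : ∀ {n} (f f' g : Fn n) → ipA (λ σ → f σ +ᶻ f' σ) g ≡ ipA f g +ᶻ ipA f' g
ipA-+ f f' g = trans (ipA-congˡ g (λ σ → cong (_+ᶻ f' σ) (sym (ℤP.*-identityˡ (f σ)))))
  (trans (ipA-lin 1ℤ f f' g) (cong (_+ᶻ ipA f' g) (ℤP.*-identityˡ (ipA f g))))

ipA-0 : ∀ {n} (f g : Fn n) → (∀ σ → f σ ≡ 0ℤ) → ipA f g ≡ 0ℤ
ipA-0 {zero} f g h = trans (cong (_*ᶻ g []) (h [])) (ℤP.*-zeroˡ (g []))
ipA-0 {suc n} f g h = cong₂ _+ᶻ_ (ipA-0 _ _ (λ σ → h (true ∷ σ))) (ipA-0 _ _ (λ σ → h (false ∷ σ)))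

ipA-neg : ∀ {n} (f g : Fn n) → ipA (λ σ → -ᶻ f σ) g ≡ -ᶻ ipA f g
ipA-neg {zero} f g = sym (ℤP.neg-distribˡ-* (f []) (g []))
ipA-neg {suc n} f g = trans (cong₂ _+ᶻ_ (ipA-neg (f ᵗ) _) (ipA-neg (f ᶠ) _)) (sym (ℤP.neg-distrib-+ (ipA (f ᵗ) _) _))

ipA-smul : ∀ {n} k (f g : Fn n) → ipA (λ σ → k *ᶻ f σ) g ≡ k *ᶻ ipA f g
ipA-smul k f g = trans (ipA-congˡ g (λ σ → sym (ℤP.+-identityʳ (k *ᶻ f σ)))) (trans (ipA-lin k f (λ _ → 0ℤ) g)
   (trans (cong (k *ᶻ ipA f g +ᶻ_) (ipA-0 (λ _ → 0ℤ) g (λ _ → refl))) (ℤP.+-identityʳ _)))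

adjoint : ∀ {n} (f g : Fn n) → ipA (cobd f) g ≡ ipA f (bd g)
adjoint {zero} f g = trans (ℤP.*-zeroˡ (g [])) (sym (ℤP.*-zeroʳ (f [])))
adjoint {suc n} f g = trans
  (cong (_+ᶻ ipA (cobd (f ᶠ)) (g ᶠ))
    (trans (ipA-+ (f ᶠ) _ (g ᵗ))
      (cong (ipA (f ᶠ) (g ᵗ) +ᶻ_) (trans (ipA-neg (cobd (f ᵗ)) _) (cong -ᶻ_ (adjoint (f ᵗ) (g ᵗ)))))))
  (trans (cong (ipA (f ᶠ) (g ᵗ) +ᶻ -ᶻ ipA (f ᵗ) (bd (g ᵗ)) +ᶻ_) (adjoint (f ᶠ) (g ᶠ)))
  (trans (lem (ipA (f ᶠ) (g ᵗ)) (ipA (f ᵗ) (bd (g ᵗ))) (ipA (f ᶠ) (bd (g ᶠ))))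
  (sym (cong₂ _+ᶻ_
     (trans (ipA-comm (f ᵗ) _) (trans (ipA-neg (bd (g ᵗ)) _) (cong -ᶻ_ (ipA-comm (bd (g ᵗ)) _))))
     (trans (ipA-comm (f ᶠ) _) (trans (ipA-+ (g ᵗ) (bd (g ᶠ)) (f ᶠ))
        (cong₂ _+ᶻ_ (ipA-comm (g ᵗ) _) (ipA-comm (bd (g ᶠ)) _))))))))
  where lem : ∀ a b c → (a +ᶻ -ᶻ b) +ᶻ c ≡ -ᶻ b +ᶻ (a +ᶻ c)
        lem = ringℤ

ind : ∀ {n} → Subset n → Fn n
ind [] [] = 1ℤ
ind (true ∷ t) (true ∷ s) = ind t s
ind (true ∷ t) (false ∷ s) = 0ℤ
ind (false ∷ t) (true ∷ s) = 0ℤ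
ind (false ∷ t) (false ∷ s) = ind t s

ipA-ind : ∀ {n} (t : Subset n) (f : Fn n) → ipA (ind t) f ≡ f t
ipA-ind [] f = ℤP.*-identityˡ (f [])
ipA-ind (true ∷ t) f = trans (cong₂ _+ᶻ_ (ipA-ind t (f ᵗ)) (ipA-0 _ (f ᶠ) (λ _ → refl))) (ℤP.+-identityʳ _)
ipA-ind (false ∷ t) f = trans (cong₂ _+ᶻ_ (ipA-0 _ (f ᵗ) (λ _ → refl)) (ipA-ind t (f ᶠ))) (ℤP.+-identityˡ _)

ind-refl : ∀ {n} (t : Subset n) → ind t t ≡ 1ℤ
ind-refl [] = refl
ind-refl (true ∷ t) = ind-refl t
ind-refl (false ∷ t) = ind-refl t

ind-≢ : ∀ {n} (s t : Subset n) → s ≢ t → ind s t ≡ 0ℤ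
ind-≢ [] [] h = ⊥-elim (h refl)
ind-≢ (true ∷ s) (true ∷ t) h = ind-≢ s t (h ∘ cong (true ∷_))
ind-≢ (true ∷ s) (false ∷ t) h = refl
ind-≢ (false ∷ s) (true ∷ t) h = refl
ind-≢ (false ∷ s) (false ∷ t) h = ind-≢ s t (h ∘ cong (false ∷_))

bd-ind : ∀ {n} (σ τ : Subset n) → bd (ind τ) σ ≡ cobd (ind σ) τ
bd-ind σ τ = trans (sym (ipA-ind σ (bd (ind τ)))) (trans (sym (adjoint (ind σ) (ind τ)))
  (trans (ipA-comm (cobd (ind σ)) (ind τ)) (ipA-ind τ (cobd (ind σ)))))

norm-bd-ind : ∀ {n} (t : Subset n) → ipA (bd (ind t)) (bd (ind t)) ≡ pos ∣ t ∣
norm-bd-ind [] = refl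
norm-bd-ind (true ∷ t) = trans (cong₂ _+ᶻ_
    (trans (ipA-neg (bd (ind t)) _) (trans (cong -ᶻ_ (trans (ipA-comm (bd (ind t)) _) (trans (ipA-neg (bd (ind t)) _) (cong -ᶻ_ (norm-bd-ind t))))) (ℤP.neg-involutive _)))
    (trans (ipA-congˡ _ (λ σ → trans (cong (ind t σ +ᶻ_) (bd-0 _ (λ _ → refl) σ)) (ℤP.+-identityʳ _)))
      (trans (ipA-ind t _) (trans (cong (ind t t +ᶻ_) (bd-0 _ (λ _ → refl) t)) (trans (ℤP.+-identityʳ _) (ind-refl t))))))
   (ℤP.+-comm (pos ∣ t ∣) 1ℤ)
norm-bd-ind (false ∷ t) = trans (cong₂ _+ᶻ_ (ipA-0 (bd (ind (false ∷ t)) ᵗ) (bd (ind (false ∷ t)) ᵗ) (λ σ → cong -ᶻ_ (bd-0 (ind (false ∷ t) ᵗ) (λ _ → refl) σ)))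
    (trans (ipA-congˡ (bd (ind (false ∷ t)) ᶠ) h) (trans (ipA-comm (bd (ind t)) (bd (ind (false ∷ t)) ᶠ)) (trans (ipA-congˡ (bd (ind t)) h) (norm-bd-ind t)))))
   (ℤP.+-identityˡ _)
  where h : ∀ σ → (bd (ind (false ∷ t)) ᶠ) σ ≡ bd (ind t) σ
        h σ = ℤP.+-identityˡ (bd (ind t) σ)

-- Chains stay functions on all subsets, so that the recursion on vertices needs no arithmetic of
-- sizes; the degree is recorded separately, for the places where a sum over one level is wanted.
Supp : ∀ {n} → ℕ → Fn n → Set
Supp {n} s f = ∀ σ → ∣ σ ∣ ≢ s → f σ ≡ 0ℤ

ipA-lv : ∀ {n} s (f g : Fn n) → Supp s f → ipA f g ≡ ∑ᶻ (lv n s) (λ σ → f σ *ᶻ g σ)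
ipA-lv {zero} zero f g h = sym (ℤP.+-identityʳ _)
ipA-lv {zero} (suc s) f g h = trans (cong (_*ᶻ g []) (h [] (λ ()))) (ℤP.*-zeroˡ (g []))
ipA-lv {suc n} zero f g h = trans (cong₂ _+ᶻ_ (ipA-0 _ _ (λ σ → h (true ∷ σ) (λ ())))
    (trans (ipA-lv zero _ _ (λ σ e → h (false ∷ σ) e)) (sym (∑ᶻ-map (false ∷_) (lv n zero) _)))) (ℤP.+-identityˡ _)
ipA-lv {suc n} (suc s) f g h = trans (cong₂ _+ᶻ_
    (trans (ipA-lv s _ _ (λ σ e → h (true ∷ σ) (e ∘ suc-injective))) (sym (∑ᶻ-map (true ∷_) (lv n s) _)))
    (trans (ipA-lv (suc s) _ _ (λ σ e → h (false ∷ σ) e)) (sym (∑ᶻ-map (false ∷_) (lv n (suc s)) _))))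
   (sym (∑ᶻ-++ (map (true ∷_) (lv n s)) _ _))

Supp-ind : ∀ {n} (t : Subset n) → Supp ∣ t ∣ (ind t)
Supp-ind t σ e = ind-≢ t σ (λ { refl → e refl })

Supp-cobd : ∀ {n} s (f : Fn n) → Supp s f → Supp (suc s) (cobd f)
Supp-cobd s f h [] e = refl
Supp-cobd zero f h (true ∷ σ) e = cong₂ (λ x y → x +ᶻ -ᶻ y) (h (false ∷ σ) (e ∘ cong suc)) (cobd-0 _ (λ τ → h (true ∷ τ) (λ ())) σ)
Supp-cobd (suc s) f h (true ∷ σ) e = cong₂ (λ x y → x +ᶻ -ᶻ y) (h (false ∷ σ) (e ∘ cong suc))
   (Supp-cobd s _ (λ τ e' → h (true ∷ τ) (e' ∘ suc-injective)) σ (e ∘ cong suc))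
Supp-cobd s f h (false ∷ σ) e = Supp-cobd s _ (λ τ e' → h (false ∷ τ) e') σ e

Supp-bd : ∀ {n} s (f : Fn n) → Supp (suc s) f → Supp s (bd f)
Supp-bd s f h [] e = refl
Supp-bd zero f h (true ∷ σ) e = cong -ᶻ_ (lem f h σ)
  where lem : ∀ {n} (f : Fn (suc n)) → Supp 1 f → ∀ σ → bd (f ᵗ) σ ≡ 0ℤ
        lem f h [] = refl
        lem f h (true ∷ σ) = cong -ᶻ_ (bd-0 _ (λ τ → h (true ∷ true ∷ τ) (λ ())) σ)
        lem f h (false ∷ σ) = cong₂ _+ᶻ_ (h (true ∷ true ∷ σ) (λ ())) (lem (λ { (b ∷ τ) → f (b ∷ false ∷ τ) })
           (λ { (true ∷ τ) e' → h (true ∷ false ∷ τ) e' ; (false ∷ τ) e' → h (false ∷ false ∷ τ) e' }) σ)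
Supp-bd (suc s) f h (true ∷ σ) e = cong -ᶻ_ (Supp-bd s _ (λ τ e' → h (true ∷ τ) (e' ∘ suc-injective)) σ (e ∘ cong suc))
Supp-bd s f h (false ∷ σ) e = cong₂ _+ᶻ_ (h (true ∷ σ) (e ∘ suc-injective)) (Supp-bd s _ (λ τ e' → h (false ∷ τ) e') σ e)

-- Fermionic Fock space over a list of modes

cr an : {A : Set} (L : List A) → (A → ℤ) → Fn (length L) → Fn (length L)
cr [] v ψ s = 0ℤ
cr (c ∷ L) v ψ (true ∷ s) = v c *ᶻ ψ (false ∷ s) +ᶻ -ᶻ cr L v (ψ ᵗ) s
cr (c ∷ L) v ψ (false ∷ s) = cr L v (ψ ᶠ) s
an [] v ψ s = 0ℤ
an (c ∷ L) v ψ (true ∷ s) = -ᶻ an L v (ψ ᵗ) s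
an (c ∷ L) v ψ (false ∷ s) = v c *ᶻ ψ (true ∷ s) +ᶻ an L v (ψ ᶠ) s

dot : {A : Set} → List A → (A → ℤ) → (A → ℤ) → ℤ
dot L u v = ∑ᶻ L (λ t → u t *ᶻ v t)

_≗ᶠ_ : {A : Set} → (A → ℤ) → (A → ℤ) → Set
f ≗ᶠ g = ∀ x → f x ≡ g x

module _ {A : Set} where

  cr-cong : (L : List A) {v v' : A → ℤ} {ψ ψ' : Fn (length L)} → v ≗ᶠ v' → ψ ≗ᶠ ψ' → cr L v ψ ≗ᶠ cr L v' ψ'
  cr-cong [] hv h s = refl
  cr-cong (c ∷ L) hv h (true ∷ s) = cong₂ _+ᶻ_ (cong₂ _*ᶻ_ (hv c) (h (false ∷ s))) (cong -ᶻ_ (cr-cong L hv (λ s → h (true ∷ s)) s))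
  cr-cong (c ∷ L) hv h (false ∷ s) = cr-cong L hv (λ s → h (false ∷ s)) s

  an-cong : (L : List A) {v v' : A → ℤ} {ψ ψ' : Fn (length L)} → v ≗ᶠ v' → ψ ≗ᶠ ψ' → an L v ψ ≗ᶠ an L v' ψ'
  an-cong [] hv h s = refl
  an-cong (c ∷ L) hv h (true ∷ s) = cong -ᶻ_ (an-cong L hv (λ s → h (true ∷ s)) s)
  an-cong (c ∷ L) hv h (false ∷ s) = cong₂ _+ᶻ_ (cong₂ _*ᶻ_ (hv c) (h (true ∷ s))) (an-cong L hv (λ s → h (false ∷ s)) s)

  cr-congψ : (L : List A) (v : A → ℤ) {ψ ψ' : Fn (length L)} → ψ ≗ᶠ ψ' → cr L v ψ ≗ᶠ cr L v ψ'
  cr-congψ L v h = cr-cong L (λ _ → refl) h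

  private
    m1 : ∀ k a a' x c c' → (k *ᶻ a +ᶻ a') *ᶻ x +ᶻ -ᶻ (k *ᶻ c +ᶻ c') ≡ k *ᶻ (a *ᶻ x +ᶻ -ᶻ c) +ᶻ (a' *ᶻ x +ᶻ -ᶻ c')
    m1 = ringℤ
    m2 : ∀ k a a' x c c' → x *ᶻ (k *ᶻ a +ᶻ a') +ᶻ -ᶻ (k *ᶻ c +ᶻ c') ≡ k *ᶻ (x *ᶻ a +ᶻ -ᶻ c) +ᶻ (x *ᶻ a' +ᶻ -ᶻ c')
    m2 = ringℤ
    m3 : ∀ k a a' x c c' → (k *ᶻ a +ᶻ a') *ᶻ x +ᶻ (k *ᶻ c +ᶻ c') ≡ k *ᶻ (a *ᶻ x +ᶻ c) +ᶻ (a' *ᶻ x +ᶻ c')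
    m3 = ringℤ
    m4 : ∀ k a a' x c c' → x *ᶻ (k *ᶻ a +ᶻ a') +ᶻ (k *ᶻ c +ᶻ c') ≡ k *ᶻ (x *ᶻ a +ᶻ c) +ᶻ (x *ᶻ a' +ᶻ c')
    m4 = ringℤ
    m5 : ∀ k c c' → -ᶻ (k *ᶻ c +ᶻ c') ≡ k *ᶻ -ᶻ c +ᶻ -ᶻ c'
    m5 = ringℤ
    m6 : ∀ k → 0ℤ ≡ k *ᶻ 0ℤ +ᶻ 0ℤ
    m6 = ringℤ

  cr-linᵛ : (L : List A) (k : ℤ) (v v' : A → ℤ) (ψ : Fn (length L)) →
    cr L (λ t → k *ᶻ v t +ᶻ v' t) ψ ≗ᶠ (λ s → k *ᶻ cr L v ψ s +ᶻ cr L v' ψ s)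
  cr-linᵛ [] k v v' ψ s = m6 k
  cr-linᵛ (c ∷ L) k v v' ψ (true ∷ s) =
    trans (cong (λ z → (k *ᶻ v c +ᶻ v' c) *ᶻ ψ (false ∷ s) +ᶻ -ᶻ z) (cr-linᵛ L k v v' (ψ ᵗ) s))
          (m1 k (v c) (v' c) (ψ (false ∷ s)) (cr L v (ψ ᵗ) s) (cr L v' (ψ ᵗ) s))
  cr-linᵛ (c ∷ L) k v v' ψ (false ∷ s) = cr-linᵛ L k v v' (ψ ᶠ) s

  an-linᵛ : (L : List A) (k : ℤ) (v v' : A → ℤ) (ψ : Fn (length L)) →
    an L (λ t → k *ᶻ v t +ᶻ v' t) ψ ≗ᶠ (λ s → k *ᶻ an L v ψ s +ᶻ an L v' ψ s)
  an-linᵛ [] k v v' ψ s = m6 k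
  an-linᵛ (c ∷ L) k v v' ψ (true ∷ s) =
    trans (cong -ᶻ_ (an-linᵛ L k v v' (ψ ᵗ) s)) (m5 k (an L v (ψ ᵗ) s) (an L v' (ψ ᵗ) s))
  an-linᵛ (c ∷ L) k v v' ψ (false ∷ s) =
    trans (cong (λ z → (k *ᶻ v c +ᶻ v' c) *ᶻ ψ (true ∷ s) +ᶻ z) (an-linᵛ L k v v' (ψ ᶠ) s))
          (m3 k (v c) (v' c) (ψ (true ∷ s)) (an L v (ψ ᶠ) s) (an L v' (ψ ᶠ) s))

  cr-lin : (L : List A) (v : A → ℤ) (k : ℤ) (ψ ψ' : Fn (length L)) →
    cr L v (λ s → k *ᶻ ψ s +ᶻ ψ' s) ≗ᶠ (λ s → k *ᶻ cr L v ψ s +ᶻ cr L v ψ' s)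
  cr-lin [] v k ψ ψ' s = m6 k
  cr-lin (c ∷ L) v k ψ ψ' (true ∷ s) =
    trans (cong (λ z → v c *ᶻ (k *ᶻ ψ (false ∷ s) +ᶻ ψ' (false ∷ s)) +ᶻ -ᶻ z) (cr-lin L v k (ψ ᵗ) (ψ' ᵗ) s))
          (m2 k (ψ (false ∷ s)) (ψ' (false ∷ s)) (v c) (cr L v (ψ ᵗ) s) (cr L v (ψ' ᵗ) s))
  cr-lin (c ∷ L) v k ψ ψ' (false ∷ s) = cr-lin L v k (ψ ᶠ) (ψ' ᶠ) s

  an-lin : (L : List A) (v : A → ℤ) (k : ℤ) (ψ ψ' : Fn (length L)) →
    an L v (λ s → k *ᶻ ψ s +ᶻ ψ' s) ≗ᶠ (λ s → k *ᶻ an L v ψ s +ᶻ an L v ψ' s)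
  an-lin [] v k ψ ψ' s = m6 k
  an-lin (c ∷ L) v k ψ ψ' (true ∷ s) =
    trans (cong -ᶻ_ (an-lin L v k (ψ ᵗ) (ψ' ᵗ) s)) (m5 k (an L v (ψ ᵗ) s) (an L v (ψ' ᵗ) s))
  an-lin (c ∷ L) v k ψ ψ' (false ∷ s) =
    trans (cong (λ z → v c *ᶻ (k *ᶻ ψ (true ∷ s) +ᶻ ψ' (true ∷ s)) +ᶻ z) (an-lin L v k (ψ ᶠ) (ψ' ᶠ) s))
          (m4 k (ψ (true ∷ s)) (ψ' (true ∷ s)) (v c) (an L v (ψ ᶠ) s) (an L v (ψ' ᶠ) s))

  cr-0 : (L : List A) (v : A → ℤ) (ψ : Fn (length L)) → (∀ s → ψ s ≡ 0ℤ) → ∀ s → cr L v ψ s ≡ 0ℤ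
  cr-0 [] v ψ h s = refl
  cr-0 (c ∷ L) v ψ h (true ∷ s) = cong₂ (λ x y → x +ᶻ -ᶻ y)
    (trans (cong (v c *ᶻ_) (h (false ∷ s))) (ℤP.*-zeroʳ (v c))) (cr-0 L v (ψ ᵗ) (λ s → h (true ∷ s)) s)
  cr-0 (c ∷ L) v ψ h (false ∷ s) = cr-0 L v (ψ ᶠ) (λ s → h (false ∷ s)) s

  an-0 : (L : List A) (v : A → ℤ) (ψ : Fn (length L)) → (∀ s → ψ s ≡ 0ℤ) → ∀ s → an L v ψ s ≡ 0ℤ
  an-0 [] v ψ h s = refl
  an-0 (c ∷ L) v ψ h (true ∷ s) = cong -ᶻ_ (an-0 L v (ψ ᵗ) (λ s → h (true ∷ s)) s)
  an-0 (c ∷ L) v ψ h (false ∷ s) = cong₂ _+ᶻ_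
    (trans (cong (v c *ᶻ_) (h (true ∷ s))) (ℤP.*-zeroʳ (v c))) (an-0 L v (ψ ᶠ) (λ s → h (false ∷ s)) s)

  private
    cr-lin₂ : (L : List A) (v : A → ℤ) (k : ℤ) (ψ ψ' : Fn (length L)) →
      cr L v (λ s → k *ᶻ ψ s +ᶻ -ᶻ ψ' s) ≗ᶠ (λ s → k *ᶻ cr L v ψ s +ᶻ -ᶻ cr L v ψ' s)
    cr-lin₂ L v k ψ ψ' s = trans (cr-congψ L v {ψ' = λ s → -1ℤ *ᶻ ψ' s +ᶻ k *ᶻ ψ s} (λ s → e (k *ᶻ ψ s) (ψ' s)) s)
      (trans (cr-lin L v -1ℤ ψ' (λ s → k *ᶻ ψ s) s) (trans (cong (-1ℤ *ᶻ cr L v ψ' s +ᶻ_)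
        (trans (cr-congψ L v (λ s → sym (ℤP.+-identityʳ (k *ᶻ ψ s))) s)
          (trans (cr-lin L v k ψ (λ _ → 0ℤ) s) (trans (cong (k *ᶻ cr L v ψ s +ᶻ_) (cr-0 L v (λ _ → 0ℤ) (λ _ → refl) s)) (ℤP.+-identityʳ _)))))
        (sym (e (k *ᶻ cr L v ψ s) (cr L v ψ' s)))))
      where e : ∀ a b → a +ᶻ -ᶻ b ≡ -1ℤ *ᶻ b +ᶻ a
            e = ringℤ

    an-neg : (L : List A) (v : A → ℤ) (ψ : Fn (length L)) → an L v (λ s → -ᶻ ψ s) ≗ᶠ (λ s → -ᶻ an L v ψ s)
    an-neg [] v ψ s = refl
    an-neg (c ∷ L) v ψ (true ∷ s) = cong -ᶻ_ (an-neg L v (ψ ᵗ) s)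
    an-neg (c ∷ L) v ψ (false ∷ s) = trans (cong (v c *ᶻ -ᶻ ψ (true ∷ s) +ᶻ_) (an-neg L v (ψ ᶠ) s)) (e (v c) (ψ (true ∷ s)) (an L v (ψ ᶠ) s))
      where e : ∀ a b x → a *ᶻ -ᶻ b +ᶻ -ᶻ x ≡ -ᶻ (a *ᶻ b +ᶻ x)
            e = ringℤ

    cr-neg : (L : List A) (v : A → ℤ) (ψ : Fn (length L)) → cr L v (λ s → -ᶻ ψ s) ≗ᶠ (λ s → -ᶻ cr L v ψ s)
    cr-neg [] v ψ s = refl
    cr-neg (c ∷ L) v ψ (true ∷ s) = trans (cong (λ z → v c *ᶻ -ᶻ ψ (false ∷ s) +ᶻ -ᶻ z) (cr-neg L v (ψ ᵗ) s)) (e (v c) (ψ (false ∷ s)) (cr L v (ψ ᵗ) s))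
      where e : ∀ a b x → a *ᶻ -ᶻ b +ᶻ -ᶻ (-ᶻ x) ≡ -ᶻ (a *ᶻ b +ᶻ -ᶻ x)
            e = ringℤ
    cr-neg (c ∷ L) v ψ (false ∷ s) = cr-neg L v (ψ ᶠ) s

    an-lin₂ : (L : List A) (v : A → ℤ) (k : ℤ) (ψ ψ' : Fn (length L)) →
      an L v (λ s → k *ᶻ ψ s +ᶻ -ᶻ ψ' s) ≗ᶠ (λ s → k *ᶻ an L v ψ s +ᶻ -ᶻ an L v ψ' s)
    an-lin₂ L v k ψ ψ' s = trans (an-lin L v k ψ (λ s → -ᶻ ψ' s) s) (cong (k *ᶻ an L v ψ s +ᶻ_) (an-neg L v ψ' s))

  cr-cr : (L : List A) (u v : A → ℤ) (ψ : Fn (length L)) → cr L u (cr L v ψ) ≗ᶠ (λ s → -ᶻ cr L v (cr L u ψ) s)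
  cr-cr [] u v ψ s = refl
  cr-cr (c ∷ L) u v ψ (true ∷ s) = trans
    (cong (λ z → u c *ᶻ cr L v (ψ ᶠ) s +ᶻ -ᶻ z) (cr-lin₂ L u (v c) (ψ ᶠ) (cr L v (ψ ᵗ)) s))
    (trans (cong (λ z → u c *ᶻ cr L v (ψ ᶠ) s +ᶻ -ᶻ (v c *ᶻ cr L u (ψ ᶠ) s +ᶻ -ᶻ z)) (cr-cr L u v (ψ ᵗ) s))
    (trans (e (u c) (cr L v (ψ ᶠ) s) (v c) (cr L u (ψ ᶠ) s) (cr L v (cr L u (ψ ᵗ)) s))
      (cong (λ z → -ᶻ (v c *ᶻ cr L u (ψ ᶠ) s +ᶻ -ᶻ z)) (sym (cr-lin₂ L v (u c) (ψ ᶠ) (cr L u (ψ ᵗ)) s)))))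
    where e : ∀ a x b y z → a *ᶻ x +ᶻ -ᶻ (b *ᶻ y +ᶻ -ᶻ (-ᶻ z)) ≡ -ᶻ (b *ᶻ y +ᶻ -ᶻ (a *ᶻ x +ᶻ -ᶻ z))
          e = ringℤ
  cr-cr (c ∷ L) u v ψ (false ∷ s) = cr-cr L u v (ψ ᶠ) s

  cr-sq : (L : List A) (v : A → ℤ) (ψ : Fn (length L)) → ∀ s → cr L v (cr L v ψ) s ≡ 0ℤ
  cr-sq [] v ψ s = refl
  cr-sq (c ∷ L) v ψ (true ∷ s) = trans
    (cong (λ z → v c *ᶻ cr L v (ψ ᶠ) s +ᶻ -ᶻ z) (trans (cr-lin₂ L v (v c) (ψ ᶠ) (cr L v (ψ ᵗ)) s)
       (cong (λ z → v c *ᶻ cr L v (ψ ᶠ) s +ᶻ -ᶻ z) (cr-sq L v (ψ ᵗ) s))))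
    (e (v c *ᶻ cr L v (ψ ᶠ) s))
    where e : ∀ a → a +ᶻ -ᶻ (a +ᶻ -ᶻ 0ℤ) ≡ 0ℤ
          e = ringℤ
  cr-sq (c ∷ L) v ψ (false ∷ s) = cr-sq L v (ψ ᶠ) s

  an-an : (L : List A) (u v : A → ℤ) (ψ : Fn (length L)) → an L u (an L v ψ) ≗ᶠ (λ s → -ᶻ an L v (an L u ψ) s)
  an-an [] u v ψ s = refl
  an-an (c ∷ L) u v ψ (true ∷ s) = cong -ᶻ_ (trans (an-neg L u (an L v (ψ ᵗ)) s)
    (trans (cong -ᶻ_ (an-an L u v (ψ ᵗ) s)) (cong -ᶻ_ (sym (an-neg L v (an L u (ψ ᵗ)) s)))))
  an-an (c ∷ L) u v ψ (false ∷ s) = trans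
    (cong (u c *ᶻ -ᶻ an L v (ψ ᵗ) s +ᶻ_) (trans (an-lin L u (v c) (ψ ᵗ) (an L v (ψ ᶠ)) s)
       (cong (v c *ᶻ an L u (ψ ᵗ) s +ᶻ_) (an-an L u v (ψ ᶠ) s))))
    (trans (e (u c) (an L v (ψ ᵗ) s) (v c) (an L u (ψ ᵗ) s) (an L v (an L u (ψ ᶠ)) s))
    (cong (λ z → -ᶻ (v c *ᶻ -ᶻ an L u (ψ ᵗ) s +ᶻ z)) (sym (an-lin L v (u c) (ψ ᵗ) (an L u (ψ ᶠ)) s))))
    where e : ∀ a x b y z → a *ᶻ -ᶻ x +ᶻ (b *ᶻ y +ᶻ -ᶻ z) ≡ -ᶻ (b *ᶻ -ᶻ y +ᶻ (a *ᶻ x +ᶻ z))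
          e = ringℤ

  -- The minus sign taken when passing an occupied head mode makes all terms mixing two modes
  -- cancel. Each mode `c` then contributes `u c * v c` exactly once, from whichever of the two
  -- orders is possible there.
  CAR : (L : List A) (u v : A → ℤ) (ψ : Fn (length L)) →
    (λ s → an L u (cr L v ψ) s +ᶻ cr L v (an L u ψ) s) ≗ᶠ (λ s → dot L u v *ᶻ ψ s)
  CAR [] u v ψ [] = sym (ℤP.*-zeroˡ (ψ []))
  CAR (c ∷ L) u v ψ (true ∷ s) = trans
    (cong₂ (λ x y → -ᶻ x +ᶻ (v c *ᶻ (u c *ᶻ ψ (true ∷ s) +ᶻ an L u (ψ ᶠ) s) +ᶻ -ᶻ y))
      (an-lin₂ L u (v c) (ψ ᶠ) (cr L v (ψ ᵗ)) s) (cr-neg L v (an L u (ψ ᵗ)) s))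
    (trans (e (v c) (an L u (ψ ᶠ) s) (an L u (cr L v (ψ ᵗ)) s) (u c) (ψ (true ∷ s)) (cr L v (an L u (ψ ᵗ)) s))
    (trans (cong (u c *ᶻ v c *ᶻ ψ (true ∷ s) +ᶻ_) (CAR L u v (ψ ᵗ) s)) (sym (ℤP.*-distribʳ-+ (ψ (true ∷ s)) (u c *ᶻ v c) (dot L u v)))))
    where e : ∀ b x y a p z → -ᶻ (b *ᶻ x +ᶻ -ᶻ y) +ᶻ (b *ᶻ (a *ᶻ p +ᶻ x) +ᶻ -ᶻ (-ᶻ z)) ≡ a *ᶻ b *ᶻ p +ᶻ (y +ᶻ z)
          e = ringℤ
  CAR (c ∷ L) u v ψ (false ∷ s) = trans
    (cong (u c *ᶻ (v c *ᶻ ψ (false ∷ s) +ᶻ -ᶻ cr L v (ψ ᵗ) s) +ᶻ an L u (cr L v (ψ ᶠ)) s +ᶻ_) (cr-lin L v (u c) (ψ ᵗ) (an L u (ψ ᶠ)) s))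
    (trans (e (u c) (v c) (ψ (false ∷ s)) (cr L v (ψ ᵗ) s) (an L u (cr L v (ψ ᶠ)) s) (cr L v (an L u (ψ ᶠ)) s))
    (trans (cong (u c *ᶻ v c *ᶻ ψ (false ∷ s) +ᶻ_) (CAR L u v (ψ ᶠ) s)) (sym (ℤP.*-distribʳ-+ (ψ (false ∷ s)) (u c *ᶻ v c) (dot L u v)))))
    where e : ∀ a b p x y z → a *ᶻ (b *ᶻ p +ᶻ -ᶻ x) +ᶻ y +ᶻ (a *ᶻ x +ᶻ z) ≡ a *ᶻ b *ᶻ p +ᶻ (y +ᶻ z)
          e = ringℤ

  cr-adj : (L : List A) (v : A → ℤ) (ψ φ : Fn (length L)) → ipA (cr L v ψ) φ ≡ ipA ψ (an L v φ)
  cr-adj [] v ψ φ = trans (ℤP.*-zeroˡ (φ [])) (sym (ℤP.*-zeroʳ (ψ [])))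
  cr-adj (c ∷ L) v ψ φ = trans
    (cong₂ _+ᶻ_
      (trans (ipA-lin (v c) (ψ ᶠ) (λ s → -ᶻ cr L v (ψ ᵗ) s) (φ ᵗ))
        (cong (v c *ᶻ ipA (ψ ᶠ) (φ ᵗ) +ᶻ_) (trans (ipA-neg (cr L v (ψ ᵗ)) (φ ᵗ)) (cong -ᶻ_ (cr-adj L v (ψ ᵗ) (φ ᵗ))))))
      (cr-adj L v (ψ ᶠ) (φ ᶠ)))
    (trans (e (v c *ᶻ ipA (ψ ᶠ) (φ ᵗ)) (ipA (ψ ᵗ) (an L v (φ ᵗ))) (ipA (ψ ᶠ) (an L v (φ ᶠ))))
    (sym (cong₂ _+ᶻ_
      (trans (ipA-comm (ψ ᵗ) (λ s → -ᶻ an L v (φ ᵗ) s)) (trans (ipA-neg (an L v (φ ᵗ)) (ψ ᵗ)) (cong -ᶻ_ (ipA-comm (an L v (φ ᵗ)) (ψ ᵗ)))))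
      (trans (ipA-comm (ψ ᶠ) (λ s → v c *ᶻ φ (true ∷ s) +ᶻ an L v (φ ᶠ) s)) (trans (ipA-lin (v c) (φ ᵗ) (an L v (φ ᶠ)) (ψ ᶠ))
         (cong₂ _+ᶻ_ (cong (v c *ᶻ_) (ipA-comm (φ ᵗ) (ψ ᶠ))) (ipA-comm (an L v (φ ᶠ)) (ψ ᶠ))))))))
    where e : ∀ a b c → (a +ᶻ -ᶻ b) +ᶻ c ≡ -ᶻ b +ᶻ (a +ᶻ c)
          e = ringℤ

  an-adj : (L : List A) (v : A → ℤ) (ψ φ : Fn (length L)) → ipA (an L v ψ) φ ≡ ipA ψ (cr L v φ)
  an-adj L v ψ φ = trans (ipA-comm (an L v ψ) φ) (trans (sym (cr-adj L v φ ψ)) (ipA-comm (cr L v φ) ψ))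

  -- Since `an L u` and `cr L u` are adjoint, this is `CAR` with v = u, paired with ψ. Both summands
  -- are squares, so each is at most the right side; that is how it is used.
  norm-split : (L : List A) (u : A → ℤ) (ψ : Fn (length L)) →
    ipA (an L u ψ) (an L u ψ) +ᶻ ipA (cr L u ψ) (cr L u ψ) ≡ dot L u u *ᶻ ipA ψ ψ
  norm-split L u ψ = trans (cong₂ _+ᶻ_ (trans (an-adj L u ψ (an L u ψ)) (ipA-comm ψ (cr L u (an L u ψ)))) (trans (cr-adj L u ψ (cr L u ψ)) (ipA-comm ψ (an L u (cr L u ψ)))))
    (trans (ℤP.+-comm (ipA (cr L u (an L u ψ)) ψ) (ipA (an L u (cr L u ψ)) ψ)) (trans (sym (ipA-+ (an L u (cr L u ψ)) (cr L u (an L u ψ)) ψ))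
    (trans (ipA-congˡ ψ (CAR L u u ψ)) (ipA-smul (dot L u u) ψ ψ))))

  vac : (L : List A) → Fn (length L)
  vac [] s = 1ℤ
  vac (c ∷ L) (true ∷ s) = 0ℤ
  vac (c ∷ L) (false ∷ s) = vac L s

  pre : (L : List A) → List (A → ℤ) → Fn (length L) → Fn (length L)
  pre L [] ψ = ψ
  pre L (v ∷ vs) ψ = cr L v (pre L vs ψ)

  wedge : (L : List A) → List (A → ℤ) → Fn (length L)
  wedge L vs = pre L vs (vac L)

  pre-++ : (L : List A) (us vs : List (A → ℤ)) (ψ : Fn (length L)) → pre L (us ++ vs) ψ ≗ᶠ pre L us (pre L vs ψ)
  pre-++ L [] vs ψ s = refl
  pre-++ L (u ∷ us) vs ψ = cr-congψ L u (pre-++ L us vs ψ)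

  pre-cong : (L : List A) (us : List (A → ℤ)) {ψ ψ' : Fn (length L)} → ψ ≗ᶠ ψ' → pre L us ψ ≗ᶠ pre L us ψ'
  pre-cong L [] h = h
  pre-cong L (u ∷ us) h = cr-congψ L u (pre-cong L us h)

  an-vac : (L : List A) (u : A → ℤ) → ∀ s → an L u (vac L) s ≡ 0ℤ
  an-vac [] u s = refl
  an-vac (c ∷ L) u (true ∷ s) = cong -ᶻ_ (an-0 L u _ (λ _ → refl) s)
  an-vac (c ∷ L) u (false ∷ s) = cong₂ _+ᶻ_ (ℤP.*-zeroʳ (u c)) (an-vac L u s)

  an-wedge-0 : (L : List A) (u : A → ℤ) (vs : List (A → ℤ)) → All (λ v → dot L u v ≡ 0ℤ) vs → ∀ s → an L u (wedge L vs) s ≡ 0ℤ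
  an-wedge-0 L u [] h = an-vac L u
  an-wedge-0 L u (v ∷ vs) (p ∷ h) s = trans (sym (ℤP.+-identityʳ _)) (trans (cong (an L u (cr L v (wedge L vs)) s +ᶻ_)
     (sym (cr-0 L v _ (an-wedge-0 L u vs h) s)))
    (trans (CAR L u v (wedge L vs) s) (trans (cong (_*ᶻ wedge L vs s) p) (ℤP.*-zeroˡ (wedge L vs s)))))

  cr-pre-0 : (L : List A) (vs : List (A → ℤ)) {v : A → ℤ} (ψ : Fn (length L)) → v ∈ vs → ∀ s → cr L v (pre L vs ψ) s ≡ 0ℤ
  cr-pre-0 L (v ∷ vs) ψ (here refl) s = cr-sq L v (pre L vs ψ) s
  cr-pre-0 L (w ∷ vs) {v} ψ (there m) s = trans (cr-cr L v w (pre L vs ψ) s) (cong -ᶻ_ (cr-0 L w _ (cr-pre-0 L vs ψ m) s))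

  pre-cr-0 : (L : List A) (vs : List (A → ℤ)) {v : A → ℤ} (ψ : Fn (length L)) → v ∈ vs → ∀ s → pre L vs (cr L v ψ) s ≡ 0ℤ
  pre-cr-0 L (v ∷ vs) ψ (here refl) s = lem vs v ψ s
    where
    lem : ∀ vs v ψ s → cr L v (pre L vs (cr L v ψ)) s ≡ 0ℤ
    lem [] v ψ s = cr-sq L v ψ s
    lem (w ∷ vs) v ψ s = trans (cr-cr L v w (pre L vs (cr L v ψ)) s) (cong -ᶻ_ (cr-0 L w _ (lem vs v ψ) s))
  pre-cr-0 L (w ∷ vs) ψ (there m) s = cr-0 L w _ (pre-cr-0 L vs ψ m) s

  comb : {X : Set} → List X → (X → ℤ) → (X → A → ℤ) → A → ℤ
  comb xs k f t = ∑ᶻ xs (λ x → k x *ᶻ f x t)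

  cr-0ᵛ : (L : List A) (ψ : Fn (length L)) → ∀ s → cr L (λ _ → 0ℤ) ψ s ≡ 0ℤ
  cr-0ᵛ [] ψ s = refl
  cr-0ᵛ (c ∷ L) ψ (true ∷ s) = cong (λ z → 0ℤ +ᶻ -ᶻ z) (cr-0ᵛ L (ψ ᵗ) s)
  cr-0ᵛ (c ∷ L) ψ (false ∷ s) = cr-0ᵛ L (ψ ᶠ) s

  cr-comb-0 : {X : Set} (L : List A) (xs : List X) (k : X → ℤ) (f : X → A → ℤ) (ψ : Fn (length L)) →
    (∀ x → x ∈ xs → ∀ s → cr L (f x) ψ s ≡ 0ℤ) → ∀ s → cr L (comb xs k f) ψ s ≡ 0ℤ
  cr-comb-0 L [] k f ψ h s = cr-0ᵛ L ψ s
  cr-comb-0 L (x ∷ xs) k f ψ h s = trans (cr-linᵛ L (k x) (f x) (comb xs k f) ψ s)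
    (cong₂ _+ᶻ_ (trans (cong (k x *ᶻ_) (h x (here refl) s)) (ℤP.*-zeroʳ (k x))) (cr-comb-0 L xs k f ψ (λ y m → h y (there m)) s))

  pre-0 : (L : List A) (vs : List (A → ℤ)) (ψ : Fn (length L)) → (∀ s → ψ s ≡ 0ℤ) → ∀ s → pre L vs ψ s ≡ 0ℤ
  pre-0 L [] ψ h = h
  pre-0 L (v ∷ vs) ψ h = cr-0 L v _ (pre-0 L vs ψ h)

  pre-lin : (L : List A) (vs : List (A → ℤ)) (k : ℤ) (ψ ψ' : Fn (length L)) →
    pre L vs (λ s → k *ᶻ ψ s +ᶻ ψ' s) ≗ᶠ (λ s → k *ᶻ pre L vs ψ s +ᶻ pre L vs ψ' s)
  pre-lin L [] k ψ ψ' s = refl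
  pre-lin L (v ∷ vs) k ψ ψ' s = trans (cr-congψ L v (pre-lin L vs k ψ ψ') s) (cr-lin L v k _ _ s)

  pre-comb-0 : {X : Set} (L : List A) (vs : List (A → ℤ)) (xs : List X) (k : X → ℤ) (f : X → A → ℤ) (ψ : Fn (length L)) →
    (∀ x → x ∈ xs → f x ∈ vs) → ∀ s → pre L vs (cr L (comb xs k f) ψ) s ≡ 0ℤ
  pre-comb-0 L vs [] k f ψ h s = pre-0 L vs _ (cr-0ᵛ L ψ) s
  pre-comb-0 L vs (x ∷ xs) k f ψ h s = trans (pre-cong L vs (cr-linᵛ L (k x) (f x) (comb xs k f) ψ) s)
    (trans (pre-lin L vs (k x) (cr L (f x) ψ) (cr L (comb xs k f) ψ) s)
    (cong₂ _+ᶻ_ (trans (cong (k x *ᶻ_) (pre-cr-0 L vs ψ (h x (here refl)) s)) (ℤP.*-zeroʳ (k x)))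
                (pre-comb-0 L vs xs k f ψ (λ y m → h y (there m)) s)))

  module _ {X Y : Set} (L : List A) (xs : List X) (f : X → A → ℤ) (g h : Y → A → ℤ) (k : Y → X → ℤ)
           where

    Shear : Y → Set
    Shear y = h y ≗ᶠ (λ t → 1ℤ *ᶻ g y t +ᶻ comb xs (k y) f t)

    -- The added combination involves only vectors of the prefix `vs`, and creating such a vector
    -- again gives zero. A treated vector joins the end of the prefix, so the order is never changed
    -- and no sign has to be tracked.
    pre-shear : (vs : List (A → ℤ)) → (∀ x → x ∈ xs → f x ∈ vs) → (ys : List Y) → All Shear ys →
      pre L vs (wedge L (map h ys)) ≗ᶠ pre L vs (wedge L (map g ys))
    pre-shear vs m [] [] s = refl
    pre-shear vs m (y ∷ ys) (e ∷ es) s = trans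
      (pre-cong L vs (λ s → trans (cr-cong L e (λ _ → refl) s) (cr-linᵛ L 1ℤ (g y) (comb xs (k y) f) (wedge L (map h ys)) s)) s)
      (trans (pre-lin L vs 1ℤ (cr L (g y) (wedge L (map h ys))) (cr L (comb xs (k y) f) (wedge L (map h ys))) s)
      (trans (cong₂ _+ᶻ_ (ℤP.*-identityˡ (pre L vs (cr L (g y) (wedge L (map h ys))) s)) (pre-comb-0 L vs xs (k y) f (wedge L (map h ys)) m s))
      (trans (ℤP.+-identityʳ _)
      (trans (sym (pre-++ L vs (g y ∷ []) (wedge L (map h ys)) s))
      (trans (pre-shear (vs ++ g y ∷ []) (λ x p → MemP.∈-++⁺ˡ (m x p)) ys es s)
      (pre-++ L vs (g y ∷ []) (wedge L (map g ys)) s))))))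

    -- The mirror image, with the vectors used for the shear standing to the right of the sheared
    -- ones. `Kalai` needs one change of each kind.
    wedge-shear : (vs : List (A → ℤ)) → (∀ x → x ∈ xs → f x ∈ vs) → (ys : List Y) → All Shear ys →
      wedge L (map h ys ++ vs) ≗ᶠ wedge L (map g ys ++ vs)
    wedge-shear vs m [] [] s = refl
    wedge-shear vs m (y ∷ ys) (e ∷ es) s = trans (cr-cong L e (wedge-shear vs m ys es) s)
      (trans (cr-linᵛ L 1ℤ (g y) (comb xs (k y) f) ψ s)
      (trans (cong₂ _+ᶻ_ (ℤP.*-identityˡ (cr L (g y) ψ s)) (cr-comb-0 L xs (k y) f ψ (λ x p → cr-pre-0 L (map g ys ++ vs) (vac L) (MemP.∈-++⁺ʳ (map g ys) (m x p))) s))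
      (ℤP.+-identityʳ _)))
      where ψ = wedge L (map g ys ++ vs)

  -- A triangular Gram determinant. The creator of `q x`, moved across the pairing, becomes an
  -- annihilator: it meets `p x` with value κ, anticommutes past all later vectors, to which `q x`
  -- is orthogonal, and kills the vacuum.
  wedge-pairing : {X : Set} (L : List A) (κ : ℤ) (p q : X → A → ℤ) (P Q : List (A → ℤ)) (xs : List X) →
    AllPairs (λ x y → dot L (q x) (p y) ≡ 0ℤ) xs → All (λ x → dot L (q x) (p x) ≡ κ) xs →
    All (λ x → All (λ v → dot L (q x) v ≡ 0ℤ) P) xs →
    ipA (wedge L (map p xs ++ P)) (wedge L (map q xs ++ Q)) ≡ κ ℤ.^ length xs *ᶻ ipA (wedge L P) (wedge L Q)
  wedge-pairing L κ p q P Q [] _ _ _ = sym (ℤP.*-identityˡ _)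
  wedge-pairing L κ p q P Q (x ∷ xs) (a ∷ as) (b ∷ bs) (c ∷ cs) = trans
    (ipA-comm (cr L (p x) ψ) (cr L (q x) φ))
    (trans (cr-adj L (q x) φ (cr L (p x) ψ))
    (trans (ipA-comm φ (an L (q x) (cr L (p x) ψ)))
    (trans (ipA-congˡ φ (λ s → trans (sym (ℤP.+-identityʳ _)) (trans (cong (an L (q x) (cr L (p x) ψ) s +ᶻ_)
        (sym (cr-0 L (p x) (an L (q x) ψ) (an-wedge-0 L (q x) (map p xs ++ P) (all-++ xs a)) s)))
        (trans (CAR L (q x) (p x) ψ s) (cong (_*ᶻ ψ s) b)))))
    (trans (ipA-smul κ ψ φ)
    (trans (cong (κ *ᶻ_) (wedge-pairing L κ p q P Q xs as bs cs)) (sym (ℤP.*-assoc κ (κ ℤ.^ length xs) _)))))))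
    where
    ψ = wedge L (map p xs ++ P)
    φ = wedge L (map q xs ++ Q)
    all-++ : ∀ ys → All (λ y → dot L (q x) (p y) ≡ 0ℤ) ys → All (λ v → dot L (q x) v ≡ 0ℤ) (map p ys ++ P)
    all-++ [] [] = c
    all-++ (y ∷ ys) (e ∷ es) = e ∷ all-++ ys es

sq : ℤ → ℕ
sq z = ∣ z ∣ᶻ * ∣ z ∣ᶻ

sq-neg : ∀ z → sq (-ᶻ z) ≡ sq z
sq-neg z = cong₂ _*_ (ℤP.∣-i∣≡∣i∣ z) (ℤP.∣-i∣≡∣i∣ z)

+sq : ∀ z → pos (sq z) ≡ z *ᶻ z
+sq (pos n) = ℤP.pos-* n n
+sq ℤ.-[1+ n ] = refl

∏ : {A : Set} → List A → (A → ℕ) → ℕ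
∏ [] f = 1
∏ (x ∷ xs) f = f x * ∏ xs f

∏-cong∈ : {A : Set} (xs : List A) {f g : A → ℕ} → (∀ x → x ∈ xs → f x ≡ g x) → ∏ xs f ≡ ∏ xs g
∏-cong∈ [] h = refl
∏-cong∈ (x ∷ xs) h = cong₂ _*_ (h x (here refl)) (∏-cong∈ xs (λ y m → h y (there m)))

∑-cong∈ : {A : Set} (xs : List A) {f g : A → ℕ} → (∀ x → x ∈ xs → f x ≡ g x) → ∑ xs f ≡ ∑ xs g
∑-cong∈ [] h = refl
∑-cong∈ (x ∷ xs) h = cong₂ _+_ (h x (here refl)) (∑-cong∈ xs (λ y m → h y (there m)))

∑-cong : {A : Set} (xs : List A) {f g : A → ℕ} → (∀ x → f x ≡ g x) → ∑ xs f ≡ ∑ xs g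
∑-cong xs h = ∑-cong∈ xs (λ x _ → h x)

∑-++ : {A : Set} (xs ys : List A) (f : A → ℕ) → ∑ (xs ++ ys) f ≡ ∑ xs f + ∑ ys f
∑-++ [] ys f = refl
∑-++ (x ∷ xs) ys f = trans (cong (f x +_) (∑-++ xs ys f)) (sym (+-assoc (f x) _ _))

sum-map : {A : Set} (xs : List A) (f : A → ℕ) → sum (map f xs) ≡ ∑ xs f
sum-map [] f = refl
sum-map (x ∷ xs) f = cong (f x +_) (sum-map xs f)

∑-map : {A B : Set} (g : A → B) (xs : List A) (f : B → ℕ) → ∑ (map g xs) f ≡ ∑ xs (f ∘ g)
∑-map g [] f = refl
∑-map g (x ∷ xs) f = cong (f (g x) +_) (∑-map g xs f)

∑-* : {A : Set} (xs : List A) (k : ℕ) (f : A → ℕ) → ∑ xs (λ x → k * f x) ≡ k * ∑ xs f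
∑-* [] k f = sym (*-zeroʳ k)
∑-* (x ∷ xs) k f = trans (cong (k * f x +_) (∑-* xs k f)) (sym (*-distribˡ-+ k (f x) _))

-- Weighted squared norms: a mode contributes α when occupied and β when empty.

Vw : {A : Set} (L : List A) → (A → ℕ) → (A → ℕ) → Fn (length L) → ℕ
Vw [] α β ψ = sq (ψ [])
Vw (c ∷ L) α β ψ = α c * Vw L α β (ψ ᵗ) + β c * Vw L α β (ψ ᶠ)

one : {A : Set} → A → ℕ
one _ = 1

nrm : {A : Set} (L : List A) → Fn (length L) → ℕ
nrm L = Vw L one one

nrm-ip : {A : Set} (L : List A) (ψ : Fn (length L)) → pos (nrm L ψ) ≡ ipA ψ ψ
nrm-ip [] ψ = +sq (ψ [])
nrm-ip (c ∷ L) ψ = trans (cong pos (cong₂ _+_ (*-identityˡ (nrm L (ψ ᵗ))) (*-identityˡ (nrm L (ψ ᶠ)))))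
  (trans (ℤP.pos-+ (nrm L (ψ ᵗ)) (nrm L (ψ ᶠ))) (cong₂ _+ᶻ_ (nrm-ip L (ψ ᵗ)) (nrm-ip L (ψ ᶠ))))

Vw-congψ : {A : Set} (L : List A) (α β : A → ℕ) {ψ ψ' : Fn (length L)} → (∀ s → sq (ψ s) ≡ sq (ψ' s)) → Vw L α β ψ ≡ Vw L α β ψ'
Vw-congψ [] α β h = h []
Vw-congψ (c ∷ L) α β h = cong₂ _+_ (cong (α c *_) (Vw-congψ L α β (λ s → h (true ∷ s)))) (cong (β c *_) (Vw-congψ L α β (λ s → h (false ∷ s))))

Vw-cong : {A : Set} (L : List A) {α α' β β' : A → ℕ} (ψ : Fn (length L)) →
  (∀ x → x ∈ L → α x ≡ α' x) → (∀ x → x ∈ L → β x ≡ β' x) → Vw L α β ψ ≡ Vw L α' β' ψ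
Vw-cong [] ψ h h' = refl
Vw-cong (c ∷ L) ψ h h' = cong₂ _+_
  (cong₂ _*_ (h c (here refl)) (Vw-cong L (ψ ᵗ) (λ x m → h x (there m)) (λ x m → h' x (there m))))
  (cong₂ _*_ (h' c (here refl)) (Vw-cong L (ψ ᶠ) (λ x m → h x (there m)) (λ x m → h' x (there m))))

Vw-0 : {A : Set} (L : List A) (α β : A → ℕ) (ψ : Fn (length L)) → (∀ s → ψ s ≡ 0ℤ) → Vw L α β ψ ≡ 0
Vw-0 [] α β ψ h = cong sq (h [])
Vw-0 (c ∷ L) α β ψ h = trans (cong₂ (λ x y → α c * x + β c * y) (Vw-0 L α β _ (λ s → h (true ∷ s))) (Vw-0 L α β _ (λ s → h (false ∷ s))))
  (cong₂ _+_ (*-zeroʳ (α c)) (*-zeroʳ (β c)))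

an-outside : {A : Set} (L : List A) (e : A → ℤ) (ψ : Fn (length L)) → (∀ x → x ∈ L → e x ≡ 0ℤ) → ∀ s → an L e ψ s ≡ 0ℤ
an-outside [] e ψ h s = refl
an-outside (c ∷ L) e ψ h (true ∷ s) = cong -ᶻ_ (an-outside L e (ψ ᵗ) (λ x m → h x (there m)) s)
an-outside (c ∷ L) e ψ h (false ∷ s) = cong₂ _+ᶻ_ (trans (cong (_*ᶻ ψ (true ∷ s)) (h c (here refl))) (ℤP.*-zeroˡ (ψ (true ∷ s)))) (an-outside L e (ψ ᶠ) (λ x m → h x (there m)) s)

cr-outside : {A : Set} (L : List A) (e : A → ℤ) (ψ : Fn (length L)) → (∀ x → x ∈ L → e x ≡ 0ℤ) → ∀ s → cr L e ψ s ≡ 0ℤ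
cr-outside [] e ψ h s = refl
cr-outside (c ∷ L) e ψ h (true ∷ s) = cong₂ (λ x y → x +ᶻ -ᶻ y) (trans (cong (_*ᶻ ψ (false ∷ s)) (h c (here refl))) (ℤP.*-zeroˡ (ψ (false ∷ s)))) (cr-outside L e (ψ ᵗ) (λ x m → h x (there m)) s)
cr-outside (c ∷ L) e ψ h (false ∷ s) = cr-outside L e (ψ ᶠ) (λ x m → h x (there m)) s

module _ {A : Set} (t : A) (e : A → ℤ) (e1 : e t ≡ 1ℤ) (e0 : ∀ s → s ≢ t → e s ≡ 0ℤ)
         (y : ℕ) (α α' : A → ℕ) (a1 : α t ≡ 1) (a2 : α' t ≡ 1 + y) (a3 : ∀ s → s ≢ t → α' s ≡ α s) where

  private
    off : {L : List A} → All (λ z → t ≢ z) L → ∀ x → x ∈ L → x ≢ t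
    off p x m refl = All.lookup p m refl

    r1 : ∀ y a b → (1 + y) * a + 1 * b ≡ (1 * a + 1 * b) + y * (1 * 0 + 1 * a)
    r1 = ringℕ
    r2 : ∀ y p q a a' b b' → p * (a + y * a') + q * (b + y * b') ≡ (p * a + q * b) + y * (p * a' + q * b')
    r2 = ringℕ
    r1' : ∀ y a b → 1 * b + (1 + y) * a ≡ (1 * b + 1 * a) + y * (1 * a + 1 * 0)
    r1' = ringℕ

  -- Annihilating the basis mode t keeps exactly the amplitudes with t occupied, up to sign, and
  -- empties t. These are the amplitudes whose weight grows from 1 to 1 + y.
  Vw-an : (L : List A) → Unique L → t ∈ L → (ψ : Fn (length L)) → Vw L α' one ψ ≡ Vw L α one ψ + y * Vw L α one (an L e ψ)
  Vw-an (c ∷ L) (p ∷ u) (here refl) ψ = trans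
    (cong₂ (λ a b → a + 1 * b) (cong₂ _*_ a2 (Vw-cong L (ψ ᵗ) (λ x m → a3 x (off p x m)) (λ _ _ → refl))) (Vw-cong L (ψ ᶠ) (λ x m → a3 x (off p x m)) (λ _ _ → refl)))
    (trans (r1 y (Vw L α one (ψ ᵗ)) (Vw L α one (ψ ᶠ)))
    (sym (cong₂ (λ a b → (a * Vw L α one (ψ ᵗ) + 1 * Vw L α one (ψ ᶠ)) + y * b) a1
      (cong₂ _+_ (cong₂ _*_ a1 (Vw-0 L α one _ (λ s → cong -ᶻ_ (z (ψ ᵗ) s))))
        (cong (1 *_) (Vw-congψ L α one (λ s → cong sq (trans (cong₂ _+ᶻ_ (trans (cong (_*ᶻ ψ (true ∷ s)) e1) (ℤP.*-identityˡ _)) (z (ψ ᶠ) s)) (ℤP.+-identityʳ (ψ (true ∷ s)))))))))))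
    where z : ∀ ψ s → an L e ψ s ≡ 0ℤ
          z ψ = an-outside L e ψ (λ x m → e0 x (off p x m))
  Vw-an (c ∷ L) (p ∷ u) (there m) ψ = trans
    (cong₂ _+_ (cong₂ _*_ (a3 c ne) (Vw-an L u m (ψ ᵗ))) (cong (1 *_) (Vw-an L u m (ψ ᶠ))))
    (trans (r2 y (α c) 1 (Vw L α one (ψ ᵗ)) (Vw L α one (an L e (ψ ᵗ))) (Vw L α one (ψ ᶠ)) (Vw L α one (an L e (ψ ᶠ))))
    (sym (cong (λ b → (α c * Vw L α one (ψ ᵗ) + 1 * Vw L α one (ψ ᶠ)) + y * b)
      (cong₂ _+_ (cong (α c *_) (Vw-congψ L α one (λ s → sq-neg (an L e (ψ ᵗ) s))))
        (cong (1 *_) (Vw-congψ L α one (λ s → cong sq (trans (cong (_+ᶻ an L e (ψ ᶠ) s) (trans (cong (_*ᶻ ψ (true ∷ s)) (e0 c ne)) (ℤP.*-zeroˡ (ψ (true ∷ s))))) (ℤP.+-identityˡ (an L e (ψ ᶠ) s))))))))))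
    where ne : c ≢ t
          ne refl = All.lookup p m refl

  -- The particle-hole dual: creation keeps the amplitudes with t empty, and the tilted weights are
  -- now those of empty modes.
  Vw-cr : (L : List A) → Unique L → t ∈ L → (ψ : Fn (length L)) → Vw L one α' ψ ≡ Vw L one α ψ + y * Vw L one α (cr L e ψ)
  Vw-cr (c ∷ L) (p ∷ u) (here refl) ψ = trans
    (cong₂ (λ a b → 1 * b + a) (cong₂ _*_ a2 (Vw-cong L (ψ ᶠ) (λ _ _ → refl) (λ x m → a3 x (off p x m)))) (Vw-cong L (ψ ᵗ) (λ _ _ → refl) (λ x m → a3 x (off p x m))))
    (trans (r1' y (Vw L one α (ψ ᶠ)) (Vw L one α (ψ ᵗ)))
    (sym (cong₂ (λ a b → (1 * Vw L one α (ψ ᵗ) + a * Vw L one α (ψ ᶠ)) + y * b) a1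
      (cong₂ _+_
        (cong (1 *_) (Vw-congψ L one α (λ s → cong sq (trans (cong₂ (λ a b → a +ᶻ -ᶻ b) (trans (cong (_*ᶻ ψ (false ∷ s)) e1) (ℤP.*-identityˡ _)) (z (ψ ᵗ) s)) (ℤP.+-identityʳ (ψ (false ∷ s)))))))
        (cong₂ _*_ a1 (Vw-0 L one α _ (z (ψ ᶠ))))))))
    where z : ∀ ψ s → cr L e ψ s ≡ 0ℤ
          z ψ = cr-outside L e ψ (λ x m → e0 x (off p x m))
  Vw-cr (c ∷ L) (p ∷ u) (there m) ψ = trans
    (cong₂ _+_ (cong (1 *_) (Vw-cr L u m (ψ ᵗ))) (cong₂ _*_ (a3 c ne) (Vw-cr L u m (ψ ᶠ))))
    (trans (r2 y 1 (α c) (Vw L one α (ψ ᵗ)) (Vw L one α (cr L e (ψ ᵗ))) (Vw L one α (ψ ᶠ)) (Vw L one α (cr L e (ψ ᶠ))))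
    (sym (cong (λ b → (1 * Vw L one α (ψ ᵗ) + α c * Vw L one α (ψ ᶠ)) + y * b)
      (cong (λ z → 1 * z + α c * Vw L one α (cr L e (ψ ᶠ)))
        (Vw-congψ L one α (λ s → trans (cong sq (trans (cong (_+ᶻ -ᶻ cr L e (ψ ᵗ) s) (trans (cong (_*ᶻ ψ (false ∷ s)) (e0 c ne)) (ℤP.*-zeroˡ (ψ (false ∷ s))))) (ℤP.+-identityˡ (-ᶻ cr L e (ψ ᵗ) s)))) (sq-neg (cr L e (ψ ᵗ) s))))))))
    where ne : c ≢ t
          ne refl = All.lookup p m refl

-- If inserting any further mode costs a factor of at most D/n, then
-- exponential moments factorise.
module Moment {A State : Set} (_≟_ : (x y : A) → Dec (x ≡ y)) (G : State → Set) (op : A → State → State)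
  (V : (A → ℕ) → State → ℕ) (In : A → Set) (n D : ℕ)
  (V-up : ∀ t → In t → ∀ y α α' → α t ≡ 1 → α' t ≡ 1 + y → (∀ s → s ≢ t → α' s ≡ α s) → ∀ ψ → V α' ψ ≡ V α ψ + y * V α (op t ψ))
  (closed : ∀ t ψ → In t → G ψ → G (op t ψ))
  (bound : ∀ t ψ → In t → G ψ → n * V one (op t ψ) ≤ D * V one ψ)
  (y : A → ℕ) where

  wt : List A → A → ℕ
  wt [] s = 1
  wt (t ∷ ts) s with s ≟ t
  ... | yes _ = 1 + y t
  ... | no _ = wt ts s

  wt-∉ : ∀ ts s → All (λ z → s ≢ z) ts → wt ts s ≡ 1
  wt-∉ [] s [] = refl
  wt-∉ (t ∷ ts) s (p ∷ ps) with s ≟ t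
  ... | yes e = ⊥-elim (p e)
  ... | no _ = wt-∉ ts s ps

  wt-here : ∀ t ts → wt (t ∷ ts) t ≡ 1 + y t
  wt-here t ts with t ≟ t
  ... | yes _ = refl
  ... | no p = ⊥-elim (p refl)

  wt-there : ∀ t ts s → s ≢ t → wt (t ∷ ts) s ≡ wt ts s
  wt-there t ts s p with s ≟ t
  ... | yes e = ⊥-elim (p e)
  ... | no _ = refl

  wt-∈ : ∀ ts s → s ∈ ts → wt ts s ≡ 1 + y s
  wt-∈ (t ∷ ts) s m with s ≟ t
  ... | yes refl = refl
  wt-∈ (t ∷ ts) s (here e) | no p = ⊥-elim (p e)
  wt-∈ (t ∷ ts) s (there m) | no p = wt-∈ ts s m

  -- Tilting one more mode splits the mass into that of ψ and that of `op t ψ`. The induction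
  -- hypothesis is applied to both, which is why `bound` must hold throughout the closed class `G`
  -- and not just at the initial state.
  moment : ∀ ts → Unique ts → All In ts → ∀ ψ → G ψ → n ^ length ts * V (wt ts) ψ ≤ ∏ ts (λ t → n + D * y t) * V one ψ
  moment [] _ _ ψ g = ≤-refl
  moment (t ∷ ts) (p ∷ u) (i ∷ is) ψ g = begin
    n * n ^ length ts * V (wt (t ∷ ts)) ψ
      ≡⟨ cong (n * n ^ length ts *_) (V-up t i (y t) (wt ts) (wt (t ∷ ts)) (wt-∉ ts t p) (wt-here t ts) (wt-there t ts) ψ) ⟩
    n * n ^ length ts * (V (wt ts) ψ + y t * V (wt ts) (op t ψ))
      ≡⟨ s1 n (n ^ length ts) _ (y t) _ ⟩
    n * (n ^ length ts * V (wt ts) ψ) + n * y t * (n ^ length ts * V (wt ts) (op t ψ))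
      ≤⟨ +-mono-≤ (*-monoʳ-≤ n (moment ts u is ψ g)) (*-monoʳ-≤ (n * y t) (moment ts u is (op t ψ) (closed t ψ i g))) ⟩
    n * (P * V one ψ) + n * y t * (P * V one (op t ψ))
      ≡⟨ s2 n P (V one ψ) (y t) (V one (op t ψ)) ⟩
    n * P * V one ψ + y t * P * (n * V one (op t ψ))
      ≤⟨ +-monoʳ-≤ (n * P * V one ψ) (*-monoʳ-≤ (y t * P) (bound t ψ i g)) ⟩
    n * P * V one ψ + y t * P * (D * V one ψ)
      ≡⟨ s3 n P (V one ψ) (y t) D ⟩
    (n + D * y t) * P * V one ψ ∎
    where
    open ≤-Reasoning
    P = ∏ ts (λ t → n + D * y t)
    s1 : ∀ n m a y b → n * m * (a + y * b) ≡ n * (m * a) + n * y * (m * b)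
    s1 = ringℕ
    s2 : ∀ n P v y w → n * (P * v) + n * y * (P * w) ≡ n * P * v + y * P * (n * w)
    s2 = ringℕ
    s3 : ∀ n P v y D → n * P * v + y * P * (D * v) ≡ (n + D * y) * P * v
    s3 = ringℕ

-- Sublists, and families of states compatible with restriction to them.

data _⊑_ {A : Set} : List A → List A → Set where
  nil : [] ⊑ []
  keep : ∀ {x xs ys} → xs ⊑ ys → (x ∷ xs) ⊑ (x ∷ ys)
  drop : ∀ {x xs ys} → xs ⊑ ys → xs ⊑ (x ∷ ys)

⊑-refl : {A : Set} (xs : List A) → xs ⊑ xs
⊑-refl [] = nil
⊑-refl (x ∷ xs) = keep (⊑-refl xs)

emb : {A : Set} {T L : List A} → T ⊑ L → Subset (length T) → Subset (length L)
emb nil s = s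
emb (keep p) (b ∷ s) = b ∷ emb p s
emb (drop p) s = false ∷ emb p s

emb-refl : {A : Set} (L : List A) (s : Subset (length L)) → emb (⊑-refl L) s ≡ s
emb-refl [] s = refl
emb-refl (x ∷ L) (b ∷ s) = cong (b ∷_) (emb-refl L s)

full : ∀ n → Subset n
full zero = []
full (suc n) = true ∷ full n

-- Leaving modes empty is the same as deleting them. Hence the amplitude of a wedge over `L` at the
-- configuration occupying `T` is the top amplitude of the wedge over `T` alone, that is, a maximal
-- minor.
Natural : {A : Set} → ((T : List A) → Fn (length T)) → Set
Natural {A} G = ∀ {T L : List A} (p : T ⊑ L) s → G L (emb p s) ≡ G T s

cr-natural : {A : Set} (v : A → ℤ) (G : (T : List A) → Fn (length T)) → Natural G → Natural (λ T → cr T v (G T))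
cr-natural v G h {T} {L} p s = trans (go p (G L) s) (cr-congψ T v (h p) s)
  where
  go : ∀ {T L} (p : T ⊑ L) (ψ : Fn (length L)) s → cr L v ψ (emb p s) ≡ cr T v (ψ ∘ emb p) s
  go nil ψ s = refl
  go {x ∷ T} (keep p) ψ (true ∷ s) = cong (λ z → v x *ᶻ ψ (false ∷ emb p s) +ᶻ -ᶻ z) (go p (ψ ᵗ) s)
  go (keep p) ψ (false ∷ s) = go p (ψ ᶠ) s
  go (drop p) ψ s = go p (ψ ᶠ) s

vac-natural : {A : Set} → Natural {A} vac
vac-natural nil s = refl
vac-natural (keep p) (true ∷ s) = refl
vac-natural (keep p) (false ∷ s) = vac-natural p s
vac-natural (drop p) s = vac-natural p s

wedge-natural : {A : Set} (vs : List (A → ℤ)) → Natural (λ T → wedge T vs)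
wedge-natural [] = vac-natural
wedge-natural (v ∷ vs) = cr-natural v (λ T → wedge T vs) (wedge-natural vs)

top : {A : Set} (T : List A) → Fn (length T) → ℤ
top T ψ = ψ (full (length T))

module _ {A : Set} where

  private
    drop-head : (G : (T : List A) → Fn (length T)) → Natural G → ∀ c L s → G L s ≡ G (c ∷ L) (false ∷ s)
    drop-head G h c L s = trans (sym (h (drop {x = c} (⊑-refl L)) s)) (cong (λ z → G (c ∷ L) (false ∷ z)) (emb-refl L s))

    tail-natural : (G : (T : List A) → Fn (length T)) → Natural G → ∀ c → Natural (λ T → G (c ∷ T) ᵗ)
    tail-natural G h c p s = h (keep p) (true ∷ s)

  -- Sublists of `L` correspond to configurations, and by naturality the amplitudes agree. Weighted
  -- sums of squared minors thereby become norms of a single state, with no Cauchy-Binet formula.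
  sublist-sum : (G : (T : List A) → Fn (length T)) → Natural G → ∀ L α →
    ∑ (sublists L) (λ T → sq (top T (G T)) * ∏ T α) ≡ Vw L α one (G L)
  sublist-sum G h [] α = trans (+-identityʳ _) (*-identityʳ _)
  sublist-sum G h (c ∷ L) α = trans (∑-++ (map (c ∷_) (sublists L)) (sublists L) _)
    (cong₂ _+_
      (trans (∑-map (c ∷_) (sublists L) _) (trans (∑-cong (sublists L) (λ T → e (sq (top (c ∷ T) (G (c ∷ T)))) (α c) (∏ T α)))
        (trans (∑-* (sublists L) (α c) _) (cong (α c *_) (sublist-sum (λ T → G (c ∷ T) ᵗ) (tail-natural G h c) L α)))))
      (trans (sublist-sum G h L α) (trans (Vw-congψ L α one (λ s → cong sq (drop-head G h c L s))) (sym (*-identityˡ (Vw L α one (G (c ∷ L) ᶠ)))))))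
    where e : ∀ w a p → w * (a * p) ≡ a * (w * p)
          e = ringℕ

  cnt : (A → Bool) → List A → ℕ
  cnt p [] = 0
  cnt p (x ∷ xs) = (if p x then 1 else 0) + cnt p xs

  cnt-sublist : (p : A → Bool) (L : List A) → ∀ T → T ∈ sublists L → cnt p T ≤ cnt p L
  cnt-sublist p [] T (here refl) = z≤n
  cnt-sublist p (x ∷ L) T m with MemP.∈-++⁻ (map (x ∷_) (sublists L)) m
  ... | inj₂ m' = ≤-trans (cnt-sublist p L T m') (m≤n+m _ _)
  ... | inj₁ m' with MemP.∈-map⁻ (x ∷_) m'
  ...   | T' , m'' , refl = +-monoʳ-≤ (if p x then 1 else 0) (cnt-sublist p L T' m'')

  -- The exponent counts the members of `X` missed by `T`, so here it is the empty modes that carry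
  -- the weight 2.
  sublist-sum-out : (X : A → Bool) (G : (T : List A) → Fn (length T)) → Natural G → ∀ L →
    ∑ (sublists L) (λ T → sq (top T (G T)) * 2 ^ (cnt X L ∸ cnt X T)) ≡ Vw L one (λ t → if X t then 2 else 1) (G L)
  sublist-sum-out X G h [] = trans (+-identityʳ _) (*-identityʳ _)
  sublist-sum-out X G h (c ∷ L) = trans (∑-++ (map (c ∷_) (sublists L)) (sublists L) _)
    (cong₂ _+_
      (trans (∑-map (c ∷_) (sublists L) _) (trans (∑-cong (sublists L) (λ T → cong (λ z → sq (top (c ∷ T) (G (c ∷ T))) * 2 ^ z) ([m+n]∸[m+o]≡n∸o (if X c then 1 else 0) (cnt X L) (cnt X T))))
        (trans (sublist-sum-out X (λ T → G (c ∷ T) ᵗ) (tail-natural G h c) L) (sym (*-identityˡ (Vw L one _ (G (c ∷ L) ᵗ)))))))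
      (trans (trans (∑-cong∈ (sublists L) (λ T m → trans (cong (λ z → sq (top T (G T)) * 2 ^ z) (+-∸-assoc (if X c then 1 else 0) (cnt-sublist X L T m))) (e (X c) (sq (top T (G T))) _)))
        (trans (∑-* (sublists L) (if X c then 2 else 1) _) (cong ((if X c then 2 else 1) *_) (sublist-sum-out X G h L))))
        (cong ((if X c then 2 else 1) *_) (Vw-congψ L one _ (λ s → cong sq (drop-head G h c L s))))))
    where e : ∀ b w a → w * 2 ^ ((if b then 1 else 0) + a) ≡ (if b then 2 else 1) * (w * 2 ^ a)
          e true w a = e1 w (2 ^ a)
            where e1 : ∀ w x → w * (2 * x) ≡ 2 * (w * x)
                  e1 = ringℕ
          e false w a = sym (*-identityˡ _)

_≟ˢ_ : ∀ {n} (σ τ : Subset n) → Dec (σ ≡ τ)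
_≟ˢ_ = VecP.≡-dec BoolP._≟_

lv-size : ∀ n s {σ} → σ ∈ lv n s → ∣ σ ∣ ≡ s
lv-size zero zero (here refl) = refl
lv-size (suc n) zero m with MemP.∈-map⁻ (false ∷_) m
... | σ , m' , refl = lv-size n zero m'
lv-size (suc n) (suc s) m with MemP.∈-++⁻ (map (true ∷_) (lv n s)) m
... | inj₁ m₁ with MemP.∈-map⁻ (true ∷_) m₁
...   | σ , m' , refl = cong suc (lv-size n s m')
lv-size (suc n) (suc s) m | inj₂ m₂ with MemP.∈-map⁻ (false ∷_) m₂
...   | σ , m' , refl = lv-size n (suc s) m'

∈-lv : ∀ {n} (σ : Subset n) → σ ∈ lv n ∣ σ ∣
∈-lv [] = here refl
∈-lv (true ∷ σ) = MemP.∈-++⁺ˡ (MemP.∈-map⁺ (true ∷_) (∈-lv σ))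
∈-lv {suc n} (false ∷ σ) with ∣ σ ∣ | ∈-lv σ
... | zero | m = MemP.∈-map⁺ (false ∷_) m
... | suc s | m = MemP.∈-++⁺ʳ (map (true ∷_) (lv n s)) (MemP.∈-map⁺ (false ∷_) m)

size⇒∈lv : ∀ {n s} (σ : Subset n) → ∣ σ ∣ ≡ s → σ ∈ lv n s
size⇒∈lv σ refl = ∈-lv σ

∷-inj : ∀ {n} {b : Bool} {σ τ : Subset n} → (b Data.Vec.∷ σ) ≡ (b ∷ τ) → σ ≡ τ
∷-inj refl = refl

lv-unique : ∀ n s → Unique (lv n s)
lv-unique zero zero = [] ∷ []
lv-unique zero (suc s) = []
lv-unique (suc n) zero = UniqueP.map⁺ ∷-inj (lv-unique n zero)
lv-unique (suc n) (suc s) = UniqueP.++⁺ (UniqueP.map⁺ ∷-inj (lv-unique n s)) (UniqueP.map⁺ ∷-inj (lv-unique n (suc s))) dis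
  where dis : ∀ {v} → ¬ (v ∈ map (true ∷_) (lv n s) × v ∈ map (false ∷_) (lv n (suc s)))
        dis (p , q) with MemP.∈-map⁻ (true ∷_) p | MemP.∈-map⁻ (false ∷_) q
        ... | _ , _ , refl | _ , _ , ()

∣∣≤n : ∀ {n} (σ : Subset n) → ∣ σ ∣ ≤ n
∣∣≤n [] = z≤n
∣∣≤n (true ∷ σ) = s≤s (∣∣≤n σ)
∣∣≤n (false ∷ σ) = m≤n⇒m≤1+n (∣∣≤n σ)

-- Row σ τ is the incidence number of σ in τ.
Row : ∀ {n} → Subset n → Fn n
Row σ = cobd (ind σ)

Supp-Row : ∀ {n} (σ : Subset n) {s} → ∣ σ ∣ ≡ s → Supp (suc s) (Row σ)
Supp-Row σ refl = Supp-cobd ∣ σ ∣ (ind σ) (Supp-ind σ)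

cobd-Row : ∀ {n} (f : Fn n) τ → cobd f τ ≡ ipA f (λ σ → Row σ τ)
cobd-Row f τ = trans (sym (ipA-ind τ (cobd f))) (trans (ipA-comm (ind τ) (cobd f)) (trans (adjoint f (ind τ))
  (trans (ipA-comm f (bd (ind τ))) (trans (ipA-congˡ f (λ σ → bd-ind σ τ)) (ipA-comm (λ σ → Row σ τ) f)))))

ip-Row-cobd-bd : ∀ {n} (σ : Subset n) (c : Fn n) → ipA (Row σ) (cobd (bd c)) ≡ pos n *ᶻ bd c σ
ip-Row-cobd-bd σ c = trans (adjoint (ind σ) (cobd (bd c))) (trans (ipA-ind σ (bd (cobd (bd c)))) (bd-cobd-bd c σ))

-- n times the orthogonal projection of the basis vector t onto the row space.
Proj : ∀ {n} → Subset n → Fn n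
Proj t = cobd (bd (ind t))

Coproj : ∀ {n} → Subset n → Fn n
Coproj {n} t s = pos n *ᶻ ind t s +ᶻ -ᶻ Proj t s

-- The wedge of the boundary rows and its exponential moments.

module Rows (m d : ℕ) where

  -- Index shift: the complexes have dimension `suc d`, and `D` is the number of vertices of a top
  -- face.
  n D : ℕ
  n = suc m
  D = suc (suc d)

  L : List (Subset n)
  L = lv n D

  -- Dropping the faces through vertex 0 loses nothing of the row space, by `Row-relation`, and
  -- makes the number of rows equal to the number of top faces of a hypertree.
  rows : List (Fn n)
  rows = map (λ σ → Row (false ∷ σ)) (lv m (suc d))

  ω : (T : List (Subset n)) → Fn (length T)
  ω T = wedge T rows

  detT : List (Subset n) → ℤ
  detT T = top T (ω T)

  wgt : List (Subset n) → ℕ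
  wgt T = sq (detT T)

  dot-ip : ∀ f g → Supp D f → dot L f g ≡ ipA f g
  dot-ip f g h = sym (ipA-lv D f g h)

  Supp-Proj : ∀ (t : Subset n) → ∣ t ∣ ≡ D → Supp D (Proj t)
  Supp-Proj t e = Supp-cobd (suc d) (bd (ind t)) (Supp-bd (suc d) (ind t) (subst (λ z → Supp z (ind t)) e (Supp-ind t)))

  dot-Proj-Row : ∀ (t : Subset n) → ∣ t ∣ ≡ D → ∀ σ → dot L (Proj t) (Row σ) ≡ pos n *ᶻ Row σ t
  dot-Proj-Row t e σ = trans (dot-ip (Proj t) (Row σ) (Supp-Proj t e)) (trans (ipA-comm (Proj t) (Row σ))
    (trans (ip-Row-cobd-bd σ (ind t)) (cong (pos n *ᶻ_) (bd-ind σ t))))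

  dot-Proj-Proj : ∀ (t : Subset n) → ∣ t ∣ ≡ D → dot L (Proj t) (Proj t) ≡ pos n *ᶻ pos D
  dot-Proj-Proj t e = trans (dot-ip (Proj t) (Proj t) (Supp-Proj t e)) (trans (adjoint (bd (ind t)) (Proj t))
    (trans (ipA-comm (bd (ind t)) (bd (Proj t))) (trans (ipA-congˡ (bd (ind t)) (bd-cobd-bd (ind t)))
    (trans (ipA-smul (pos n) (bd (ind t)) (bd (ind t))) (cong (pos n *ᶻ_) (trans (norm-bd-ind t) (cong pos e)))))))

  dot-ind : ∀ (t : Subset n) → ∣ t ∣ ≡ D → ∀ g → dot L (ind t) g ≡ g t
  dot-ind t e g = trans (dot-ip (ind t) g (subst (λ z → Supp z (ind t)) e (Supp-ind t))) (ipA-ind t g)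

  dot-lin : ∀ k (f f' g : Fn n) → dot L (λ s → k *ᶻ f s +ᶻ -ᶻ f' s) g ≡ k *ᶻ dot L f g +ᶻ -ᶻ dot L f' g
  dot-lin k f f' g = go L
    where
    e : ∀ k a b c x y → (k *ᶻ a +ᶻ -ᶻ b) *ᶻ c +ᶻ (k *ᶻ x +ᶻ -ᶻ y) ≡ k *ᶻ (a *ᶻ c +ᶻ x) +ᶻ -ᶻ (b *ᶻ c +ᶻ y)
    e = ringℤ
    e0 : ∀ k → 0ℤ ≡ k *ᶻ 0ℤ +ᶻ -ᶻ 0ℤ
    e0 = ringℤ
    go : ∀ M → dot M (λ s → k *ᶻ f s +ᶻ -ᶻ f' s) g ≡ k *ᶻ dot M f g +ᶻ -ᶻ dot M f' g
    go [] = e0 k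
    go (x ∷ M) = trans (cong ((k *ᶻ f x +ᶻ -ᶻ f' x) *ᶻ g x +ᶻ_) (go M)) (e k (f x) (f' x) (g x) (dot M f g) (dot M f' g))

  dot-comm : ∀ (f g : Fn n) → dot L f g ≡ dot L g f
  dot-comm f g = ∑ᶻ-cong L (λ s → ℤP.*-comm (f s) (g s))

  dot-Coproj : ∀ (t : Subset n) → ∣ t ∣ ≡ D → dot L (Coproj t) (Coproj t) ≡ pos n *ᶻ (pos n +ᶻ -ᶻ pos D)
  dot-Coproj t e = trans (dot-lin (pos n) (ind t) (Proj t) (Coproj t))
    (trans (cong₂ (λ a b → pos n *ᶻ a +ᶻ -ᶻ b) (dot-ind t e (Coproj t))
       (trans (dot-comm (Proj t) (Coproj t)) (trans (dot-lin (pos n) (ind t) (Proj t) (Proj t)) (cong₂ (λ a b → pos n *ᶻ a +ᶻ -ᶻ b) (dot-ind t e (Proj t)) (dot-Proj-Proj t e)))))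
    (trans (cong₂ (λ a b → pos n *ᶻ (pos n *ᶻ a +ᶻ -ᶻ b) +ᶻ -ᶻ (pos n *ᶻ b +ᶻ -ᶻ (pos n *ᶻ pos D))) (ind-refl t) pt) (r (pos n) (pos D))))
    where
    pt : Proj t t ≡ pos D
    pt = trans (sym (ipA-ind t (Proj t))) (trans (ipA-comm (ind t) (Proj t)) (trans (adjoint (bd (ind t)) (ind t)) (trans (norm-bd-ind t) (cong pos e))))
    r : ∀ n D → n *ᶻ (n *ᶻ 1ℤ +ᶻ -ᶻ D) +ᶻ -ᶻ (n *ᶻ D +ᶻ -ᶻ (n *ᶻ D)) ≡ n *ᶻ (n +ᶻ -ᶻ D)
    r = ringℤ

  -- `Proj t` pairs with each row as n times the basis vector of t does, so their difference is
  -- orthogonal to every vector of the wedge.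
  an-Coproj-ω : ∀ (t : Subset n) → ∣ t ∣ ≡ D → ∀ s → an L (Coproj t) (ω L) s ≡ 0ℤ
  an-Coproj-ω t e = an-wedge-0 L (Coproj t) rows (All.tabulate h)
    where
    r : ∀ a → a +ᶻ -ᶻ a ≡ 0ℤ
    r = ringℤ
    h : ∀ {v} → v ∈ rows → dot L (Coproj t) v ≡ 0ℤ
    h mem with MemP.∈-map⁻ (λ σ → Row (false ∷ σ)) mem
    ... | σ , _ , refl = trans (dot-lin (pos n) (ind t) (Proj t) (Row (false ∷ σ)))
      (trans (cong₂ (λ a b → pos n *ᶻ a +ᶻ -ᶻ b) (dot-ind t e (Row (false ∷ σ))) (dot-Proj-Row t e (false ∷ σ))) (r (pos n *ᶻ Row (false ∷ σ) t)))

  Row-relation : ∀ ρ → ∣ ρ ∣ ≡ d → ∀ τ → Row (true ∷ ρ) τ +ᶻ ∑ᶻ (lv m (suc d)) (λ σ → Row ρ σ *ᶻ Row (false ∷ σ) τ) ≡ 0ℤ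
  Row-relation ρ e τ = trans (cong₂ _+ᶻ_
      (trans (sym (ipA-ind ρ (λ σ → Row (true ∷ σ) τ))) (ipA-congˡ (λ σ → Row (true ∷ σ) τ) (λ σ → sym (trans (cong (λ z → ind ρ σ +ᶻ -ᶻ z) (cobd-0 _ (λ _ → refl) σ)) (ℤP.+-identityʳ _)))))
      (sym (ipA-lv (suc d) (Row ρ) (λ σ → Row (false ∷ σ) τ) (Supp-Row ρ e))))
    (trans (sym (cobd-Row (cobd (ind (false ∷ ρ))) τ)) (cobd-cobd (ind (false ∷ ρ)) τ))

  -- A row through vertex 0 is an integral combination of rows already in the wedge, because
  -- `cobd ∘ cobd` vanishes.
  cr-Row-ω : ∀ σ → σ ∈ lv n (suc d) → ∀ s → cr L (Row σ) (ω L) s ≡ 0ℤ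
  cr-Row-ω (false ∷ σ) mem = cr-pre-0 L rows (vac L) (MemP.∈-map⁺ (λ σ → Row (false ∷ σ)) (size⇒∈lv σ (lv-size n (suc d) mem)))
  cr-Row-ω (true ∷ ρ) mem s = trans (cr-cong L exp (λ _ → refl) s)
    (cr-comb-0 L (lv m (suc d)) (λ σ → -ᶻ cobd (ind ρ) σ) (λ σ → Row (false ∷ σ)) (ω L)
       (λ σ mem' → cr-pre-0 L rows (vac L) (MemP.∈-map⁺ (λ σ → Row (false ∷ σ)) mem')) s)
    where
    r : ∀ a b → a +ᶻ b ≡ 0ℤ → a ≡ -ᶻ b
    r a b e = trans (r' a b) (trans (cong (_+ᶻ -ᶻ b) e) (ℤP.+-identityˡ (-ᶻ b)))
      where r' : ∀ a b → a ≡ (a +ᶻ b) +ᶻ -ᶻ b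
            r' = ringℤ
    ρsz : ∣ ρ ∣ ≡ d
    ρsz = suc-injective (lv-size n (suc d) mem)
    exp : Row (true ∷ ρ) ≗ᶠ comb (lv m (suc d)) (λ σ → -ᶻ cobd (ind ρ) σ) (λ σ → Row (false ∷ σ))
    exp τ = trans (r (Row (true ∷ ρ) τ) (∑ᶻ (lv m (suc d)) (λ σ → cobd (ind ρ) σ *ᶻ Row (false ∷ σ) τ))
      (Row-relation ρ ρsz τ))
      (trans (sym (ℤP.-1*i≡-i _)) (trans (sym (∑ᶻ-* (lv m (suc d)) -1ℤ _)) (∑ᶻ-cong (lv m (suc d)) (λ σ → r2 (cobd (ind ρ) σ) (Row (false ∷ σ) τ)))))
      where r2 : ∀ a b → -1ℤ *ᶻ (a *ᶻ b) ≡ -ᶻ a *ᶻ b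
            r2 = ringℤ

  cr-Proj-ω : ∀ (t : Subset n) → ∣ t ∣ ≡ D → ∀ s → cr L (Proj t) (ω L) s ≡ 0ℤ
  cr-Proj-ω t e s = trans (cr-cong L (λ τ → trans (cobd-Row (bd (ind t)) τ) (ipA-lv (suc d) (bd (ind t)) (λ σ → Row σ τ)
      (Supp-bd (suc d) (ind t) (subst (λ z → Supp z (ind t)) e (Supp-ind t))))) (λ _ → refl) s)
    (cr-comb-0 L (lv n (suc d)) (bd (ind t)) Row (ω L) cr-Row-ω s)

  Vw-scale : ∀ (M : List (Subset n)) (k : ℕ) (ψ ψ' : Fn (length M)) → (∀ s → ψ' s ≡ pos k *ᶻ ψ s) → nrm M ψ' ≡ k * k * nrm M ψ
  Vw-scale [] k ψ ψ' h = trans (cong sq (h [])) (trans (cong (λ z → z * z) (ℤP.abs-* (pos k) (ψ []))) (r k ∣ ψ [] ∣ᶻ))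
    where r : ∀ k x → k * x * (k * x) ≡ k * k * (x * x)
          r = ringℕ
  Vw-scale (c ∷ M) k ψ ψ' h = trans (cong₂ (λ a b → 1 * a + 1 * b) (Vw-scale M k (ψ ᵗ) (ψ' ᵗ) (λ s → h (true ∷ s))) (Vw-scale M k (ψ ᶠ) (ψ' ᶠ) (λ s → h (false ∷ s))))
    (r (k * k) (nrm M (ψ ᵗ)) (nrm M (ψ ᶠ)))
    where r : ∀ k x y → 1 * (k * x) + 1 * (k * y) ≡ k * (1 * x + 1 * y)
          r = ringℕ

  nrm-split : (u : Fn n) (U : ℕ) → dot L u u ≡ pos U → ∀ ψ → nrm L (an L u ψ) + nrm L (cr L u ψ) ≡ U * nrm L ψ
  nrm-split u U e ψ = ℤP.+-injective (trans (ℤP.pos-+ (nrm L (an L u ψ)) (nrm L (cr L u ψ)))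
    (trans (cong₂ _+ᶻ_ (nrm-ip L (an L u ψ)) (nrm-ip L (cr L u ψ)))
    (trans (norm-split L u ψ) (trans (cong₂ _*ᶻ_ e (sym (nrm-ip L ψ))) (sym (ℤP.pos-* U (nrm L ψ)))))))

  -- The parts of "ψ comes from ω" that survive inserting modes: annihilators of vectors orthogonal
  -- to the row space, respectively creators of vectors in it, give zero. Anticommutation preserves
  -- the first under annihilators and the second under creators.
  Good↓ Good↑ : Fn (length L) → Set
  Good↓ ψ = ∀ (t : Subset n) → ∣ t ∣ ≡ D → ∀ s → an L (Coproj t) ψ s ≡ 0ℤ
  Good↑ ψ = ∀ (t : Subset n) → ∣ t ∣ ≡ D → ∀ s → cr L (Proj t) ψ s ≡ 0ℤ

  private
    cancel : ∀ a b c → n * n * a ≤ n * b * c → n * a ≤ b * c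
    cancel a b c h = *-cancelˡ-≤ n (subst₂ _≤_ (*-assoc n n a) (*-assoc n b c) h)

    solve-ne : ∀ a b → a +ᶻ -ᶻ b ≡ 0ℤ → b ≡ a
    solve-ne a b e = trans (r a b) (trans (cong (λ z → -ᶻ z +ᶻ a) e) (ℤP.+-identityˡ a))
      where r : ∀ a b → b ≡ -ᶻ (a +ᶻ -ᶻ b) +ᶻ a
            r = ringℤ

    negv : (u : Fn n) → (λ s → -ᶻ u s) ≗ᶠ (λ s → -1ℤ *ᶻ u s +ᶻ 0ℤ)
    negv u s = r (u s)
      where r : ∀ a → -ᶻ a ≡ -1ℤ *ᶻ a +ᶻ 0ℤ
            r = ringℤ
    r-1 : ∀ a → -1ℤ *ᶻ a +ᶻ 0ℤ ≡ -ᶻ a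
    r-1 = ringℤ

    an-0ᵛ : (M : List (Subset n)) (ψ : Fn (length M)) → ∀ s → an M (λ _ → 0ℤ) ψ s ≡ 0ℤ
    an-0ᵛ [] ψ s = refl
    an-0ᵛ (c ∷ M) ψ (true ∷ s) = cong -ᶻ_ (an-0ᵛ M (ψ ᵗ) s)
    an-0ᵛ (c ∷ M) ψ (false ∷ s) = cong (0ℤ +ᶻ_) (an-0ᵛ M (ψ ᶠ) s)

    an-Coproj : ∀ t ψ s → an L (Coproj t) ψ s ≡ pos n *ᶻ an L (ind t) ψ s +ᶻ -ᶻ an L (Proj t) ψ s
    an-Coproj t ψ s = trans (an-linᵛ L (pos n) (ind t) (λ s → -ᶻ Proj t s) ψ s) (cong (pos n *ᶻ an L (ind t) ψ s +ᶻ_)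
      (trans (an-cong L (negv (Proj t)) (λ _ → refl) s) (trans (an-linᵛ L -1ℤ (Proj t) (λ _ → 0ℤ) ψ s)
        (trans (cong (-1ℤ *ᶻ an L (Proj t) ψ s +ᶻ_) (an-0ᵛ L ψ s)) (r-1 (an L (Proj t) ψ s))))))

    cr-Coproj : ∀ t ψ s → cr L (Coproj t) ψ s ≡ pos n *ᶻ cr L (ind t) ψ s +ᶻ -ᶻ cr L (Proj t) ψ s
    cr-Coproj t ψ s = trans (cr-linᵛ L (pos n) (ind t) (λ s → -ᶻ Proj t s) ψ s) (cong (pos n *ᶻ cr L (ind t) ψ s +ᶻ_)
      (trans (cr-cong L (negv (Proj t)) (λ _ → refl) s) (trans (cr-linᵛ L -1ℤ (Proj t) (λ _ → 0ℤ) ψ s)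
        (trans (cong (-1ℤ *ᶻ cr L (Proj t) ψ s +ᶻ_) (cr-0ᵛ L ψ s)) (r-1 (cr L (Proj t) ψ s))))))

  -- On a good state n times the annihilator of t equals that of `Proj t`. The squared length of
  -- `Proj t` is n·D, so `norm-split` bounds n² times the wanted norm, and one n cancels.
  bound↓ : ∀ t ψ → t ∈ L → Good↓ ψ → n * nrm L (an L (ind t) ψ) ≤ D * nrm L ψ
  bound↓ t ψ mem g = cancel (nrm L (an L (ind t) ψ)) D (nrm L ψ)
    (subst₂ _≤_ (Vw-scale L n (an L (ind t) ψ) (an L (Proj t) ψ)
        (λ s → solve-ne (pos n *ᶻ an L (ind t) ψ s) (an L (Proj t) ψ s) (trans (sym (an-Coproj t ψ s)) (g t e s))))
      (nrm-split (Proj t) (n * D) (trans (dot-Proj-Proj t e) (sym (ℤP.pos-* n D))) ψ)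
      (m≤m+n _ _))
    where e = lv-size n D mem

  -- The same with the complementary projection, of squared length n·(n - D). The truncated
  -- subtraction is harmless because a face with `D` vertices exists.
  bound↑ : ∀ t ψ → t ∈ L → Good↑ ψ → n * nrm L (cr L (ind t) ψ) ≤ (n ∸ D) * nrm L ψ
  bound↑ t ψ mem g = cancel (nrm L (cr L (ind t) ψ)) (n ∸ D) (nrm L ψ)
    (subst₂ _≤_ (Vw-scale L n (cr L (ind t) ψ) (cr L (Coproj t) ψ)
        (λ s → trans (cr-Coproj t ψ s) (trans (cong (λ z → pos n *ᶻ cr L (ind t) ψ s +ᶻ -ᶻ z) (g t e s)) (ℤP.+-identityʳ _))))
      (nrm-split (Coproj t) (n * (n ∸ D)) (trans (dot-Coproj t e) (trans (cong (pos n *ᶻ_) (trans (ℤP.m-n≡m⊖n n D) (ℤP.⊖-≥ D≤n))) (sym (ℤP.pos-* n (n ∸ D))))) ψ)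
      (m≤n+m _ _))
    where e = lv-size n D mem
          D≤n : D ≤ n
          D≤n = subst (_≤ n) e (∣∣≤n t)

  closed↓ : ∀ t ψ → t ∈ L → Good↓ ψ → Good↓ (an L (ind t) ψ)
  closed↓ t ψ mem g t' e s = trans (an-an L (Coproj t') (ind t) ψ s) (cong -ᶻ_ (an-0 L (ind t) _ (g t' e) s))

  closed↑ : ∀ t ψ → t ∈ L → Good↑ ψ → Good↑ (cr L (ind t) ψ)
  closed↑ t ψ mem g t' e s = trans (cr-cr L (Proj t') (ind t) ψ s) (cong -ᶻ_ (cr-0 L (ind t) _ (g t' e) s))

  Z : ℕ
  Z = ∑ (sublists L) wgt

  Z≡nrm : Z ≡ nrm L (ω L)
  Z≡nrm = trans (∑-cong (sublists L) (λ T → sym (trans (cong (wgt T *_) (prod1 T)) (*-identityʳ _)))) (sublist-sum ω (wedge-natural rows) L one)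
    where prod1 : (T : List (Subset n)) → ∏ T one ≡ 1
          prod1 [] = refl
          prod1 (x ∷ T) = trans (+-identityʳ _) (prod1 T)

  -- The substitute for independence: the exponential moment is at most what it would be if every
  -- top face occurred independently with probability D/n.
  moment-in : (y : Subset n → ℕ) → n ^ length L * ∑ (sublists L) (λ T → wgt T * ∏ T (λ t → 1 + y t)) ≤ ∏ L (λ t → n + D * y t) * Z
  moment-in y = subst₂ _≤_
    (cong (n ^ length L *_) (trans (Vw-cong L (ω L) (wt-∈ L) (λ _ _ → refl)) (sym (sublist-sum ω (wedge-natural rows) L _))))
    (cong (∏ L (λ t → n + D * y t) *_) (sym Z≡nrm))
    (moment L (lv-unique n D) (All.tabulate id) (ω L) an-Coproj-ω)
    where open Moment _≟ˢ_ Good↓ (λ t → an L (ind t)) (λ α → Vw L α one) (_∈ L) n D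
            (λ t mem y α α' a b c ψ → Vw-an t (ind t) (ind-refl t) (λ s ne → ind-≢ t s (λ e → ne (sym e))) y α α' a b c L (lv-unique n D) mem ψ) closed↓ bound↓ y

  -- Likewise as if each face of `X` were missed independently with probability 1 - D/n; this gives
  -- the lower tail that `moment-in` cannot give.
  moment-out : (X : Subset n → Bool) → n ^ length L * ∑ (sublists L) (λ T → wgt T * 2 ^ (cnt X L ∸ cnt X T)) ≤ ∏ L (λ t → n + (n ∸ D) * (if X t then 1 else 0)) * Z
  moment-out X = subst₂ _≤_
    (cong (n ^ length L *_) (trans (Vw-cong L (ω L) (λ _ _ → refl) (λ t mem → trans (wt-∈ L t mem) (b (X t)))) (sym (sublist-sum-out X ω (wedge-natural rows) L))))
    (cong (∏ L (λ t → n + (n ∸ D) * y t) *_) (sym Z≡nrm))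
    (moment L (lv-unique n D) (All.tabulate id) (ω L) cr-Proj-ω)
    where
    y : Subset n → ℕ
    y t = if X t then 1 else 0
    b : ∀ x → 1 + (if x then 1 else 0) ≡ (if x then 2 else 1)
    b true = refl
    b false = refl
    open Moment _≟ˢ_ Good↑ (λ t → cr L (ind t)) (λ α → Vw L one α) (_∈ L) n (n ∸ D)
            (λ t mem y α α' a b c ψ → Vw-cr t (ind t) (ind-refl t) (λ s ne → ind-≢ t s (λ e → ne (sym e))) y α α' a b c L (lv-unique n D) mem ψ) closed↑ bound↑ y

-- Kalai's formula

module Kalai (m d : ℕ) where

  open Rows (suc m) d

  private
    ρs σs : List (Subset m)
    ρs = lv m d
    σs = lv m (suc d)

    R1 R2 S Q0 : Subset m → Fn n
    R1 ρ = Row (false ∷ true ∷ ρ)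
    R2 σ = Row (false ∷ false ∷ σ)
    S σ = cobd (bd (ind (false ∷ true ∷ σ)))
    Q0 ρ τ = -ᶻ Row (true ∷ false ∷ ρ) τ

    -- S and Q0 arise from R2 and R1 by unimodular changes, and the Gram matrix of
    -- (R1 , S) against (Q0 , R2) is triangular with diagonal entries 1 and n.
    rows-split : rows ≡ map R1 ρs ++ map R2 σs
    rows-split = trans (ListP.map-++ _ (map (true ∷_) ρs) _) (cong₂ _++_ (sym (ListP.map-∘ ρs)) (sym (ListP.map-∘ σs)))

    z+ : ∀ a {b} → b ≡ 0ℤ → a +ᶻ b ≡ a
    z+ a refl = ℤP.+-identityʳ a

    bd-FT-F : ∀ (σ η : Subset m) → bd (ind (false ∷ true ∷ σ)) (false ∷ false ∷ η) ≡ ind σ η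
    bd-FT-F σ η = trans (ℤP.+-identityˡ _) (z+ (ind σ η) (bd-0 _ (λ _ → refl) η))

    bd-FT-T : ∀ (σ : Subset m) η → bd (ind (false ∷ true ∷ σ)) (true ∷ η) ≡ 0ℤ
    bd-FT-T σ η = cong -ᶻ_ (bd-0 _ (λ _ → refl) η)

    -- The facets of {1} ∪ σ are σ, which gives `R2 σ`, and the faces through vertex 1, which give
    -- the rows `R1`.
    S-shear : ∀ σ → ∣ σ ∣ ≡ suc d → ∀ τ → S σ τ ≡ 1ℤ *ᶻ R2 σ τ +ᶻ ∑ᶻ ρs (λ ρ → -ᶻ bd (ind σ) ρ *ᶻ R1 ρ τ)
    S-shear σ e τ = trans (cobd-Row f τ) (trans (cong₂ _+ᶻ_ (ipA-0 (f ᵗ) (λ σ → Row (true ∷ σ) τ) (bd-FT-T σ))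
        (cong₂ _+ᶻ_
          (trans (ipA-congˡ (λ ρ → R1 ρ τ) (λ ρ → ℤP.+-identityˡ (-ᶻ bd (ind σ) ρ))) (ipA-lv d (λ ρ → -ᶻ bd (ind σ) ρ) (λ ρ → R1 ρ τ)
             (λ ρ ne → cong -ᶻ_ (Supp-bd d (ind σ) (subst (λ z → Supp z (ind σ)) e (Supp-ind σ)) ρ ne))))
          (trans (ipA-congˡ (λ σ → R2 σ τ) (bd-FT-F σ)) (ipA-ind σ (λ σ → R2 σ τ)))))
      (r (R2 σ τ) _))
      where f = bd (ind (false ∷ true ∷ σ))
            r : ∀ a b → 0ℤ +ᶻ (b +ᶻ a) ≡ 1ℤ *ᶻ a +ᶻ b
            r = ringℤ

    -- This is `cobd ∘ cobd` = 0 at ρ, sorted by whether the vertex added to ρ is 0, 1 or another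
    -- one.
    Q0-shear : ∀ ρ → ∣ ρ ∣ ≡ d → ∀ τ → Q0 ρ τ ≡ 1ℤ *ᶻ R1 ρ τ +ᶻ ∑ᶻ σs (λ σ → cobd (ind ρ) σ *ᶻ R2 σ τ)
    Q0-shear ρ e τ = r (Row (true ∷ false ∷ ρ) τ) (R1 ρ τ) _
      (trans (sym (trans (cong₂ _+ᶻ_
        (cong₂ _+ᶻ_ (ipA-0 (f ᵗ ᵗ) _ (λ η → trans (cong (λ z → 0ℤ +ᶻ -ᶻ z) (cobd-0 _ (λ _ → refl) (true ∷ η))) refl))
          (trans (ipA-congˡ (λ σ → Row (true ∷ false ∷ σ) τ) (λ η → z+ (ind ρ η) (cong -ᶻ_ (cobd-0 _ (λ _ → refl) (false ∷ η))))) (ipA-ind ρ _)))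
        (cong₂ _+ᶻ_ (trans (ipA-congˡ (λ σ → R1 σ τ) (λ η → z+ (ind ρ η) (cong -ᶻ_ (cobd-0 _ (λ _ → refl) η)))) (ipA-ind ρ _))
          (ipA-lv (suc d) (cobd (ind ρ)) (λ σ → R2 σ τ) (Supp-Row ρ e))))
        refl))
      (trans (sym (cobd-Row f τ)) (cobd-cobd (ind (false ∷ false ∷ ρ)) τ)))
      where f = cobd (ind (false ∷ false ∷ ρ))
            r : ∀ a b c → 0ℤ +ᶻ a +ᶻ (b +ᶻ c) ≡ 0ℤ → -ᶻ a ≡ 1ℤ *ᶻ b +ᶻ c
            r a b c h = trans (r' a b c) (trans (cong (_+ᶻ (1ℤ *ᶻ b +ᶻ c)) (cong -ᶻ_ h)) (ℤP.+-identityˡ _))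
              where r' : ∀ a b c → -ᶻ a ≡ -ᶻ (0ℤ +ᶻ a +ᶻ (b +ᶻ c)) +ᶻ (1ℤ *ᶻ b +ᶻ c)
                    r' = ringℤ

    ω-left : wedge L (map R1 ρs ++ map S σs) ≗ᶠ wedge L (map R1 ρs ++ map R2 σs)
    ω-left s = trans (pre-++ L (map R1 ρs) (map S σs) (vac L) s) (trans
      (pre-shear L ρs R1 R2 S (λ σ ρ → -ᶻ bd (ind σ) ρ) (map R1 ρs) (λ x → MemP.∈-map⁺ R1) σs (All.tabulate (λ {σ} mem → S-shear σ (lv-size m (suc d) mem))) s)
      (sym (pre-++ L (map R1 ρs) (map R2 σs) (vac L) s)))

    ω-right : wedge L (map Q0 ρs ++ map R2 σs) ≗ᶠ wedge L (map R1 ρs ++ map R2 σs)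
    ω-right = wedge-shear L σs R2 R1 Q0 (λ ρ → cobd (ind ρ)) (map R2 σs) (λ x → MemP.∈-map⁺ R2) ρs (All.tabulate (λ {ρ} mem → Q0-shear ρ (lv-size m d mem)))

    dot-Q0 : ∀ ρ → ∣ ρ ∣ ≡ d → ∀ g → dot L (Q0 ρ) g ≡ -ᶻ bd g (true ∷ false ∷ ρ)
    dot-Q0 ρ e g = trans (dot-ip (Q0 ρ) g (λ σ ne → cong -ᶻ_ (Supp-Row (true ∷ false ∷ ρ) (cong suc e) σ ne)))
      (trans (ipA-neg (Row (true ∷ false ∷ ρ)) g) (cong -ᶻ_ (trans (adjoint (ind (true ∷ false ∷ ρ)) g) (ipA-ind (true ∷ false ∷ ρ) (bd g)))))

    -- The faces `τ` and `t` differ, so off the diagonal `bd-cobd` trades `bd ∘ cobd` for minus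
    -- `cobd ∘ bd`. What remains counts common facets of {0} ∪ ρ and {1} ∪ ρ', and there is one only
    -- if ρ = ρ'.
    Q0-R1 : ∀ ρ ρ' → ∣ ρ ∣ ≡ d → dot L (Q0 ρ) (R1 ρ') ≡ ind ρ' ρ
    Q0-R1 ρ ρ' e = trans (dot-Q0 ρ e (R1 ρ')) (trans (r (bd (R1 ρ') τ) (cobd (bd (ind t)) τ) _ (bd-cobd (ind t) τ))
      (trans (cong (_+ᶻ -ᶻ (pos n *ᶻ 0ℤ)) (trans (cong₂ (λ a b → a +ᶻ -ᶻ b) (bd-FT-F ρ' ρ) (cobd-0 _ (λ σ → bd-FT-T ρ' σ) (false ∷ ρ))) (ℤP.+-identityʳ (ind ρ' ρ))))
        (z+ (ind ρ' ρ) (cong -ᶻ_ (ℤP.*-zeroʳ (pos n))))))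
      where
      τ t : Subset n
      τ = true ∷ false ∷ ρ
      t = false ∷ true ∷ ρ'
      r : ∀ a b c → a +ᶻ b ≡ c → -ᶻ a ≡ b +ᶻ -ᶻ c
      r a b c refl = r' a b
        where r' : ∀ a b → -ᶻ a ≡ b +ᶻ -ᶻ (a +ᶻ b)
              r' = ringℤ

    Q0-S : ∀ ρ σ → ∣ ρ ∣ ≡ d → dot L (Q0 ρ) (S σ) ≡ 0ℤ
    Q0-S ρ σ e = trans (dot-Q0 ρ e (S σ)) (cong -ᶻ_ (trans (bd-cobd-bd (ind (false ∷ true ∷ σ)) (true ∷ false ∷ ρ))
      (trans (cong (pos n *ᶻ_) (bd-FT-T σ (false ∷ ρ))) (ℤP.*-zeroʳ (pos n)))))

    R2-S : ∀ σ σ' → ∣ σ ∣ ≡ suc d → dot L (R2 σ) (S σ') ≡ pos n *ᶻ ind σ' σ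
    R2-S σ σ' e = trans (dot-ip (R2 σ) (S σ') (Supp-Row (false ∷ false ∷ σ) e))
      (trans (ip-Row-cobd-bd (false ∷ false ∷ σ) (ind (false ∷ true ∷ σ'))) (cong (pos n *ᶻ_) (bd-FT-F σ' σ)))

    vac-norm : (M : List (Subset n)) → ipA (vac M) (vac M) ≡ 1ℤ
    vac-norm [] = refl
    vac-norm (c ∷ M) = trans (cong₂ _+ᶻ_ (ipA-0 {length M} (λ _ → 0ℤ) (λ _ → 0ℤ) (λ _ → refl)) (vac-norm M)) refl

    one^ : ∀ k → 1ℤ ℤ.^ k ≡ 1ℤ
    one^ zero = refl
    one^ (suc k) = trans (ℤP.*-identityˡ _) (one^ k)

    pos^ : ∀ a k → pos a ℤ.^ k ≡ pos (a ^ k)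
    pos^ a zero = refl
    pos^ a (suc k) = trans (cong (pos a *ᶻ_) (pos^ a k)) (sym (ℤP.pos-* a (a ^ k)))

    pairs : {P : Subset m → Set} {Q : Subset m → Subset m → Set} (xs : List (Subset m)) → (∀ x y → P x → x ≢ y → Q x y) → All P xs → Unique xs → AllPairs Q xs
    pairs [] f [] [] = []
    pairs (x ∷ xs) f (p ∷ ps) (u ∷ us) = All.map (λ {y} → f x y p) u ∷ pairs xs f ps us

  kalai : Z ≡ n ^ (m C suc d)
  kalai = ℤP.+-injective (begin
    pos Z
      ≡⟨ trans (cong pos Z≡nrm) (nrm-ip L (ω L)) ⟩
    ipA (ω L) (ω L)
      ≡⟨ cong (λ z → ipA (wedge L z) (wedge L z)) rows-split ⟩
    ipA ω' ω'
      ≡⟨ ipA-congˡ ω' (λ s → sym (ω-left s)) ⟩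
    ipA (wedge L (map R1 ρs ++ map S σs)) ω'
      ≡⟨ ipA-comm (wedge L (map R1 ρs ++ map S σs)) ω' ⟩
    ipA ω' (wedge L (map R1 ρs ++ map S σs))
      ≡⟨ ipA-congˡ (wedge L (map R1 ρs ++ map S σs)) (λ s → sym (ω-right s)) ⟩
    ipA (wedge L (map Q0 ρs ++ map R2 σs)) (wedge L (map R1 ρs ++ map S σs))
      ≡⟨ ipA-comm (wedge L (map Q0 ρs ++ map R2 σs)) (wedge L (map R1 ρs ++ map S σs)) ⟩
    ipA (wedge L (map R1 ρs ++ map S σs)) (wedge L (map Q0 ρs ++ map R2 σs))
      ≡⟨ wedge-pairing L 1ℤ R1 Q0 (map S σs) (map R2 σs) ρs
           (pairs ρs (λ x y e ne → trans (Q0-R1 x y e) (ind-≢ y x (λ q → ne (sym q)))) szρ (lv-unique m d))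
           (All.map (λ {x} e → trans (Q0-R1 x x e) (ind-refl x)) szρ)
           (All.map (λ {x} e → All.tabulate (λ mem → h x e mem)) szρ) ⟩
    1ℤ ℤ.^ length ρs *ᶻ ipA (wedge L (map S σs)) (wedge L (map R2 σs))
      ≡⟨ trans (cong (_*ᶻ ipA (wedge L (map S σs)) (wedge L (map R2 σs))) (one^ (length ρs))) (ℤP.*-identityˡ _) ⟩
    ipA (wedge L (map S σs)) (wedge L (map R2 σs))
      ≡⟨ cong₂ (λ a b → ipA (wedge L a) (wedge L b)) (sym (ListP.++-identityʳ (map S σs))) (sym (ListP.++-identityʳ (map R2 σs))) ⟩
    ipA (wedge L (map S σs ++ [])) (wedge L (map R2 σs ++ []))
      ≡⟨ wedge-pairing L (pos n) S R2 [] [] σs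
           (pairs σs (λ x y e ne → trans (R2-S x y e) (trans (cong (pos n *ᶻ_) (ind-≢ y x (λ q → ne (sym q)))) (ℤP.*-zeroʳ (pos n)))) szσ (lv-unique m (suc d)))
           (All.map (λ {x} e → trans (R2-S x x e) (trans (cong (pos n *ᶻ_) (ind-refl x)) (ℤP.*-identityʳ (pos n)))) szσ)
           (All.map (λ _ → []) szσ) ⟩
    pos n ℤ.^ length σs *ᶻ ipA (vac L) (vac L)
      ≡⟨ trans (cong (pos n ℤ.^ length σs *ᶻ_) (vac-norm L)) (ℤP.*-identityʳ _) ⟩
    pos n ℤ.^ length σs
      ≡⟨ trans (pos^ n (length σs)) (cong (λ z → pos (n ^ z)) (length-lv m (suc d))) ⟩
    pos (n ^ (m C suc d)) ∎)
    where
    open ≡-Reasoning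
    ω' : Fn (length L)
    ω' = wedge L (map R1 ρs ++ map R2 σs)
    szρ : All (λ ρ → ∣ ρ ∣ ≡ d) ρs
    szρ = All.tabulate (lv-size m d)
    szσ : All (λ ρ → ∣ ρ ∣ ≡ suc d) σs
    szσ = All.tabulate (lv-size m (suc d))
    h : ∀ x → ∣ x ∣ ≡ d → ∀ {v} → v ∈ map S σs → dot L (Q0 x) v ≡ 0ℤ
    h x e mem with MemP.∈-map⁻ S mem
    ... | σ , _ , refl = Q0-S x σ e

-- Index of the lattice spanned by the columns of an integer matrix

_-ᵛ_ : ∀ {r} → Vec ℤ r → Vec ℤ r → Vec ℤ r
_-ᵛ_ = Vec.zipWith _-ᶻ_

0ᵛ : ∀ {r} → Vec ℤ r
0ᵛ = Vec.replicate _ 0ℤ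

-ᵛ-self : ∀ {r} (x : Vec ℤ r) → x -ᵛ x ≡ 0ᵛ
-ᵛ-self [] = refl
-ᵛ-self (x ∷ xs) = cong₂ _∷_ (ℤP.+-inverseʳ x) (-ᵛ-self xs)

module Lattice {A : Set} where

  val : (T : List A) → Vec ℤ (length T) → (A → ℤ) → ℤ
  val [] [] R = 0ℤ
  val (c ∷ T) (a ∷ as) R = a *ᶻ R c +ᶻ val T as R

  val-lin : ∀ T as k R R' → val T as (λ t → k *ᶻ R t +ᶻ R' t) ≡ k *ᶻ val T as R +ᶻ val T as R'
  val-lin [] [] k R R' = r k
    where r : ∀ k → 0ℤ ≡ k *ᶻ 0ℤ +ᶻ 0ℤ
          r = ringℤ
  val-lin (c ∷ T) (a ∷ as) k R R' = trans (cong (a *ᶻ (k *ᶻ R c +ᶻ R' c) +ᶻ_) (val-lin T as k R R')) (r a k (R c) (R' c) (val T as R) (val T as R'))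
    where r : ∀ a k x y p q → a *ᶻ (k *ᶻ x +ᶻ y) +ᶻ (k *ᶻ p +ᶻ q) ≡ k *ᶻ (a *ᶻ x +ᶻ p) +ᶻ (a *ᶻ y +ᶻ q)
          r = ringℤ

  val-sub : ∀ T as bs R → val T (as -ᵛ bs) R ≡ val T as R -ᶻ val T bs R
  val-sub [] [] [] R = refl
  val-sub (c ∷ T) (a ∷ as) (b ∷ bs) R = trans (cong ((a -ᶻ b) *ᶻ R c +ᶻ_) (val-sub T as bs R)) (r a b (R c) (val T as R) (val T bs R))
    where r : ∀ a b x p q → (a -ᶻ b) *ᶻ x +ᶻ (p -ᶻ q) ≡ (a *ᶻ x +ᶻ p) -ᶻ (b *ᶻ x +ᶻ q)
          r = ringℤ

  val-0 : ∀ T R → val T 0ᵛ R ≡ 0ℤ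
  val-0 [] R = refl
  val-0 (c ∷ T) R = trans (cong₂ _+ᶻ_ (ℤP.*-zeroˡ (R c)) (val-0 T R)) refl

  InLat : ∀ T → Vec ℤ (length T) → ∀ {r} → Vec (A → ℤ) r → Vec ℤ r → Set
  InLat T as [] [] = ⊤
  InLat T as (R ∷ Rs) (v ∷ vs) = (v ≡ val T as R) × InLat T as Rs vs

  Lat : ∀ T {r} → Vec (A → ℤ) r → Vec ℤ r → Set
  Lat T rows v = Σ (Vec ℤ (length T)) λ as → InLat T as rows v

  InLat-sub : ∀ T as bs {r} (rows : Vec (A → ℤ) r) u v → InLat T as rows u → InLat T bs rows v → InLat T (as -ᵛ bs) rows (u -ᵛ v)
  InLat-sub T as bs [] [] [] _ _ = tt
  InLat-sub T as bs (R ∷ rows) (u ∷ us) (v ∷ vs) (e , p) (e' , p') = trans (cong₂ _-ᶻ_ e e') (sym (val-sub T as bs R)) , InLat-sub T as bs rows us vs p p'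

  Cover : ∀ T {r} → Vec (A → ℤ) r → ℕ → Set
  Cover T {r} rows k = Σ (Fin k → Vec ℤ r) λ cs → ∀ x → Σ (Fin k) λ i → Lat T rows (x -ᵛ cs i)

  Ord : ∀ T {r} → Vec (A → ℤ) r → ℕ → Set
  Ord T {r} rows k = Σ (Fin k → Vec ℤ r) λ cs → (∀ i j → i ≢ j → ¬ Lat T rows (cs i -ᵛ cs j)) × (∀ x → Σ (Fin k) λ i → Lat T rows (x -ᵛ cs i))

  Ord-≤ : ∀ T {r} (rows : Vec (A → ℤ) r) k k' → Ord T rows k → Ord T rows k' → k ≤ k'
  Ord-≤ T rows k k' (cs , dist , _) (cs' , _ , cov) = FinP.injective⇒≤ {f = f} inj
    where
    f : Fin k → Fin k'
    f i = proj₁ (cov (cs i))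
    swap : ∀ {r} (x y z : Vec ℤ r) → (x -ᵛ z) -ᵛ (y -ᵛ z) ≡ x -ᵛ y
    swap [] [] [] = refl
    swap (x ∷ xs) (y ∷ ys) (z ∷ zs) = cong₂ _∷_ (e x y z) (swap xs ys zs)
      where e : ∀ x y z → (x -ᶻ z) -ᶻ (y -ᶻ z) ≡ x -ᶻ y
            e = ringℤ
    inj : ∀ {i j} → f i ≡ f j → i ≡ j
    inj {i} {j} e with i FinP.≟ j
    ... | yes p = p
    ... | no p = ⊥-elim (dist i j p (proj₁ pi -ᵛ proj₁ pj , subst (InLat T _ rows) (swap (cs i) (cs j) (cs' (f j)))
             (InLat-sub T (proj₁ pi) (proj₁ pj) rows _ _ (proj₂ pi) (proj₂ pj))))
      where pi = subst (λ z → Lat T rows (cs i -ᵛ cs' z)) e (proj₂ (cov (cs i)))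
            pj = proj₂ (cov (cs j))

  Ord-unique : ∀ T {r} (rows : Vec (A → ℤ) r) k k' → Ord T rows k → Ord T rows k' → k ≡ k'
  Ord-unique T rows k k' o o' = ≤-antisym (Ord-≤ T rows k k' o o') (Ord-≤ T rows k' k o' o)

  det : ∀ T {r} → Vec (A → ℤ) r → ℤ
  det T rows = top T (wedge T (Vec.toList rows))

  -- A unimodular row operation: an additive bijection of ℤ^r that matches the column lattices for
  -- every choice `T` of columns at once and changes the wedge at most by a sign.
  record _⇝_ {r} (rows rows' : Vec (A → ℤ) r) : Set where
    field
      f g : Vec ℤ r → Vec ℤ r
      fg : ∀ x → f (g x) ≡ x
      gf : ∀ x → g (f x) ≡ x
      f-sub : ∀ x y → f (x -ᵛ y) ≡ f x -ᵛ f y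
      g-sub : ∀ x y → g (x -ᵛ y) ≡ g x -ᵛ g y
      f-lat : ∀ T as v → InLat T as rows v → InLat T as rows' (f v)
      g-lat : ∀ T as v → InLat T as rows' v → InLat T as rows (g v)
      wdg : ∀ T → (wedge T (Vec.toList rows') ≗ᶠ wedge T (Vec.toList rows)) ⊎ (wedge T (Vec.toList rows') ≗ᶠ (λ s → -ᶻ wedge T (Vec.toList rows) s))
  open _⇝_

  ⇝-refl : ∀ {r} (rows : Vec (A → ℤ) r) → rows ⇝ rows
  ⇝-refl rows = record { f = id ; g = id ; fg = λ _ → refl ; gf = λ _ → refl ; f-sub = λ _ _ → refl ; g-sub = λ _ _ → refl
    ; f-lat = λ _ _ _ p → p ; g-lat = λ _ _ _ p → p ; wdg = λ T → inj₁ (λ _ → refl) }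

  ⇝-trans : ∀ {r} {a b c : Vec (A → ℤ) r} → a ⇝ b → b ⇝ c → a ⇝ c
  ⇝-trans p q = record
    { f = f q ∘ f p ; g = g p ∘ g q
    ; fg = λ x → trans (cong (f q) (fg p (g q x))) (fg q x)
    ; gf = λ x → trans (cong (g p) (gf q (f p x))) (gf p x)
    ; f-sub = λ x y → trans (cong (f q) (f-sub p x y)) (f-sub q _ _)
    ; g-sub = λ x y → trans (cong (g p) (g-sub q x y)) (g-sub p _ _)
    ; f-lat = λ T as v m → f-lat q T as _ (f-lat p T as v m)
    ; g-lat = λ T as v m → g-lat p T as _ (g-lat q T as v m)
    ; wdg = λ T → w T (wdg p T) (wdg q T) }
    where
    w : ∀ T → _ → _ → _
    w T (inj₁ x) (inj₁ y) = inj₁ (λ s → trans (y s) (x s))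
    w T (inj₁ x) (inj₂ y) = inj₂ (λ s → trans (y s) (cong -ᶻ_ (x s)))
    w T (inj₂ x) (inj₁ y) = inj₂ (λ s → trans (y s) (x s))
    w T (inj₂ x) (inj₂ y) = inj₁ (λ s → trans (y s) (trans (cong -ᶻ_ (x s)) (ℤP.neg-involutive _)))

  private
    cr-neg' : ∀ (T : List A) v (ψ : Fn (length T)) s → cr T v (λ s → -ᶻ ψ s) s ≡ -ᶻ cr T v ψ s
    cr-neg' T v ψ s = trans (cr-congψ T v (λ s → sym (r (ψ s))) s) (trans (cr-lin T v -1ℤ ψ (λ _ → 0ℤ) s)
      (trans (cong (-1ℤ *ᶻ cr T v ψ s +ᶻ_) (cr-0 T v (λ _ → 0ℤ) (λ _ → refl) s)) (r (cr T v ψ s))))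
      where r : ∀ a → -1ℤ *ᶻ a +ᶻ 0ℤ ≡ -ᶻ a
            r = ringℤ

  ⇝-cons : ∀ {r} (R : A → ℤ) {a b : Vec (A → ℤ) r} → a ⇝ b → (R ∷ a) ⇝ (R ∷ b)
  ⇝-cons R {a} {b} p = record
    { f = λ { (x ∷ xs) → x ∷ f p xs } ; g = λ { (x ∷ xs) → x ∷ g p xs }
    ; fg = λ { (x ∷ xs) → cong (x ∷_) (fg p xs) } ; gf = λ { (x ∷ xs) → cong (x ∷_) (gf p xs) }
    ; f-sub = λ { (x ∷ xs) (y ∷ ys) → cong (_ ∷_) (f-sub p xs ys) } ; g-sub = λ { (x ∷ xs) (y ∷ ys) → cong (_ ∷_) (g-sub p xs ys) }
    ; f-lat = λ { T as (v ∷ vs) (e , m) → e , f-lat p T as vs m } ; g-lat = λ { T as (v ∷ vs) (e , m) → e , g-lat p T as vs m }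
    ; wdg = λ T → w T (wdg p T) }
    where
    w : ∀ T → _ → _
    w T (inj₁ x) = inj₁ (cr-congψ T R x)
    w T (inj₂ x) = inj₂ (λ s → trans (cr-congψ T R x s) (cr-neg' T R (wedge T (Vec.toList a)) s))

  ⇝-swap : ∀ {r} (R R' : A → ℤ) (a : Vec (A → ℤ) r) → (R ∷ R' ∷ a) ⇝ (R' ∷ R ∷ a)
  ⇝-swap R R' a = record
    { f = λ { (x ∷ y ∷ xs) → y ∷ x ∷ xs } ; g = λ { (x ∷ y ∷ xs) → y ∷ x ∷ xs }
    ; fg = λ { (x ∷ y ∷ xs) → refl } ; gf = λ { (x ∷ y ∷ xs) → refl }
    ; f-sub = λ { (x ∷ y ∷ xs) (x' ∷ y' ∷ xs') → refl } ; g-sub = λ { (x ∷ y ∷ xs) (x' ∷ y' ∷ xs') → refl }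
    ; f-lat = λ { T as (x ∷ y ∷ xs) (e , e' , m) → e' , e , m } ; g-lat = λ { T as (x ∷ y ∷ xs) (e , e' , m) → e' , e , m }
    ; wdg = λ T → inj₂ (cr-cr T R' R (wedge T (Vec.toList a))) }

  ⇝-add : ∀ {r} (q : ℤ) (R R' : A → ℤ) (a : Vec (A → ℤ) r) → (R ∷ R' ∷ a) ⇝ ((λ t → q *ᶻ R' t +ᶻ R t) ∷ R' ∷ a)
  ⇝-add q R R' a = record
    { f = λ { (x ∷ y ∷ xs) → (q *ᶻ y +ᶻ x) ∷ y ∷ xs } ; g = λ { (x ∷ y ∷ xs) → (x -ᶻ q *ᶻ y) ∷ y ∷ xs }
    ; fg = λ { (x ∷ y ∷ xs) → cong (λ z → z ∷ y ∷ xs) (r1 q x y) } ; gf = λ { (x ∷ y ∷ xs) → cong (λ z → z ∷ y ∷ xs) (r2 q x y) }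
    ; f-sub = λ { (x ∷ y ∷ xs) (x' ∷ y' ∷ xs') → cong (λ z → z ∷ _ ∷ _) (r3 q x y x' y') } ; g-sub = λ { (x ∷ y ∷ xs) (x' ∷ y' ∷ xs') → cong (λ z → z ∷ _ ∷ _) (r4 q x y x' y') }
    ; f-lat = λ { T as (x ∷ y ∷ xs) (e , e' , m) → trans (cong₂ (λ x y → q *ᶻ y +ᶻ x) e e') (sym (val-lin T as q R' R)) , e' , m }
    ; g-lat = λ { T as (x ∷ y ∷ xs) (e , e' , m) → trans (cong₂ (λ x y → x -ᶻ q *ᶻ y) (trans e (val-lin T as q R' R)) e') (r2 q (val T as R) (val T as R')) , e' , m }
    ; wdg = λ T → inj₁ (λ s → trans (cr-linᵛ T q R' R (wedge T (Vec.toList (R' ∷ a))) s)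
        (trans (cong (λ z → q *ᶻ z +ᶻ cr T R (wedge T (Vec.toList (R' ∷ a))) s) (cr-sq T R' (wedge T (Vec.toList a)) s)) (r5 q (cr T R (wedge T (Vec.toList (R' ∷ a))) s)))) }
    where
    r1 : ∀ q x y → q *ᶻ y +ᶻ (x -ᶻ q *ᶻ y) ≡ x
    r1 = ringℤ
    r2 : ∀ q x y → (q *ᶻ y +ᶻ x) -ᶻ q *ᶻ y ≡ x
    r2 = ringℤ
    r3 : ∀ q x y x' y' → q *ᶻ (y -ᶻ y') +ᶻ (x -ᶻ x') ≡ (q *ᶻ y +ᶻ x) -ᶻ (q *ᶻ y' +ᶻ x')
    r3 = ringℤ
    r4 : ∀ q x y x' y' → (x -ᶻ x') -ᶻ q *ᶻ (y -ᶻ y') ≡ (x -ᶻ q *ᶻ y) -ᶻ (x' -ᶻ q *ᶻ y')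
    r4 = ringℤ
    r5 : ∀ q x → q *ᶻ 0ℤ +ᶻ x ≡ x
    r5 = ringℤ

  Zeros : A → ∀ {r} → Vec (A → ℤ) r → Set
  Zeros c [] = ⊤
  Zeros c (R ∷ Rs) = (R c ≡ 0ℤ) × Zeros c Rs

  Reduced : A → ∀ {r} → Vec (A → ℤ) (suc r) → Set
  Reduced c {r} rows = Σ (A → ℤ) λ R → Σ (Vec (A → ℤ) r) λ Rs → Zeros c Rs × (rows ⇝ (R ∷ Rs))

  -- Euclid's algorithm on the entries of two rows in column `c`. The remainder replaces the first
  -- row, the rows are swapped, and the absolute value of the second entry decreases.
  euclid : ∀ c {r} (R R' : A → ℤ) (Rs : Vec (A → ℤ) r) → Zeros c Rs → Acc _<_ ∣ R' c ∣ᶻ → Reduced c (R ∷ R' ∷ Rs)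
  euclid c R R' Rs z (acc rec) with R' c ℤP.≟ 0ℤ
  ... | yes e = R , R' ∷ Rs , (e , z) , ⇝-refl _
  ... | no ne = let S , Ss , z' , p = euclid c R' R'' Rs z (rec small) in
        S , Ss , z' , ⇝-trans (⇝-add (-ᶻ q) R R' Rs) (⇝-trans (⇝-swap R'' R' Rs) p)
    where
    instance nz = ℤ.≢-nonZero ne
    q = R c ℤD./ R' c
    R'' : A → ℤ
    R'' t = -ᶻ q *ᶻ R' t +ᶻ R t
    eq : R'' c ≡ pos (R c ℤD.% R' c)
    eq = trans (cong (-ᶻ q *ᶻ R' c +ᶻ_) (ℤD.a≡a%n+[a/n]*n (R c) (R' c))) (r q (R' c) (pos (R c ℤD.% R' c)))
      where r : ∀ q b x → -ᶻ q *ᶻ b +ᶻ (x +ᶻ q *ᶻ b) ≡ x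
            r = ringℤ
    small : ∣ R'' c ∣ᶻ < ∣ R' c ∣ᶻ
    small = subst (_< ∣ R' c ∣ᶻ) (sym (cong ∣_∣ᶻ eq)) (ℤD.n%d<d (R c) (R' c))

  reduce : ∀ c {r} (rows : Vec (A → ℤ) (suc r)) → Reduced c rows
  reduce c (R ∷ []) = R , [] , tt , ⇝-refl _
  reduce c (R ∷ rows@(_ ∷ _)) = let R' , Rs , z , p = reduce c rows
                                    S , Ss , z' , q = euclid c R R' Rs z (<-wellFounded _) in
    S , Ss , z' , ⇝-trans (⇝-cons R p) q

  -- Infinite index, in the form that contradicts any finite list of representatives. Distinctness
  -- of the representatives is left out, which makes the property pass easily to quotients.
  NoCover : ∀ T {r} → Vec (A → ℤ) r → Set
  NoCover T rows = ∀ k → ¬ Cover T rows k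

  ⇝-cover : ∀ T {r} {a b : Vec (A → ℤ) r} → a ⇝ b → ∀ k → Cover T a k → Cover T b k
  ⇝-cover T {a = a} {b} p k (cs , cov) = (λ i → f p (cs i)) , λ x → let i , as , m = cov (g p x) in
    i , as , subst (InLat T as b) (trans (f-sub p (g p x) (cs i)) (cong (_-ᵛ f p (cs i)) (fg p x))) (f-lat p T as _ m)

  Zeros-lat : ∀ c T a as {r} (Rs : Vec (A → ℤ) r) → Zeros c Rs → ∀ v → InLat (c ∷ T) (a ∷ as) Rs v → InLat T as Rs v
  Zeros-lat c T a as [] _ [] _ = tt
  Zeros-lat c T a as (R ∷ Rs) (z , zs) (v ∷ vs) (e , es) =
    trans e (trans (cong (λ z → a *ᶻ z +ᶻ val T as R) z) (trans (cong (_+ᶻ val T as R) (ℤP.*-zeroʳ a)) (ℤP.+-identityˡ _))) , Zeros-lat c T a as Rs zs vs es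

  lat-Zeros : ∀ c T a as {r} (Rs : Vec (A → ℤ) r) → Zeros c Rs → ∀ v → InLat T as Rs v → InLat (c ∷ T) (a ∷ as) Rs v
  lat-Zeros c T a as [] _ [] _ = tt
  lat-Zeros c T a as (R ∷ Rs) (z , zs) (v ∷ vs) (e , es) =
    trans e (sym (trans (cong (λ z → a *ᶻ z +ᶻ val T as R) z) (trans (cong (_+ᶻ val T as R) (ℤP.*-zeroʳ a)) (ℤP.+-identityˡ _)))) , lat-Zeros c T a as Rs zs vs es

  cover-tail : ∀ c T {r} R (Rs : Vec (A → ℤ) r) → Zeros c Rs → ∀ k → Cover (c ∷ T) (R ∷ Rs) k → Cover T Rs k
  cover-tail c T R Rs z k (cs , cov) = (λ i → Vec.tail (cs i)) , λ xs → h xs (cov (0ℤ ∷ xs))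
    where
    h : ∀ xs → Σ (Fin k) (λ i → Lat (c ∷ T) (R ∷ Rs) ((0ℤ ∷ xs) -ᵛ cs i)) → Σ (Fin k) λ i → Lat T Rs (xs -ᵛ Vec.tail (cs i))
    h xs (i , (a ∷ as) , m) with cs i in eq
    h xs (i , (a ∷ as) , (_ , m)) | y ∷ ys = i , as , subst (λ z → InLat T as Rs (xs -ᵛ Vec.tail z)) (sym eq) (Zeros-lat c T a as Rs z _ m)

  -- Fewer columns than rows. Each reduction removes one column together with one row, so in the end
  -- a row is left with no columns, and finitely many representatives cannot reach its unbounded
  -- coordinate.
  thin : ∀ T {r} (rows : Vec (A → ℤ) r) → length T < r → NoCover T rows
  thin [] (R ∷ Rs) _ k (cs , cov) = h (cov (pos (suc (bnd k cs)) ∷ 0ᵛ))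
    where
    bnd : ∀ k → (Fin k → Vec ℤ (suc _)) → ℕ
    bnd zero cs = 0
    bnd (suc k) cs = ∣ Vec.head (cs Fin.zero) ∣ᶻ + bnd k (cs ∘ Fin.suc)
    bnd-≤ : ∀ k (cs : Fin k → Vec ℤ (suc _)) i → ∣ Vec.head (cs i) ∣ᶻ ≤ bnd k cs
    bnd-≤ (suc k) cs Fin.zero = m≤m+n _ _
    bnd-≤ (suc k) cs (Fin.suc i) = ≤-trans (bnd-≤ k (cs ∘ Fin.suc) i) (m≤n+m _ _)
    h : Σ (Fin k) (λ i → Lat [] (R ∷ Rs) ((pos (suc (bnd k cs)) ∷ 0ᵛ) -ᵛ cs i)) → ⊥
    h (i , [] , m) with cs i | bnd-≤ k cs i
    h (i , [] , (e , _)) | y ∷ ys | b = 1+n≰n (≤-trans (≤-reflexive (cong ∣_∣ᶻ (ℤP.i-j≡0⇒i≡j (pos (suc (bnd k cs))) y e))) b)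
  thin (c ∷ T) {suc r} rows (s≤s lt) k cov = let R , Rs , z , p = reduce c rows in
    thin T Rs lt k (cover-tail c T R Rs z k (⇝-cover (c ∷ T) p k cov))

  Inj : ∀ T {r} → Vec (A → ℤ) r → Set
  Inj T rows = ∀ as → InLat T as rows 0ᵛ → as ≡ 0ᵛ

  -- Independence of the columns is carried along with the order: in the inductive step it forces
  -- the tail coefficients of a relation to vanish, so that only a multiple of the pivot is left in
  -- the first coordinate.
  Outcome : ∀ T {r} → Vec (A → ℤ) r → Set
  Outcome T rows = (det T rows ≡ 0ℤ × NoCover T rows) ⊎ (Ord T rows ∣ det T rows ∣ᶻ × Inj T rows)

  det-⇝ : ∀ T {r} {a b : Vec (A → ℤ) r} → a ⇝ b → ∣ det T b ∣ᶻ ≡ ∣ det T a ∣ᶻ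
  det-⇝ T {a = a} p with wdg p T
  ... | inj₁ e = cong ∣_∣ᶻ (e _)
  ... | inj₂ e = trans (cong ∣_∣ᶻ (e _)) (ℤP.∣-i∣≡∣i∣ (det T a))

  f-0 : ∀ {r} {a b : Vec (A → ℤ) r} (p : a ⇝ b) → f p 0ᵛ ≡ 0ᵛ
  f-0 p = trans (cong (f p) (sym (-ᵛ-self 0ᵛ))) (trans (f-sub p 0ᵛ 0ᵛ) (-ᵛ-self (f p 0ᵛ)))

  outcome-⇝ : ∀ T {r} {a b : Vec (A → ℤ) r} → a ⇝ b → Outcome T b → Outcome T a
  outcome-⇝ T p (inj₁ (e , nc)) = inj₁ (ℤP.∣i∣≡0⇒i≡0 (trans (sym (det-⇝ T p)) (cong ∣_∣ᶻ e)) , λ k c → nc k (⇝-cover T p k c))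
  outcome-⇝ T {a = a} {b} p (inj₂ ((cs , dist , cov) , inj)) = inj₂ (subst (Ord T a) (det-⇝ T p)
    ((λ i → g p (cs i)) ,
     (λ i j ne (as , m) → dist i j ne (as , subst (InLat T as b) (fg p _) (f-lat p T as _ (subst (InLat T as a) (sym (g-sub p (cs i) (cs j))) m)))) ,
     (λ x → let i , as , m = cov (f p x) in i , as , subst (InLat T as a) (trans (g-sub p (f p x) (cs i)) (cong (_-ᵛ g p (cs i)) (gf p x))) (g-lat p T as _ m))) ,
    λ as m → inj as (subst (InLat T as b) (f-0 p) (f-lat p T as 0ᵛ m)))

  wedge-Zeros : ∀ c T {r} (Rs : Vec (A → ℤ) r) → Zeros c Rs → ∀ s → wedge (c ∷ T) (Vec.toList Rs) (true ∷ s) ≡ 0ℤ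
  wedge-Zeros c T [] z s = refl
  wedge-Zeros c T (R ∷ Rs) (z , zs) s = cong₂ (λ x y → x +ᶻ -ᶻ y) (trans (cong (_*ᶻ wedge (c ∷ T) (Vec.toList Rs) (false ∷ s)) z) (ℤP.*-zeroˡ (wedge (c ∷ T) (Vec.toList Rs) (false ∷ s))))
    (cr-0 T R _ (wedge-Zeros c T Rs zs) s)

  wedge-drop : ∀ c T (Rs : List (A → ℤ)) s → wedge (c ∷ T) Rs (false ∷ s) ≡ wedge T Rs s
  wedge-drop c T [] s = refl
  wedge-drop c T (R ∷ Rs) s = cr-congψ T R (wedge-drop c T Rs) s

  det-Zeros : ∀ c T {r} R (Rs : Vec (A → ℤ) r) → Zeros c Rs → det (c ∷ T) (R ∷ Rs) ≡ R c *ᶻ det T Rs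
  det-Zeros c T R Rs z = trans (cong₂ (λ x y → R c *ᶻ x +ᶻ -ᶻ y) (wedge-drop c T (Vec.toList Rs) _) (cr-0 T R _ (wedge-Zeros c T Rs z) _)) (ℤP.+-identityʳ _)

  private
    ∣pos-∣< : ∀ i j k → i < k → j < k → ∣ pos i -ᶻ pos j ∣ᶻ < k
    ∣pos-∣< i j k p q = ≤-<-trans (subst (_≤ i ⊔ j) (cong ∣_∣ᶻ (sym (ℤP.m-n≡m⊖n i j))) (ℤP.∣m⊝n∣≤m⊔n i j)) (⊔-lub p q)

    small-multiple : ∀ a γ x → x ≡ a *ᶻ γ → ∣ x ∣ᶻ < ∣ γ ∣ᶻ → x ≡ 0ℤ
    small-multiple a γ x e lt with a ℤP.≟ 0ℤ
    ... | yes refl = trans e (ℤP.*-zeroˡ γ)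
    ... | no ne = ⊥-elim (<-irrefl refl (<-≤-trans lt (subst (∣ γ ∣ᶻ ≤_) (sym (trans (cong ∣_∣ᶻ e) (ℤP.abs-* a γ))) (m≤n*m ∣ γ ∣ᶻ ∣ a ∣ᶻ {{≢-nonZero (λ z → ne (ℤP.∣i∣≡0⇒i≡0 z))}}))))

  -- The determinant expands along the reduced column. A nonzero pivot γ contributes the residues
  -- modulo |γ| in the first coordinate, paired with the representatives of the tail. With pivot
  -- zero the whole column vanishes, leaving more rows than columns, so `thin` applies.
  outcome-step : ∀ c T {r} R (Rs : Vec (A → ℤ) r) → Zeros c Rs → r ≡ length T → Outcome T Rs → Outcome (c ∷ T) (R ∷ Rs)
  outcome-step c T R Rs z len (inj₁ (e , nc)) = inj₁ (trans (det-Zeros c T R Rs z) (trans (cong (R c *ᶻ_) e) (ℤP.*-zeroʳ (R c))) , λ k cov → nc k (cover-tail c T R Rs z k cov))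
  outcome-step c T {r} R Rs z len (inj₂ ((cs , dist , cov) , inj)) with R c ℤP.≟ 0ℤ
  ... | yes e0 = inj₁ (trans (det-Zeros c T R Rs z) (trans (cong (_*ᶻ det T Rs) e0) (ℤP.*-zeroˡ (det T Rs))) ,
      λ k → λ { (xs , cv) → thin T (R ∷ Rs) (s≤s (≤-reflexive (sym len))) k (xs , λ x → h x (cv x)) })
    where
    h : ∀ {k} {xs : Fin k → Vec ℤ (suc r)} x → Σ (Fin k) (λ i → Lat (c ∷ T) (R ∷ Rs) (x -ᵛ xs i)) → Σ (Fin k) λ i → Lat T (R ∷ Rs) (x -ᵛ xs i)
    h x (i , a ∷ as , m) = i , as , Zeros-lat c T a as (R ∷ Rs) (e0 , z) _ m
  ... | no γ≠0 = inj₂ (subst (Ord (c ∷ T) (R ∷ Rs)) (sym (trans (cong ∣_∣ᶻ (det-Zeros c T R Rs z)) (ℤP.abs-* (R c) (det T Rs)))) (reps , dist' , cov') , inj')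
    where
    γ = R c
    instance nz = ℤ.≢-nonZero γ≠0
    q = ∣ γ ∣ᶻ
    k = ∣ det T Rs ∣ᶻ
    rep : Fin q × Fin k → Vec ℤ (suc r)
    rep (i , j) = pos (Fin.toℕ i) ∷ cs j
    reps : Fin (q * k) → Vec ℤ (suc r)
    reps x = rep (Fin.remQuot {q} k x)
    distp : ∀ u v → Lat (c ∷ T) (R ∷ Rs) (rep u -ᵛ rep v) → u ≡ v
    distp (i , j) (i' , j') (a ∷ as , (e , m)) with j FinP.≟ j'
    ... | no ne = ⊥-elim (dist j j' ne (as , Zeros-lat c T a as Rs z _ m))
    ... | yes refl = cong (_, j) (FinP.toℕ-injective (ℤP.+-injective (ℤP.i-j≡0⇒i≡j _ _
             (small-multiple a γ _ (trans e (trans (cong (a *ᶻ γ +ᶻ_) (trans (cong (λ z → val T z R) as0) (val-0 T R))) (ℤP.+-identityʳ _)))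
               (∣pos-∣< (Fin.toℕ i) (Fin.toℕ i') q (FinP.toℕ<n i) (FinP.toℕ<n i'))))))
      where as0 = inj as (subst (InLat T as Rs) (-ᵛ-self (cs j)) (Zeros-lat c T a as Rs z _ m))
    dist' : ∀ i j → i ≢ j → ¬ Lat (c ∷ T) (R ∷ Rs) (reps i -ᵛ reps j)
    dist' i j ne l = ne (trans (sym (FinP.combine-remQuot {q} k i)) (trans (cong (λ { (a , b) → Fin.combine a b }) (distp (Fin.remQuot {q} k i) (Fin.remQuot {q} k j) l)) (FinP.combine-remQuot {q} k j)))
    cov' : ∀ x → Σ (Fin (q * k)) λ i → Lat (c ∷ T) (R ∷ Rs) (x -ᵛ reps i)
    cov' (x ∷ xs) = let j , as , m = cov xs
                        y = x -ᶻ val T as R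
                        i = Fin.fromℕ< (ℤD.n%d<d y γ)
                        a = y ℤD./ γ
                    in Fin.combine i j , a ∷ as , subst (λ u → InLat (c ∷ T) (a ∷ as) (R ∷ Rs) ((x ∷ xs) -ᵛ rep u)) (sym (FinP.remQuot-combine i j))
                       (trans (cong (λ z → x -ᶻ pos z) (FinP.toℕ-fromℕ< (ℤD.n%d<d y γ))) (r0 x (val T as R) (pos (y ℤD.% γ)) (a *ᶻ γ) (ℤD.a≡a%n+[a/n]*n y γ)) ,
                        lat-Zeros c T a as Rs z _ m)
      where r0 : ∀ x v p aγ → x -ᶻ v ≡ p +ᶻ aγ → x -ᶻ p ≡ aγ +ᶻ v
            r0 x v p aγ e = trans (r1 x v p) (trans (cong (λ z → z +ᶻ (v -ᶻ p)) e) (r2 p aγ v))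
              where r1 : ∀ x v p → x -ᶻ p ≡ (x -ᶻ v) +ᶻ (v -ᶻ p)
                    r1 = ringℤ
                    r2 : ∀ p aγ v → (p +ᶻ aγ) +ᶻ (v -ᶻ p) ≡ aγ +ᶻ v
                    r2 = ringℤ
    inj' : Inj (c ∷ T) (R ∷ Rs)
    inj' (a ∷ as) (e , m) = cong₂ _∷_ a0 as0
      where
      as0 = inj as (Zeros-lat c T a as Rs z _ m)
      a0 : a ≡ 0ℤ
      a0 with ℤP.i*j≡0⇒i≡0∨j≡0 a (sym (trans e (trans (cong (a *ᶻ γ +ᶻ_) (trans (cong (λ z → val T z R) as0) (val-0 T R))) (ℤP.+-identityʳ (a *ᶻ γ)))))
      ... | inj₁ p = p
      ... | inj₂ p = ⊥-elim (γ≠0 p)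

  outcome : ∀ T {r} (rows : Vec (A → ℤ) r) → r ≡ length T → Outcome T rows
  outcome [] [] refl = inj₂ (((λ _ → []) , (λ { Fin.zero Fin.zero ne → ⊥-elim (ne refl) }) , λ { [] → Fin.zero , [] , tt }) , λ { [] _ → refl })
  outcome (c ∷ T) {suc r} rows e = let R , Rs , z , p = reduce c rows in
    outcome-⇝ (c ∷ T) p (outcome-step c T R Rs z (suc-injective e) (outcome T Rs (suc-injective e)))

-- The signed boundary of the definitions, expressed by incidence rows.

subᵇ : ∀ {n} → Subset n → Subset n → Bool
subᵇ [] [] = true
subᵇ (false ∷ ρ) (_ ∷ τ) = subᵇ ρ τ
subᵇ (true ∷ ρ) (true ∷ τ) = subᵇ ρ τ
subᵇ (true ∷ ρ) (false ∷ τ) = false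

⊆ᵇ≡subᵇ : ∀ {n} (ρ τ : Subset n) → (ρ ⊆ᵇ τ) ≡ subᵇ ρ τ
⊆ᵇ≡subᵇ ρ τ = trans (isYes≗does (ρ ⊆? τ)) (go ρ τ)
  where
  go : ∀ {n} (ρ τ : Subset n) → does (ρ ⊆? τ) ≡ subᵇ ρ τ
  go [] [] = refl
  go (false ∷ ρ) (_ ∷ τ) = go ρ τ
  go (true ∷ ρ) (true ∷ τ) = go ρ τ
  go (true ∷ ρ) (false ∷ τ) = refl

subᵇ-size : ∀ {n} (ρ τ : Subset n) → subᵇ ρ τ ≡ true → ∣ ρ ∣ ≤ ∣ τ ∣
subᵇ-size [] [] e = z≤n
subᵇ-size (false ∷ ρ) (true ∷ τ) e = m≤n⇒m≤1+n (subᵇ-size ρ τ e)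
subᵇ-size (false ∷ ρ) (false ∷ τ) e = subᵇ-size ρ τ e
subᵇ-size (true ∷ ρ) (true ∷ τ) e = s≤s (subᵇ-size ρ τ e)

oddB-suc : ∀ m → oddB (suc m) ≡ not (oddB m)
oddB-suc zero = refl
oddB-suc (suc m) = trans (ss m) (trans (sym (BoolP.not-involutive (oddB m))) (cong not (sym (oddB-suc m))))
  where
  ss : ∀ m → oddB (suc (suc m)) ≡ oddB m
  ss m = cong (_≡ᵇ 1) (trans (cong (_% 2) (+-comm 2 m)) ([m+n]%n≡m%n m 2))

ind-sub : ∀ {n} (ρ τ : Subset n) → ∣ τ ∣ ≡ ∣ ρ ∣ → (if subᵇ ρ τ then 1ℤ else 0ℤ) ≡ ind ρ τ
ind-sub [] [] e = refl
ind-sub (true ∷ ρ) (true ∷ τ) e = ind-sub ρ τ (suc-injective e)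
ind-sub (true ∷ ρ) (false ∷ τ) e = refl
ind-sub (false ∷ ρ) (true ∷ τ) e with subᵇ ρ τ in eq
... | false = refl
... | true = ⊥-elim (1+n≰n (≤-trans (≤-reflexive e) (subᵇ-size ρ τ eq)))
ind-sub (false ∷ ρ) (false ∷ τ) e = ind-sub ρ τ e

sgn-tt : ∀ {n} (τ ρ : Subset n) → sgn (true ∷ τ) (true ∷ ρ) ≡ -ᶻ sgn τ ρ
sgn-tt τ ρ with oddB (signExp τ ρ) | oddB (suc (signExp τ ρ)) | oddB-suc (signExp τ ρ)
... | true | .false | refl = refl
... | false | .true | refl = refl

sgn-Row : ∀ {n} (ρ τ : Subset n) → ∣ τ ∣ ≡ suc ∣ ρ ∣ → (if subᵇ ρ τ then sgn τ ρ else 0ℤ) ≡ Row ρ τ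
sgn-Row (true ∷ ρ) (true ∷ τ) e with subᵇ ρ τ in eq | sgn-Row ρ τ (suc-injective e)
... | true | ih = trans (sgn-tt τ ρ) (trans (cong -ᶻ_ ih) (sym (ℤP.+-identityˡ _)))
... | false | ih = trans (cong -ᶻ_ ih) (sym (ℤP.+-identityˡ _))
sgn-Row (true ∷ ρ) (false ∷ τ) e = sym (cobd-0 _ (λ _ → refl) τ)
sgn-Row (false ∷ ρ) (true ∷ τ) e = trans (ind-sub ρ τ (suc-injective e)) (sym (trans (cong (λ z → ind ρ τ +ᶻ -ᶻ z) (cobd-0 _ (λ _ → refl) τ)) (ℤP.+-identityʳ _)))
sgn-Row (false ∷ ρ) (false ∷ τ) e = sgn-Row ρ τ e

∂-Row : ∀ {n} (T : List (Subset n)) (c : Chain n) ρ → (∀ τ → τ ∈ T → ∣ τ ∣ ≡ suc ∣ ρ ∣) → ∂ T c ρ ≡ ∑ᶻ T (λ τ → Row ρ τ *ᶻ c τ)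
∂-Row T c ρ h = ∑ᶻ-cong∈ T (λ τ m → go τ (h τ m))
  where
  go : ∀ τ → ∣ τ ∣ ≡ suc ∣ ρ ∣ → (if ρ ⊆ᵇ τ then sgn τ ρ *ᶻ c τ else 0ℤ) ≡ Row ρ τ *ᶻ c τ
  go τ e rewrite ⊆ᵇ≡subᵇ ρ τ with subᵇ ρ τ | sgn-Row ρ τ e
  ... | true | ih = cong (_*ᶻ c τ) ih
  ... | false | ih = trans (sym (ℤP.*-zeroˡ (c τ))) (cong (_*ᶻ c τ) ih)

∂-lv : ∀ {n} s (c : Chain n) ρ → ∣ ρ ∣ ≡ s → ∂ (lv n (suc s)) c ρ ≡ bd c ρ
∂-lv {n} s c ρ refl = trans (∂-Row (lv n (suc s)) c ρ (λ τ m → lv-size n (suc s) m))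
  (trans (sym (ipA-lv (suc s) (Row ρ) c (Supp-Row ρ refl))) (trans (adjoint (ind ρ) c) (ipA-ind ρ (bd c))))

module _ {B : Set} where

  restr : (xs : List B) → (B → ℤ) → Vec ℤ (length xs)
  restr [] h = []
  restr (x ∷ xs) h = h x ∷ restr xs h

  rowsOf : {E : Set} (xs : List B) → (B → E) → Vec E (length xs)
  rowsOf [] g = []
  rowsOf (x ∷ xs) g = g x ∷ rowsOf xs g

  toList-rowsOf : {E : Set} (xs : List B) (g : B → E) → Vec.toList (rowsOf xs g) ≡ map g xs
  toList-rowsOf [] g = refl
  toList-rowsOf (x ∷ xs) g = cong (g x ∷_) (toList-rowsOf xs g)

  restr-sub : (xs : List B) (h h' : B → ℤ) → restr xs h -ᵛ restr xs h' ≡ restr xs (λ x → h x -ᶻ h' x)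
  restr-sub [] h h' = refl
  restr-sub (x ∷ xs) h h' = cong (_ ∷_) (restr-sub xs h h')

  restr-cong : (xs : List B) {h h' : B → ℤ} → (∀ x → x ∈ xs → h x ≡ h' x) → restr xs h ≡ restr xs h'
  restr-cong [] e = refl
  restr-cong (x ∷ xs) e = cong₂ _∷_ (e x (here refl)) (restr-cong xs (λ y m → e y (there m)))

  module _ (_≟_ : (x y : B) → Dec (x ≡ y)) where

    fnOf : (xs : List B) → Vec ℤ (length xs) → B → ℤ
    fnOf [] [] y = 0ℤ
    fnOf (x ∷ xs) (a ∷ as) y with y ≟ x
    ... | yes _ = a
    ... | no _ = fnOf xs as y

    fnOf-here : ∀ x xs a as → fnOf (x ∷ xs) (a ∷ as) x ≡ a
    fnOf-here x xs a as with x ≟ x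
    ... | yes _ = refl
    ... | no p = ⊥-elim (p refl)

    fnOf-there : ∀ x xs a as y → y ≢ x → fnOf (x ∷ xs) (a ∷ as) y ≡ fnOf xs as y
    fnOf-there x xs a as y p with y ≟ x
    ... | yes e = ⊥-elim (p e)
    ... | no _ = refl

    restr-fnOf : (xs : List B) → Unique xs → (v : Vec ℤ (length xs)) → restr xs (fnOf xs v) ≡ v
    restr-fnOf [] _ [] = refl
    restr-fnOf (x ∷ xs) (p ∷ u) (a ∷ as) = cong₂ _∷_ (fnOf-here x xs a as)
      (trans (restr-cong xs (λ y m → fnOf-there x xs a as y (λ { refl → All.lookup p m refl }))) (restr-fnOf xs u as))

open Lattice

val-restr : {A : Set} (T : List A) (a R : A → ℤ) → val T (restr T a) R ≡ ∑ᶻ T (λ τ → R τ *ᶻ a τ)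
val-restr [] a R = refl
val-restr (c ∷ T) a R = cong₂ _+ᶻ_ (ℤP.*-comm (a c) (R c)) (val-restr T a R)

InLat-rows : {A B : Set} (T : List A) (as : Vec ℤ (length T)) (xs : List B) (g : B → A → ℤ) (h : B → ℤ) →
  (∀ x → x ∈ xs → h x ≡ val T as (g x)) → InLat T as (rowsOf xs g) (restr xs h)
InLat-rows T as [] g h e = tt
InLat-rows T as (x ∷ xs) g h e = e x (here refl) , InLat-rows T as xs g h (λ y m → e y (there m))

rows-InLat : {A B : Set} (T : List A) (as : Vec ℤ (length T)) (xs : List B) (g : B → A → ℤ) (h : B → ℤ) →
  InLat T as (rowsOf xs g) (restr xs h) → ∀ x → x ∈ xs → h x ≡ val T as (g x)
rows-InLat T as (x ∷ xs) g h (e , es) .x (here refl) = e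
rows-InLat T as (x ∷ xs) g h (e , es) y (there m) = rows-InLat T as xs g h es y m

sublists-⊑ : {A : Set} (L T : List A) → T ∈ sublists L → T ⊑ L
sublists-⊑ [] T (here refl) = nil
sublists-⊑ (x ∷ L) T m with MemP.∈-++⁻ (map (x ∷_) (sublists L)) m
... | inj₂ m' = drop (sublists-⊑ L T m')
... | inj₁ m' with MemP.∈-map⁻ (x ∷_) m'
...   | T' , m'' , refl = keep (sublists-⊑ L T' m'')

⊑-∈ : {A : Set} {T L : List A} → T ⊑ L → ∀ {x} → x ∈ T → x ∈ L
⊑-∈ (keep p) (here e) = here e
⊑-∈ (keep p) (there m) = there (⊑-∈ p m)
⊑-∈ (drop p) m = there (⊑-∈ p m)

⊑-unique : {A : Set} {T L : List A} → T ⊑ L → Unique L → Unique T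
⊑-unique nil u = u
⊑-unique (keep p) (a ∷ u) = All.tabulate (λ m → All.lookup a (⊑-∈ p m)) ∷ ⊑-unique p u
⊑-unique (drop p) (_ ∷ u) = ⊑-unique p u

-- A wedge of r vectors has amplitude only where r modes are occupied. In particular a list `T` of
-- the wrong length gets weight zero.
wedge-Supp : {A : Set} (T : List A) (vs : List (A → ℤ)) → Supp (length vs) (wedge T vs)
wedge-Supp T [] = vac-Supp T
  where
  vac-Supp : ∀ T → Supp 0 (vac T)
  vac-Supp [] [] ne = ⊥-elim (ne refl)
  vac-Supp (c ∷ T) (true ∷ s) ne = refl
  vac-Supp (c ∷ T) (false ∷ s) ne = vac-Supp T s ne
wedge-Supp T (v ∷ vs) = cr-Supp T v (length vs) (wedge T vs) (wedge-Supp T vs)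
  where
  cr-Supp : ∀ T v k (ψ : Fn (length T)) → Supp k ψ → Supp (suc k) (cr T v ψ)
  cr-Supp [] v k ψ h s ne = refl
  cr-Supp (c ∷ T) v k ψ h (false ∷ s) ne = cr-Supp T v k (ψ ᶠ) (λ σ e → h (false ∷ σ) e) s ne
  cr-Supp (c ∷ T) v k ψ h (true ∷ s) ne = cong₂ (λ x y → x +ᶻ -ᶻ y) (trans (cong (v c *ᶻ_) (h (false ∷ s) (ne ∘ cong suc))) (ℤP.*-zeroʳ (v c))) (tl k h ne)
    where
    tl : ∀ k → Supp k ψ → suc ∣ s ∣ ≢ suc k → cr T v (ψ ᵗ) s ≡ 0ℤ
    tl zero h ne = cr-0 T v (ψ ᵗ) (λ σ → h (true ∷ σ) (λ ())) s
    tl (suc k) h ne = cr-Supp T v k (ψ ᵗ) (λ σ e → h (true ∷ σ) (e ∘ suc-injective)) s (ne ∘ cong suc)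

∣full∣ : ∀ n → ∣ full n ∣ ≡ n
∣full∣ zero = refl
∣full∣ (suc n) = cong suc (∣full∣ n)

-- Reduced homology of a complex with complete skeleton is the cokernel of the reduced boundary matrix.

module Homology (m d : ℕ) (T : List (Subset (suc m))) (T⊑ : T ⊑ lv (suc m) (suc (suc d))) where

  open Rows m d

  private
    szT : ∀ τ → τ ∈ T → ∣ τ ∣ ≡ D
    szT τ mem = lv-size n D (⊑-∈ T⊑ mem)

    uT : Unique T
    uT = ⊑-unique T⊑ (lv-unique n D)

    σs : List (Subset m)
    σs = lv m (suc d)

    F : Subset m → Fn n
    F σ = Row (false ∷ σ)

    ∂T : ∀ (a : Chain n) σ → ∣ σ ∣ ≡ suc d → ∂ T a σ ≡ ∑ᶻ T (λ τ → Row σ τ *ᶻ a τ)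
    ∂T a σ e = ∂-Row T a σ (λ τ mem → trans (szT τ mem) (cong suc (sym e)))

  rowsV : Vec (Fn n) (length σs)
  rowsV = rowsOf σs F

  det-rowsV : det T rowsV ≡ detT T
  det-rowsV = cong (λ z → top T (wedge T z)) (toList-rowsOf σs F)

  res : Chain n → Vec ℤ (length σs)
  res c = restr σs (c ᶠ)

  Cycle : Chain n → Set
  Cycle = IsCycle (sizeLevel n (suc d)) (sizeLevel n d)

  Hom : Chain n → Chain n → Set
  Hom = Homologous T (sizeLevel n (suc d))

  cycle-bd : ∀ c → Cycle c → ∀ ρ → ∣ ρ ∣ ≡ d → bd c ρ ≡ 0ℤ
  cycle-bd c h ρ e = trans (sym (∂-lv d c ρ e)) (trans (cong (λ z → ∂ z c ρ) (sym (sizeLevel≡lv n (suc d)))) (h ρ (subst (ρ ∈_) (sym (sizeLevel≡lv n d)) (size⇒∈lv ρ e))))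

  bd-cycle : ∀ c → (∀ ρ → bd c ρ ≡ 0ℤ) → Cycle c
  bd-cycle c h ρ mem = trans (cong (λ z → ∂ z c ρ) (sizeLevel≡lv n (suc d))) (trans (∂-lv d c ρ (lv-size n d (subst (ρ ∈_) (sizeLevel≡lv n d) mem))) (h ρ))

  Hom→Lat : ∀ c c' → Hom c c' → Lat T rowsV (res c -ᵛ res c')
  Hom→Lat c c' (a , h) = restr T a , subst (InLat T (restr T a) rowsV) (sym (restr-sub σs (c ᶠ) (c' ᶠ)))
    (InLat-rows T (restr T a) σs F _ (λ σ mem → trans (sym (h (false ∷ σ) (subst (_ ∈_) (sym (sizeLevel≡lv n (suc d))) (size⇒∈lv (false ∷ σ) (lv-size m (suc d) mem)))))
      (trans (∂T a (false ∷ σ) (lv-size m (suc d) mem)) (sym (val-restr T a (F σ))))))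

  private
    bd-split : ∀ (c : Chain n) ρ → ∣ ρ ∣ ≡ d → bd c (false ∷ ρ) ≡ c (true ∷ ρ) +ᶻ ∑ᶻ σs (λ σ → Row ρ σ *ᶻ c (false ∷ σ))
    bd-split c ρ e = cong (c (true ∷ ρ) +ᶻ_) (trans (sym (∂-lv d (c ᶠ) ρ e)) (∂-Row σs (c ᶠ) ρ (λ τ mem → trans (lv-size m (suc d) mem) (cong suc (sym e)))))

    swap : ∀ (xs : List (Subset m)) (ys : List (Subset n)) (f : Subset m → ℤ) (g : Subset m → Subset n → ℤ) →
      ∑ᶻ xs (λ x → f x *ᶻ ∑ᶻ ys (g x)) ≡ ∑ᶻ ys (λ y → ∑ᶻ xs (λ x → f x *ᶻ g x y))
    swap [] ys f g = sym (∑ᶻ-zero ys (λ _ _ → refl))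
    swap (x ∷ xs) ys f g = trans (cong₂ _+ᶻ_ (sym (∑ᶻ-* ys (f x) (g x))) (swap xs ys f g)) (sym (∑ᶻ-+ ys _ _))

  -- The lattice condition controls only faces avoiding vertex 0. The cycle equation at ρ expresses
  -- the coefficient at {0} ∪ ρ through those, and `∂ T a` satisfies the same equation by
  -- `Row-relation`.
  Lat→Hom : ∀ c c' → Cycle c → Cycle c' → Lat T rowsV (res c -ᵛ res c') → Hom c c'
  Lat→Hom c c' zc zc' (as , l) = a , λ σ mem → go σ (lv-size n (suc d) (subst (σ ∈_) (sizeLevel≡lv n (suc d)) mem))
    where
    a = fnOf _≟ˢ_ T as
    onF : ∀ σ → ∣ σ ∣ ≡ suc d → ∂ T a (false ∷ σ) ≡ c (false ∷ σ) -ᶻ c' (false ∷ σ)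
    onF σ e = trans (∂T a (false ∷ σ) e) (trans (sym (val-restr T a (F σ))) (trans (cong (λ z → val T z (F σ)) (restr-fnOf _≟ˢ_ T uT as))
      (sym (rows-InLat T as σs F _ (subst (InLat T as rowsV) (restr-sub σs (c ᶠ) (c' ᶠ)) l) σ (size⇒∈lv σ e)))))
    go : ∀ σ → ∣ σ ∣ ≡ suc d → ∂ T a σ ≡ c σ -ᶻ c' σ
    go (false ∷ σ) e = onF σ e
    go (true ∷ ρ) e = fin (∂ T a (true ∷ ρ)) (c (true ∷ ρ)) (c' (true ∷ ρ)) X Y Y' eqa (trans (sym (bd-split c ρ e')) (cycle-bd c zc (false ∷ ρ) e')) (trans (sym (bd-split c' ρ e')) (cycle-bd c' zc' (false ∷ ρ) e')) XY
      where
      e' = suc-injective e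
      X = ∑ᶻ σs (λ σ → Row ρ σ *ᶻ ∂ T a (false ∷ σ))
      Y = ∑ᶻ σs (λ σ → Row ρ σ *ᶻ c (false ∷ σ))
      Y' = ∑ᶻ σs (λ σ → Row ρ σ *ᶻ c' (false ∷ σ))
      r3 : ∀ p x y → p *ᶻ (x -ᶻ y) ≡ p *ᶻ x +ᶻ -1ℤ *ᶻ (p *ᶻ y)
      r3 = ringℤ
      XY : X ≡ Y +ᶻ -1ℤ *ᶻ Y'
      XY = trans (∑ᶻ-cong∈ σs (λ σ mem → trans (cong (Row ρ σ *ᶻ_) (onF σ (lv-size m (suc d) mem))) (r3 (Row ρ σ) (c (false ∷ σ)) (c' (false ∷ σ)))))
        (trans (∑ᶻ-+ σs _ _) (cong (Y +ᶻ_) (∑ᶻ-* σs -1ℤ _)))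
      r4 : ∀ p q x → p *ᶻ x +ᶻ q *ᶻ x ≡ (p +ᶻ q) *ᶻ x
      r4 = ringℤ
      r5 : ∀ p q x → p *ᶻ (q *ᶻ x) ≡ x *ᶻ (p *ᶻ q)
      r5 = ringℤ
      eqa : ∂ T a (true ∷ ρ) +ᶻ X ≡ 0ℤ
      eqa = trans (cong₂ _+ᶻ_ (∂T a (true ∷ ρ) e)
             (trans (∑ᶻ-cong∈ σs (λ σ mem → cong (Row ρ σ *ᶻ_) (∂T a (false ∷ σ) (lv-size m (suc d) mem)))) (swap σs T (Row ρ) (λ σ τ → F σ τ *ᶻ a τ))))
           (trans (sym (∑ᶻ-+ T _ _)) (∑ᶻ-zero T (λ τ _ → trans (cong (Row (true ∷ ρ) τ *ᶻ a τ +ᶻ_)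
               (trans (∑ᶻ-cong σs (λ σ → r5 (Row ρ σ) (F σ τ) (a τ))) (trans (∑ᶻ-* σs (a τ) _) (ℤP.*-comm (a τ) _))))
              (trans (r4 (Row (true ∷ ρ) τ) _ (a τ)) (trans (cong (_*ᶻ a τ) (Row-relation ρ e' τ)) (ℤP.*-zeroˡ (a τ)))))))
      fin : ∀ A x x' X Y Y' → A +ᶻ X ≡ 0ℤ → x +ᶻ Y ≡ 0ℤ → x' +ᶻ Y' ≡ 0ℤ → X ≡ Y +ᶻ -1ℤ *ᶻ Y' → A ≡ x -ᶻ x'
      fin A x x' X Y Y' p q s refl = trans (k1 A x x' Y Y') (trans (cong₂ (λ u v → (u -ᶻ (v -ᶻ (x' +ᶻ Y'))) +ᶻ (x -ᶻ x')) p q) (trans (cong (λ w → (0ℤ -ᶻ (0ℤ -ᶻ w)) +ᶻ (x -ᶻ x')) s) (ℤP.+-identityˡ _)))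
        where k1 : ∀ A x x' Y Y' → A ≡ ((A +ᶻ (Y +ᶻ -1ℤ *ᶻ Y')) -ᶻ ((x +ᶻ Y) -ᶻ (x' +ᶻ Y'))) +ᶻ (x -ᶻ x')
              k1 = ringℤ

  -- The boundary of the cone from vertex 0 over v. Its cone faces take care of the cycle condition,
  -- so every vector on the faces avoiding 0 is the restriction of a cycle.
  extend : Vec ℤ (length σs) → Chain n
  extend v = bd cone
    where
    cone : Chain n
    cone (true ∷ σ) = fnOf _≟ˢ_ σs v σ
    cone (false ∷ σ) = 0ℤ

  extend-cycle : ∀ v → Cycle (extend v)
  extend-cycle v = bd-cycle (extend v) (bd-bd _)

  res-extend : ∀ v → res (extend v) ≡ v
  res-extend v = trans (restr-cong σs (λ σ _ → trans (cong (fnOf _≟ˢ_ σs v σ +ᶻ_) (bd-0 _ (λ _ → refl) σ)) (ℤP.+-identityʳ _))) (restr-fnOf _≟ˢ_ σs (lv-unique m (suc d)) v)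

  HO→Ord : ∀ k → HomologyOrder n (suc d) T k → Ord T rowsV k
  HO→Ord k (cs , cyc , dist , cov) = (λ i → res (lookup cs i)) ,
    (λ i j ne l → dist i j ne (Lat→Hom _ _ (cyc i) (cyc j) l)) ,
    (λ x → let i , h = cov (extend x) (extend-cycle x) in i , subst (λ z → Lat T rowsV (z -ᵛ res (lookup cs i))) (res-extend x) (Hom→Lat (extend x) (lookup cs i) h))

  Ord→HO : ∀ k → Ord T rowsV k → HomologyOrder n (suc d) T k
  Ord→HO k (cs , dist , cov) = Vec.tabulate f ,
    (λ i → subst Cycle (sym (VecP.lookup∘tabulate f i)) (extend-cycle (cs i))) ,
    (λ i j ne h → dist i j ne (subst₂ (λ x y → Lat T rowsV (x -ᵛ y)) (trans (cong res (VecP.lookup∘tabulate f i)) (res-extend (cs i))) (trans (cong res (VecP.lookup∘tabulate f j)) (res-extend (cs j))) (Hom→Lat (lookup (Vec.tabulate f) i) (lookup (Vec.tabulate f) j) h))) ,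
    (λ c z → let i , l = cov (res c) in i , subst (Hom c) (sym (VecP.lookup∘tabulate f i))
       (Lat→Hom c (f i) z (extend-cycle (cs i)) (subst (λ y → Lat T rowsV (res c -ᵛ y)) (sym (res-extend (cs i))) l)))
    where
    f : Fin k → Chain n
    f i = extend (cs i)

  -- A specification by cases determines the value: `outcome` decides between finite and infinite
  -- index, and the order of a finite quotient is unique.
  weight : (w : ℕ) →
    (Σ ℕ λ k → (length T ≡ (n ∸ 1) C suc d) × HomologyOrder n (suc d) T k × (w ≡ k * k)) ⊎ (¬ IsHypertree n (suc d) T × (w ≡ 0)) → w ≡ wgt T
  weight w h with length T ≟ length σs
  ... | no ne = trans (w0 h) (sym (cong sq (wedge-Supp T rows (full (length T)) (λ e → ne (trans (sym (∣full∣ (length T))) (trans e (ListP.length-map _ σs)))))))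
    where w0 : _ → w ≡ 0
          w0 (inj₁ (k , len , _)) = ⊥-elim (ne (trans len (sym (length-lv m (suc d)))))
          w0 (inj₂ (_ , e)) = e
  ... | yes len with outcome T rowsV (sym len) | h
  ...   | inj₁ (d0 , nc) | inj₁ (k , _ , ho , _) = let cs , _ , cov = HO→Ord k ho in ⊥-elim (nc k (cs , cov))
  ...   | inj₁ (d0 , nc) | inj₂ (_ , e) = trans e (sym (cong sq (trans (sym det-rowsV) d0)))
  ...   | inj₂ (o , _) | inj₁ (k , _ , ho , e) = trans e (trans (cong (λ z → z * z) (Ord-unique T rowsV k _ (HO→Ord k ho) o)) (cong sq det-rowsV))
  ...   | inj₂ (o , _) | inj₂ (nh , _) = ⊥-elim (nh (trans len (length-lv m (suc d)) , _ , Ord→HO _ o))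

  -- A face of degree zero would give a cycle of infinite order.
  degree-pos : ∀ k → HomologyOrder n (suc d) T k → ∀ σ → ∣ σ ∣ ≡ suc d → suc d < n → ¬ (∀ τ → τ ∈ T → Row σ τ ≡ 0ℤ)
  degree-pos k (cs , _ , _ , cov) σ e lt zero-deg = go (coface σ (subst (_< n) (sym e) lt))
    where
    coface : ∀ {n} (σ : Subset n) → ∣ σ ∣ < n → Σ (Subset n) λ τ → Row σ τ ≢ 0ℤ
    coface (false ∷ σ) lt = true ∷ σ , λ p → absurd (trans (sym (trans (cong (λ z → ind σ σ +ᶻ -ᶻ z) (cobd-0 _ (λ _ → refl) σ)) (trans (ℤP.+-identityʳ _) (ind-refl σ)))) p)
      where absurd : ¬ (1ℤ ≡ 0ℤ)
            absurd ()
    coface (true ∷ σ) (s≤s lt) = let τ , p = coface σ lt in true ∷ τ , λ q → p (trans (sym (ℤP.neg-involutive _)) (cong -ᶻ_ (trans (sym (ℤP.+-identityˡ _)) q)))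
    ∂0 : ∀ a → ∂ T a σ ≡ 0ℤ
    ∂0 a = trans (∂T a σ e) (∑ᶻ-zero T (λ τ mem → trans (cong (_*ᶻ a τ) (zero-deg τ mem)) (ℤP.*-zeroˡ (a τ))))
    σ∈ : σ ∈ sizeLevel n (suc d)
    σ∈ = subst (σ ∈_) (sym (sizeLevel≡lv n (suc d))) (size⇒∈lv σ e)
    go : Σ (Subset n) (λ τ → Row σ τ ≢ 0ℤ) → ⊥
    -- Multiples of the boundary of a coface τ of σ in the full simplex. Their coefficients at σ are
    -- pairwise distinct, yet homologous cycles agree at σ, so k classes cannot hold k + 1 of them.
    go (τ , ne) = contra (FinP.pigeonhole (n<1+n k) (λ i → proj₁ (cv i)))
      where
      z : ℕ → Chain n
      z i ρ = pos i *ᶻ bd (ind τ) ρ +ᶻ 0ℤ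
      zc : ∀ i → Cycle (z i)
      zc i = bd-cycle (z i) (λ ρ → trans (bd-lin (pos i) (bd (ind τ)) (λ _ → 0ℤ) ρ) (trans (cong₂ (λ x y → pos i *ᶻ x +ᶻ y) (bd-bd (ind τ) ρ) (bd-0 _ (λ _ → refl) ρ)) (trans (cong (_+ᶻ 0ℤ) (ℤP.*-zeroʳ (pos i))) refl)))
      cv : (i : Fin (suc k)) → ∃ λ j → Hom (z (Fin.toℕ i)) (lookup cs j)
      cv i = cov (z (Fin.toℕ i)) (zc (Fin.toℕ i))
      at : ∀ i → z (Fin.toℕ i) σ ≡ lookup cs (proj₁ (cv i)) σ
      at i = ℤP.i-j≡0⇒i≡j _ _ (trans (sym (proj₂ (proj₂ (cv i)) σ σ∈)) (∂0 _))
      contra : ∃ (λ i → ∃ λ j → i Fin.< j × proj₁ (cv i) ≡ proj₁ (cv j)) → ⊥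
      contra (i , j , lt , eq) = <⇒≢ lt (ℤP.+-injective (ℤP.*-cancelʳ-≡ (pos (Fin.toℕ i)) (pos (Fin.toℕ j)) (Row σ τ) {{ℤ.≢-nonZero ne}}
        (subst₂ _≡_ (conv i) (conv j) (trans (at i) (trans (cong (λ x → lookup cs x σ) eq) (sym (at j)))))))
        where conv : ∀ i → z (Fin.toℕ i) σ ≡ pos (Fin.toℕ i) *ᶻ Row σ τ
              conv i = trans (ℤP.+-identityʳ _) (cong (pos (Fin.toℕ i) *ᶻ_) (bd-ind σ τ))

-- Elementary inequalities

one-minus : ∀ n h → suc n ^ h * suc n ≤ n ^ h * suc n + h * suc n ^ h
one-minus n zero = ≤-reflexive (sym (+-identityʳ _))
one-minus n (suc h) = begin
  suc n * suc n ^ h * suc n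
    ≡⟨ *-assoc (suc n) (suc n ^ h) (suc n) ⟩
  suc n * (suc n ^ h * suc n)
    ≤⟨ *-monoʳ-≤ (suc n) (one-minus n h) ⟩
  suc n * (n ^ h * suc n + h * suc n ^ h)
    ≡⟨ e n (n ^ h) h (suc n ^ h) ⟩
  n * n ^ h * suc n + (suc n * n ^ h + h * (suc n * suc n ^ h))
    ≤⟨ +-monoʳ-≤ (n * n ^ h * suc n) (+-monoˡ-≤ (h * (suc n * suc n ^ h)) (*-monoʳ-≤ (suc n) (^-monoˡ-≤ h (n≤1+n n)))) ⟩
  n * n ^ h * suc n + (suc n * suc n ^ h + h * (suc n * suc n ^ h)) ∎
  where
  open ≤-Reasoning
  e : ∀ n p h q → suc n * (p * suc n + h * q) ≡ n * p * suc n + (suc n * p + h * (suc n * q))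
  e = ringℕ

-- The role of e is played by 4: with h about n/2, `one-minus` gives (1 + 1/n)^h ≤ 2, and squaring
-- gives the claim.
suc^≤4 : ∀ n → suc n ^ n ≤ 4 * n ^ n
suc^≤4 n = *-cancelʳ-≤ (suc n ^ n) (4 * n ^ n) (suc n ^ (2 * h ∸ n)) {{m^n≢0 (suc n) (2 * h ∸ n)}} (begin
  suc n ^ n * suc n ^ (2 * h ∸ n)  ≡⟨ ^-distribˡ-+-* (suc n) n (2 * h ∸ n) ⟨
  suc n ^ (n + (2 * h ∸ n))        ≡⟨ cong (suc n ^_) (m+[n∸m]≡n n≤2h) ⟩
  suc n ^ (2 * h)                  ≡⟨ sq^ (suc n) ⟩
  suc n ^ h * suc n ^ h            ≤⟨ *-mono-≤ half half ⟩
  (2 * n ^ h) * (2 * n ^ h)        ≡⟨ r (n ^ h) ⟩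
  4 * (n ^ h * n ^ h)              ≡⟨ cong (4 *_) (sym (sq^ n)) ⟩
  4 * n ^ (2 * h)                  ≡⟨ cong (λ z → 4 * n ^ z) (sym (m+[n∸m]≡n n≤2h)) ⟩
  4 * n ^ (n + (2 * h ∸ n))        ≡⟨ cong (4 *_) (^-distribˡ-+-* n n (2 * h ∸ n)) ⟩
  4 * (n ^ n * n ^ (2 * h ∸ n))    ≤⟨ *-monoʳ-≤ 4 (*-monoʳ-≤ (n ^ n) (^-monoˡ-≤ (2 * h ∸ n) (n≤1+n n))) ⟩
  4 * (n ^ n * suc n ^ (2 * h ∸ n)) ≡⟨ *-assoc 4 (n ^ n) _ ⟨
  4 * n ^ n * suc n ^ (2 * h ∸ n)  ∎)
  where
  open ≤-Reasoning
  h = ⌈ n /2⌉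
  dbl : ∀ h → 2 * h ≡ h + h
  dbl = ringℕ
  r : ∀ x → (2 * x) * (2 * x) ≡ 4 * (x * x)
  r = ringℕ
  sq^ : ∀ x → x ^ (2 * h) ≡ x ^ h * x ^ h
  sq^ x = trans (cong (x ^_) (dbl h)) (^-distribˡ-+-* x h h)
  n≤2h : n ≤ 2 * h
  n≤2h = subst₂ _≤_ (⌊n/2⌋+⌈n/2⌉≡n n) (sym (dbl h)) (+-monoˡ-≤ h (⌊n/2⌋≤⌈n/2⌉ n))
  2h≤ : 2 * h ≤ suc n
  2h≤ = subst₂ _≤_ (sym (dbl h)) (⌊n/2⌋+⌈n/2⌉≡n (suc n)) (+-monoʳ-≤ h (⌊n/2⌋≤⌈n/2⌉ (suc n)))
  half : suc n ^ h ≤ 2 * n ^ h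
  half = *-cancelʳ-≤ (suc n ^ h) (2 * n ^ h) (suc n) (+-cancelʳ-≤ (suc n ^ h * suc n) _ _ (begin
    suc n ^ h * suc n + suc n ^ h * suc n ≡⟨ sym (dbl (suc n ^ h * suc n)) ⟩
    2 * (suc n ^ h * suc n) ≤⟨ *-monoʳ-≤ 2 (one-minus n h) ⟩
    2 * (n ^ h * suc n + h * suc n ^ h) ≡⟨ r2 (n ^ h) (suc n) h (suc n ^ h) ⟩
    2 * n ^ h * suc n + 2 * h * suc n ^ h ≤⟨ +-monoʳ-≤ (2 * n ^ h * suc n) (*-monoˡ-≤ (suc n ^ h) 2h≤) ⟩
    2 * n ^ h * suc n + suc n * suc n ^ h ≡⟨ cong (2 * n ^ h * suc n +_) (*-comm (suc n) (suc n ^ h)) ⟩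
    2 * n ^ h * suc n + suc n ^ h * suc n ∎))
    where r2 : ∀ p s h q → 2 * (p * s + h * q) ≡ 2 * p * s + 2 * h * q
          r2 = ringℕ

^-* : ∀ a b k → (a * b) ^ k ≡ a ^ k * b ^ k
^-* a b zero = refl
^-* a b (suc k) = trans (cong (a * b *_) (^-* a b k)) (r a b (a ^ k) (b ^ k))
  where r : ∀ a b c d → a * b * (c * d) ≡ a * c * (b * d)
        r = ringℕ

-- Integer form of 1 + x ≤ e^x: first n + a ≤ n·(1 + 1/n)^a for each factor, then `suc^≤4` for the
-- total exponent, rounded up to a multiple of n.
exp-bound : {A : Set} (L : List A) (a : A → ℕ) (n B : ℕ) .{{_ : NonZero n}} → ∑ L a ≤ B * n → ∏ L (λ t → n + a t) ≤ n ^ length L * 4 ^ B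
exp-bound L a n B le = *-cancelʳ-≤ _ _ (n ^ ∑ L a) {{m^n≢0 n (∑ L a)}} (begin
  ∏ L (λ t → n + a t) * n ^ ∑ L a ≤⟨ prod L ⟩
  n ^ length L * suc n ^ ∑ L a ≤⟨ *-monoʳ-≤ (n ^ length L) pw ⟩
  n ^ length L * (4 ^ B * n ^ ∑ L a) ≡⟨ *-assoc (n ^ length L) (4 ^ B) _ ⟨
  n ^ length L * 4 ^ B * n ^ ∑ L a ∎)
  where
  open ≤-Reasoning
  single : ∀ a → (n + a) * n ^ a ≤ n * suc n ^ a
  single zero = ≤-reflexive (cong (_* 1) (+-identityʳ n))
  single (suc a) = begin
    (n + suc a) * (n * n ^ a) ≡⟨ *-assoc (n + suc a) n (n ^ a) ⟨
    (n + suc a) * n * n ^ a ≤⟨ *-monoˡ-≤ (n ^ a) (subst ((n + suc a) * n ≤_) (r1 n a) (m≤m+n _ a)) ⟩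
    suc n * (n + a) * n ^ a ≡⟨ *-assoc (suc n) (n + a) (n ^ a) ⟩
    suc n * ((n + a) * n ^ a) ≤⟨ *-monoʳ-≤ (suc n) (single a) ⟩
    suc n * (n * suc n ^ a) ≡⟨ r2 (suc n) n (suc n ^ a) ⟩
    n * (suc n * suc n ^ a) ∎
    where r1 : ∀ n a → (n + suc a) * n + a ≡ suc n * (n + a)
          r1 = ringℕ
          r2 : ∀ s n p → s * (n * p) ≡ n * (s * p)
          r2 = ringℕ
  prod : ∀ M → ∏ M (λ t → n + a t) * n ^ ∑ M a ≤ n ^ length M * suc n ^ ∑ M a
  prod [] = ≤-refl
  prod (t ∷ M) = begin
    (n + a t) * ∏ M (λ t → n + a t) * n ^ (a t + ∑ M a) ≡⟨ cong ((n + a t) * ∏ M (λ t → n + a t) *_) (^-distribˡ-+-* n (a t) (∑ M a)) ⟩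
    (n + a t) * ∏ M (λ t → n + a t) * (n ^ a t * n ^ ∑ M a) ≡⟨ r (n + a t) (∏ M (λ t → n + a t)) (n ^ a t) (n ^ ∑ M a) ⟩
    ((n + a t) * n ^ a t) * (∏ M (λ t → n + a t) * n ^ ∑ M a) ≤⟨ *-mono-≤ (single (a t)) (prod M) ⟩
    (n * suc n ^ a t) * (n ^ length M * suc n ^ ∑ M a) ≡⟨ r n (suc n ^ a t) (n ^ length M) (suc n ^ ∑ M a) ⟩
    (n * n ^ length M) * (suc n ^ a t * suc n ^ ∑ M a) ≡⟨ cong (n * n ^ length M *_) (^-distribˡ-+-* (suc n) (a t) (∑ M a)) ⟨
    n * n ^ length M * suc n ^ (a t + ∑ M a) ∎
    where r : ∀ a b c d → a * b * (c * d) ≡ a * c * (b * d)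
          r = ringℕ
  S = ∑ L a
  pw : suc n ^ S ≤ 4 ^ B * n ^ S
  pw = *-cancelʳ-≤ _ _ (n ^ (B * n ∸ S)) {{m^n≢0 n (B * n ∸ S)}} (begin
    suc n ^ S * n ^ (B * n ∸ S) ≤⟨ *-monoʳ-≤ (suc n ^ S) (^-monoˡ-≤ (B * n ∸ S) (n≤1+n n)) ⟩
    suc n ^ S * suc n ^ (B * n ∸ S) ≡⟨ ^-distribˡ-+-* (suc n) S (B * n ∸ S) ⟨
    suc n ^ (S + (B * n ∸ S)) ≡⟨ cong (suc n ^_) (trans (m+[n∸m]≡n le) (*-comm B n)) ⟩
    suc n ^ (n * B) ≡⟨ ^-*-assoc (suc n) n B ⟨
    (suc n ^ n) ^ B ≤⟨ ^-monoˡ-≤ B (suc^≤4 n) ⟩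
    (4 * n ^ n) ^ B ≡⟨ ^-* 4 (n ^ n) B ⟩
    4 ^ B * (n ^ n) ^ B ≡⟨ cong (4 ^ B *_) (trans (^-*-assoc n n B) (cong (n ^_) (trans (*-comm n B) (sym (m+[n∸m]≡n le))))) ⟩
    4 ^ B * n ^ (S + (B * n ∸ S)) ≡⟨ cong (4 ^ B *_) (^-distribˡ-+-* n S (B * n ∸ S)) ⟩
    4 ^ B * (n ^ S * n ^ (B * n ∸ S)) ≡⟨ *-assoc (4 ^ B) (n ^ S) _ ⟨
    4 ^ B * n ^ S * n ^ (B * n ∸ S) ∎)

-- (1 - D/N)^{2X} ≤ 2^{-a} as soon as 2DX ≥ aN.
lower-tail : ∀ N D X a .{{_ : NonZero N}} → a * N ≤ 2 * X * D → (N ∸ D) ^ (2 * X) * 2 ^ a ≤ N ^ (2 * X)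
lower-tail (suc M) D X a le = *-cancelʳ-≤ _ _ (N ^ (2 * X * D)) {{m^n≢0 N (2 * X * D)}} (begin
  (N ∸ D) ^ (2 * X) * 2 ^ a * N ^ (2 * X * D) ≡⟨ r1 ((N ∸ D) ^ (2 * X)) (2 ^ a) (N ^ (2 * X * D)) ⟩
  (N ∸ D) ^ (2 * X) * N ^ (2 * X * D) * 2 ^ a ≡⟨ cong (_* 2 ^ a) (trans (cong ((N ∸ D) ^ (2 * X) *_) (pw N)) (sym (^-* (N ∸ D) (N ^ D) (2 * X)))) ⟩
  ((N ∸ D) * N ^ D) ^ (2 * X) * 2 ^ a ≤⟨ *-monoˡ-≤ (2 ^ a) (^-monoˡ-≤ (2 * X) s1) ⟩
  (N * M ^ D) ^ (2 * X) * 2 ^ a ≡⟨ cong (_* 2 ^ a) (trans (^-* N (M ^ D) (2 * X)) (cong (N ^ (2 * X) *_) (sym (pw M)))) ⟩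
  N ^ (2 * X) * M ^ (2 * X * D) * 2 ^ a ≡⟨ *-assoc (N ^ (2 * X)) _ _ ⟩
  N ^ (2 * X) * (M ^ (2 * X * D) * 2 ^ a) ≤⟨ *-monoʳ-≤ (N ^ (2 * X)) s3 ⟩
  N ^ (2 * X) * N ^ (2 * X * D) ∎)
  where
  open ≤-Reasoning
  N = suc M
  r1 : ∀ x y z → x * y * z ≡ x * z * y
  r1 = ringℕ
  pw : ∀ x → x ^ (2 * X * D) ≡ (x ^ D) ^ (2 * X)
  pw x = trans (cong (x ^_) (*-comm (2 * X) D)) (sym (^-*-assoc x D (2 * X)))
  s1 : (N ∸ D) * N ^ D ≤ N * M ^ D
  s1 = begin
    (N ∸ D) * N ^ D ≡⟨ *-distribʳ-∸ (N ^ D) N D ⟩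
    N * N ^ D ∸ D * N ^ D ≤⟨ m≤n+o⇒m∸n≤o (N * N ^ D) (D * N ^ D) (begin
      N * N ^ D ≡⟨ *-comm N (N ^ D) ⟩
      N ^ D * N ≤⟨ one-minus M D ⟩
      M ^ D * N + D * N ^ D ≡⟨ trans (+-comm (M ^ D * N) _) (cong (D * N ^ D +_) (*-comm (M ^ D) N)) ⟩
      D * N ^ D + N * M ^ D ∎) ⟩
    N * M ^ D ∎
  s2 : M ^ N * 2 ≤ N ^ N
  s2 = *-cancelʳ-≤ _ _ N (+-cancelʳ-≤ (N * N ^ N) _ _ (begin
    M ^ N * 2 * N + N * N ^ N ≤⟨ h ⟩
    N ^ N * N + N * N ^ N ∎))
    where
    bern : ∀ k → M ^ k + k * M ^ pred k ≤ N ^ k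
    bern zero = ≤-refl
    bern (suc zero) = ≤-reflexive (r M)
      where r : ∀ M → M * 1 + (1 + 0) ≡ suc M * 1
            r = ringℕ
    bern (suc (suc k)) = begin
      M * (M * M ^ k) + suc (suc k) * (M * M ^ k) ≤⟨ m≤m+n _ (suc k * M ^ k) ⟩
      M * (M * M ^ k) + suc (suc k) * (M * M ^ k) + suc k * M ^ k ≡⟨ r M (M ^ k) k ⟩
      suc M * (M * M ^ k + suc k * M ^ k) ≤⟨ *-monoʳ-≤ (suc M) (bern (suc k)) ⟩
      suc M * (suc M * suc M ^ k) ∎
      where r : ∀ M p k → M * (M * p) + suc (suc k) * (M * p) + suc k * p ≡ suc M * (M * p + suc k * p)
            r = ringℕ
    h : M ^ N * 2 * N + N * N ^ N ≤ N ^ N * N + N * N ^ N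
    h = +-monoˡ-≤ (N * N ^ N) (*-monoˡ-≤ N (begin
      M ^ N * 2 ≡⟨ trans (*-comm (M ^ N) 2) (cong (M ^ N +_) (+-identityʳ _)) ⟩
      M ^ N + M * M ^ M ≤⟨ +-monoʳ-≤ (M ^ N) (*-monoˡ-≤ (M ^ M) (n≤1+n M)) ⟩
      M ^ N + N * M ^ M ≤⟨ bern N ⟩
      N ^ N ∎))
  s3 : M ^ (2 * X * D) * 2 ^ a ≤ N ^ (2 * X * D)
  s3 = begin
    M ^ (2 * X * D) * 2 ^ a ≡⟨ cong (λ z → M ^ z * 2 ^ a) (sym (m+[n∸m]≡n le)) ⟩
    M ^ (a * N + R) * 2 ^ a ≡⟨ cong (_* 2 ^ a) (^-distribˡ-+-* M (a * N) R) ⟩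
    M ^ (a * N) * M ^ R * 2 ^ a ≡⟨ r1 (M ^ (a * N)) (M ^ R) (2 ^ a) ⟩
    M ^ (a * N) * 2 ^ a * M ^ R ≡⟨ cong (λ z → z * 2 ^ a * M ^ R) (sw M) ⟩
    (M ^ N) ^ a * 2 ^ a * M ^ R ≡⟨ cong (_* M ^ R) (sym (^-* (M ^ N) 2 a)) ⟩
    (M ^ N * 2) ^ a * M ^ R ≤⟨ *-mono-≤ (^-monoˡ-≤ a s2) (^-monoˡ-≤ R (n≤1+n M)) ⟩
    (N ^ N) ^ a * N ^ R ≡⟨ cong (_* N ^ R) (sym (sw N)) ⟩
    N ^ (a * N) * N ^ R ≡⟨ ^-distribˡ-+-* N (a * N) R ⟨
    N ^ (a * N + R) ≡⟨ cong (N ^_) (m+[n∸m]≡n le) ⟩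
    N ^ (2 * X * D) ∎
    where
    R = 2 * X * D ∸ a * N
    sw : ∀ x → x ^ (a * N) ≡ (x ^ N) ^ a
    sw x = trans (cong (x ^_) (*-comm a N)) (sym (^-*-assoc x N a))

n<2^n : ∀ n → n < 2 ^ n
n<2^n zero = s≤s z≤n
n<2^n (suc n) = ≤-trans (s≤s (n<2^n n)) (≤-trans (+-monoˡ-≤ (2 ^ n) (m^n>0 2 n)) (≤-reflexive (cong (2 ^ n +_) (sym (+-identityʳ _)))))

poly≤exp : ∀ e n → n ^ suc e ≤ suc e ^ suc e * 2 ^ n
poly≤exp e n = begin
  n ^ k ≤⟨ ^-monoˡ-≤ k n≤ ⟩
  (k * suc q) ^ k ≡⟨ ^-* k (suc q) k ⟩
  k ^ k * suc q ^ k ≤⟨ *-monoʳ-≤ (k ^ k) (^-monoˡ-≤ k (n<2^n q)) ⟩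
  k ^ k * (2 ^ q) ^ k ≡⟨ cong (k ^ k *_) (^-*-assoc 2 q k) ⟩
  k ^ k * 2 ^ (q * k) ≤⟨ *-monoʳ-≤ (k ^ k) (^-monoʳ-≤ 2 (m/n*n≤m n k)) ⟩
  k ^ k * 2 ^ n ∎
  where
  open ≤-Reasoning
  k = suc e
  q = n / k
  n≤ : n ≤ k * suc q
  n≤ = begin
    n ≡⟨ m≡m%n+[m/n]*n n k ⟩
    n % k + q * k ≤⟨ +-monoˡ-≤ (q * k) (<⇒≤ (m%n<n n k)) ⟩
    k + q * k ≡⟨ *-comm (suc q) k ⟩
    k * suc q ∎

^-cancel-≤ : ∀ e a b → a ^ suc e ≤ b ^ suc e → a ≤ b
^-cancel-≤ e a b h with a ≤? b
... | yes p = p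
... | no p = ⊥-elim (<-irrefl refl (<-≤-trans (^-monoˡ-< (suc e) (≰⇒> p)) h))

-- A root rounded up. Rounding costs nothing in `markov-^`: an integer whose power passes the
-- threshold `M` is already at least `g`.
root : ∀ M c e → 1 ≤ c → Σ ℕ λ g → (M ≤ c * g ^ suc e) × (∀ g' → M ≤ c * g' ^ suc e → g ≤ g')
root M c e 1≤c = go M big
  where
  open ≤-Reasoning
  big : M ≤ c * M ^ suc e
  big = begin
    M ≤⟨ b M ⟩
    M ^ suc e ≡⟨ *-identityˡ _ ⟨
    1 * M ^ suc e ≤⟨ *-monoˡ-≤ (M ^ suc e) 1≤c ⟩
    c * M ^ suc e ∎
    where b : ∀ M → M ≤ M ^ suc e
          b zero = z≤n
          b M@(suc _) = m≤m*n M (M ^ e) {{m^n≢0 M e}}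
  go : ∀ g → M ≤ c * g ^ suc e → Σ ℕ λ g → (M ≤ c * g ^ suc e) × (∀ g' → M ≤ c * g' ^ suc e → g ≤ g')
  go zero h = zero , h , λ _ _ → z≤n
  go (suc g) h with M ≤? c * g ^ suc e
  ... | yes p = go g p
  ... | no p = suc g , h , least
    where
    least : ∀ g' → M ≤ c * g' ^ suc e → suc g ≤ g'
    least g' q with g' ≤? g
    ... | yes le = ⊥-elim (p (≤-trans q (*-monoʳ-≤ c (^-monoˡ-≤ (suc e) le))))
    ... | no nle = ≰⇒> nle

-- The two-variable weighted inequality. One factor x·y is replaced through 2xy ≤ x² + y², and the
-- part linear in x is returned to the induction hypothesis.
am-gm₂ : ∀ m x y → suc m * x * y ^ m ≤ x ^ suc m + m * y ^ suc m
am-gm₂ zero x y = ≤-reflexive (r x)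
  where r : ∀ x → (x + 0) * 1 ≡ x * 1 + 0
        r = ringℕ
am-gm₂ (suc m) x y = +-cancelʳ-≤ (m * x * (y * p)) _ _ (begin
  suc (suc m) * x * (y * p) + m * x * (y * p) ≡⟨ r1 m x y p ⟩
  suc m * p * (2 * x * y) ≤⟨ *-monoʳ-≤ (suc m * p) (2xy x y) ⟩
  suc m * p * (x * x + y * y) ≡⟨ r2 m x y p ⟩
  x * (suc m * x * p) + suc m * (y * (y * p)) ≤⟨ +-monoˡ-≤ _ (*-monoʳ-≤ x (am-gm₂ m x y)) ⟩
  x * (x ^ suc m + m * (y * p)) + suc m * (y * (y * p)) ≡⟨ r3 m x y p (x ^ suc m) ⟩
  x * x ^ suc m + suc m * (y * (y * p)) + m * x * (y * p) ∎)
  where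
  open ≤-Reasoning
  p = y ^ m
  r1 : ∀ m x y p → suc (suc m) * x * (y * p) + m * x * (y * p) ≡ suc m * p * (2 * x * y)
  r1 = ringℕ
  r2 : ∀ m x y p → suc m * p * (x * x + y * y) ≡ x * (suc m * x * p) + suc m * (y * (y * p))
  r2 = ringℕ
  r3 : ∀ m x y p q → x * (q + m * (y * p)) + suc m * (y * (y * p)) ≡ x * q + suc m * (y * (y * p)) + m * x * (y * p)
  r3 = ringℕ
  2xy : ∀ x y → 2 * x * y ≤ x * x + y * y
  2xy x y with ≤-total x y
  ... | inj₁ le = subst (λ y → 2 * x * y ≤ x * x + y * y) (m+[n∸m]≡n le) (lem x (y ∸ x))
    where lem : ∀ x z → 2 * x * (x + z) ≤ x * x + (x + z) * (x + z)
          lem x z = subst (2 * x * (x + z) ≤_) (r x z) (m≤m+n _ (z * z))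
            where r : ∀ x z → 2 * x * (x + z) + z * z ≡ x * x + (x + z) * (x + z)
                  r = ringℕ
  ... | inj₂ le = subst (λ x → 2 * x * y ≤ x * x + y * y) (m+[n∸m]≡n le) (lem y (x ∸ y))
    where lem : ∀ y z → 2 * (y + z) * y ≤ (y + z) * (y + z) + y * y
          lem y z = subst (2 * (y + z) * y ≤_) (r y z) (m≤m+n _ (z * z))
            where r : ∀ y z → 2 * (y + z) * y + z * z ≡ (y + z) * (y + z) + y * y
                  r = ringℕ

-- To add a term u to a terms of sum s, apply `am-gm₂` to a·(u + s) and (a + 1)·s; the multiples
-- clear the denominators of the two means.
am-gm : {A : Set} (xs : List A) (u : A → ℕ) → length xs ^ length xs * ∏ xs u ≤ ∑ xs u ^ length xs
am-gm [] u = ≤-refl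
am-gm (x ∷ []) u = ≤-reflexive (r (u x))
  where r : ∀ u → (1 + 0) * (u * 1) ≡ (u + 0) * 1
        r = ringℕ
am-gm (x ∷ xs@(_ ∷ _)) u = *-cancelˡ-≤ (a ^ a) {{m^n≢0 a a}} (begin
  a ^ a * (suc a ^ suc a * (u x * P)) ≡⟨ r1 (a ^ a) (suc a ^ suc a) (u x) P ⟩
  suc a ^ suc a * u x * (a ^ a * P) ≤⟨ *-monoʳ-≤ (suc a ^ suc a * u x) (am-gm xs u) ⟩
  suc a ^ suc a * u x * s ^ a ≤⟨ *-cancelˡ-≤ a (+-cancelʳ-≤ (a * Y) _ _ step) ⟩
  a ^ a * (u x + s) ^ suc a ∎)
  where
  open ≤-Reasoning
  a = length xs
  P = ∏ xs u
  s = ∑ xs u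
  Y = (suc a * s) ^ suc a
  r1 : ∀ p q u P → p * (q * (u * P)) ≡ q * u * (p * P)
  r1 = ringℕ
  step : a * (suc a ^ suc a * u x * s ^ a) + a * Y ≤ a * (a ^ a * (u x + s) ^ suc a) + a * Y
  step = begin
    a * (suc a ^ suc a * u x * s ^ a) + a * Y ≡⟨ cong (λ z → a * (suc a ^ suc a * u x * s ^ a) + a * z) (^-* (suc a) s (suc a)) ⟩
    a * (suc a * suc a ^ a * u x * s ^ a) + a * (suc a * suc a ^ a * (s * s ^ a)) ≡⟨ r2 a (suc a ^ a) (u x) (s ^ a) s ⟩
    suc a * (a * (u x + s)) * (suc a ^ a * s ^ a) ≡⟨ cong (suc a * (a * (u x + s)) *_) (sym (^-* (suc a) s a)) ⟩
    suc a * (a * (u x + s)) * (suc a * s) ^ a ≤⟨ am-gm₂ a (a * (u x + s)) (suc a * s) ⟩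
    (a * (u x + s)) ^ suc a + a * Y ≡⟨ cong (_+ a * Y) (trans (^-* a (u x + s) (suc a)) (*-assoc a (a ^ a) _)) ⟩
    a * (a ^ a * (u x + s) ^ suc a) + a * Y ∎
    where r2 : ∀ a q u t s → a * (suc a * q * u * t) + a * (suc a * q * (s * t)) ≡ suc a * (a * (u + s)) * (q * t)
          r2 = ringℕ

am-gm-common : {A : Set} (xs : List A) (u : A → ℕ) (v : ℕ) → v ^ length xs ≤ ∏ xs u → length xs * v ≤ ∑ xs u
am-gm-common [] u v h = z≤n
am-gm-common xs@(_ ∷ ys) u v h = ^-cancel-≤ (length ys) _ _ (begin
  (length xs * v) ^ length xs ≡⟨ ^-* (length xs) v (length xs) ⟩
  length xs ^ length xs * v ^ length xs ≤⟨ *-monoʳ-≤ (length xs ^ length xs) h ⟩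
  length xs ^ length xs * ∏ xs u ≤⟨ am-gm xs u ⟩
  ∑ xs u ^ length xs ∎)
  where open ≤-Reasoning

-- Sums and products of natural numbers.

bit : Bool → ℕ
bit true = 1
bit false = 0

bit≤1 : ∀ b → bit b ≤ 1
bit≤1 true = ≤-refl
bit≤1 false = z≤n

module _ {A : Set} where

  ∑-mono∈ : (xs : List A) {f g : A → ℕ} → (∀ x → x ∈ xs → f x ≤ g x) → ∑ xs f ≤ ∑ xs g
  ∑-mono∈ [] h = z≤n
  ∑-mono∈ (x ∷ xs) h = +-mono-≤ (h x (here refl)) (∑-mono∈ xs (λ y m → h y (there m)))

  ∑-mono : (xs : List A) {f g : A → ℕ} → (∀ x → f x ≤ g x) → ∑ xs f ≤ ∑ xs g
  ∑-mono xs h = ∑-mono∈ xs (λ x _ → h x)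

  ∑-+ : (xs : List A) (f g : A → ℕ) → ∑ xs (λ x → f x + g x) ≡ ∑ xs f + ∑ xs g
  ∑-+ [] f g = refl
  ∑-+ (x ∷ xs) f g = trans (cong (f x + g x +_) (∑-+ xs f g)) (r (f x) (g x) (∑ xs f) (∑ xs g))
    where r : ∀ a b c d → a + b + (c + d) ≡ a + c + (b + d)
          r = ringℕ

  ∑-const : (xs : List A) (c : ℕ) → ∑ xs (λ _ → c) ≡ length xs * c
  ∑-const [] c = refl
  ∑-const (x ∷ xs) c = cong (c +_) (∑-const xs c)

  ∑-≤-const : (xs : List A) {f : A → ℕ} (c : ℕ) → (∀ x → x ∈ xs → f x ≤ c) → ∑ xs f ≤ length xs * c
  ∑-≤-const xs c h = ≤-trans (∑-mono∈ xs h) (≤-reflexive (∑-const xs c))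

  ∑-0 : (xs : List A) → ∑ xs (λ _ → 0) ≡ 0
  ∑-0 xs = trans (∑-const xs 0) (*-zeroʳ (length xs))

  ∑-swap : {B : Set} (xs : List A) (ys : List B) (f : A → B → ℕ) → ∑ xs (λ x → ∑ ys (f x)) ≡ ∑ ys (λ y → ∑ xs (λ x → f x y))
  ∑-swap [] ys f = sym (trans (∑-const' ys) refl)
    where ∑-const' : ∀ {B : Set} (ys : List B) → ∑ ys (λ _ → 0) ≡ 0
          ∑-const' [] = refl
          ∑-const' (y ∷ ys) = ∑-const' ys
  ∑-swap (x ∷ xs) ys f = trans (cong (∑ ys (f x) +_) (∑-swap xs ys f)) (sym (split ys))
    where
    split : ∀ ys → ∑ ys (λ y → f x y + ∑ xs (λ x → f x y)) ≡ ∑ ys (f x) + ∑ ys (λ y → ∑ xs (λ x → f x y))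
    split [] = refl
    split (y ∷ ys) = trans (cong (f x y + ∑ xs (λ x → f x y) +_) (split ys)) (r (f x y) (∑ xs (λ x → f x y)) (∑ ys (f x)) _)
      where r : ∀ a b c d → a + b + (c + d) ≡ a + c + (b + d)
            r = ringℕ

  ∏-mono∈ : (xs : List A) {f g : A → ℕ} → (∀ x → x ∈ xs → f x ≤ g x) → ∏ xs f ≤ ∏ xs g
  ∏-mono∈ [] h = ≤-refl
  ∏-mono∈ (x ∷ xs) h = *-mono-≤ (h x (here refl)) (∏-mono∈ xs (λ y m → h y (there m)))

  ∏-* : (xs : List A) (f g : A → ℕ) → ∏ xs (λ x → f x * g x) ≡ ∏ xs f * ∏ xs g
  ∏-* [] f g = refl
  ∏-* (x ∷ xs) f g = trans (cong (f x * g x *_) (∏-* xs f g)) (r (f x) (g x) (∏ xs f) (∏ xs g))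
    where r : ∀ a b c d → a * b * (c * d) ≡ a * c * (b * d)
          r = ringℕ

  ∏-const : (xs : List A) (c : ℕ) → ∏ xs (λ _ → c) ≡ c ^ length xs
  ∏-const [] c = refl
  ∏-const (x ∷ xs) c = cong (c *_) (∏-const xs c)

  ∏-^ : (xs : List A) (f : A → ℕ) (k : ℕ) → ∏ xs (λ x → f x ^ k) ≡ ∏ xs f ^ k
  ∏-^ [] f k = sym (^-zeroˡ k)
  ∏-^ (x ∷ xs) f k = trans (cong (f x ^ k *_) (∏-^ xs f k)) (sym (^-* (f x) (∏ xs f) k))

  ∏-swap : {B : Set} (xs : List A) (ys : List B) (f : A → B → ℕ) → ∏ xs (λ x → ∏ ys (f x)) ≡ ∏ ys (λ y → ∏ xs (λ x → f x y))
  ∏-swap [] ys f = sym (one^ ys)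
    where one^ : ∀ {B : Set} (ys : List B) → ∏ ys (λ _ → 1) ≡ 1
          one^ [] = refl
          one^ (y ∷ ys) = trans (+-identityʳ _) (one^ ys)
  ∏-swap (x ∷ xs) ys f = trans (cong (∏ ys (f x) *_) (∏-swap xs ys f)) (sym (split ys))
    where
    split : ∀ ys → ∏ ys (λ y → f x y * ∏ xs (λ x → f x y)) ≡ ∏ ys (f x) * ∏ ys (λ y → ∏ xs (λ x → f x y))
    split [] = refl
    split (y ∷ ys) = trans (cong (f x y * ∏ xs (λ x → f x y) *_) (split ys)) (r (f x y) (∏ xs (λ x → f x y)) (∏ ys (f x)) _)
      where r : ∀ a b c d → a * b * (c * d) ≡ a * c * (b * d)
            r = ringℕ

  ∏-pos : (xs : List A) (f : A → ℕ) → (∀ x → x ∈ xs → 1 ≤ f x) → 1 ≤ ∏ xs f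
  ∏-pos [] f h = ≤-refl
  ∏-pos (x ∷ xs) f h = *-mono-≤ (h x (here refl)) (∏-pos xs f (λ y m → h y (there m)))

  ∑-⊑ : {T L : List A} → T ⊑ L → (f : A → ℕ) → ∑ T f ≤ ∑ L f
  ∑-⊑ nil f = z≤n
  ∑-⊑ (keep {x} p) f = +-monoʳ-≤ (f x) (∑-⊑ p f)
  ∑-⊑ (drop {x} p) f = ≤-trans (∑-⊑ p f) (m≤n+m _ (f x))

  length-⊑ : {T L : List A} → T ⊑ L → length T ≤ length L
  length-⊑ nil = z≤n
  length-⊑ (keep p) = s≤s (length-⊑ p)
  length-⊑ (drop p) = m≤n⇒m≤1+n (length-⊑ p)

-- Deleting one member of a list.

module _ {A : Set} where

  picks : List A → List (A × List A)
  picks [] = []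
  picks (x ∷ xs) = (x , xs) ∷ map (λ { (y , ys) → y , x ∷ ys }) (picks xs)

  data Pick : A → List A → List A → Set where
    hit : ∀ {x xs} → Pick x xs (x ∷ xs)
    skip : ∀ {x y ys xs} → Pick y ys xs → Pick y (x ∷ ys) (x ∷ xs)

  picks-Pick : ∀ xs {y ys} → (y , ys) ∈ picks xs → Pick y ys xs
  picks-Pick (x ∷ xs) (here refl) = hit
  picks-Pick (x ∷ xs) (there m) with MemP.∈-map⁻ _ m
  ... | (y , ys) , m' , refl = skip (picks-Pick xs m')

  Pick-∈ : ∀ {y ys xs} → Pick y ys xs → y ∈ xs
  Pick-∈ hit = here refl
  Pick-∈ (skip p) = there (Pick-∈ p)

  ∈-Pick : ∀ {y xs} → y ∈ xs → Σ (List A) λ ys → Pick y ys xs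
  ∈-Pick (here refl) = _ , hit
  ∈-Pick (there m) = let _ , p = ∈-Pick m in _ , skip p

  Pick-⊑ : ∀ {y ys xs} → Pick y ys xs → ys ⊑ xs
  Pick-⊑ hit = drop (⊑-refl _)
  Pick-⊑ (skip p) = keep (Pick-⊑ p)

  Pick-∑ : ∀ {y ys xs} → Pick y ys xs → (f : A → ℕ) → ∑ xs f ≡ f y + ∑ ys f
  Pick-∑ hit f = refl
  Pick-∑ (skip {x} {y} p) f = trans (cong (f x +_) (Pick-∑ p f)) (r (f x) (f y) _)
    where r : ∀ a b c → a + (b + c) ≡ b + (a + c)
          r = ringℕ

  Pick-∏ : ∀ {y ys xs} → Pick y ys xs → (f : A → ℕ) → ∏ xs f ≡ f y * ∏ ys f
  Pick-∏ hit f = refl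
  Pick-∏ (skip {x} {y} p) f = trans (cong (f x *_) (Pick-∏ p f)) (r (f x) (f y) _)
    where r : ∀ a b c → a * (b * c) ≡ b * (a * c)
          r = ringℕ

  Pick-length : ∀ {y ys xs} → Pick y ys xs → length xs ≡ suc (length ys)
  Pick-length hit = refl
  Pick-length (skip p) = cong suc (Pick-length p)

  length-picks : ∀ xs → length (picks xs) ≡ length xs
  length-picks [] = refl
  length-picks (x ∷ xs) = cong suc (trans (ListP.length-map _ (picks xs)) (length-picks xs))

  ∏-picks : ∀ xs (f : A → ℕ) → ∏ (picks xs) (λ z → f (proj₁ z)) ≡ ∏ xs f
  ∏-picks [] f = refl
  ∏-picks (x ∷ xs) f = cong (f x *_) (trans (go (picks xs)) (∏-picks xs f))
    where go : ∀ zs → ∏ (map (λ { (y , ys) → y , x ∷ ys }) zs) (λ z → f (proj₁ z)) ≡ ∏ zs (λ z → f (proj₁ z))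
          go [] = refl
          go (z ∷ zs) = cong (f (proj₁ z) *_) (go zs)

  -- Double counting: a set with a distinguished member is a smaller set together with an added one.
  -- On the right the added member may be any element of `V`, which only enlarges the sum.
  sublists-picks : ∀ V (g : A × List A → ℕ) → ∑ (sublists V) (λ S → ∑ (picks S) g) ≤ ∑ (sublists V) (λ S → ∑ V (λ σ → g (σ , S)))
  sublists-picks [] g = ≤-refl
  sublists-picks (x ∷ V) g = begin
    ∑ (map (x ∷_) SV ++ SV) (λ S → ∑ (picks S) g)
      ≡⟨ trans (∑-++ (map (x ∷_) SV) SV _) (cong (_+ ∑ SV (λ S → ∑ (picks S) g)) (∑-map (x ∷_) SV _)) ⟩
    ∑ SV (λ S → g (x , S) + ∑ (map (λ { (y , ys) → y , x ∷ ys }) (picks S)) g) + ∑ SV (λ S → ∑ (picks S) g)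
      ≡⟨ cong (_+ ∑ SV (λ S → ∑ (picks S) g)) (trans (∑-+ SV _ _) (cong (∑ SV (λ S → g (x , S)) +_) (∑-cong SV (λ S → ∑-map _ (picks S) g)))) ⟩
    ∑ SV (λ S → g (x , S)) + ∑ SV (λ S → ∑ (picks S) g') + ∑ SV (λ S → ∑ (picks S) g)
      ≤⟨ +-mono-≤ (+-monoʳ-≤ _ (sublists-picks V g')) (sublists-picks V g) ⟩
    ∑ SV (λ S → g (x , S)) + ∑ SV (λ S → ∑ V (λ σ → g (σ , x ∷ S))) + ∑ SV (λ S → ∑ V (λ σ → g (σ , S)))
      ≡⟨ r (∑ SV (λ S → g (x , S))) _ _ ⟩
    ∑ SV (λ S → ∑ V (λ σ → g (σ , x ∷ S))) + (∑ SV (λ S → g (x , S)) + ∑ SV (λ S → ∑ V (λ σ → g (σ , S))))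
      ≤⟨ +-monoˡ-≤ _ (∑-mono SV (λ S → m≤n+m _ (g (x , x ∷ S)))) ⟩
    ∑ SV (λ S → g (x , x ∷ S) + ∑ V (λ σ → g (σ , x ∷ S))) + (∑ SV (λ S → g (x , S)) + ∑ SV (λ S → ∑ V (λ σ → g (σ , S))))
      ≡⟨ cong₂ _+_ (sym (∑-map (x ∷_) SV _)) (sym (∑-+ SV _ _)) ⟩
    ∑ (map (x ∷_) SV) (λ S → ∑ (x ∷ V) (λ σ → g (σ , S))) + ∑ SV (λ S → ∑ (x ∷ V) (λ σ → g (σ , S)))
      ≡⟨ ∑-++ (map (x ∷_) SV) SV _ ⟨
    ∑ (map (x ∷_) SV ++ SV) (λ S → ∑ (x ∷ V) (λ σ → g (σ , S))) ∎
    where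
    open ≤-Reasoning
    SV = sublists V
    g' : A × List A → ℕ
    g' (y , ys) = g (y , x ∷ ys)
    r : ∀ a b c → a + b + c ≡ b + (a + c)
    r = ringℕ

-- Counting vertex sets by their internal degrees: a Caro–Wei type recursion,
-- with arithmetic–geometric means in place of a random ordering.

module Entropy {X : Set} (V : List X) (a : X → X → ℕ) (a≤1 : ∀ x y → a x y ≤ 1) (a-sym : ∀ x y → a x y ≡ a y x) (a-irr : ∀ x → a x x ≡ 0)
  (n e D : ℕ) (1≤n : 1 ≤ n) (1≤D : 1 ≤ D) (degV : ∀ x → x ∈ V → ∑ V (λ σ → a σ x) ≤ D * n) (V≤ : length V ≤ n ^ suc e) where

  private
    d = suc e
    Cn = 8 * D * n

  deg : List X → X → ℕ
  deg S σ = ∑ S (a σ)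

  Ψ : List X → ℕ
  Ψ S = ∏ S (λ τ → suc (deg S τ) ^ d)

  deg≤ : ∀ {S} → S ⊑ V → ∀ σ → σ ∈ V → deg S σ ≤ D * n
  deg≤ p σ m = ≤-trans (∑-⊑ p (a σ)) (≤-trans (≤-reflexive (∑-cong V (λ τ → a-sym σ τ))) (degV σ m))

  private
    -- The cost of adding σ to `S`, chosen so that both kinds of σ are affordable: about n^d choices
    -- have degree 0 and cost 1 each, while neighbours of `S` have total degree of order n times |S|
    -- and cost n^e per unit of degree.
    G : X × List X → ℕ
    G (σ , S) = Cn ^ d * ((deg S σ * n ^ e + 1) * Ψ S)

    module _ (S : List X) (S⊑ : S ⊑ V) where
      open ≤-Reasoning
      N = length S
      x : X → ℕ
      x = deg S
      sx : X → ℕ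
      sx τ = suc (x τ)
      c : X → ℕ
      c σ = Cn ^ d * (x σ * n ^ e + 1)
      H : X → ℕ
      H τ = ∏ S (λ σ → sx τ ∸ a τ σ)

      Pick-deg : ∀ {σ S'} → Pick σ S' S → ∀ τ → x τ ≡ a τ σ + deg S' τ
      Pick-deg p τ = Pick-∑ p (a τ)

      -- Deleting σ lowers the degree of each τ by `a τ σ`. The extra factor `sx σ ^ d` fills the
      -- gap at τ = σ, so that the product runs over all of `S` and can be exchanged with the
      -- product over σ.
      term : ∀ {σ S'} → Pick σ S' S → G (σ , S') * sx σ ^ d ≡ c σ * ∏ S (λ τ → (sx τ ∸ a τ σ) ^ d)
      term {σ} {S'} p = begin-equality
        Cn ^ d * ((deg S' σ * n ^ e + 1) * Ψ S') * sx σ ^ d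
          ≡⟨ cong (λ z → Cn ^ d * ((z * n ^ e + 1) * Ψ S') * sx σ ^ d) (sym (trans (Pick-deg p σ) (cong (_+ deg S' σ) (a-irr σ)))) ⟩
        Cn ^ d * ((x σ * n ^ e + 1) * Ψ S') * sx σ ^ d
          ≡⟨ r (Cn ^ d) (x σ * n ^ e + 1) (Ψ S') (sx σ ^ d) ⟩
        c σ * (sx σ ^ d * Ψ S')
          ≡⟨ cong (c σ *_) (cong₂ _*_ (cong (λ z → (sx σ ∸ z) ^ d) (sym (a-irr σ))) (∏-cong∈ S' (λ τ _ → cong (_^ d) (sym (step τ))))) ⟩
        c σ * ((sx σ ∸ a σ σ) ^ d * ∏ S' (λ τ → (sx τ ∸ a τ σ) ^ d))
          ≡⟨ cong (c σ *_) (Pick-∏ p (λ τ → (sx τ ∸ a τ σ) ^ d)) ⟨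
        c σ * ∏ S (λ τ → (sx τ ∸ a τ σ) ^ d) ∎
        where
        r : ∀ C y P s → C * (y * P) * s ≡ C * y * (s * P)
        r = ringℕ
        step : ∀ τ → sx τ ∸ a τ σ ≡ suc (deg S' τ)
        step τ = trans (cong (λ z → suc z ∸ a τ σ) (trans (Pick-deg p τ) (+-comm (a τ σ) _))) (m+n∸n≡m (suc (deg S' τ)) (a τ σ))

      -- Among the N factors of `H τ` exactly `x τ` equal `x τ`, one for each neighbour, and the
      -- others equal `x τ + 1`. By `suc^≤4` the neighbours therefore cost at most a factor 4
      -- altogether, whatever the degree is.
      H-eq : ∀ τ → H τ * sx τ ^ x τ ≡ x τ ^ x τ * sx τ ^ N
      H-eq τ = go S
        where
        y = x τ
        go : ∀ M → ∏ M (λ σ → suc y ∸ a τ σ) * suc y ^ ∑ M (a τ) ≡ y ^ ∑ M (a τ) * suc y ^ length M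
        go [] = refl
        go (σ ∷ M) with a τ σ | a≤1 τ σ
        ... | zero | _ = trans (*-assoc (suc y) (∏ M (λ σ → suc y ∸ a τ σ)) (suc y ^ ∑ M (a τ))) (trans (cong (suc y *_) (go M)) (r (suc y) (y ^ ∑ M (a τ)) (suc y ^ length M)))
          where r : ∀ s p q → s * (p * q) ≡ p * (s * q)
                r = ringℕ
        ... | suc zero | _ = trans (r1 y (∏ M (λ σ → suc y ∸ a τ σ)) (suc y) (suc y ^ ∑ M (a τ))) (trans (cong (y * suc y *_) (go M)) (r2 y (suc y) (y ^ ∑ M (a τ)) (suc y ^ length M)))
          where r1 : ∀ y p s q → y * p * (s * q) ≡ y * s * (p * q)
                r1 = ringℕ
                r2 : ∀ y s p q → y * s * (p * q) ≡ y * p * (s * q)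
                r2 = ringℕ
        ... | suc (suc _) | s≤s ()

      -- For y = 0 the summand 1 suffices. For y ≥ 1 one power of y is kept, and the remaining e
      -- powers are bounded through y ≤ D·n.
      point : ∀ y → y ≤ D * n → n ^ d * (4 * suc y) ^ d ≤ Cn ^ d * (y * n ^ e + 1)
      point zero _ = begin
        n ^ d * 4 ^ d ≡⟨ ^-* n 4 d ⟨
        (n * 4) ^ d ≤⟨ ^-monoˡ-≤ d (≤-trans (≤-reflexive (*-comm n 4)) (*-monoˡ-≤ n (≤-trans (m≤m+n 4 4) (m≤m*n 8 D {{>-nonZero 1≤D}})))) ⟩
        Cn ^ d ≡⟨ *-identityʳ _ ⟨
        Cn ^ d * 1 ∎
      point y@(suc y') le = begin
        n ^ d * (4 * suc y) ^ d ≤⟨ *-monoʳ-≤ (n ^ d) (^-monoˡ-≤ d (≤-trans (*-monoʳ-≤ 4 (s≤s (m≤n+m y y'))) (≤-reflexive (r0 y')))) ⟩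
        n ^ d * (8 * y) ^ d ≡⟨ r1 n (n ^ e) y ((8 * y) ^ e) ⟩
        8 * n * y * n ^ e * (8 * y) ^ e ≤⟨ *-mono-≤ (*-monoˡ-≤ (n ^ e) (*-monoˡ-≤ y (*-monoˡ-≤ n (m≤m*n 8 D {{>-nonZero 1≤D}})))) (^-monoˡ-≤ e (≤-trans (*-monoʳ-≤ 8 le) (≤-reflexive (sym (*-assoc 8 D n))))) ⟩
        Cn * y * n ^ e * Cn ^ e ≡⟨ r2 Cn y (n ^ e) (Cn ^ e) ⟩
        Cn ^ d * (y * n ^ e) ≤⟨ *-monoʳ-≤ (Cn ^ d) (m≤m+n _ 1) ⟩
        Cn ^ d * (y * n ^ e + 1) ∎
        where r0 : ∀ y' → 4 * suc (y' + suc y') ≡ 8 * suc y'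
              r0 = ringℕ
              r1 : ∀ n p y q → n * p * (8 * y * q) ≡ 8 * n * y * p * q
              r1 = ringℕ
              r2 : ∀ C y p q → C * y * p * q ≡ C * q * (y * p)
              r2 = ringℕ

      termwise : ∀ τ → τ ∈ S → n ^ d * (sx τ ^ d) ^ N * sx τ ^ d ≤ c τ * H τ ^ d
      termwise τ m = *-cancelʳ-≤ _ _ ((sx τ ^ x τ) ^ d) {{m^n≢0 (sx τ ^ x τ) d {{m^n≢0 (sx τ) (x τ)}}}} (begin
        n ^ d * (sx τ ^ d) ^ N * sx τ ^ d * (sx τ ^ x τ) ^ d
          ≤⟨ *-monoʳ-≤ (n ^ d * (sx τ ^ d) ^ N * sx τ ^ d) (^-monoˡ-≤ d (suc^≤4 (x τ))) ⟩
        n ^ d * (sx τ ^ d) ^ N * sx τ ^ d * (4 * x τ ^ x τ) ^ d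
          ≡⟨ cong (n ^ d * (sx τ ^ d) ^ N * sx τ ^ d *_) (^-* 4 (x τ ^ x τ) d) ⟩
        n ^ d * (sx τ ^ d) ^ N * sx τ ^ d * (4 ^ d * (x τ ^ x τ) ^ d)
          ≡⟨ r1 (n ^ d) ((sx τ ^ d) ^ N) (sx τ ^ d) (4 ^ d) ((x τ ^ x τ) ^ d) ⟩
        n ^ d * (4 ^ d * sx τ ^ d) * ((sx τ ^ d) ^ N * (x τ ^ x τ) ^ d)
          ≡⟨ cong (λ z → n ^ d * z * ((sx τ ^ d) ^ N * (x τ ^ x τ) ^ d)) (sym (^-* 4 (sx τ) d)) ⟩
        n ^ d * (4 * sx τ) ^ d * ((sx τ ^ d) ^ N * (x τ ^ x τ) ^ d)
          ≤⟨ *-monoˡ-≤ _ (point (x τ) (deg≤ S⊑ τ (⊑-∈ S⊑ m))) ⟩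
        c τ * ((sx τ ^ d) ^ N * (x τ ^ x τ) ^ d)
          ≡⟨ cong (c τ *_) (trans (*-comm ((sx τ ^ d) ^ N) ((x τ ^ x τ) ^ d)) (cong ((x τ ^ x τ) ^ d *_) (trans (^-*-assoc (sx τ) d N) (trans (cong (sx τ ^_) (*-comm d N)) (sym (^-*-assoc (sx τ) N d)))))) ⟩
        c τ * ((x τ ^ x τ) ^ d * (sx τ ^ N) ^ d)
          ≡⟨ cong (c τ *_) (^-* (x τ ^ x τ) (sx τ ^ N) d) ⟨
        c τ * (x τ ^ x τ * sx τ ^ N) ^ d
          ≡⟨ cong (λ z → c τ * z ^ d) (sym (H-eq τ)) ⟩
        c τ * (H τ * sx τ ^ x τ) ^ d
          ≡⟨ trans (cong (c τ *_) (^-* (H τ) (sx τ ^ x τ) d)) (sym (*-assoc (c τ) _ _)) ⟩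
        c τ * H τ ^ d * (sx τ ^ x τ) ^ d ∎)
        where r1 : ∀ n p s f q → n * p * s * (f * q) ≡ n * (f * s) * (p * q)
              r1 = ringℕ

      -- The geometric mean over the deleted member: after exchanging products, each τ collects the
      -- effect of all deletions in `H τ`, and `termwise` compares it with the N-th power of its own
      -- factor of `Ψ S`.
      prod≥ : (n ^ d * Ψ S) ^ length (picks S) ≤ ∏ (picks S) G
      prod≥ = subst (λ z → (n ^ d * Ψ S) ^ z ≤ ∏ (picks S) G) (sym (length-picks S))
        (*-cancelʳ-≤ _ _ (∏ S (λ τ → sx τ ^ d)) {{>-nonZero (∏-pos S _ (λ τ _ → m^n>0 (sx τ) d))}} (begin
        (n ^ d * Ψ S) ^ N * ∏ S (λ τ → sx τ ^ d)
          ≡⟨ cong (_* ∏ S (λ τ → sx τ ^ d)) (trans (^-* (n ^ d) (Ψ S) N) (cong₂ _*_ (sym (∏-const S (n ^ d))) (sym (∏-^ S (λ τ → sx τ ^ d) N)))) ⟩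
        ∏ S (λ _ → n ^ d) * ∏ S (λ τ → (sx τ ^ d) ^ N) * ∏ S (λ τ → sx τ ^ d)
          ≡⟨ trans (cong (_* ∏ S (λ τ → sx τ ^ d)) (sym (∏-* S _ _))) (sym (∏-* S _ _)) ⟩
        ∏ S (λ τ → n ^ d * (sx τ ^ d) ^ N * sx τ ^ d)
          ≤⟨ ∏-mono∈ S termwise ⟩
        ∏ S (λ τ → c τ * H τ ^ d)
          ≡⟨ ∏-* S c (λ τ → H τ ^ d) ⟩
        ∏ S c * ∏ S (λ τ → H τ ^ d)
          ≡⟨ cong (∏ S c *_) (trans (∏-cong∈ S (λ τ _ → sym (∏-^ S (λ σ → sx τ ∸ a τ σ) d))) (∏-swap S S (λ τ σ → (sx τ ∸ a τ σ) ^ d))) ⟩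
        ∏ S c * ∏ S (λ σ → ∏ S (λ τ → (sx τ ∸ a τ σ) ^ d))
          ≡⟨ ∏-* S c _ ⟨
        ∏ S (λ σ → c σ * ∏ S (λ τ → (sx τ ∸ a τ σ) ^ d))
          ≡⟨ ∏-picks S _ ⟨
        ∏ (picks S) (λ z → c (proj₁ z) * ∏ S (λ τ → (sx τ ∸ a τ (proj₁ z)) ^ d))
          ≡⟨ ∏-cong∈ (picks S) (λ z m → sym (term (picks-Pick S m))) ⟩
        ∏ (picks S) (λ z → G z * sx (proj₁ z) ^ d)
          ≡⟨ trans (∏-* (picks S) G _) (cong (∏ (picks S) G *_) (∏-picks S (λ σ → sx σ ^ d))) ⟩
        ∏ (picks S) G * ∏ S (λ τ → sx τ ^ d) ∎))

      recursion : N * (n ^ d * Ψ S) ≤ ∑ (picks S) G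
      recursion = subst (λ z → z * (n ^ d * Ψ S) ≤ ∑ (picks S) G) (length-picks S) (am-gm-common (picks S) G (n ^ d * Ψ S) prod≥)

    ext : ∀ S → S ⊑ V → ∑ V (λ σ → deg S σ * n ^ e + 1) ≤ suc (length S) * D * n ^ d
    ext S p = begin
      ∑ V (λ σ → deg S σ * n ^ e + 1) ≡⟨ ∑-+ V _ _ ⟩
      ∑ V (λ σ → deg S σ * n ^ e) + ∑ V (λ _ → 1) ≡⟨ cong₂ _+_ (trans (∑-cong V (λ σ → *-comm (deg S σ) (n ^ e))) (∑-* V (n ^ e) (deg S))) (trans (∑-const V 1) (*-identityʳ _)) ⟩
      n ^ e * ∑ V (deg S) + length V ≤⟨ +-mono-≤ (*-monoʳ-≤ (n ^ e) (≤-trans (≤-reflexive (∑-swap V S a)) (∑-≤-const S (D * n) (λ τ m → degV τ (⊑-∈ p m))))) V≤ ⟩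
      n ^ e * (length S * (D * n)) + n ^ d ≤⟨ +-monoʳ-≤ _ (≤-trans (≤-reflexive (sym (*-identityˡ (n ^ d)))) (*-monoˡ-≤ (n ^ d) 1≤D)) ⟩
      n ^ e * (length S * (D * n)) + D * n ^ d ≡⟨ r (n ^ e) (length S) D n ⟩
      suc (length S) * D * n ^ d ∎
      where
      open ≤-Reasoning
      r : ∀ p l D n → p * (l * (D * n)) + D * (n * p) ≡ suc l * D * (n * p)
      r = ringℕ

  m : ℕ
  m = D * Cn ^ d

  private
    is : ℕ → List X → ℕ
    is k S = bit (length S ≡ᵇ k)

    Sum : ℕ → ℕ
    Sum k = ∑ (sublists V) (λ S → is k S * Ψ S)

    is-mul : ∀ k S → is k S * length S ≡ is k S * k
    is-mul k S with length S ≡ᵇ k in eq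
    ... | true = cong (1 *_) (≡ᵇ⇒≡ (length S) k (subst BoolT (sym eq) tt))
      where BoolT = Data.Bool.T
    ... | false = refl

    -- The factor k + 1 for the choice of the deleted member cancels the factor |S| + 1 of `ext`. No
    -- factorial is lost, so the sum over sets of size k grows only geometrically.
    Sum-step : ∀ k → Sum (suc k) ≤ m * Sum k
    Sum-step k = *-cancelˡ-≤ (suc k * n ^ d) {{m*n≢0 (suc k) (n ^ d) {{_}} {{m^n≢0 n d {{>-nonZero 1≤n}}}}}} (begin
      suc k * n ^ d * Sum (suc k)
        ≡⟨ ∑-* (sublists V) (suc k * n ^ d) _ ⟨
      ∑ (sublists V) (λ S → suc k * n ^ d * (is (suc k) S * Ψ S))
        ≤⟨ ∑-mono∈ (sublists V) (λ S mem → begin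
            suc k * n ^ d * (is (suc k) S * Ψ S) ≡⟨ r1 (suc k) (n ^ d) (is (suc k) S) (Ψ S) ⟩
            is (suc k) S * suc k * (n ^ d * Ψ S) ≡⟨ cong (_* (n ^ d * Ψ S)) (sym (is-mul (suc k) S)) ⟩
            is (suc k) S * length S * (n ^ d * Ψ S) ≡⟨ *-assoc (is (suc k) S) _ _ ⟩
            is (suc k) S * (length S * (n ^ d * Ψ S)) ≤⟨ *-monoʳ-≤ (is (suc k) S) (recursion S (sublists-⊑ V S mem)) ⟩
            is (suc k) S * ∑ (picks S) G ≡⟨ ∑-* (picks S) (is (suc k) S) G ⟨
            ∑ (picks S) (λ z → is (suc k) S * G z) ≡⟨ ∑-cong∈ (picks S) (λ { (σ , S') mem → cong (λ l → bit (l ≡ᵇ suc k) * G (σ , S')) (Pick-length (picks-Pick S mem)) }) ⟩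
            ∑ (picks S) g ∎) ⟩
      ∑ (sublists V) (λ S → ∑ (picks S) g)
        ≤⟨ sublists-picks V g ⟩
      ∑ (sublists V) (λ S → ∑ V (λ σ → g (σ , S)))
        ≤⟨ ∑-mono∈ (sublists V) (λ S mem → begin
            ∑ V (λ σ → is k S * (Cn ^ d * ((deg S σ * n ^ e + 1) * Ψ S))) ≡⟨ ∑-cong V (λ σ → r2 (is k S) (Cn ^ d) (deg S σ * n ^ e + 1) (Ψ S)) ⟩
            ∑ V (λ σ → is k S * Cn ^ d * Ψ S * (deg S σ * n ^ e + 1)) ≡⟨ ∑-* V (is k S * Cn ^ d * Ψ S) _ ⟩
            is k S * Cn ^ d * Ψ S * ∑ V (λ σ → deg S σ * n ^ e + 1) ≤⟨ *-monoʳ-≤ (is k S * Cn ^ d * Ψ S) (ext S (sublists-⊑ V S mem)) ⟩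
            is k S * Cn ^ d * Ψ S * (suc (length S) * D * n ^ d) ≡⟨ r3 (is k S) (Cn ^ d) (Ψ S) (length S) D (n ^ d) ⟩
            (is k S * length S + is k S) * (Cn ^ d * Ψ S * D * n ^ d) ≡⟨ cong (λ z → (z + is k S) * (Cn ^ d * Ψ S * D * n ^ d)) (is-mul k S) ⟩
            (is k S * k + is k S) * (Cn ^ d * Ψ S * D * n ^ d) ≡⟨ r4 (is k S) k (Cn ^ d) (Ψ S) D (n ^ d) ⟩
            suc k * n ^ d * m * (is k S * Ψ S) ∎) ⟩
      ∑ (sublists V) (λ S → suc k * n ^ d * m * (is k S * Ψ S))
        ≡⟨ ∑-* (sublists V) (suc k * n ^ d * m) _ ⟩
      suc k * n ^ d * m * Sum k
        ≡⟨ *-assoc (suc k * n ^ d) m (Sum k) ⟩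
      suc k * n ^ d * (m * Sum k) ∎)
      where
      open ≤-Reasoning
      g : X × List X → ℕ
      g (σ , S) = is k S * G (σ , S)
      r1 : ∀ k p i f → k * p * (i * f) ≡ i * k * (p * f)
      r1 = ringℕ
      r2 : ∀ i C x f → i * (C * (x * f)) ≡ i * C * f * x
      r2 = ringℕ
      r3 : ∀ i C f l D p → i * C * f * (suc l * D * p) ≡ (i * l + i) * (C * f * D * p)
      r3 = ringℕ
      r4 : ∀ i k C f D p → (i * k + i) * (C * f * D * p) ≡ suc k * p * (D * C) * (i * f)
      r4 = ringℕ

    Sum-0 : Sum 0 ≤ 1
    Sum-0 = go V
      where
      go : ∀ W → ∑ (sublists W) (λ S → is 0 S * Ψ S) ≤ 1
      go [] = ≤-refl
      go (w ∷ W) = ≤-trans (≤-reflexive (trans (∑-++ (map (w ∷_) (sublists W)) (sublists W) _) (cong (_+ ∑ (sublists W) (λ S → is 0 S * Ψ S)) (trans (∑-map (w ∷_) (sublists W) _) (∑-0 (sublists W)))))) (go W)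

    Sum≤ : ∀ k → Sum k ≤ m ^ k
    Sum≤ zero = Sum-0
    Sum≤ (suc k) = ≤-trans (Sum-step k) (*-monoʳ-≤ m (Sum≤ k))

    sumTo : ℕ → (ℕ → ℕ) → ℕ
    sumTo zero f = f 0
    sumTo (suc k) f = sumTo k f + f (suc k)

    sumTo-mono : ∀ k {f g} → (∀ i → f i ≤ g i) → sumTo k f ≤ sumTo k g
    sumTo-mono zero h = h 0
    sumTo-mono (suc k) h = +-mono-≤ (sumTo-mono k h) (h (suc k))

    ∑-sumTo : ∀ k (Ss : List (List X)) (f : ℕ → List X → ℕ) → ∑ Ss (λ S → sumTo k (λ i → f i S)) ≡ sumTo k (λ i → ∑ Ss (f i))
    ∑-sumTo zero Ss f = refl
    ∑-sumTo (suc k) Ss f = trans (∑-+ Ss _ _) (cong (_+ ∑ Ss (f (suc k))) (∑-sumTo k Ss f))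

    at : ∀ k l (h : ℕ → ℕ) → l ≤ k → h l ≤ sumTo k (λ i → bit (l ≡ᵇ i) * h i)
    at zero .zero h z≤n = ≤-reflexive (sym (+-identityʳ _))
    at (suc k) l h le with m≤n⇒m<n∨m≡n le
    ... | inj₁ (s≤s lt) = ≤-trans (at k l h lt) (m≤m+n _ _)
    ... | inj₂ refl = ≤-trans (≤-reflexive (sym (trans (cong (λ b → bit b * h (suc k)) (same k)) (+-identityʳ _)))) (m≤n+m _ (sumTo k (λ i → bit (suc k ≡ᵇ i) * h i)))
      where same : ∀ k → (k ≡ᵇ k) ≡ true
            same zero = refl
            same (suc k) = same k

  -- The sum of `Ψ S` / (2m)^|S| is at most 2, multiplied by the common denominator. Size k
  -- contributes at most m^k before weighting, so the 2 in the base makes the sum over sizes a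
  -- geometric series.
  entropy : ∑ (sublists V) (λ S → Ψ S * (2 * m) ^ (length V ∸ length S)) ≤ 2 * (2 * m) ^ length V
  entropy = begin
    ∑ (sublists V) (λ S → Ψ S * M ^ (ℓ ∸ length S))
      ≤⟨ ∑-mono∈ (sublists V) (λ S mem → at ℓ (length S) (λ i → Ψ S * M ^ (ℓ ∸ i)) (length-⊑ (sublists-⊑ V S mem))) ⟩
    ∑ (sublists V) (λ S → sumTo ℓ (λ i → is i S * (Ψ S * M ^ (ℓ ∸ i))))
      ≡⟨ ∑-sumTo ℓ (sublists V) (λ i S → is i S * (Ψ S * M ^ (ℓ ∸ i))) ⟩
    sumTo ℓ (λ i → ∑ (sublists V) (λ S → is i S * (Ψ S * M ^ (ℓ ∸ i))))
      ≤⟨ sumTo-mono ℓ (λ i → ≤-trans (≤-reflexive (trans (∑-cong (sublists V) (λ S → r (is i S) (Ψ S) (M ^ (ℓ ∸ i)))) (∑-* (sublists V) (M ^ (ℓ ∸ i)) _))) (*-monoʳ-≤ (M ^ (ℓ ∸ i)) (Sum≤ i))) ⟩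
    sumTo ℓ t
      ≤⟨ ≤-trans (m≤m+n _ (t ℓ)) (geo ℓ ≤-refl) ⟩
    2 * M ^ ℓ ∎
    where
    open ≤-Reasoning
    M = 2 * m
    ℓ = length V
    t : ℕ → ℕ
    t i = M ^ (ℓ ∸ i) * m ^ i
    r : ∀ i p q → i * (p * q) ≡ q * (i * p)
    r = ringℕ
    geo : ∀ j → j ≤ ℓ → sumTo j t + t j ≤ 2 * M ^ ℓ
    geo zero _ = ≤-reflexive (r0 (M ^ ℓ))
      where r0 : ∀ x → x * 1 + x * 1 ≡ 2 * x
            r0 = ringℕ
    geo (suc j) lt = begin
      sumTo j t + t (suc j) + t (suc j) ≡⟨ +-assoc (sumTo j t) _ _ ⟩
      sumTo j t + (t (suc j) + t (suc j)) ≡⟨ cong (sumTo j t +_) tt' ⟩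
      sumTo j t + t j ≤⟨ geo j (<⇒≤ lt) ⟩
      2 * M ^ ℓ ∎
      where
      tt' : t (suc j) + t (suc j) ≡ t j
      tt' = trans (r1 (M ^ (ℓ ∸ suc j)) m (m ^ j)) (cong (λ z → M ^ z * m ^ j) (sym (+-∸-assoc 1 lt)))
        where r1 : ∀ p m q → p * (m * q) + p * (m * q) ≡ 2 * m * p * q
              r1 = ringℕ

-- Counting faces

subᵇ-> : ∀ {n} (σ τ : Subset n) → ∣ τ ∣ < ∣ σ ∣ → subᵇ σ τ ≡ false
subᵇ-> σ τ lt with subᵇ σ τ in eq
... | false = refl
... | true = ⊥-elim (<-irrefl refl (<-≤-trans lt (subᵇ-size σ τ eq)))

subᵇ-refl : ∀ {n} (σ : Subset n) → subᵇ σ σ ≡ true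
subᵇ-refl [] = refl
subᵇ-refl (true ∷ σ) = subᵇ-refl σ
subᵇ-refl (false ∷ σ) = subᵇ-refl σ

subᵇ-≡ : ∀ {n} (σ τ : Subset n) → subᵇ σ τ ≡ true → ∣ σ ∣ ≡ ∣ τ ∣ → σ ≡ τ
subᵇ-≡ [] [] _ _ = refl
subᵇ-≡ (true ∷ σ) (true ∷ τ) p e = cong (true ∷_) (subᵇ-≡ σ τ p (suc-injective e))
subᵇ-≡ (false ∷ σ) (true ∷ τ) p e = ⊥-elim (1+n≰n (≤-trans (≤-reflexive (sym e)) (subᵇ-size σ τ p)))
subᵇ-≡ (false ∷ σ) (false ∷ τ) p e = cong (false ∷_) (subᵇ-≡ σ τ p e)

subᵇ-trans : ∀ {n} (ρ σ τ : Subset n) → subᵇ ρ σ ≡ true → subᵇ σ τ ≡ true → subᵇ ρ τ ≡ true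
subᵇ-trans [] [] [] _ _ = refl
subᵇ-trans (true ∷ ρ) (true ∷ σ) (true ∷ τ) p q = subᵇ-trans ρ σ τ p q
subᵇ-trans (false ∷ ρ) (true ∷ σ) (true ∷ τ) p q = subᵇ-trans ρ σ τ p q
subᵇ-trans (false ∷ ρ) (false ∷ σ) (_ ∷ τ) p q = subᵇ-trans ρ σ τ p q

∑-*1 : {A : Set} (xs : List A) (f : A → ℕ) → ∑ xs f ≡ ∑ xs (λ x → f x * 1)
∑-*1 xs f = ∑-cong xs (λ x → sym (*-identityʳ (f x)))

∑-zero : {A : Set} (xs : List A) {f : A → ℕ} → (∀ x → x ∈ xs → f x ≡ 0) → ∑ xs f ≡ 0
∑-zero xs h = trans (∑-cong∈ xs h) (∑-0 xs)

∑-lv : ∀ {n} s (f : Subset (suc n) → ℕ) → ∑ (lv (suc n) (suc s)) f ≡ ∑ (lv n s) (f ᵗ) + ∑ (lv n (suc s)) (f ᶠ)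
∑-lv {n} s f = trans (∑-++ (map (true ∷_) (lv n s)) _ f) (cong₂ _+_ (∑-map (true ∷_) (lv n s) f) (∑-map (false ∷_) (lv n (suc s)) f))

∑-lv0 : ∀ {n} (f : Subset (suc n) → ℕ) → ∑ (lv (suc n) 0) f ≡ ∑ (lv n 0) (f ᶠ)
∑-lv0 {n} f = ∑-map (false ∷_) (lv n 0) f

at-up : ∀ {n} (σ : Subset n) s → ∣ σ ∣ ≡ s → (g : Subset n → ℕ) → ∑ (lv n s) (λ η → bit (subᵇ σ η) * g η) ≡ g σ
at-up [] .0 refl g = trans (+-identityʳ _) (+-identityʳ _)
at-up {suc n} (true ∷ σ) (suc s) e g = trans (∑-lv {n} s _) (trans (cong₂ _+_ (at-up σ s (suc-injective e) (g ᵗ)) (∑-0 (lv n (suc s)))) (+-identityʳ _))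
at-up {suc n} (false ∷ σ) zero e g = trans (∑-lv0 {n} _) (at-up σ zero e (g ᶠ))
at-up {suc n} (false ∷ σ) (suc s) e g = trans (∑-lv {n} s _) (cong₂ _+_
  (∑-zero (lv n s) (λ η m → cong (λ b → bit b * g (true ∷ η)) (subᵇ-> σ η (≤-reflexive (trans (cong suc (lv-size n s m)) (sym e))))))
  (at-up σ (suc s) e (g ᶠ)))

at-down : ∀ {n} (τ : Subset n) s → ∣ τ ∣ ≡ s → (g : Subset n → ℕ) → ∑ (lv n s) (λ σ → bit (subᵇ σ τ) * g σ) ≡ g τ
at-down [] .0 refl g = trans (+-identityʳ _) (+-identityʳ _)
at-down {suc n} (true ∷ τ) (suc s) e g = trans (∑-lv {n} s _) (trans (cong₂ _+_ (at-down τ s (suc-injective e) (g ᵗ))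
  (∑-zero (lv n (suc s)) (λ σ m → cong (λ b → bit b * g (false ∷ σ)) (subᵇ-> σ τ (≤-reflexive (trans e (sym (lv-size n (suc s) m)))))))) (+-identityʳ _))
at-down {suc n} (false ∷ τ) zero e g = trans (∑-lv0 {n} _) (at-down τ zero e (g ᶠ))
at-down {suc n} (false ∷ τ) (suc s) e g = trans (∑-lv {n} s _) (cong₂ _+_ (∑-0 (lv n s)) (at-down τ (suc s) e (g ᶠ)))

vs : ∀ n → List (Fin n)
vs zero = []
vs (suc n) = Fin.zero ∷ map Fin.suc (vs n)

length-vs : ∀ n → length (vs n) ≡ n
length-vs zero = refl
length-vs (suc n) = cong suc (trans (ListP.length-map _ (vs n)) (length-vs n))

ins : ∀ {n} → Fin n → Subset n → Subset n
ins Fin.zero (_ ∷ σ) = true ∷ σ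
ins (Fin.suc v) (b ∷ σ) = b ∷ ins v σ

-- The cofaces of σ are obtained by inserting the vertices outside σ, once each.
up-sum : ∀ {n} (σ : Subset n) s → ∣ σ ∣ ≡ s → (X : Subset n → ℕ) →
  ∑ (vs n) (λ v → bit (not (lookup σ v)) * X (ins v σ)) ≡ ∑ (lv n (suc s)) (λ η → bit (subᵇ σ η) * X η)
up-sum [] .0 refl X = refl
up-sum {suc n} (false ∷ σ) s e X = trans (cong₂ _+_ (trans (+-identityʳ _) (sym (at-up σ s e (X ᵗ)))) (trans (∑-map Fin.suc (vs n) _) (up-sum σ s e (X ᶠ)))) (sym (∑-lv {n} s _))
up-sum {suc n} (true ∷ σ) (suc s) e X = trans (trans (∑-map Fin.suc (vs n) _) (up-sum σ s (suc-injective e) (X ᵗ)))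
  (sym (trans (∑-lv {n} (suc s) _) (trans (cong (∑ (lv n (suc s)) (λ η → bit (subᵇ σ η) * X (true ∷ η)) +_) (∑-0 (lv n (suc (suc s))))) (+-identityʳ _))))

cofaces≤ : ∀ {n} (σ : Subset n) s → ∣ σ ∣ ≡ s → ∑ (lv n (suc s)) (λ η → bit (subᵇ σ η)) ≤ n
cofaces≤ {n} σ s e = begin
  ∑ (lv n (suc s)) (λ η → bit (subᵇ σ η)) ≡⟨ ∑-*1 (lv n (suc s)) _ ⟩
  ∑ (lv n (suc s)) (λ η → bit (subᵇ σ η) * 1) ≡⟨ up-sum σ s e (λ _ → 1) ⟨
  ∑ (vs n) (λ v → bit (not (lookup σ v)) * 1) ≤⟨ ∑-≤-const (vs n) 1 (λ v _ → ≤-trans (≤-reflexive (*-identityʳ _)) (bit≤1 (not (lookup σ v)))) ⟩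
  length (vs n) * 1 ≡⟨ trans (*-identityʳ _) (length-vs n) ⟩
  n ∎
  where open ≤-Reasoning

facets≤ : ∀ {n} (τ : Subset n) s → ∣ τ ∣ ≡ suc s → ∑ (lv n s) (λ σ → bit (subᵇ σ τ)) ≤ suc s
facets≤ {suc n} (true ∷ τ) zero e = ≤-reflexive (trans (∑-lv0 {n} _) (trans (∑-*1 (lv n 0) _) (at-down τ 0 (suc-injective e) (λ _ → 1))))
facets≤ {suc n} (true ∷ τ) (suc s) e = ≤-trans (≤-reflexive (∑-lv {n} s _)) (≤-trans (+-mono-≤ (facets≤ τ s (suc-injective e))
  (≤-reflexive (trans (∑-*1 (lv n (suc s)) _) (at-down τ (suc s) (suc-injective e) (λ _ → 1))))) (≤-reflexive (+-comm (suc s) 1)))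
facets≤ {suc n} (false ∷ τ) zero e = ≤-trans (≤-reflexive (∑-lv0 {n} _)) (facets≤ τ zero e)
facets≤ {suc n} (false ∷ τ) (suc s) e = ≤-trans (≤-reflexive (trans (∑-lv {n} s _) (cong (_+ ∑ (lv n (suc s)) (λ σ → bit (subᵇ σ τ))) (∑-0 (lv n s))))) (facets≤ τ (suc s) e)

cofaces-C : ∀ {n} (σ : Subset n) s j → ∣ σ ∣ ≡ s → ∑ (lv n (s + j)) (λ η → bit (subᵇ σ η)) ≡ (n ∸ s) C j
cofaces-C [] .0 zero refl = refl
cofaces-C [] .0 (suc j) refl = refl
cofaces-C {suc n} (true ∷ σ) (suc s) j e = trans (∑-lv {n} (s + j) _) (trans (cong₂ _+_ (cofaces-C σ s j (suc-injective e)) (∑-0 (lv n (suc (s + j))))) (+-identityʳ _))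
cofaces-C {suc n} (false ∷ σ) s zero e = trans (trans (cong (λ z → ∑ (lv (suc n) z) (λ η → bit (subᵇ (false ∷ σ) η))) (+-identityʳ s)) (trans (∑-cong (lv (suc n) s) (λ η → sym (*-identityʳ _))) (at-up (false ∷ σ) s e (λ _ → 1)))) refl
cofaces-C {suc n} (false ∷ σ) s (suc j) e = begin-equality
  ∑ (lv (suc n) (s + suc j)) (λ η → bit (subᵇ (false ∷ σ) η)) ≡⟨ cong (λ z → ∑ (lv (suc n) z) (λ η → bit (subᵇ (false ∷ σ) η))) (+-suc s j) ⟩
  ∑ (lv (suc n) (suc (s + j))) (λ η → bit (subᵇ (false ∷ σ) η)) ≡⟨ ∑-lv {n} (s + j) _ ⟩
  ∑ (lv n (s + j)) (λ η → bit (subᵇ σ η)) + ∑ (lv n (suc (s + j))) (λ η → bit (subᵇ σ η))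
    ≡⟨ cong₂ _+_ (cofaces-C σ s j e) (trans (cong (λ z → ∑ (lv n z) (λ η → bit (subᵇ σ η))) (sym (+-suc s j))) (cofaces-C σ s (suc j) e)) ⟩
  (n ∸ s) C j + (n ∸ s) C suc j ≡⟨ nCk+nC[k+1]≡[n+1]C[k+1] (n ∸ s) j ⟩
  suc (n ∸ s) C suc j ≡⟨ cong (_C suc j) (sym (+-∸-assoc 1 (subst (_≤ n) e (∣∣≤n σ)))) ⟩
  (suc n ∸ s) C suc j ∎
  where open ≤-Reasoning

C≤^ : ∀ t j → t C j ≤ t ^ j
C≤^ t zero = ≤-refl
C≤^ zero (suc j) = z≤n
C≤^ (suc t) (suc j) = begin
  suc t C suc j ≡⟨ nCk+nC[k+1]≡[n+1]C[k+1] t j ⟨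
  t C j + t C suc j ≤⟨ +-mono-≤ (C≤^ t j) (C≤^ t (suc j)) ⟩
  suc t * t ^ j ≤⟨ *-monoʳ-≤ (suc t) (^-monoˡ-≤ j (n≤1+n t)) ⟩
  suc t ^ suc j ∎
  where open ≤-Reasoning

^≤C : ∀ t j → (t ∸ j) ^ j ≤ j ! * (t C j)
^≤C t zero = ≤-refl
^≤C zero (suc j) = z≤n
^≤C (suc t) (suc j) = begin
  (t ∸ j) ^ suc j ≤⟨ diff (t ∸ j) ⟩
  suc j * (t ∸ j) ^ j + (t ∸ j ∸ 1) ^ suc j ≡⟨ cong (λ z → suc j * (t ∸ j) ^ j + z ^ suc j) (trans (∸-+-assoc t j 1) (cong (t ∸_) (+-comm j 1))) ⟩
  suc j * (t ∸ j) ^ j + (t ∸ suc j) ^ suc j ≤⟨ +-mono-≤ (*-monoʳ-≤ (suc j) (^≤C t j)) (^≤C t (suc j)) ⟩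
  suc j * (j ! * (t C j)) + suc j * j ! * (t C suc j) ≡⟨ r (suc j) (j !) (t C j) (t C suc j) ⟩
  suc j * j ! * (t C j + t C suc j) ≡⟨ cong (suc j * j ! *_) (nCk+nC[k+1]≡[n+1]C[k+1] t j) ⟩
  suc j * j ! * (suc t C suc j) ∎
  where
  open ≤-Reasoning
  r : ∀ s f a b → s * (f * a) + s * f * b ≡ s * f * (a + b)
  r = ringℕ
  diff : ∀ y → y ^ suc j ≤ suc j * y ^ j + (y ∸ 1) ^ suc j
  diff zero = z≤n
  diff (suc y) = *-cancelʳ-≤ _ _ (suc y) (begin
    suc y ^ suc j * suc y ≤⟨ one-minus y (suc j) ⟩
    y ^ suc j * suc y + suc j * (suc y * suc y ^ j) ≡⟨ r2 (y ^ suc j) (suc y) (suc j) (suc y ^ j) ⟩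
    (suc j * suc y ^ j + y ^ suc j) * suc y ∎)
    where r2 : ∀ p s j q → p * s + j * (s * q) ≡ (j * q + p) * s
          r2 = ringℕ

pair-cofaces≤1 : ∀ {n} (σ σ' : Subset n) s → ∣ σ ∣ ≡ s → ∣ σ' ∣ ≡ s → σ ≢ σ' → ∑ (lv n (suc s)) (λ τ → bit (subᵇ σ τ) * bit (subᵇ σ' τ)) ≤ 1
pair-cofaces≤1 [] [] s e e' ne = ⊥-elim (ne refl)
pair-cofaces≤1 {suc n} (true ∷ σ) (true ∷ σ') (suc s) e e' ne = ≤-trans (≤-reflexive (trans (∑-lv {n} (suc s) _) (trans (cong (∑ (lv n (suc s)) _ +_) (∑-0 (lv n (suc (suc s))))) (+-identityʳ _))))
  (pair-cofaces≤1 σ σ' s (suc-injective e) (suc-injective e') (ne ∘ cong (true ∷_)))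
pair-cofaces≤1 {suc n} (true ∷ σ) (false ∷ σ') s e e' ne = ≤-trans (≤-reflexive (trans (∑-lv {n} s _) (trans (cong₂ _+_
    (trans (∑-cong (lv n s) (λ τ → *-comm (bit (subᵇ σ τ)) _)) (at-up σ' s e' (λ τ → bit (subᵇ σ τ)))) (∑-0 (lv n (suc s)))) (+-identityʳ _)))) (bit≤1 (subᵇ σ σ'))
pair-cofaces≤1 {suc n} (false ∷ σ) (true ∷ σ') s e e' ne = ≤-trans (≤-reflexive (trans (∑-lv {n} s _) (trans (cong₂ _+_
    (at-up σ s e (λ τ → bit (subᵇ σ' τ))) (∑-zero (lv n (suc s)) (λ τ _ → *-zeroʳ (bit (subᵇ σ τ))))) (+-identityʳ _)))) (bit≤1 (subᵇ σ' σ))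
pair-cofaces≤1 {suc n} (false ∷ σ) (false ∷ σ') s e e' ne = ≤-trans (≤-reflexive (trans (∑-lv {n} s _) (cong (_+ ∑ (lv n (suc s)) (λ τ → bit (subᵇ σ τ) * bit (subᵇ σ' τ)))
    (trans (at-up σ s e (λ τ → bit (subᵇ σ' τ))) z)))) (pair-cofaces≤1 σ σ' s e e' (ne ∘ cong (false ∷_)))
  where
  z : bit (subᵇ σ' σ) ≡ 0
  z with subᵇ σ' σ in eq
  ... | false = refl
  ... | true = ⊥-elim (ne (cong (false ∷_) (sym (subᵇ-≡ σ' σ eq (trans e' (sym e))))))

-- Cochains over F₂ as Boolean functions

cob₂ : ∀ {n} → (Subset n → Bool) → Subset n → Bool
cob₂ f [] = false
cob₂ f (true ∷ τ) = f (false ∷ τ) xor cob₂ (f ᵗ) τ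
cob₂ f (false ∷ τ) = cob₂ (f ᶠ) τ

cob₂-xor : ∀ {n} (f g : Subset n → Bool) τ → cob₂ (λ σ → f σ xor g σ) τ ≡ cob₂ f τ xor cob₂ g τ
cob₂-xor f g [] = refl
cob₂-xor f g (true ∷ τ) = trans (cong ((f (false ∷ τ) xor g (false ∷ τ)) xor_) (cob₂-xor (f ᵗ) (g ᵗ) τ)) (r (f (false ∷ τ)) (g (false ∷ τ)) (cob₂ (f ᵗ) τ) (cob₂ (g ᵗ) τ))
  where r : ∀ a b c d → (a xor b) xor (c xor d) ≡ (a xor c) xor (b xor d)
        r true true true true = refl
        r true true true false = refl
        r true true false true = refl
        r true true false false = refl
        r true false true true = refl
        r true false true false = refl
        r true false false true = refl
        r true false false false = refl
        r false true true true = refl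
        r false true true false = refl
        r false true false true = refl
        r false true false false = refl
        r false false c d = refl
cob₂-xor f g (false ∷ τ) = cob₂-xor (f ᶠ) (g ᶠ) τ

cob₂-cong : ∀ {n} {f g : Subset n → Bool} → (∀ σ → f σ ≡ g σ) → ∀ τ → cob₂ f τ ≡ cob₂ g τ
cob₂-cong h [] = refl
cob₂-cong h (true ∷ τ) = cong₂ _xor_ (h (false ∷ τ)) (cob₂-cong (λ σ → h (true ∷ σ)) τ)
cob₂-cong h (false ∷ τ) = cob₂-cong (λ σ → h (false ∷ σ)) τ

cob₂-cob₂ : ∀ {n} (f : Subset n → Bool) τ → cob₂ (cob₂ f) τ ≡ false
cob₂-cob₂ f [] = refl
cob₂-cob₂ f (true ∷ τ) = trans (cong (cob₂ (f ᶠ) τ xor_) (trans (cob₂-xor (f ᶠ) (cob₂ (f ᵗ)) τ) (cong (cob₂ (f ᶠ) τ xor_) (cob₂-cob₂ (f ᵗ) τ)))) (r (cob₂ (f ᶠ) τ))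
  where r : ∀ a → a xor (a xor false) ≡ false
        r true = refl
        r false = refl
cob₂-cob₂ f (false ∷ τ) = cob₂-cob₂ (f ᶠ) τ

cob₂-empty : ∀ {n} (f : Subset n → Bool) τ → ∣ τ ∣ ≡ 0 → cob₂ f τ ≡ false
cob₂-empty f [] e = refl
cob₂-empty f (false ∷ τ) e = cob₂-empty (f ᶠ) τ e

-- Contraction with the vertex v, the dual of coning from v.
ι : ∀ {n} → Fin n → (Subset n → Bool) → Subset n → Bool
ι v f σ = not (lookup σ v) ∧ f (ins v σ)

-- The cone homotopy over F₂: modulo coboundaries f is the contraction of its own coboundary, so a
-- small coboundary produces a small representative of the coset.
homotopy : ∀ {n} (v : Fin n) (f : Subset n → Bool) σ → f σ xor cob₂ (ι v f) σ ≡ ι v (cob₂ f) σ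
homotopy Fin.zero f (true ∷ σ) = trans (cong (λ z → f (true ∷ σ) xor (f (true ∷ σ) xor z)) (cob₂-0 σ)) (r (f (true ∷ σ)))
  where r : ∀ a → a xor (a xor false) ≡ false
        r true = refl
        r false = refl
        cob₂-0 : ∀ {n} (σ : Subset n) → cob₂ (λ _ → false) σ ≡ false
        cob₂-0 [] = refl
        cob₂-0 (true ∷ σ) = cob₂-0 σ
        cob₂-0 (false ∷ σ) = cob₂-0 σ
homotopy Fin.zero f (false ∷ σ) = refl
homotopy (Fin.suc v) f (true ∷ σ) = trans (r (f (true ∷ σ)) (ι v (f ᶠ) σ) (cob₂ (ι v (f ᵗ)) σ)) (trans (cong (ι v (f ᶠ) σ xor_) (homotopy v (f ᵗ) σ)) (r2 (not (lookup σ v)) (f (false ∷ ins v σ)) (cob₂ (f ᵗ) (ins v σ))))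
  where r : ∀ a b c → a xor (b xor c) ≡ b xor (a xor c)
        r true true c = refl
        r true false c = refl
        r false b c = refl
        r2 : ∀ p a b → (p ∧ a) xor (p ∧ b) ≡ p ∧ (a xor b)
        r2 true a b = refl
        r2 false a b = refl
homotopy (Fin.suc v) f (false ∷ σ) = homotopy v (f ᶠ) σ

oddB-+ : ∀ a b → oddB (a + b) ≡ oddB a xor oddB b
oddB-+ zero b = refl
oddB-+ (suc a) b = trans (oddB-suc (a + b)) (trans (cong not (oddB-+ a b)) (trans (r (oddB a) (oddB b)) (cong (_xor oddB b) (sym (oddB-suc a)))))
  where r : ∀ x y → not (x xor y) ≡ not x xor y
        r true true = refl
        r true false = refl
        r false y = refl

oddB-bit : ∀ b → oddB (bit b) ≡ b
oddB-bit true = refl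
oddB-bit false = refl

odd-cob₂ : ∀ {n} (f : Subset n → Bool) s τ → ∣ τ ∣ ≡ suc s → oddB (∑ (lv n s) (λ σ → bit (subᵇ σ τ) * bit (f σ))) ≡ cob₂ f τ
odd-cob₂ {suc n} f zero (true ∷ τ) e = trans (cong oddB (trans (∑-lv0 {n} _) (at-down τ 0 (suc-injective e) (λ σ → bit (f (false ∷ σ))))))
  (trans (oddB-bit (f (false ∷ τ))) (sym (trans (cong (f (false ∷ τ) xor_) (cob₂-empty (f ᵗ) τ (suc-injective e))) (BoolP.xor-identityʳ _))))
odd-cob₂ {suc n} f (suc s) (true ∷ τ) e = trans (cong oddB (trans (∑-lv {n} s _) (+-comm (∑ (lv n s) _) _)))
  (trans (oddB-+ (∑ (lv n (suc s)) (λ σ → bit (subᵇ σ τ) * bit (f (false ∷ σ)))) _)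
  (cong₂ _xor_ (trans (cong oddB (at-down τ (suc s) (suc-injective e) (λ σ → bit (f (false ∷ σ))))) (oddB-bit (f (false ∷ τ)))) (odd-cob₂ (f ᵗ) s τ (suc-injective e))))
odd-cob₂ {suc n} f zero (false ∷ τ) e = trans (cong oddB (∑-lv0 {n} _)) (odd-cob₂ (f ᶠ) zero τ e)
odd-cob₂ {suc n} f (suc s) (false ∷ τ) e = trans (cong oddB (trans (∑-lv {n} s _) (cong (_+ ∑ (lv n (suc s)) (λ σ → bit (subᵇ σ τ) * bit (f (false ∷ σ)))) (∑-0 (lv n s))))) (odd-cob₂ (f ᶠ) (suc s) τ e)

cob₂-level : ∀ {n} {f g : Subset n → Bool} s → (∀ σ → ∣ σ ∣ ≡ s → f σ ≡ g σ) → ∀ τ → ∣ τ ∣ ≡ suc s → cob₂ f τ ≡ cob₂ g τ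
cob₂-level {n} {f} {g} s h τ e = trans (sym (odd-cob₂ f s τ e)) (trans (cong oddB (∑-cong∈ (lv n s) (λ σ m → cong (λ b → bit (subᵇ σ τ) * bit b) (h σ (lv-size n s m))))) (odd-cob₂ g s τ e))

-- Used to average the cone bound over all v. Each η in `X` appears once for each of its facets, as
-- the facet opposite v, so a gain of order n comes from only boundedly many terms per η.
ι-sum : ∀ n s (X : Subset n → Bool) (h : Subset n → ℕ) →
  ∑ (vs n) (λ v → ∑ (lv n s) (λ σ → bit (ι v X σ) * h σ)) ≡ ∑ (lv n (suc s)) (λ η → bit (X η) * ∑ (lv n s) (λ σ → bit (subᵇ σ η) * h σ))
ι-sum n s X h = begin-equality
  ∑ (vs n) (λ v → ∑ (lv n s) (λ σ → bit (ι v X σ) * h σ))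
    ≡⟨ ∑-swap (vs n) (lv n s) (λ v σ → bit (ι v X σ) * h σ) ⟩
  ∑ (lv n s) (λ σ → ∑ (vs n) (λ v → bit (ι v X σ) * h σ))
    ≡⟨ ∑-cong∈ (lv n s) (λ σ m → trans (∑-cong (vs n) (λ v → trans (cong (_* h σ) (bit-∧ (not (lookup σ v)) (X (ins v σ)))) (*-assoc (bit (not (lookup σ v))) (bit (X (ins v σ))) (h σ)))) (up-sum σ s (lv-size n s m) (λ η → bit (X η) * h σ))) ⟩
  ∑ (lv n s) (λ σ → ∑ (lv n (suc s)) (λ η → bit (subᵇ σ η) * (bit (X η) * h σ)))
    ≡⟨ ∑-swap (lv n s) (lv n (suc s)) (λ σ η → bit (subᵇ σ η) * (bit (X η) * h σ)) ⟩
  ∑ (lv n (suc s)) (λ η → ∑ (lv n s) (λ σ → bit (subᵇ σ η) * (bit (X η) * h σ)))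
    ≡⟨ ∑-cong (lv n (suc s)) (λ η → trans (∑-cong (lv n s) (λ σ → r (bit (subᵇ σ η)) (bit (X η)) (h σ))) (∑-* (lv n s) (bit (X η)) _)) ⟩
  ∑ (lv n (suc s)) (λ η → bit (X η) * ∑ (lv n s) (λ σ → bit (subᵇ σ η) * h σ)) ∎
  where
  open ≤-Reasoning
  bit-∧ : ∀ a b → bit (a ∧ b) ≡ bit a * bit b
  bit-∧ true b = sym (+-identityʳ _)
  bit-∧ false b = refl
  r : ∀ a b c → a * (b * c) ≡ b * (a * c)
  r = ringℕ

≟ₛ-refl : ∀ {n} (σ : Subset n) → (σ ≟ₛ σ) ≡ true
≟ₛ-refl σ with VecP.≡-dec BoolP._≟_ σ σ
... | yes _ = refl
... | no p = ⊥-elim (p refl)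

≟ₛ-sound : ∀ {n} (σ τ : Subset n) → (σ ≟ₛ τ) ≡ true → σ ≡ τ
≟ₛ-sound σ τ e with VecP.≡-dec BoolP._≟_ σ τ
... | yes p = p

∈-memb : ∀ {n} {σ : Subset n} {F} → σ ∈ F → memb σ F ≡ true
∈-memb {σ = σ} {_ ∷ F} (here refl) = cong (_∨ memb σ F) (≟ₛ-refl σ)
∈-memb {σ = σ} {τ ∷ F} (there m) = trans (cong ((σ ≟ₛ τ) ∨_) (∈-memb m)) (BoolP.∨-zeroʳ (σ ≟ₛ τ))

memb-∈ : ∀ {n} (σ : Subset n) F → memb σ F ≡ true → σ ∈ F
memb-∈ σ (τ ∷ F) e with σ ≟ₛ τ in eq
... | true = here (≟ₛ-sound σ τ eq)
... | false = there (memb-∈ σ F e)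

∉-memb : ∀ {n} (σ : Subset n) F → σ ∉ F → memb σ F ≡ false
∉-memb σ F ne with memb σ F in eq
... | false = refl
... | true = ⊥-elim (ne (memb-∈ σ F eq))

module _ {A : Set} where

  ∑-bfilter : (p : A → Bool) (xs : List A) (h : A → ℕ) → ∑ (bfilter p xs) h ≡ ∑ xs (λ x → bit (p x) * h x)
  ∑-bfilter p [] h = refl
  ∑-bfilter p (x ∷ xs) h with p x
  ... | true = cong₂ _+_ (sym (+-identityʳ (h x))) (∑-bfilter p xs h)
  ... | false = ∑-bfilter p xs h

  countB-∑ : (p : A → Bool) (xs : List A) → countB p xs ≡ ∑ xs (λ x → bit (p x))
  countB-∑ p [] = refl
  countB-∑ p (x ∷ xs) with p x
  ... | true = cong suc (countB-∑ p xs)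
  ... | false = countB-∑ p xs

  cnt-∑ : (p : A → Bool) (xs : List A) → cnt p xs ≡ ∑ xs (λ x → bit (p x))
  cnt-∑ p [] = refl
  cnt-∑ p (x ∷ xs) = cong₂ _+_ (e (p x)) (cnt-∑ p xs)
    where e : ∀ b → (if b then 1 else 0) ≡ bit b
          e true = refl
          e false = refl

  bfilter-cong∈ : (xs : List A) {p q : A → Bool} → (∀ x → x ∈ xs → p x ≡ q x) → bfilter p xs ≡ bfilter q xs
  bfilter-cong∈ [] h = refl
  bfilter-cong∈ (x ∷ xs) {p} {q} h rewrite h x (here refl) with q x
  ... | true = cong (x ∷_) (bfilter-cong∈ xs (λ y m → h y (there m)))
  ... | false = bfilter-cong∈ xs (λ y m → h y (there m))

  bfilter-sublist : (p : A → Bool) (xs : List A) → bfilter p xs ∈ sublists xs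
  bfilter-sublist p [] = here refl
  bfilter-sublist p (x ∷ xs) with p x
  ... | true = MemP.∈-++⁺ˡ (MemP.∈-map⁺ (x ∷_) (bfilter-sublist p xs))
  ... | false = MemP.∈-++⁺ʳ (map (x ∷_) (sublists xs)) (bfilter-sublist p xs)

  ∈-bfilter : (p : A → Bool) (xs : List A) {x : A} → x ∈ bfilter p xs → x ∈ xs × p x ≡ true
  ∈-bfilter p (y ∷ xs) m with p y in eq
  ... | false = let a , b = ∈-bfilter p xs m in there a , b
  ∈-bfilter p (y ∷ xs) (here refl) | true = here refl , eq
  ∈-bfilter p (y ∷ xs) (there m) | true = let a , b = ∈-bfilter p xs m in there a , b

  bfilter-∈ : (p : A → Bool) (xs : List A) {x : A} → x ∈ xs → p x ≡ true → x ∈ bfilter p xs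
  bfilter-∈ p (y ∷ xs) (here refl) e rewrite e = here refl
  bfilter-∈ p (y ∷ xs) (there m) e with p y
  ... | true = there (bfilter-∈ p xs m e)
  ... | false = bfilter-∈ p xs m e

memb-bfilter : ∀ {n} (p : Subset n → Bool) (L : List (Subset n)) {σ} → σ ∈ L → memb σ (bfilter p L) ≡ p σ
memb-bfilter p L {σ} m with p σ in eq
... | true = ∈-memb (bfilter-∈ p L m eq)
... | false = ∉-memb σ _ (λ m' → contra (trans (sym eq) (proj₂ (∈-bfilter p L m'))))
  where contra : false ≢ true
        contra ()

bfilter-memb : ∀ {n} {A L : List (Subset n)} → A ⊑ L → Unique L → bfilter (λ σ → memb σ A) L ≡ A
bfilter-memb nil u = refl
bfilter-memb (keep {x} {xs} {ys} p) (a ∷ u) rewrite ∈-memb {σ = x} {F = x ∷ xs} (here refl) =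
  cong (x ∷_) (trans (bfilter-cong∈ ys (λ y m → cong (_∨ memb y xs) (neq y m))) (bfilter-memb p u))
  where neq : ∀ y → y ∈ ys → (y ≟ₛ x) ≡ false
        neq y m with y ≟ₛ x in eq
        ... | false = refl
        ... | true = ⊥-elim (All.lookup a m (sym (≟ₛ-sound y x eq)))
bfilter-memb (drop {x} {xs} {ys} p) (a ∷ u) rewrite ∉-memb x xs (λ m → All.lookup a (⊑-∈ p m) refl) = bfilter-memb p u

∑-memb : ∀ {n} {A L : List (Subset n)} → A ⊑ L → Unique L → (h : Subset n → ℕ) → ∑ A h ≡ ∑ L (λ σ → bit (memb σ A) * h σ)
∑-memb {A = A} {L} p u h = trans (cong (λ z → ∑ z h) (sym (bfilter-memb p u))) (∑-bfilter (λ σ → memb σ A) L h)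

-- Expectation over tuples

ind? : {P : Set} → Dec P → ℕ
ind? (yes _) = 1
ind? (no _) = 0

module Expect {Tr : Set} (𝒯 : List Tr) (w : Tr → ℕ) where

  Ok : Tr → Set
  Ok T = T ∈ 𝒯 × w T ≢ 0

  μ : (Tr → ℕ) → ℕ
  μ h = ∑ 𝒯 (λ T → w T * h T)

  -- Expectation over k independent trees without normalisation: the total mass is the k-th power of
  -- the sum of the weights.
  Ex : ℕ → (List Tr → ℕ) → ℕ
  Ex zero G = G []
  Ex (suc k) G = ∑ 𝒯 (λ T → w T * Ex k (λ Ts → G (T ∷ Ts)))

  Ex-mono : ∀ k {G H : List Tr → ℕ} → (∀ Ts → length Ts ≡ k → All Ok Ts → G Ts ≤ H Ts) → Ex k G ≤ Ex k H
  Ex-mono zero h = h [] refl []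
  Ex-mono (suc k) {G} {H} h = ∑-mono∈ 𝒯 go
    where
    go : ∀ T → T ∈ 𝒯 → w T * Ex k (λ Ts → G (T ∷ Ts)) ≤ w T * Ex k (λ Ts → H (T ∷ Ts))
    go T m with w T ≟ 0
    ... | yes e = ≤-reflexive (trans (cong (_* Ex k (λ Ts → G (T ∷ Ts))) e) (sym (cong (_* Ex k (λ Ts → H (T ∷ Ts))) e)))
    ... | no ne = *-monoʳ-≤ (w T) (Ex-mono k (λ Ts l ok → h (T ∷ Ts) (cong suc l) ((m , ne) ∷ ok)))

  Ex-cong : ∀ k {G H : List Tr → ℕ} → (∀ Ts → G Ts ≡ H Ts) → Ex k G ≡ Ex k H
  Ex-cong zero h = h []
  Ex-cong (suc k) h = ∑-cong 𝒯 (λ T → cong (w T *_) (Ex-cong k (λ Ts → h (T ∷ Ts))))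

  Ex-+ : ∀ k (G H : List Tr → ℕ) → Ex k (λ Ts → G Ts + H Ts) ≡ Ex k G + Ex k H
  Ex-+ zero G H = refl
  Ex-+ (suc k) G H = trans (∑-cong 𝒯 (λ T → trans (cong (w T *_) (Ex-+ k (λ Ts → G (T ∷ Ts)) (λ Ts → H (T ∷ Ts)))) (*-distribˡ-+ (w T) _ _))) (∑-+ 𝒯 _ _)

  Ex-* : ∀ k c (G : List Tr → ℕ) → Ex k (λ Ts → c * G Ts) ≡ c * Ex k G
  Ex-* zero c G = refl
  Ex-* (suc k) c G = trans (∑-cong 𝒯 (λ T → trans (cong (w T *_) (Ex-* k c (λ Ts → G (T ∷ Ts)))) (r (w T) c _))) (∑-* 𝒯 c _)
    where r : ∀ a b x → a * (b * x) ≡ b * (a * x)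
          r = ringℕ

  Ex-0 : ∀ k → Ex k (λ _ → 0) ≡ 0
  Ex-0 k = Ex-* k 0 (λ _ → 0)

  Ex-∑ : ∀ k {I : Set} (is : List I) (G : I → List Tr → ℕ) → Ex k (λ Ts → ∑ is (λ i → G i Ts)) ≡ ∑ is (λ i → Ex k (G i))
  Ex-∑ k [] G = Ex-0 k
  Ex-∑ k (i ∷ is) G = trans (Ex-+ k (G i) _) (cong (Ex k (G i) +_) (Ex-∑ k is G))

  Ex-∏ : ∀ k (h : Tr → ℕ) → Ex k (λ Ts → ∏ Ts h) ≡ μ h ^ k
  Ex-∏ zero h = refl
  Ex-∏ (suc k) h = trans (∑-cong 𝒯 (λ T → trans (cong (w T *_) (trans (Ex-* k (h T) (λ Ts → ∏ Ts h)) (cong (h T *_) (Ex-∏ k h)))) (r (w T) (h T) (μ h ^ k))))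
    (trans (∑-* 𝒯 (μ h ^ k) _) (*-comm (μ h ^ k) (μ h)))
    where r : ∀ a b c → a * (b * c) ≡ c * (a * b)
          r = ringℕ

  Ex-1 : ∀ k → Ex k (λ _ → 1) ≡ (∑ 𝒯 w) ^ k
  Ex-1 k = trans (Ex-cong k (λ Ts → sym (trans (∏-const Ts 1) (^-zeroˡ (length Ts))))) (trans (Ex-∏ k (λ _ → 1)) (cong (_^ k) (∑-cong 𝒯 (λ T → *-identityʳ (w T)))))

  markov : ∀ k {P : List Tr → Set} (P? : ∀ Ts → Dec (P Ts)) (G : List Tr → ℕ) M →
    (∀ Ts → length Ts ≡ k → All Ok Ts → P Ts → M ≤ G Ts) → Ex k (λ Ts → ind? (P? Ts)) * M ≤ Ex k G
  markov k P? G M h = ≤-trans (≤-reflexive (trans (*-comm _ M) (sym (Ex-* k M (λ Ts → ind? (P? Ts)))))) (Ex-mono k go)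
    where
    go : ∀ Ts → length Ts ≡ k → All Ok Ts → M * ind? (P? Ts) ≤ G Ts
    go Ts l ok with P? Ts
    ... | yes p = ≤-trans (≤-reflexive (*-identityʳ M)) (h Ts l ok p)
    ... | no _ = ≤-trans (≤-reflexive (*-zeroʳ M)) z≤n

  -- Markov's inequality for a fractional power of `M` / c, stated with all exponents cleared. The
  -- threshold is the integer provided by `root`.
  markov-^ : ∀ k {P : List Tr → Set} (P? : ∀ Ts → Dec (P Ts)) (G : List Tr → ℕ) M c e → 1 ≤ c →
    (∀ Ts → length Ts ≡ k → All Ok Ts → P Ts → M ≤ c * G Ts ^ suc e) → Ex k (λ Ts → ind? (P? Ts)) ^ suc e * M ≤ c * Ex k G ^ suc e
  markov-^ k P? G M c e 1≤c h = let g , M≤ , least = root M c e 1≤c in begin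
    E ^ suc e * M ≤⟨ *-monoʳ-≤ (E ^ suc e) M≤ ⟩
    E ^ suc e * (c * g ^ suc e) ≡⟨ r (E ^ suc e) c (g ^ suc e) ⟩
    c * (E ^ suc e * g ^ suc e) ≡⟨ cong (c *_) (sym (^-* E g (suc e))) ⟩
    c * (E * g) ^ suc e ≤⟨ *-monoʳ-≤ c (^-monoˡ-≤ (suc e) (markov k P? G g (λ Ts l ok p → least (G Ts) (h Ts l ok p)))) ⟩
    c * Ex k G ^ suc e ∎
    where
    open ≤-Reasoning
    E = Ex k (λ Ts → ind? (P? Ts))
    r : ∀ a b c → a * (b * c) ≡ b * (a * c)
    r = ringℕ

∏-2^ : {A : Set} (xs : List A) (f : A → ℕ) → ∏ xs (λ x → 2 ^ f x) ≡ 2 ^ ∑ xs f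
∏-2^ [] f = refl
∏-2^ (x ∷ xs) f = trans (cong (2 ^ f x *_) (∏-2^ xs f)) (sym (^-distribˡ-+-* 2 (f x) (∑ xs f)))

1+bit : ∀ b → 1 + bit b ≡ 2 ^ bit b
1+bit true = refl
1+bit false = refl

∏-∈ : {A : Set} {xs : List A} {x : A} (f : A → ℕ) → x ∈ xs → (∀ y → y ∈ xs → 1 ≤ f y) → f x ≤ ∏ xs f
∏-∈ {xs = x ∷ xs} f (here refl) h = ≤-trans (≤-reflexive (sym (*-identityʳ (f x)))) (*-monoʳ-≤ (f x) (∏-pos xs f (λ y m → h y (there m))))
∏-∈ {xs = y ∷ xs} {x} f (there m) h = ≤-trans (∏-∈ f m (λ y m → h y (there m))) (≤-trans (≤-reflexive (sym (+-identityʳ (∏ xs f)))) (*-monoˡ-≤ (∏ xs f) (h y (here refl))))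

*-cancel-pos : ∀ c a b → 1 ≤ c → c * a ≤ c * b → a ≤ b
*-cancel-pos (suc c) a b _ h = *-cancelˡ-≤ (suc c) h

-- Chernoff bounds for one tree, and the events of large multiplicity and large degree.

module Events (m e : ℕ) where

  open Rows (suc m) e public
  open Expect (sublists L) wgt public

  Face : Set
  Face = Subset n

  dd : ℕ
  dd = suc e

  mgf : ∀ (y : Face → ℕ) B → ∑ L (λ t → D * y t) ≤ B * n → μ (λ T → ∏ T (λ t → 1 + y t)) ≤ 4 ^ B * Z
  mgf y B le = *-cancel-pos (n ^ length L) _ _ (m^n>0 n (length L)) (begin
    n ^ length L * μ (λ T → ∏ T (λ t → 1 + y t)) ≤⟨ moment-in y ⟩
    ∏ L (λ t → n + D * y t) * Z ≤⟨ *-monoˡ-≤ Z (exp-bound L (λ t → D * y t) n B le) ⟩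
    n ^ length L * 4 ^ B * Z ≡⟨ *-assoc (n ^ length L) (4 ^ B) Z ⟩
    n ^ length L * (4 ^ B * Z) ∎)
    where open ≤-Reasoning

  mgf-k : ∀ k (y : Face → ℕ) B → ∑ L (λ t → D * y t) ≤ B * n → Ex k (λ Ts → ∏ Ts (λ T → ∏ T (λ t → 1 + y t))) ≤ 4 ^ (B * k) * Z ^ k
  mgf-k k y B le = begin
    Ex k (λ Ts → ∏ Ts (λ T → ∏ T (λ t → 1 + y t))) ≡⟨ Ex-∏ k _ ⟩
    μ (λ T → ∏ T (λ t → 1 + y t)) ^ k ≤⟨ ^-monoˡ-≤ k (mgf y B le) ⟩
    (4 ^ B * Z) ^ k ≡⟨ trans (^-* (4 ^ B) Z k) (cong (_* Z ^ k) (^-*-assoc 4 B k)) ⟩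
    4 ^ (B * k) * Z ^ k ∎
    where open ≤-Reasoning

  -- A face outside `X` contributes n on both sides of `moment-out`, and a face of `X` contributes n
  -- + (n - D). Hence doubling for every missed face costs 2 - D/n for each face of `X`.
  mgf-out : D ≤ n → ∀ (X : Face → Bool) → μ (λ T → 2 ^ (cnt X L ∸ cnt X T)) * n ^ cnt X L ≤ (2 * n ∸ D) ^ cnt X L * Z
  mgf-out D≤n X = *-cancel-pos (n ^ length L) _ _ (m^n>0 n (length L)) (begin
    n ^ length L * (E * n ^ cnt X L) ≡⟨ *-assoc (n ^ length L) E _ ⟨
    n ^ length L * E * n ^ cnt X L ≤⟨ *-monoˡ-≤ (n ^ cnt X L) (moment-out X) ⟩
    ∏ L g * Z * n ^ cnt X L ≡⟨ r (∏ L g) Z (n ^ cnt X L) ⟩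
    ∏ L g * n ^ cnt X L * Z ≡⟨ cong (_* Z) (count L) ⟩
    n ^ length L * (2 * n ∸ D) ^ cnt X L * Z ≡⟨ *-assoc (n ^ length L) _ Z ⟩
    n ^ length L * ((2 * n ∸ D) ^ cnt X L * Z) ∎)
    where
    open ≤-Reasoning
    E = μ (λ T → 2 ^ (cnt X L ∸ cnt X T))
    g : Face → ℕ
    g t = n + (n ∸ D) * (if X t then 1 else 0)
    r : ∀ a b c → a * b * c ≡ a * c * b
    r = ringℕ
    2n : n + (n ∸ D) * 1 ≡ 2 * n ∸ D
    2n = trans (cong (n +_) (*-identityʳ _)) (trans (sym (+-∸-assoc n D≤n)) (cong (λ z → n + z ∸ D) (sym (+-identityʳ n))))
    count : ∀ M → ∏ M g * n ^ cnt X M ≡ n ^ length M * (2 * n ∸ D) ^ cnt X M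
    count [] = refl
    count (t ∷ M) with X t
    ... | true = trans (r2 (n + (n ∸ D) * 1) (∏ M g) n (n ^ cnt X M)) (trans (cong₂ (λ a b → a * n * b) 2n (count M)) (r3 (2 * n ∸ D) n (n ^ length M) _))
      where r2 : ∀ a b c d → a * b * (c * d) ≡ a * c * (b * d)
            r2 = ringℕ
            r3 : ∀ a c p q → a * c * (p * q) ≡ c * p * (a * q)
            r3 = ringℕ
    ... | false = trans (*-assoc (n + (n ∸ D) * 0) (∏ M g) _) (trans (cong₂ _*_ (trans (cong (n +_) (*-zeroʳ (n ∸ D))) (+-identityʳ n)) (count M)) (sym (*-assoc n (n ^ length M) _)))

  mult : Face → List (List Face) → ℕ
  mult τ Ts = ∑ Ts (λ T → bit (memb τ T))

  E2 : List (List Face) → ℕ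
  E2 Ts = ∑ L (λ τ → ind? (D <? mult τ Ts))

  L≤ : length L ≤ n ^ D
  L≤ = subst (_≤ n ^ D) (sym (length-lv n D)) (C≤^ n D)

  -- Tilting a single face by n makes the exponential moment bounded, so multiplicity above `D` has
  -- probability of order n^-(D+1). This is the least threshold that leaves a factor 1/n after
  -- summing over at most n^D faces.
  E2-bound : ∀ k → n * Ex k E2 ≤ 4 ^ (D * k) * Z ^ k
  E2-bound k = *-cancel-pos (n ^ D) _ _ (m^n>0 n D) (begin
    n ^ D * (n * Ex k E2) ≡⟨ r (n ^ D) n (Ex k E2) ⟩
    n ^ suc D * Ex k E2 ≡⟨ cong (n ^ suc D *_) (Ex-∑ k L (λ τ Ts → ind? (D <? mult τ Ts))) ⟩
    n ^ suc D * ∑ L (λ τ → Ex k (λ Ts → ind? (D <? mult τ Ts))) ≡⟨ ∑-* L (n ^ suc D) _ ⟨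
    ∑ L (λ τ → n ^ suc D * Ex k (λ Ts → ind? (D <? mult τ Ts))) ≤⟨ ∑-≤-const L (4 ^ (D * k) * Z ^ k) single ⟩
    length L * (4 ^ (D * k) * Z ^ k) ≤⟨ *-monoˡ-≤ _ L≤ ⟩
    n ^ D * (4 ^ (D * k) * Z ^ k) ∎)
    where
    open ≤-Reasoning
    r : ∀ a b c → a * (b * c) ≡ b * a * c
    r = ringℕ
    single : ∀ τ → τ ∈ L → n ^ suc D * Ex k (λ Ts → ind? (D <? mult τ Ts)) ≤ 4 ^ (D * k) * Z ^ k
    single τ mem = ≤-trans (≤-reflexive (*-comm (n ^ suc D) _)) (≤-trans (markov k (λ Ts → D <? mult τ Ts) _ (n ^ suc D) (λ Ts _ _ → big Ts)) (mgf-k k y D ysum))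
      where
      y : Face → ℕ
      y t = bit (τ ≟ₛ t) * n
      ysum : ∑ L (λ t → D * y t) ≤ D * n
      ysum = ≤-trans (≤-reflexive (∑-* L D y)) (*-monoʳ-≤ D (go L (lv-unique n D)))
        where
        go : ∀ M → Unique M → ∑ M y ≤ n
        go [] _ = z≤n
        go (t ∷ M) (p ∷ u) with τ ≟ₛ t in eq
        ... | true = ≤-reflexive (trans (cong₂ _+_ (+-identityʳ n) (∑-zero M (λ x mx → cong (_* n) (off x mx)))) (+-identityʳ n))
          where off : ∀ x → x ∈ M → bit (τ ≟ₛ x) ≡ 0
                off x mx with τ ≟ₛ x in eq'
                ... | false = refl
                ... | true = ⊥-elim (All.lookup p mx (trans (sym (≟ₛ-sound τ t eq)) (≟ₛ-sound τ x eq')))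
        ... | false = go M u
      tree : ∀ T → n ^ bit (memb τ T) ≤ ∏ T (λ t → 1 + y t)
      tree T with memb τ T in eq
      ... | false = ∏-pos T _ (λ _ _ → s≤s z≤n)
      ... | true = ≤-trans (≤-trans (≤-reflexive (trans (*-identityʳ n) (sym (trans (cong (λ b → bit b * n) (≟ₛ-refl τ)) (+-identityʳ n))))) (n≤1+n (y τ))) (∏-∈ (λ t → 1 + y t) (memb-∈ τ T eq) (λ _ _ → s≤s z≤n))
      trees : ∀ Ts → n ^ mult τ Ts ≤ ∏ Ts (λ T → ∏ T (λ t → 1 + y t))
      trees [] = ≤-refl
      trees (T ∷ Ts) = ≤-trans (≤-reflexive (^-distribˡ-+-* n (bit (memb τ T)) (mult τ Ts))) (*-mono-≤ (tree T) (trees Ts))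
      big : ∀ Ts → D < mult τ Ts → n ^ suc D ≤ ∏ Ts (λ T → ∏ T (λ t → 1 + y t))
      big Ts lt = ≤-trans (^-monoʳ-≤ n lt) (trees Ts)

  degT : List Face → Face → ℕ
  degT T σ = ∑ T (λ τ → bit (subᵇ σ τ))

  degs : List (List Face) → Face → ℕ
  degs Ts σ = ∑ Ts (λ T → degT T σ)

  big? : ∀ k i σ Ts → Dec (suc (2 * D) * k * n ^ suc i < degs Ts σ)
  big? k i σ Ts = suc (2 * D) * k * n ^ suc i <? degs Ts σ

  -- Here i indexes the codimension: the face lacks i + 2 vertices of a top face, so its expected
  -- degree in one tree has order n^(i+1).
  E1ᵢ : ℕ → ℕ → List (List Face) → ℕ
  E1ᵢ k i Ts = ∑ (lv n (dd ∸ suc i)) (λ σ → ind? (big? k i σ Ts))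

  E1 : ℕ → List (List Face) → ℕ
  E1 k Ts = ∑ (upTo dd) (λ i → E1ᵢ k i Ts)

  ∏-1+bit : ∀ {A : Set} (T : List A) (p : A → Bool) → ∏ T (λ t → 1 + bit (p t)) ≡ 2 ^ ∑ T (λ t → bit (p t))
  ∏-1+bit T p = trans (∏-cong∈ T (λ t _ → 1+bit (p t))) (∏-2^ T _)

  -- With tilt 1 the moment is at most 2^(2·D·k·R), where R = n^(i+1). The threshold exceeds this
  -- exponent by k·R ≥ n, which leaves the probability 2^-n.
  E1-single : ∀ k → 1 ≤ k → ∀ i → i < dd → ∀ σ → σ ∈ lv n (dd ∸ suc i) → Ex k (λ Ts → ind? (big? k i σ Ts)) * 2 ^ n ≤ Z ^ k
  E1-single k 1≤k i lt σ mem = ≤-trans (*-monoʳ-≤ E (^-monoʳ-≤ 2 n≤)) (*-cancel-pos (2 ^ (2 * D * k * R)) _ _ (m^n>0 2 (2 * D * k * R)) (begin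
    2 ^ (2 * D * k * R) * (E * 2 ^ (k * R)) ≡⟨ r (2 ^ (2 * D * k * R)) E (2 ^ (k * R)) ⟩
    E * (2 ^ (k * R) * 2 ^ (2 * D * k * R)) ≡⟨ cong (E *_) (trans (sym (^-distribˡ-+-* 2 (k * R) (2 * D * k * R))) (cong (2 ^_) (r2 k R D))) ⟩
    E * 2 ^ (suc (2 * D) * k * R) ≤⟨ markov k (big? k i σ) _ _ (λ Ts _ _ lt → ≤-trans (^-monoʳ-≤ 2 (<⇒≤ lt)) (≤-reflexive (sym (prod Ts)))) ⟩
    Ex k (λ Ts → ∏ Ts (λ T → ∏ T (λ t → 1 + bit (subᵇ σ t)))) ≤⟨ mgf-k k (λ t → bit (subᵇ σ t)) (D * R) ysum ⟩
    4 ^ (D * R * k) * Z ^ k ≡⟨ cong (_* Z ^ k) (trans (^-*-assoc 2 2 (D * R * k)) (cong (2 ^_) (r3 D R k))) ⟩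
    2 ^ (2 * D * k * R) * Z ^ k ∎))
    where
    open ≤-Reasoning
    R = n ^ suc i
    s = dd ∸ suc i
    E = Ex k (λ Ts → ind? (big? k i σ Ts))
    r : ∀ a b c → a * (b * c) ≡ b * (c * a)
    r = ringℕ
    r2 : ∀ k R D → k * R + 2 * D * k * R ≡ suc (2 * D) * k * R
    r2 = ringℕ
    r3 : ∀ D R k → 2 * (D * R * k) ≡ 2 * D * k * R
    r3 = ringℕ
    n≤ : n ≤ k * R
    n≤ = ≤-trans (m≤m*n n (n ^ i) {{m^n≢0 n i}}) (≤-trans (≤-reflexive (sym (+-identityʳ R))) (*-monoˡ-≤ R 1≤k))
    prod : ∀ Ts → ∏ Ts (λ T → ∏ T (λ t → 1 + bit (subᵇ σ t))) ≡ 2 ^ degs Ts σ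
    prod Ts = trans (∏-cong∈ Ts (λ T _ → ∏-1+bit T (subᵇ σ))) (∏-2^ Ts _)
    Deq : s + suc (suc i) ≡ D
    Deq = trans (+-suc s (suc i)) (cong suc (m∸n+n≡m lt))
    ysum : ∑ L (λ t → D * bit (subᵇ σ t)) ≤ D * R * n
    ysum = begin
      ∑ L (λ t → D * bit (subᵇ σ t)) ≡⟨ ∑-* L D _ ⟩
      D * ∑ L (λ t → bit (subᵇ σ t)) ≡⟨ cong (D *_) (trans (cong (λ z → ∑ (lv n z) (λ t → bit (subᵇ σ t))) (sym Deq)) (cofaces-C σ s (suc (suc i)) (lv-size n s mem))) ⟩
      D * ((n ∸ s) C suc (suc i)) ≤⟨ *-monoʳ-≤ D (≤-trans (C≤^ (n ∸ s) (suc (suc i))) (^-monoˡ-≤ (suc (suc i)) (m∸n≤m n s))) ⟩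
      D * (n * R) ≡⟨ r4 D n R ⟩
      D * R * n ∎
      where r4 : ∀ D n R → D * (n * R) ≡ D * R * n
            r4 = ringℕ

  E1-bound : ∀ k → 1 ≤ k → n * Ex k (E1 k) ≤ dd * D ^ D * Z ^ k
  E1-bound k 1≤k = *-cancel-pos (2 ^ n) _ _ (m^n>0 2 n) (begin
    2 ^ n * (n * Ex k (E1 k)) ≡⟨ r (2 ^ n) n (Ex k (E1 k)) ⟩
    n * (2 ^ n * Ex k (E1 k)) ≡⟨ cong (λ z → n * (2 ^ n * z)) (trans (Ex-∑ k (upTo dd) (E1ᵢ k)) (∑-cong (upTo dd) (λ i → Ex-∑ k (lv n (dd ∸ suc i)) (λ σ Ts → ind? (big? k i σ Ts))))) ⟩
    n * (2 ^ n * ∑ (upTo dd) (λ i → ∑ (lv n (dd ∸ suc i)) (λ σ → Ex k (λ Ts → ind? (big? k i σ Ts))))) ≡⟨ cong (n *_) (sym (trans (∑-cong (upTo dd) (λ i → ∑-* (lv n (dd ∸ suc i)) (2 ^ n) _)) (∑-* (upTo dd) (2 ^ n) _))) ⟩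
    n * ∑ (upTo dd) (λ i → ∑ (lv n (dd ∸ suc i)) (λ σ → 2 ^ n * Ex k (λ Ts → ind? (big? k i σ Ts)))) ≤⟨ *-monoʳ-≤ n (∑-≤-const (upTo dd) (n ^ dd * Z ^ k) (λ i mi → begin
        ∑ (lv n (dd ∸ suc i)) (λ σ → 2 ^ n * Ex k (λ Ts → ind? (big? k i σ Ts))) ≤⟨ ∑-≤-const (lv n (dd ∸ suc i)) (Z ^ k) (λ σ mσ → ≤-trans (≤-reflexive (*-comm (2 ^ n) _)) (E1-single k 1≤k i (MemP.∈-upTo⁻ mi) σ mσ)) ⟩
        length (lv n (dd ∸ suc i)) * Z ^ k ≤⟨ *-monoˡ-≤ (Z ^ k) (≤-trans (≤-reflexive (length-lv n (dd ∸ suc i))) (≤-trans (C≤^ n (dd ∸ suc i)) (^-monoʳ-≤ n (m∸n≤m dd (suc i))))) ⟩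
        n ^ dd * Z ^ k ∎)) ⟩
    n * (length (upTo dd) * (n ^ dd * Z ^ k)) ≡⟨ cong (λ z → n * (z * (n ^ dd * Z ^ k))) (ListP.length-upTo dd) ⟩
    n * (dd * (n ^ dd * Z ^ k)) ≡⟨ r2 n dd (n ^ dd) (Z ^ k) ⟩
    dd * (n ^ D) * Z ^ k ≤⟨ *-monoˡ-≤ (Z ^ k) (*-monoʳ-≤ dd (poly≤exp dd n)) ⟩
    dd * (D ^ D * 2 ^ n) * Z ^ k ≡⟨ r3 dd (D ^ D) (2 ^ n) (Z ^ k) ⟩
    2 ^ n * (dd * D ^ D * Z ^ k) ∎)
    where
    open ≤-Reasoning
    r : ∀ a b c → a * (b * c) ≡ b * (a * c)
    r = ringℕ
    r2 : ∀ n d p z → n * (d * (p * z)) ≡ d * (n * p) * z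
    r2 = ringℕ
    r3 : ∀ d p q z → d * (p * q) * z ≡ q * (d * p * z)
    r3 = ringℕ

-- The union bound

module BadSets (m e : ℕ) (D≤n : suc (suc e) ≤ suc (suc m)) where

  open Events m e public

  V : List Face
  V = lv n dd

  -- The cap makes `adj≤1` hold for arbitrary arguments. On distinct members of `V` it changes
  -- nothing, since two such faces have at most one common coface.
  adj : Face → Face → ℕ
  adj σ σ' with σ ≟ˢ σ'
  ... | yes _ = 0
  ... | no _ = ∑ L (λ τ → bit (subᵇ σ τ) * bit (subᵇ σ' τ)) ⊓ 1

  adj≤1 : ∀ σ σ' → adj σ σ' ≤ 1
  adj≤1 σ σ' with σ ≟ˢ σ'
  ... | yes _ = z≤n
  ... | no _ = m⊓n≤n _ 1

  adj-sym : ∀ σ σ' → adj σ σ' ≡ adj σ' σ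
  adj-sym σ σ' with σ ≟ˢ σ' | σ' ≟ˢ σ
  ... | yes _ | yes _ = refl
  ... | yes p | no q = ⊥-elim (q (sym p))
  ... | no p | yes q = ⊥-elim (p (sym q))
  ... | no _ | no _ = cong (_⊓ 1) (∑-cong L (λ τ → *-comm (bit (subᵇ σ τ)) (bit (subᵇ σ' τ))))

  adj-irr : ∀ σ → adj σ σ ≡ 0
  adj-irr σ with σ ≟ˢ σ
  ... | yes _ = refl
  ... | no p = ⊥-elim (p refl)

  adj≤∑ : ∀ σ σ' → adj σ σ' ≤ ∑ L (λ τ → bit (subᵇ σ τ) * bit (subᵇ σ' τ))
  adj≤∑ σ σ' with σ ≟ˢ σ'
  ... | yes _ = z≤n
  ... | no _ = m⊓n≤m _ 1

  ∑≤adj : ∀ σ σ' → σ ∈ V → σ' ∈ V → σ ≢ σ' → ∑ L (λ τ → bit (subᵇ σ τ) * bit (subᵇ σ' τ)) ≤ adj σ σ'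
  ∑≤adj σ σ' mσ mσ' ne with σ ≟ˢ σ'
  ... | yes p = ⊥-elim (ne p)
  ... | no _ = ≤-reflexive (sym (m≤n⇒m⊓n≡m (pair-cofaces≤1 σ σ' dd (lv-size n dd mσ) (lv-size n dd mσ') ne)))

  facetsV : ∀ τ → τ ∈ L → ∑ V (λ σ → bit (subᵇ σ τ)) ≤ D
  facetsV τ mτ = facets≤ τ dd (lv-size n D mτ)

  degV : ∀ x → x ∈ V → ∑ V (λ σ → adj σ x) ≤ D * n
  degV x mx = begin
    ∑ V (λ σ → adj σ x) ≤⟨ ∑-mono V (λ σ → adj≤∑ σ x) ⟩
    ∑ V (λ σ → ∑ L (λ τ → bit (subᵇ σ τ) * bit (subᵇ x τ))) ≡⟨ ∑-swap V L (λ σ τ → bit (subᵇ σ τ) * bit (subᵇ x τ)) ⟩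
    ∑ L (λ τ → ∑ V (λ σ → bit (subᵇ σ τ) * bit (subᵇ x τ))) ≡⟨ ∑-cong L (λ τ → trans (∑-cong V (λ σ → *-comm (bit (subᵇ σ τ)) _)) (∑-* V (bit (subᵇ x τ)) _)) ⟩
    ∑ L (λ τ → bit (subᵇ x τ) * ∑ V (λ σ → bit (subᵇ σ τ))) ≤⟨ ∑-mono∈ L (λ τ mτ → ≤-trans (*-monoʳ-≤ (bit (subᵇ x τ)) (facetsV τ mτ)) (≤-reflexive (*-comm (bit (subᵇ x τ)) D))) ⟩
    ∑ L (λ τ → D * bit (subᵇ x τ)) ≡⟨ ∑-* L D _ ⟩
    D * ∑ L (λ τ → bit (subᵇ x τ)) ≤⟨ *-monoʳ-≤ D (cofaces≤ x dd (lv-size n dd mx)) ⟩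
    D * n ∎
    where open ≤-Reasoning

  V≤ : length V ≤ n ^ dd
  V≤ = subst (_≤ n ^ dd) (sym (length-lv n dd)) (C≤^ n dd)

  open Entropy V adj adj≤1 adj-sym adj-irr n e D (s≤s z≤n) (s≤s z≤n) degV V≤ renaming (m to mᴱ)

  j : List Face → Face → ℕ
  j S τ = ∑ S (λ σ → bit (subᵇ σ τ))

  odd : List Face → Face → Bool
  odd S τ = oddB (j S τ)

  xs ns : List Face → List (List Face) → ℕ
  xs S Ts = ∑ Ts (λ T → ∑ T (λ τ → bit (odd S τ)))
  ns S Ts = ∑ Ts (λ T → ∑ T (j S))

  ev : List Face → Face → Face → ℕ
  ev S σ τ = bit (subᵇ σ τ) * bit (not (odd S τ))

  evs : List Face → List (List Face) → Face → ℕ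
  evs S Ts σ = ∑ Ts (λ T → ∑ T (ev S σ))

  -- The exponent 8·D·2^D is what the moment bound in `many-inc` costs per unit of k·a; the
  -- additional 1 is the gain that remains.
  b : ℕ
  b = suc (8 * D * 2 ^ D)

  -- Minimality in the coset enters only through its consequence on the number of odd faces, which
  -- is decidable and does not involve the trees. The other two conditions are the violation and the
  -- state reached after all deletions.
  Bad : ℕ → List Face → List (List Face) → Set
  Bad k S Ts = (1 ≤ length S × n * length S ≤ D * ∑ L (λ τ → bit (odd S τ))) × (b * xs S Ts < ns S Ts) × All (λ σ → k ≤ 3 * evs S Ts σ) S

  bad? : ∀ k S Ts → Dec (Bad k S Ts)
  bad? k S Ts = ((1 ≤? length S) ×-dec (n * length S ≤? D * ∑ L (λ τ → bit (odd S τ)))) ×-dec (b * xs S Ts <? ns S Ts) ×-dec All.all? (λ σ → k ≤? 3 * evs S Ts σ) S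

  module _ (S : List Face) (S⊑ : S ⊑ V) where

    a : ℕ
    a = length S

    j≤D : ∀ τ → τ ∈ L → j S τ ≤ D
    j≤D τ mτ = ≤-trans (∑-⊑ S⊑ _) (facetsV τ mτ)

    -- The reciprocal of the density of neighbours of σ in S, rounded.
    q : Face → ℕ
    q σ = (2 * D * n) / suc (deg S σ)

    Q : ℕ
    Q = ∏ S q

    sdeg≤ : ∀ σ → σ ∈ S → suc (deg S σ) ≤ 2 * D * n
    sdeg≤ σ mσ = ≤-trans (s≤s (deg≤ S⊑ σ (⊑-∈ S⊑ mσ))) (≤-trans (≤-trans (≤-reflexive (+-comm 1 (D * n))) (+-monoʳ-≤ (D * n) (m≤m*n 1 (D * n)))) (≤-reflexive (r D n)))
      where r : ∀ D n → D * n + 1 * (D * n) ≡ 2 * D * n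
            r = ringℕ

    q-pos : ∀ σ → σ ∈ S → 1 ≤ q σ
    q-pos σ mσ = m≥n⇒m/n>0 (sdeg≤ σ mσ)

    q-deg : ∀ σ → q σ * deg S σ ≤ 2 * D * n
    q-deg σ = ≤-trans (*-monoʳ-≤ (q σ) (n≤1+n _)) (m/n*n≤m (2 * D * n) (suc (deg S σ)))

    q-big : ∀ σ → σ ∈ S → D * n ≤ q σ * (2 * suc (deg S σ))
    q-big σ mσ = ≤-trans (m≤m+n (D * n) (1 * (D * n))) (≤-trans (≤-reflexive (r0 D n)) (begin
      2 * D * n ≡⟨ m≡m%n+[m/n]*n (2 * D * n) (suc (deg S σ)) ⟩
      (2 * D * n) % suc (deg S σ) + q σ * suc (deg S σ) ≤⟨ +-monoˡ-≤ _ (<⇒≤ (m%n<n (2 * D * n) (suc (deg S σ)))) ⟩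
      suc (deg S σ) + q σ * suc (deg S σ) ≤⟨ +-monoˡ-≤ _ (≤-trans (≤-reflexive (sym (*-identityˡ _))) (*-monoˡ-≤ (suc (deg S σ)) (q-pos σ mσ))) ⟩
      q σ * suc (deg S σ) + q σ * suc (deg S σ) ≡⟨ r (q σ) (suc (deg S σ)) ⟩
      q σ * (2 * suc (deg S σ)) ∎))
      where open ≤-Reasoning
            r : ∀ q s → q * s + q * s ≡ q * (2 * s)
            r = ringℕ
            r0 : ∀ D n → D * n + 1 * (D * n) ≡ 2 * D * n
            r0 = ringℕ

    -- An even face through σ contains another member of S, and determines it.
    even≤deg : ∀ σ → σ ∈ S → ∑ L (ev S σ) ≤ deg S σ
    even≤deg σ mσ = let S' , p = ∈-Pick mσ in begin
      ∑ L (ev S σ) ≤⟨ ∑-mono L (point S' p) ⟩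
      ∑ L (λ τ → ∑ S' (λ σ' → bit (subᵇ σ τ) * bit (subᵇ σ' τ))) ≡⟨ ∑-swap L S' (λ τ σ' → bit (subᵇ σ τ) * bit (subᵇ σ' τ)) ⟩
      ∑ S' (λ σ' → ∑ L (λ τ → bit (subᵇ σ τ) * bit (subᵇ σ' τ))) ≤⟨ ∑-mono∈ S' (λ σ' m' → ∑≤adj σ σ' (⊑-∈ S⊑ mσ) (⊑-∈ S⊑ (⊑-∈ (Pick-⊑ p) m')) (differ S' p (⊑-unique S⊑ (lv-unique n dd)) σ' m')) ⟩
      ∑ S' (adj σ) ≤⟨ m≤n+m _ (adj σ σ) ⟩
      adj σ σ + ∑ S' (adj σ) ≡⟨ Pick-∑ p (adj σ) ⟨
      deg S σ ∎
      where
      open ≤-Reasoning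
      differ : ∀ {σ S} S' → Pick σ S' S → Unique S → ∀ σ' → σ' ∈ S' → σ ≢ σ'
      differ S' hit (u ∷ us) σ' m' eq = All.lookup u m' eq
      differ (x ∷ S') (skip p) (u ∷ us) σ' (here refl) eq = All.lookup u (Pick-∈ p) (sym eq)
      differ (x ∷ S') (skip p) (u ∷ us) σ' (there m') eq = differ S' p us σ' m' eq
      point : ∀ S' → Pick σ S' S → ∀ τ → ev S σ τ ≤ ∑ S' (λ σ' → bit (subᵇ σ τ) * bit (subᵇ σ' τ))
      point S' p τ with subᵇ σ τ in eq
      ... | false = z≤n
      ... | true = ≤-trans (subst (λ z → 1 * bit (not (oddB z)) ≤ j S' τ) (sym (trans (Pick-∑ p (λ σ → bit (subᵇ σ τ))) (cong (λ b → bit b + j S' τ) eq))) (go (j S' τ)))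
               (≤-reflexive (∑-cong S' (λ σ' → sym (+-identityʳ _))))
        where go : ∀ x → 1 * bit (not (oddB (1 + x))) ≤ x
              go zero = z≤n
              go (suc x) = ≤-trans (≤-reflexive (*-identityˡ _)) (≤-trans (bit≤1 _) (s≤s z≤n))

    module _ (k : ℕ) where

      -- An even face through σ is rewarded with `q σ`, inversely proportional to the degree of σ in
      -- `S`. As there are at most that many such faces, each member adds only order n to the total
      -- tilt.
      yᵉ : Face → ℕ
      yᵉ τ = bit (not (odd S τ)) * ∑ S (λ σ → bit (subᵇ σ τ) * q σ)

      yᵉ-sum : ∑ L (λ τ → D * yᵉ τ) ≤ 2 * D * D * a * n
      yᵉ-sum = begin
        ∑ L (λ τ → D * yᵉ τ) ≡⟨ ∑-* L D yᵉ ⟩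
        D * ∑ L yᵉ ≡⟨ cong (D *_) (∑-cong L (λ τ → trans (sym (∑-* S (bit (not (odd S τ))) _)) (∑-cong S (λ σ → r (bit (not (odd S τ))) (bit (subᵇ σ τ)) (q σ))))) ⟩
        D * ∑ L (λ τ → ∑ S (λ σ → q σ * ev S σ τ)) ≡⟨ cong (D *_) (trans (∑-swap L S (λ τ σ → q σ * ev S σ τ)) (∑-cong S (λ σ → ∑-* L (q σ) (ev S σ)))) ⟩
        D * ∑ S (λ σ → q σ * ∑ L (ev S σ)) ≤⟨ *-monoʳ-≤ D (∑-≤-const S (2 * D * n) (λ σ mσ → ≤-trans (*-monoʳ-≤ (q σ) (even≤deg σ mσ)) (q-deg σ))) ⟩
        D * (a * (2 * D * n)) ≡⟨ r2 D a n ⟩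
        2 * D * D * a * n ∎
        where open ≤-Reasoning
              r : ∀ e s q → e * (s * q) ≡ q * (s * e)
              r = ringℕ
              r2 : ∀ D a n → D * (a * (2 * D * n)) ≡ 2 * D * D * a * n
              r2 = ringℕ

      Gᵉ : List (List Face) → ℕ
      Gᵉ Ts = ∏ Ts (λ T → ∏ T (λ t → 1 + yᵉ t))

      -- One even face may serve up to `D` members at once. Their joint reward is a product of at
      -- most `D` numbers, each at most 1 + `yᵉ τ`, hence the exponent `D` here and in what follows.
      face-prod : ∀ τ → τ ∈ L → ∏ S (λ σ → q σ ^ ev S σ τ) ≤ (1 + yᵉ τ) ^ D
      face-prod τ mτ with odd S τ
      ... | true = ≤-trans (≤-reflexive (trans (∏-cong∈ S (λ σ _ → cong (q σ ^_) (*-zeroʳ (bit (subᵇ σ τ))))) (trans (∏-const S 1) (^-zeroˡ a)))) (m^n>0 1 D)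
      ... | false = ≤-trans (go S (λ σ m → m)) (^-monoʳ-≤ (suc Y) (j≤D τ mτ))
        where
        Y = 1 * ∑ S (λ σ → bit (subᵇ σ τ) * q σ)
        ∈-∑ : ∀ {M : List Face} {σ} (f : Face → ℕ) → σ ∈ M → f σ ≤ ∑ M f
        ∈-∑ f (here refl) = m≤m+n _ _
        ∈-∑ {x ∷ M} f (there m) = ≤-trans (∈-∑ f m) (m≤n+m _ (f x))
        go : ∀ M → (∀ σ → σ ∈ M → σ ∈ S) → ∏ M (λ σ → q σ ^ (bit (subᵇ σ τ) * 1)) ≤ suc Y ^ ∑ M (λ σ → bit (subᵇ σ τ))
        go [] h = ≤-refl
        go (σ ∷ M) h = ≤-trans (*-mono-≤ one-σ (go M (λ σ m → h σ (there m)))) (≤-reflexive (sym (^-distribˡ-+-* (suc Y) (bit (subᵇ σ τ)) _)))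
          where
          one-σ : q σ ^ (bit (subᵇ σ τ) * 1) ≤ suc Y ^ bit (subᵇ σ τ)
          one-σ with subᵇ σ τ in eq
          ... | false = ≤-refl
          ... | true = *-monoˡ-≤ 1 (≤-trans (≤-trans (≤-reflexive (sym (trans (cong (λ b → bit b * q σ) eq) (+-identityʳ _)))) (∈-∑ (λ σ → bit (subᵇ σ τ) * q σ) (h σ (here refl)))) (≤-trans (≤-reflexive (sym (*-identityˡ _))) (n≤1+n Y)))

      tree-prod : ∀ T → (∀ τ → τ ∈ T → τ ∈ L) → ∏ S (λ σ → q σ ^ ∑ T (ev S σ)) ≤ ∏ T (λ t → 1 + yᵉ t) ^ D
      tree-prod [] h = ≤-reflexive (trans (trans (∏-const S 1) (^-zeroˡ a)) (sym (^-zeroˡ D)))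
      tree-prod (τ ∷ T) h = begin
        ∏ S (λ σ → q σ ^ (ev S σ τ + ∑ T (ev S σ))) ≡⟨ trans (∏-cong∈ S (λ σ _ → ^-distribˡ-+-* (q σ) (ev S σ τ) _)) (∏-* S _ _) ⟩
        ∏ S (λ σ → q σ ^ ev S σ τ) * ∏ S (λ σ → q σ ^ ∑ T (ev S σ)) ≤⟨ *-mono-≤ (face-prod τ (h τ (here refl))) (tree-prod T (λ σ m → h σ (there m))) ⟩
        (1 + yᵉ τ) ^ D * ∏ T (λ t → 1 + yᵉ t) ^ D ≡⟨ ^-* (1 + yᵉ τ) (∏ T (λ t → 1 + yᵉ t)) D ⟨
        ((1 + yᵉ τ) * ∏ T (λ t → 1 + yᵉ t)) ^ D ∎
        where open ≤-Reasoning

      trees-prod : ∀ Ts → All Ok Ts → ∏ S (λ σ → q σ ^ evs S Ts σ) ≤ Gᵉ Ts ^ D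
      trees-prod [] _ = ≤-reflexive (trans (trans (∏-const S 1) (^-zeroˡ a)) (sym (^-zeroˡ D)))
      trees-prod (T ∷ Ts) ((mT , _) ∷ ok) = begin
        ∏ S (λ σ → q σ ^ (∑ T (ev S σ) + evs S Ts σ)) ≡⟨ trans (∏-cong∈ S (λ σ _ → ^-distribˡ-+-* (q σ) (∑ T (ev S σ)) _)) (∏-* S _ _) ⟩
        ∏ S (λ σ → q σ ^ ∑ T (ev S σ)) * ∏ S (λ σ → q σ ^ evs S Ts σ) ≤⟨ *-mono-≤ (tree-prod T (λ τ m → ⊑-∈ (sublists-⊑ L T mT) m)) (trees-prod Ts ok) ⟩
        ∏ T (λ t → 1 + yᵉ t) ^ D * Gᵉ Ts ^ D ≡⟨ ^-* (∏ T (λ t → 1 + yᵉ t)) (Gᵉ Ts) D ⟨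
        Gᵉ (T ∷ Ts) ^ D ∎
        where open ≤-Reasoning

      -- Every member lies in at least k/3 even faces, so the accumulated reward is at least
      -- Q^(k/3). Clearing the 3 and the exponent `D` of `face-prod` gives the power 3·D, and 12·D³
      -- is the exponent of the moment bound raised to it.
      even-bound : ∀ {P : List (List Face) → Set} (P? : ∀ Ts → Dec (P Ts)) → (∀ Ts → P Ts → All (λ σ → k ≤ 3 * evs S Ts σ) S) →
        Ex k (λ Ts → ind? (P? Ts)) ^ (3 * D) * Q ^ k ≤ 2 ^ (12 * (D * D * D) * (a * k)) * Z ^ (k * (3 * D))
      even-bound P? h = begin
        Ex k (λ Ts → ind? (P? Ts)) ^ (3 * D) * Q ^ k ≤⟨ markov-^ k P? Gᵉ (Q ^ k) 1 (pred (3 * D)) ≤-refl (λ Ts l ok p → ≤-trans (on Ts ok (h Ts p)) (≤-reflexive (sym (*-identityˡ _)))) ⟩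
        1 * Ex k Gᵉ ^ (3 * D) ≡⟨ *-identityˡ _ ⟩
        Ex k Gᵉ ^ (3 * D) ≤⟨ ^-monoˡ-≤ (3 * D) (mgf-k k yᵉ (2 * D * D * a) yᵉ-sum) ⟩
        (4 ^ (2 * D * D * a * k) * Z ^ k) ^ (3 * D) ≡⟨ ^-* (4 ^ (2 * D * D * a * k)) (Z ^ k) (3 * D) ⟩
        (4 ^ (2 * D * D * a * k)) ^ (3 * D) * (Z ^ k) ^ (3 * D) ≡⟨ cong₂ _*_ (trans (cong (_^ (3 * D)) (^-*-assoc 2 2 (2 * D * D * a * k))) (trans (^-*-assoc 2 (2 * (2 * D * D * a * k)) (3 * D)) (cong (2 ^_) (r D a k)))) (^-*-assoc Z k (3 * D)) ⟩
        2 ^ (12 * (D * D * D) * (a * k)) * Z ^ (k * (3 * D)) ∎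
        where
        open ≤-Reasoning
        r : ∀ D a k → 2 * (2 * D * D * a * k) * (3 * D) ≡ 12 * (D * D * D) * (a * k)
        r = ringℕ
        on : ∀ Ts → All Ok Ts → All (λ σ → k ≤ 3 * evs S Ts σ) S → Q ^ k ≤ Gᵉ Ts ^ (3 * D)
        on Ts ok al = begin
          Q ^ k ≡⟨ ∏-^ S q k ⟨
          ∏ S (λ σ → q σ ^ k) ≤⟨ ∏-mono∈ S (λ σ mσ → ^-monoʳ-≤ (q σ) {{>-nonZero (q-pos σ mσ)}} (All.lookup al mσ)) ⟩
          ∏ S (λ σ → q σ ^ (3 * evs S Ts σ)) ≡⟨ trans (∏-cong∈ S (λ σ _ → trans (cong (q σ ^_) (*-comm 3 (evs S Ts σ))) (sym (^-*-assoc (q σ) (evs S Ts σ) 3)))) (∏-^ S _ 3) ⟩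
          ∏ S (λ σ → q σ ^ evs S Ts σ) ^ 3 ≤⟨ ^-monoˡ-≤ 3 (trees-prod Ts ok) ⟩
          (Gᵉ Ts ^ D) ^ 3 ≡⟨ trans (^-*-assoc (Gᵉ Ts) D 3) (cong (Gᵉ Ts ^_) (*-comm D 3)) ⟩
          Gᵉ Ts ^ (3 * D) ∎

      -- The lower tail. `S` has at least n·a/D odd faces in the full simplex, so each tree should
      -- contain about a of them or more. The base 2n in `lower-tail` appears because doubling for a
      -- missed face turns 1 - D/n into 1 - D/(2n), up to the factor 2.
      few-odd : ∀ {P : List (List Face) → Set} (P? : ∀ Ts → Dec (P Ts)) → n * a ≤ D * ∑ L (λ τ → bit (odd S τ)) → (∀ Ts → P Ts → 4 * xs S Ts ≤ k * a) →
        Ex k (λ Ts → ind? (P? Ts)) ^ 4 * 2 ^ (k * a) ≤ Z ^ (4 * k)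
      few-odd P? cond h = *-cancel-pos (2 ^ (k * a) * (2 * n) ^ (p * (4 * k))) _ _ (*-mono-≤ (m^n>0 2 (k * a)) (m^n>0 (2 * n) (p * (4 * k)))) (begin
        2 ^ (k * a) * (2 * n) ^ (p * (4 * k)) * (E ^ 4 * 2 ^ (k * a))
          ≡⟨ cong (λ z → 2 ^ (k * a) * z * (E ^ 4 * 2 ^ (k * a))) (trans (^-* 2 n (p * (4 * k))) (cong (λ z → 2 ^ z * n ^ (p * (4 * k))) (r0 p k))) ⟩
        2 ^ (k * a) * (2 ^ (4 * (k * p)) * n ^ (p * (4 * k))) * (E ^ 4 * 2 ^ (k * a))
          ≡⟨ r1 (2 ^ (k * a)) (2 ^ (4 * (k * p))) (n ^ (p * (4 * k))) (E ^ 4) ⟩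
        E ^ 4 * 2 ^ (4 * (k * p)) * (n ^ (p * (4 * k)) * (2 ^ (k * a) * 2 ^ (k * a)))
          ≤⟨ *-monoˡ-≤ _ (markov-^ k P? G (2 ^ (4 * (k * p))) (2 ^ (k * a)) 3 (m^n>0 2 (k * a)) (λ Ts l ok pf → on Ts l ok (h Ts pf))) ⟩
        2 ^ (k * a) * Ex k G ^ 4 * (n ^ (p * (4 * k)) * (2 ^ (k * a) * 2 ^ (k * a)))
          ≡⟨ cong (λ z → 2 ^ (k * a) * z * (n ^ (p * (4 * k)) * (2 ^ (k * a) * 2 ^ (k * a)))) (trans (cong (_^ 4) (Ex-∏ k _)) (trans (^-*-assoc μX k 4) (cong (μX ^_) (*-comm k 4)))) ⟩
        2 ^ (k * a) * μX ^ (4 * k) * (n ^ (p * (4 * k)) * (2 ^ (k * a) * 2 ^ (k * a)))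
          ≡⟨ r2 (2 ^ (k * a)) (μX ^ (4 * k)) (n ^ (p * (4 * k))) (2 ^ (k * a) * 2 ^ (k * a)) ⟩
        2 ^ (k * a) * (2 ^ (k * a) * 2 ^ (k * a)) * (μX ^ (4 * k) * n ^ (p * (4 * k)))
          ≡⟨ cong (2 ^ (k * a) * (2 ^ (k * a) * 2 ^ (k * a)) *_) (trans (cong (μX ^ (4 * k) *_) (sym (^-*-assoc n p (4 * k)))) (sym (^-* μX (n ^ p) (4 * k)))) ⟩
        2 ^ (k * a) * (2 ^ (k * a) * 2 ^ (k * a)) * (μX * n ^ p) ^ (4 * k)
          ≤⟨ *-monoʳ-≤ (2 ^ (k * a) * (2 ^ (k * a) * 2 ^ (k * a))) (^-monoˡ-≤ (4 * k) (mgf-out D≤n X)) ⟩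
        2 ^ (k * a) * (2 ^ (k * a) * 2 ^ (k * a)) * ((2 * n ∸ D) ^ p * Z) ^ (4 * k)
          ≡⟨ cong (2 ^ (k * a) * (2 ^ (k * a) * 2 ^ (k * a)) *_) (trans (^-* ((2 * n ∸ D) ^ p) Z (4 * k)) (cong (_* Z ^ (4 * k)) (pw (2 * n ∸ D)))) ⟩
        2 ^ (k * a) * (2 ^ (k * a) * 2 ^ (k * a)) * (((2 * n ∸ D) ^ (2 * p)) ^ (2 * k) * Z ^ (4 * k))
          ≡⟨ r3 (2 ^ (k * a)) (((2 * n ∸ D) ^ (2 * p)) ^ (2 * k)) (Z ^ (4 * k)) ⟩
        2 ^ (k * a) * (((2 * n ∸ D) ^ (2 * p)) ^ (2 * k) * (2 ^ (k * a) * 2 ^ (k * a))) * Z ^ (4 * k)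
          ≡⟨ cong (λ z → 2 ^ (k * a) * z * Z ^ (4 * k)) (trans (cong (((2 * n ∸ D) ^ (2 * p)) ^ (2 * k) *_) two) (sym (^-* ((2 * n ∸ D) ^ (2 * p)) (2 ^ a) (2 * k)))) ⟩
        2 ^ (k * a) * ((2 * n ∸ D) ^ (2 * p) * 2 ^ a) ^ (2 * k) * Z ^ (4 * k)
          ≤⟨ *-monoˡ-≤ (Z ^ (4 * k)) (*-monoʳ-≤ (2 ^ (k * a)) (^-monoˡ-≤ (2 * k) (lower-tail (2 * n) D p a tail-cond))) ⟩
        2 ^ (k * a) * ((2 * n) ^ (2 * p)) ^ (2 * k) * Z ^ (4 * k)
          ≡⟨ cong (λ z → 2 ^ (k * a) * z * Z ^ (4 * k)) (trans (sym (pw (2 * n))) (^-*-assoc (2 * n) p (4 * k))) ⟩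
        2 ^ (k * a) * (2 * n) ^ (p * (4 * k)) * Z ^ (4 * k) ∎)
        where
        open ≤-Reasoning
        X = odd S
        p = cnt X L
        E = Ex k (λ Ts → ind? (P? Ts))
        μX = μ (λ T → 2 ^ (cnt X L ∸ cnt X T))
        G : List (List Face) → ℕ
        G Ts = ∏ Ts (λ T → 2 ^ (p ∸ cnt X T))
        r0 : ∀ p k → p * (4 * k) ≡ 4 * (k * p)
        r0 = ringℕ
        r1 : ∀ t x y E → t * (x * y) * (E * t) ≡ E * x * (y * (t * t))
        r1 = ringℕ
        r2 : ∀ t x y z → t * x * (y * z) ≡ t * z * (x * y)
        r2 = ringℕ
        r3 : ∀ t x z → t * (t * t) * (x * z) ≡ t * (x * (t * t)) * z
        r3 = ringℕ
        r4 : ∀ p k → p * (4 * k) ≡ 2 * p * (2 * k)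
        r4 = ringℕ
        r5 : ∀ k a → k * a + k * a ≡ a * (2 * k)
        r5 = ringℕ
        pw : ∀ x → (x ^ p) ^ (4 * k) ≡ (x ^ (2 * p)) ^ (2 * k)
        pw x = trans (^-*-assoc x p (4 * k)) (trans (cong (x ^_) (r4 p k)) (sym (^-*-assoc x (2 * p) (2 * k))))
        two : 2 ^ (k * a) * 2 ^ (k * a) ≡ (2 ^ a) ^ (2 * k)
        two = trans (sym (^-distribˡ-+-* 2 (k * a) (k * a))) (trans (cong (2 ^_) (r5 k a)) (sym (^-*-assoc 2 a (2 * k))))
        tail-cond : a * (2 * n) ≤ 2 * p * D
        tail-cond = begin
          a * (2 * n) ≡⟨ r6 a n ⟩
          2 * (n * a) ≤⟨ *-monoʳ-≤ 2 cond ⟩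
          2 * (D * ∑ L (λ τ → bit (odd S τ))) ≡⟨ cong (λ z → 2 * (D * z)) (sym (cnt-∑ X L)) ⟩
          2 * (D * p) ≡⟨ r7 D p ⟩
          2 * p * D ∎
          where r6 : ∀ a n → a * (2 * n) ≡ 2 * (n * a)
                r6 = ringℕ
                r7 : ∀ D p → 2 * (D * p) ≡ 2 * p * D
                r7 = ringℕ
        Geq : ∀ Ts → All Ok Ts → G Ts * 2 ^ xs S Ts ≡ 2 ^ (length Ts * p)
        Geq [] _ = refl
        Geq (T ∷ Ts) ((mT , _) ∷ ok) = trans (cong (2 ^ (p ∸ cnt X T) * G Ts *_) (^-distribˡ-+-* 2 (∑ T (λ τ → bit (odd S τ))) (xs S Ts)))
          (trans (r8 (2 ^ (p ∸ cnt X T)) (G Ts) _ _) (trans (cong₂ _*_ (trans (cong (λ z → 2 ^ (p ∸ cnt X T) * 2 ^ z) (sym (cnt-∑ X T))) (trans (sym (^-distribˡ-+-* 2 (p ∸ cnt X T) (cnt X T))) (cong (2 ^_) (m∸n+n≡m (cnt-sublist X L T mT))))) (Geq Ts ok)) (sym (^-distribˡ-+-* 2 p (length Ts * p)))))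
          where r8 : ∀ a b c d → a * b * (c * d) ≡ (a * c) * (b * d)
                r8 = ringℕ
        on : ∀ Ts → length Ts ≡ k → All Ok Ts → 4 * xs S Ts ≤ k * a → 2 ^ (4 * (k * p)) ≤ 2 ^ (k * a) * G Ts ^ 4
        on Ts l ok le = begin
          2 ^ (4 * (k * p)) ≡⟨ trans (cong (2 ^_) (*-comm 4 (k * p))) (sym (^-*-assoc 2 (k * p) 4)) ⟩
          (2 ^ (k * p)) ^ 4 ≡⟨ cong (_^ 4) (trans (cong (λ z → 2 ^ (z * p)) (sym l)) (sym (Geq Ts ok))) ⟩
          (G Ts * 2 ^ xs S Ts) ^ 4 ≡⟨ trans (^-* (G Ts) (2 ^ xs S Ts) 4) (cong (G Ts ^ 4 *_) (trans (^-*-assoc 2 (xs S Ts) 4) (cong (2 ^_) (*-comm (xs S Ts) 4)))) ⟩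
          G Ts ^ 4 * 2 ^ (4 * xs S Ts) ≤⟨ *-monoʳ-≤ (G Ts ^ 4) (^-monoʳ-≤ 2 le) ⟩
          G Ts ^ 4 * 2 ^ (k * a) ≡⟨ *-comm (G Ts ^ 4) _ ⟩
          2 ^ (k * a) * G Ts ^ 4 ∎

      -- The upper tail, with each face tilted by 2 to the number of its facets in `S`. That number
      -- is at most `D`, so the tilt is at most 2^D times it, and the sum is controlled by a·n
      -- incidences.
      many-inc : ∀ {P : List (List Face) → Set} (P? : ∀ Ts → Dec (P Ts)) → (∀ Ts → P Ts → b * (k * a) ≤ 4 * ns S Ts) →
        Ex k (λ Ts → ind? (P? Ts)) ^ 4 * 2 ^ (k * a) ≤ Z ^ (4 * k)
      many-inc P? h = *-cancel-pos (2 ^ (8 * D * 2 ^ D * (k * a))) _ _ (m^n>0 2 (8 * D * 2 ^ D * (k * a))) (begin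
        2 ^ (8 * D * 2 ^ D * (k * a)) * (E ^ 4 * 2 ^ (k * a)) ≡⟨ r1 (2 ^ (8 * D * 2 ^ D * (k * a))) (E ^ 4) (2 ^ (k * a)) ⟩
        E ^ 4 * (2 ^ (k * a) * 2 ^ (8 * D * 2 ^ D * (k * a))) ≡⟨ cong (E ^ 4 *_) (sym (^-distribˡ-+-* 2 (k * a) (8 * D * 2 ^ D * (k * a)))) ⟩
        E ^ 4 * 2 ^ (b * (k * a)) ≤⟨ markov-^ k P? G (2 ^ (b * (k * a))) 1 3 ≤-refl (λ Ts l ok pf → on Ts (h Ts pf)) ⟩
        1 * Ex k G ^ 4 ≡⟨ *-identityˡ _ ⟩
        Ex k G ^ 4 ≤⟨ ^-monoˡ-≤ 4 (≤-trans (≤-reflexive (Ex-cong k (λ Ts → ∏-cong∈ Ts (λ T _ → ∏-cong∈ T (λ t _ → sym (yeq t)))))) (mgf-k k y (D * 2 ^ D * a) ysum)) ⟩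
        (4 ^ (D * 2 ^ D * a * k) * Z ^ k) ^ 4 ≡⟨ trans (^-* (4 ^ (D * 2 ^ D * a * k)) (Z ^ k) 4) (cong₂ _*_ (trans (cong (_^ 4) (^-*-assoc 2 2 (D * 2 ^ D * a * k))) (trans (^-*-assoc 2 (2 * (D * 2 ^ D * a * k)) 4) (cong (2 ^_) (r2 D (2 ^ D) a k)))) (trans (^-*-assoc Z k 4) (cong (Z ^_) (*-comm k 4)))) ⟩
        2 ^ (8 * D * 2 ^ D * (k * a)) * Z ^ (4 * k) ∎)
        where
        open ≤-Reasoning
        E = Ex k (λ Ts → ind? (P? Ts))
        G : List (List Face) → ℕ
        G Ts = ∏ Ts (λ T → ∏ T (λ t → 2 ^ j S t))
        y : Face → ℕ
        y t = pred (2 ^ j S t)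
        yeq : ∀ t → 1 + y t ≡ 2 ^ j S t
        yeq t = suc-pred (2 ^ j S t) {{m^n≢0 2 (j S t)}}
        r1 : ∀ x E z → x * (E * z) ≡ E * (z * x)
        r1 = ringℕ
        r2 : ∀ D p a k → 2 * (D * p * a * k) * 4 ≡ 8 * D * p * (k * a)
        r2 = ringℕ
        Geq : ∀ Ts → G Ts ≡ 2 ^ ns S Ts
        Geq Ts = trans (∏-cong∈ Ts (λ T _ → ∏-2^ T (j S))) (∏-2^ Ts _)
        on : ∀ Ts → b * (k * a) ≤ 4 * ns S Ts → 2 ^ (b * (k * a)) ≤ 1 * G Ts ^ 4
        on Ts le = ≤-trans (^-monoʳ-≤ 2 le) (≤-reflexive (sym (trans (*-identityˡ _) (trans (cong (_^ 4) (Geq Ts)) (trans (^-*-assoc 2 (ns S Ts) 4) (cong (2 ^_) (*-comm (ns S Ts) 4)))))))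
        y≤ : ∀ t → t ∈ L → y t ≤ 2 ^ D * j S t
        y≤ t mt = go (j S t) (j≤D t mt)
          where go : ∀ x → x ≤ D → pred (2 ^ x) ≤ 2 ^ D * x
                go zero _ = z≤n
                go (suc x) le = ≤-trans pred[n]≤n (≤-trans (^-monoʳ-≤ 2 le) (m≤m*n (2 ^ D) (suc x)))
        ysum : ∑ L (λ t → D * y t) ≤ D * 2 ^ D * a * n
        ysum = begin
          ∑ L (λ t → D * y t) ≡⟨ ∑-* L D y ⟩
          D * ∑ L y ≤⟨ *-monoʳ-≤ D (∑-mono∈ L y≤) ⟩
          D * ∑ L (λ t → 2 ^ D * j S t) ≡⟨ cong (D *_) (trans (∑-* L (2 ^ D) (j S)) (cong (2 ^ D *_) (∑-swap L S (λ τ σ → bit (subᵇ σ τ))))) ⟩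
          D * (2 ^ D * ∑ S (λ σ → ∑ L (λ τ → bit (subᵇ σ τ)))) ≤⟨ *-monoʳ-≤ D (*-monoʳ-≤ (2 ^ D) (∑-≤-const S n (λ σ mσ → cofaces≤ σ dd (lv-size n dd (⊑-∈ S⊑ mσ))))) ⟩
          D * (2 ^ D * (a * n)) ≡⟨ r3 D (2 ^ D) a n ⟩
          D * 2 ^ D * a * n ∎
          where r3 : ∀ D p a n → D * (p * (a * n)) ≡ D * p * a * n
                r3 = ringℕ

      -- A high power of the first bound absorbs the constant lost in the second.

      u M₀ : ℕ
      u = 12 * (D * D * D) + 5
      M₀ = 4 * u + 3 * D

      Y : ℕ
      Y = 2 ^ (5 * a) * Q

      -- The exponent `M₀` is spent as 4·u on the first bound and 3·D on the second. The gain
      -- 2^(k·a·u) pays the loss 12·D³ and leaves 2^(5·a·k), the 5 being what `consts` later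
      -- requires; k ≥ `M₀`·D then allows the `M₀`-th root.
      interpolate : ∀ E → E ^ 4 * 2 ^ (k * a) ≤ Z ^ (4 * k) → E ^ (3 * D) * Q ^ k ≤ 2 ^ (12 * (D * D * D) * (a * k)) * Z ^ (k * (3 * D)) →
        M₀ * D ≤ k → E * Y ^ D ≤ Z ^ k
      interpolate E h₁ h₂ le = ^-cancel-≤ (pred M₀) _ _ (begin
        (E * Y ^ D) ^ M₀ ≡⟨ trans (^-* E (Y ^ D) M₀) (cong (E ^ M₀ *_) (trans (^-*-assoc Y D M₀) (cong (Y ^_) (*-comm D M₀)))) ⟩
        E ^ M₀ * Y ^ (M₀ * D) ≤⟨ *-monoʳ-≤ (E ^ M₀) (^-monoʳ-≤ Y {{>-nonZero Y-pos}} le) ⟩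
        E ^ M₀ * Y ^ k ≤⟨ *-cancel-pos c _ _ (m^n>0 2 (12 * (D * D * D) * (a * k))) step ⟩
        Z ^ (k * M₀) ≡⟨ ^-*-assoc Z k M₀ ⟨
        (Z ^ k) ^ M₀ ∎)
        where
        open ≤-Reasoning
        c = 2 ^ (12 * (D * D * D) * (a * k))
        Y-pos : 1 ≤ Y
        Y-pos = *-mono-≤ (m^n>0 2 (5 * a)) (∏-pos S q q-pos)
        r1 : ∀ c E F p Q → c * (E * F * (p * Q)) ≡ (E * (c * p)) * (F * Q)
        r1 = ringℕ
        r2 : ∀ D3 a k → 12 * D3 * (a * k) + 5 * a * k ≡ k * a * (12 * D3 + 5)
        r2 = ringℕ
        r3 : ∀ x y z → x * (y * z) ≡ y * (x * z)
        r3 = ringℕ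
        r4 : ∀ k u D → 4 * k * u + k * (3 * D) ≡ k * (4 * u + 3 * D)
        r4 = ringℕ
        step : c * (E ^ M₀ * Y ^ k) ≤ c * Z ^ (k * M₀)
        step = begin
          c * (E ^ M₀ * Y ^ k) ≡⟨ cong₂ (λ x y → c * (x * y)) (^-distribˡ-+-* E (4 * u) (3 * D)) (trans (^-* (2 ^ (5 * a)) Q k) (cong (_* Q ^ k) (^-*-assoc 2 (5 * a) k))) ⟩
          c * (E ^ (4 * u) * E ^ (3 * D) * (2 ^ (5 * a * k) * Q ^ k)) ≡⟨ r1 c (E ^ (4 * u)) (E ^ (3 * D)) (2 ^ (5 * a * k)) (Q ^ k) ⟩
          E ^ (4 * u) * (c * 2 ^ (5 * a * k)) * (E ^ (3 * D) * Q ^ k) ≡⟨ cong (_* (E ^ (3 * D) * Q ^ k)) (cong₂ _*_ (sym (^-*-assoc E 4 u)) (trans (sym (^-distribˡ-+-* 2 (12 * (D * D * D) * (a * k)) (5 * a * k))) (trans (cong (2 ^_) (r2 (D * D * D) a k)) (sym (^-*-assoc 2 (k * a) u))))) ⟩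
          (E ^ 4) ^ u * (2 ^ (k * a)) ^ u * (E ^ (3 * D) * Q ^ k) ≡⟨ cong (_* (E ^ (3 * D) * Q ^ k)) (sym (^-* (E ^ 4) (2 ^ (k * a)) u)) ⟩
          (E ^ 4 * 2 ^ (k * a)) ^ u * (E ^ (3 * D) * Q ^ k) ≤⟨ *-mono-≤ (^-monoˡ-≤ u h₁) h₂ ⟩
          (Z ^ (4 * k)) ^ u * (c * Z ^ (k * (3 * D))) ≡⟨ trans (cong (_* (c * Z ^ (k * (3 * D)))) (^-*-assoc Z (4 * k) u)) (r3 (Z ^ (4 * k * u)) c (Z ^ (k * (3 * D)))) ⟩
          c * (Z ^ (4 * k * u) * Z ^ (k * (3 * D))) ≡⟨ cong (c *_) (trans (sym (^-distribˡ-+-* Z (4 * k * u) (k * (3 * D)))) (cong (Z ^_) (r4 k u D))) ⟩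
          c * Z ^ (k * M₀) ∎

      Eᵇ : ℕ
      Eᵇ = Ex k (λ Ts → ind? (bad? k S Ts))

      Pa Pb : List (List Face) → Set
      Pa Ts = Bad k S Ts × 4 * xs S Ts ≤ k * a
      Pb Ts = Bad k S Ts × k * a < 4 * xs S Ts

      pa? : ∀ Ts → Dec (Pa Ts)
      pa? Ts = bad? k S Ts ×-dec (4 * xs S Ts ≤? k * a)

      pb? : ∀ Ts → Dec (Pb Ts)
      pb? Ts = bad? k S Ts ×-dec (k * a <? 4 * xs S Ts)

      -- A violation leaves two cases: either the odd faces are too few, or the incidences exceed
      -- b·k·a/4. The two Chernoff bounds cover them, and both cases share the estimate from even
      -- faces.
      bad-Y : n * a ≤ D * ∑ L (λ τ → bit (odd S τ)) → M₀ * D ≤ k → Eᵇ * Y ^ D ≤ 2 * Z ^ k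
      bad-Y cond le = begin
        Eᵇ * Y ^ D ≤⟨ *-monoˡ-≤ (Y ^ D) (≤-trans (Ex-mono k (λ Ts _ _ → split Ts)) (≤-reflexive (Ex-+ k (λ Ts → ind? (pa? Ts)) (λ Ts → ind? (pb? Ts))))) ⟩
        (Ea + Eb) * Y ^ D ≡⟨ *-distribʳ-+ (Y ^ D) Ea Eb ⟩
        Ea * Y ^ D + Eb * Y ^ D ≤⟨ +-mono-≤ (interpolate Ea (few-odd pa? cond (λ Ts → proj₂)) (even-bound pa? (λ Ts p → proj₂ (proj₂ (proj₁ p)))) le)
                                            (interpolate Eb (many-inc pb? manyᵇ) (even-bound pb? (λ Ts p → proj₂ (proj₂ (proj₁ p)))) le) ⟩
        Z ^ k + Z ^ k ≡⟨ cong (Z ^ k +_) (sym (+-identityʳ _)) ⟩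
        2 * Z ^ k ∎
        where
        open ≤-Reasoning
        Ea = Ex k (λ Ts → ind? (pa? Ts))
        Eb = Ex k (λ Ts → ind? (pb? Ts))
        split : ∀ Ts → ind? (bad? k S Ts) ≤ ind? (pa? Ts) + ind? (pb? Ts)
        split Ts with bad? k S Ts | 4 * xs S Ts ≤? k * a | k * a <? 4 * xs S Ts
        ... | no _ | _ | _ = z≤n
        ... | yes _ | yes _ | _ = s≤s z≤n
        ... | yes _ | no _ | yes _ = ≤-refl
        ... | yes _ | no p | no p' = ⊥-elim (p' (≰⇒> p))
        manyᵇ : ∀ Ts → Pb Ts → b * (k * a) ≤ 4 * ns S Ts
        manyᵇ Ts ((_ , lt , _) , gt) = begin
          b * (k * a) ≤⟨ *-monoʳ-≤ b (<⇒≤ gt) ⟩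
          b * (4 * xs S Ts) ≡⟨ r b (xs S Ts) ⟩
          4 * (b * xs S Ts) ≤⟨ *-monoʳ-≤ 4 (<⇒≤ lt) ⟩
          4 * ns S Ts ∎
          where r : ∀ b x → b * (4 * x) ≡ 4 * (b * x)
                r = ringℕ

      sdeg : Face → ℕ
      sdeg σ = suc (deg S σ)

      -- The source of the final factor 1/n. All but one factor are bounded by 2·D·n, and the
      -- remaining one by a + 1 ≤ 2^a, which saves a factor n even for the smallest sets.
      sdeg-prod : 1 ≤ a → n * ∏ S sdeg ≤ (4 * (D * n)) ^ a
      sdeg-prod 1≤a = go S refl (λ σ m → m)
        where
        open ≤-Reasoning
        deg≤a : ∀ σ → deg S σ ≤ a
        deg≤a σ = ≤-trans (∑-≤-const S 1 (λ τ _ → adj≤1 σ τ)) (≤-reflexive (*-identityʳ a))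
        go : ∀ M → M ≡ S → (∀ σ → σ ∈ M → σ ∈ S) → n * ∏ M sdeg ≤ (4 * (D * n)) ^ a
        go [] refl h = ⊥-elim (<-irrefl refl 1≤a)
        go (σ ∷ M) eq h = begin
          n * (sdeg σ * ∏ M sdeg) ≤⟨ *-monoʳ-≤ n (*-mono-≤ (≤-trans (s≤s (deg≤a σ)) (n<2^n a)) (≤-trans (∏-mono∈ M (λ τ m → sdeg≤ τ (h τ (there m)))) (≤-reflexive (∏-const M (2 * D * n))))) ⟩
          n * (2 ^ a * (2 * D * n) ^ length M) ≤⟨ *-monoˡ-≤ (2 ^ a * (2 * D * n) ^ length M) (m≤n*m n (2 * D)) ⟩
          2 * D * n * (2 ^ a * (2 * D * n) ^ length M) ≡⟨ r (2 * D * n) (2 ^ a) ((2 * D * n) ^ length M) ⟩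
          2 ^ a * (2 * D * n) ^ suc (length M) ≡⟨ cong (λ z → 2 ^ a * (2 * D * n) ^ z) (cong length eq) ⟩
          2 ^ a * (2 * D * n) ^ a ≡⟨ ^-* 2 (2 * D * n) a ⟨
          (2 * (2 * D * n)) ^ a ≡⟨ cong (_^ a) (r2 D n) ⟩
          (4 * (D * n)) ^ a ∎
          where r : ∀ x y z → x * (y * z) ≡ y * (x * z)
                r = ringℕ
                r2 : ∀ D n → 2 * (2 * D * n) ≡ 4 * (D * n)
                r2 = ringℕ

      Cond : Set
      Cond = 1 ≤ a × n * a ≤ D * ∑ L (λ τ → bit (odd S τ))

      bad-Ψ-no : ¬ Cond → n * Eᵇ * (2 * mᴱ) ^ a ≤ 2 * Z ^ k * Ψ S
      bad-Ψ-no ¬c = ≤-trans (≤-reflexive (trans (cong (λ z → n * z * (2 * mᴱ) ^ a) E0) (cong (_* (2 * mᴱ) ^ a) (*-zeroʳ n)))) z≤n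
        where
        E0 : Eᵇ ≡ 0
        E0 = trans (Ex-cong k (λ Ts → z Ts)) (Ex-0 k)
          where z : ∀ Ts → ind? (bad? k S Ts) ≡ 0
                z Ts with bad? k S Ts
                ... | no _ = refl
                ... | yes (c , _) = ⊥-elim (¬c c)

      -- Up to constants to the power a, `Q` is the product of n/(deg + 1), and it occurs to the
      -- power D = dd + 1. Of the powers of deg + 1, dd form `Ψ S`, as `entropy` requires, and the
      -- last one goes to `sdeg-prod`.
      bad-Ψ-yes : Cond → M₀ * D ≤ k → n * Eᵇ * (2 * mᴱ) ^ a ≤ 2 * Z ^ k * Ψ S
      bad-Ψ-yes (1≤a , cond) le = *-cancel-pos (w ^ a) _ _ (m^n>0 w a) (begin
        w ^ a * (n * Eᵇ * (2 * mᴱ) ^ a) ≡⟨ r1 (w ^ a) (n * Eᵇ) ((2 * mᴱ) ^ a) ⟩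
        n * Eᵇ * (w ^ a * (2 * mᴱ) ^ a) ≡⟨ cong (n * Eᵇ *_) (sym (^-* w (2 * mᴱ) a)) ⟩
        n * Eᵇ * (w * (2 * mᴱ)) ^ a ≤⟨ *-monoʳ-≤ (n * Eᵇ) (^-monoˡ-≤ a consts) ⟩
        n * Eᵇ * (2 ^ (5 * D) * (D * n) ^ D) ^ a ≡⟨ cong (n * Eᵇ *_) (trans (^-* (2 ^ (5 * D)) ((D * n) ^ D) a) (cong₂ _*_ (trans (^-*-assoc 2 (5 * D) a) (trans (cong (2 ^_) (r2 D a)) (sym (^-*-assoc 2 (5 * a) D)))) (trans (^-*-assoc (D * n) D a) (trans (cong ((D * n) ^_) (*-comm D a)) (sym (^-*-assoc (D * n) a D)))))) ⟩
        n * Eᵇ * ((2 ^ (5 * a)) ^ D * ((D * n) ^ a) ^ D) ≤⟨ *-monoʳ-≤ (n * Eᵇ) (*-monoʳ-≤ ((2 ^ (5 * a)) ^ D) (^-monoˡ-≤ D qs)) ⟩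
        n * Eᵇ * ((2 ^ (5 * a)) ^ D * (Q * (2 ^ a * ∏ S sdeg)) ^ D) ≡⟨ cong (n * Eᵇ *_) (trans (sym (^-* (2 ^ (5 * a)) (Q * (2 ^ a * ∏ S sdeg)) D)) (trans (cong (_^ D) (sym (*-assoc (2 ^ (5 * a)) Q _))) (^-* Y (2 ^ a * ∏ S sdeg) D))) ⟩
        n * Eᵇ * (Y ^ D * (2 ^ a * ∏ S sdeg) ^ D) ≡⟨ r3 n Eᵇ (Y ^ D) ((2 ^ a * ∏ S sdeg) ^ D) ⟩
        Eᵇ * Y ^ D * (n * (2 ^ a * ∏ S sdeg) ^ D) ≤⟨ *-monoˡ-≤ _ (bad-Y cond le) ⟩
        2 * Z ^ k * (n * (2 ^ a * ∏ S sdeg) ^ D) ≡⟨ cong (λ z → 2 * Z ^ k * (n * z)) (trans (^-* (2 ^ a) (∏ S sdeg) D) (cong₂ _*_ (trans (^-*-assoc 2 a D) (trans (cong (2 ^_) (*-comm a D)) (sym (^-*-assoc 2 D a)))) (cong (∏ S sdeg *_) (sym (∏-^ S sdeg dd))))) ⟩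
        2 * Z ^ k * (n * ((2 ^ D) ^ a * (∏ S sdeg * Ψ S))) ≡⟨ cong (2 * Z ^ k *_) (r4 n ((2 ^ D) ^ a) (∏ S sdeg) (Ψ S)) ⟩
        2 * Z ^ k * ((2 ^ D) ^ a * (n * ∏ S sdeg) * Ψ S) ≤⟨ *-monoʳ-≤ (2 * Z ^ k) (*-monoˡ-≤ (Ψ S) (*-monoʳ-≤ ((2 ^ D) ^ a) (sdeg-prod 1≤a))) ⟩
        2 * Z ^ k * ((2 ^ D) ^ a * (4 * (D * n)) ^ a * Ψ S) ≡⟨ cong (λ z → 2 * Z ^ k * (z * Ψ S)) (sym (^-* (2 ^ D) (4 * (D * n)) a)) ⟩
        2 * Z ^ k * (w ^ a * Ψ S) ≡⟨ r5 (2 * Z ^ k) (w ^ a) (Ψ S) ⟩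
        w ^ a * (2 * Z ^ k * Ψ S) ∎)
        where
        open ≤-Reasoning
        w = 2 ^ D * (4 * (D * n))
        instance w≢0 : NonZero w
                 w≢0 = >-nonZero (*-mono-≤ (m^n>0 2 D) (s≤s z≤n))
        r1 : ∀ x y z → x * (y * z) ≡ y * (x * z)
        r1 = ringℕ
        r2 : ∀ D a → 5 * D * a ≡ 5 * a * D
        r2 = ringℕ
        r3 : ∀ n E Y z → n * E * (Y * z) ≡ E * Y * (n * z)
        r3 = ringℕ
        r4 : ∀ n x p f → n * (x * (p * f)) ≡ x * (n * p) * f
        r4 = ringℕ
        r5 : ∀ x y z → x * (y * z) ≡ y * (x * z)
        r5 = ringℕ
        qs : (D * n) ^ a ≤ Q * (2 ^ a * ∏ S sdeg)
        qs = begin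
          (D * n) ^ a ≡⟨ ∏-const S (D * n) ⟨
          ∏ S (λ _ → D * n) ≤⟨ ∏-mono∈ S q-big ⟩
          ∏ S (λ σ → q σ * (2 * sdeg σ)) ≡⟨ trans (∏-* S q _) (cong (Q *_) (trans (∏-* S (λ _ → 2) sdeg) (cong (_* ∏ S sdeg) (∏-const S 2)))) ⟩
          Q * (2 ^ a * ∏ S sdeg) ∎
        consts : w * (2 * mᴱ) ≤ 2 ^ (5 * D) * (D * n) ^ D
        consts = begin
          2 ^ D * (4 * (D * n)) * (2 * (D * (8 * D * n) ^ dd)) ≡⟨ cong (λ z → 2 ^ D * (4 * (D * n)) * (2 * (D * z))) (trans (cong (_^ dd) (*-assoc 8 D n)) (^-* 8 (D * n) dd)) ⟩
          2 ^ D * (4 * (D * n)) * (2 * (D * (8 ^ dd * (D * n) ^ dd))) ≡⟨ r6 (2 ^ D) (D * n) D (8 ^ dd) ((D * n) ^ dd) ⟩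
          2 ^ D * D * (8 * 8 ^ dd) * (D * n * (D * n) ^ dd) ≤⟨ *-monoˡ-≤ (D * n * (D * n) ^ dd) (*-monoˡ-≤ (8 * 8 ^ dd) (*-monoʳ-≤ (2 ^ D) (<⇒≤ (n<2^n D)))) ⟩
          2 ^ D * 2 ^ D * 8 ^ D * (D * n) ^ D ≡⟨ cong (_* (D * n) ^ D) (trans (cong (2 ^ D * 2 ^ D *_) (^-*-assoc 2 3 D)) (trans (cong (_* 2 ^ (3 * D)) (sym (^-distribˡ-+-* 2 D D))) (trans (sym (^-distribˡ-+-* 2 (D + D) (3 * D))) (cong (2 ^_) (r7 D))))) ⟩
          2 ^ (5 * D) * (D * n) ^ D ∎
          where r6 : ∀ t x D e p → t * (4 * x) * (2 * (D * (e * p))) ≡ t * D * (8 * e) * (x * p)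
                r6 = ringℕ
                r7 : ∀ D → D + D + 3 * D ≡ 5 * D
                r7 = ringℕ

      bad-Ψ : M₀ * D ≤ k → n * Eᵇ * (2 * mᴱ) ^ a ≤ 2 * Z ^ k * Ψ S
      bad-Ψ le = by ((1 ≤? a) ×-dec (n * a ≤? D * ∑ L (λ τ → bit (odd S τ))))
        where by : Dec Cond → n * Eᵇ * (2 * mᴱ) ^ a ≤ 2 * Z ^ k * Ψ S
              by (yes c) = bad-Ψ-yes c le
              by (no ¬c) = bad-Ψ-no ¬c

  kᵈ : ℕ
  kᵈ = (4 * (12 * (D * D * D) + 5) + 3 * D) * D

  E3 : ℕ → List (List Face) → ℕ
  E3 k Ts = ∑ (sublists V) (λ S → ind? (bad? k S Ts))

  E3-bound : ∀ k → kᵈ ≤ k → n * Ex k (E3 k) ≤ 4 * Z ^ k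
  E3-bound k le = *-cancel-pos (M ^ N) _ _ (m^n>0 M N) (begin
    M ^ N * (n * Ex k (E3 k)) ≡⟨ cong (λ z → M ^ N * (n * z)) (Ex-∑ k (sublists V) (λ S Ts → ind? (bad? k S Ts))) ⟩
    M ^ N * (n * ∑ (sublists V) E) ≡⟨ trans (sym (*-assoc (M ^ N) n _)) (sym (∑-* (sublists V) (M ^ N * n) E)) ⟩
    ∑ (sublists V) (λ S → M ^ N * n * E S) ≤⟨ ∑-mono∈ (sublists V) (λ S mS → begin
        M ^ N * n * E S ≡⟨ cong (λ z → M ^ z * n * E S) (sym (m∸n+n≡m (length-⊑ (sublists-⊑ V S mS)))) ⟩
        M ^ (N ∸ length S + length S) * n * E S ≡⟨ cong (λ z → z * n * E S) (^-distribˡ-+-* M (N ∸ length S) (length S)) ⟩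
        M ^ (N ∸ length S) * M ^ length S * n * E S ≡⟨ r1 (M ^ (N ∸ length S)) (M ^ length S) n (E S) ⟩
        M ^ (N ∸ length S) * (n * E S * M ^ length S) ≤⟨ *-monoʳ-≤ (M ^ (N ∸ length S)) (bad-Ψ S (sublists-⊑ V S mS) k le) ⟩
        M ^ (N ∸ length S) * (2 * Z ^ k * Ψ S) ≡⟨ r2 (M ^ (N ∸ length S)) (2 * Z ^ k) (Ψ S) ⟩
        2 * Z ^ k * (Ψ S * M ^ (N ∸ length S)) ∎) ⟩
    ∑ (sublists V) (λ S → 2 * Z ^ k * (Ψ S * M ^ (N ∸ length S))) ≡⟨ ∑-* (sublists V) (2 * Z ^ k) _ ⟩
    2 * Z ^ k * ∑ (sublists V) (λ S → Ψ S * M ^ (N ∸ length S)) ≤⟨ *-monoʳ-≤ (2 * Z ^ k) entropy ⟩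
    2 * Z ^ k * (2 * M ^ N) ≡⟨ r3 (Z ^ k) (M ^ N) ⟩
    M ^ N * (4 * Z ^ k) ∎)
    where
    open ≤-Reasoning
    M = 2 * mᴱ
    N = length V
    instance M≢0 : NonZero M
             M≢0 = >-nonZero (*-mono-≤ {1} {2} (s≤s z≤n) (*-mono-≤ {1} {D} (s≤s z≤n) (m^n>0 (8 * D * n) dd)))
    E : List Face → ℕ
    E S = Ex k (λ Ts → ind? (bad? k S Ts))
    r1 : ∀ x y n E → x * y * n * E ≡ x * (n * E * y)
    r1 = ringℕ
    r2 : ∀ x y z → x * (y * z) ≡ y * (z * x)
    r2 = ringℕ
    r3 : ∀ z m → 2 * z * (2 * m) ≡ m * (4 * z)
    r3 = ringℕ

-- From the absence of rare events to expansion.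

search : {A : Set} {P : A → Set} → (∀ x → Dec (P x)) → (xs : List A) → All P xs ⊎ Σ A λ x → x ∈ xs × ¬ P x
search P? [] = inj₁ []
search P? (x ∷ xs) with P? x | search P? xs
... | no ¬p | _ = inj₂ (x , here refl , ¬p)
... | yes p | inj₁ ps = inj₁ (p ∷ ps)
... | yes _ | inj₂ (y , m , ¬p) = inj₂ (y , there m , ¬p)

argmin : {A : Set} (f : A → ℕ) (x : A) (xs : List A) → Σ A λ y → y ∈ (x ∷ xs) × (∀ z → z ∈ (x ∷ xs) → f y ≤ f z)
argmin f x [] = x , here refl , λ { z (here refl) → ≤-refl }
argmin f x (x' ∷ xs) = let y , m , h = argmin f x' xs in by y m h (f x ≤? f y)
  where
  by : ∀ y → y ∈ (x' ∷ xs) → (∀ z → z ∈ (x' ∷ xs) → f y ≤ f z) → Dec (f x ≤ f y) → Σ _ λ y → y ∈ (x ∷ x' ∷ xs) × (∀ z → z ∈ (x ∷ x' ∷ xs) → f y ≤ f z)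
  by y m h (yes le) = x , here refl , λ { z (here refl) → ≤-refl ; z (there mz) → ≤-trans le (h z mz) }
  by y m h (no nle) = y , there m , λ { z (here refl) → <⇒≤ (≰⇒> nle) ; z (there mz) → h z mz }

argmin∈ : {A : Set} (f : A → ℕ) {x : A} {xs : List A} → x ∈ xs → Σ A λ y → y ∈ xs × (∀ z → z ∈ xs → f y ≤ f z)
argmin∈ f {xs = x ∷ xs} _ = argmin f x xs

⊑-sublists : {A : Set} {T L : List A} → T ⊑ L → T ∈ sublists L
⊑-sublists nil = here refl
⊑-sublists (keep {x} p) = MemP.∈-++⁺ˡ (MemP.∈-map⁺ (x ∷_) (⊑-sublists p))
⊑-sublists (drop {x} {xs} {ys} p) = MemP.∈-++⁺ʳ (map (x ∷_) (sublists ys)) (⊑-sublists p)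

⊑-trans : {A : Set} {S T L : List A} → S ⊑ T → T ⊑ L → S ⊑ L
⊑-trans p (drop q) = drop (⊑-trans p q)
⊑-trans nil nil = nil
⊑-trans (keep p) (keep q) = keep (⊑-trans p q)
⊑-trans (drop p) (keep q) = drop (⊑-trans p q)

∑≡0 : {A : Set} (xs : List A) (f : A → ℕ) → ∑ xs f ≡ 0 → ∀ x → x ∈ xs → f x ≡ 0
∑≡0 (x ∷ xs) f e .x (here refl) = m+n≡0⇒m≡0 (f x) e
∑≡0 (x ∷ xs) f e y (there m) = ∑≡0 xs f (m+n≡0⇒n≡0 (f x) e) y m

ind?≡0 : {P : Set} (p : Dec P) → ind? p ≡ 0 → ¬ P
ind?≡0 (no ¬p) _ = ¬p

all-true : {A : Set} (p : A → Bool) (xs : List A) → (∀ x → x ∈ xs → p x ≡ true) → all p xs ≡ true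
all-true p [] h = refl
all-true p (x ∷ xs) h rewrite h x (here refl) = all-true p xs (λ y m → h y (there m))

foldr⊓≤ : ∀ x ys {y} → y ∈ ys → foldr _⊓_ x ys ≤ y
foldr⊓≤ x (y ∷ ys) (here refl) = m⊓n≤m y _
foldr⊓≤ x (z ∷ ys) (there m) = ≤-trans (m⊓n≤n z _) (foldr⊓≤ x ys m)

≤⇒≤ᵇ≡true : ∀ {m n} → m ≤ n → (m ≤ᵇ n) ≡ true
≤⇒≤ᵇ≡true {m} {n} le with m ≤ᵇ n | ≤⇒≤ᵇ le
... | true | _ = refl

factorial-mono : ∀ {i j} → i ≤ j → i ! ≤ j !
factorial-mono {zero} {j} _ = >-nonZero⁻¹ (j !) {{j !≢0}}
factorial-mono {suc i} {suc j} (s≤s le) = *-mono-≤ (s≤s le) (factorial-mono le)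

Pick-memb : ∀ {n} {σ : Subset n} {S' S} → Pick σ S' S → ∀ η → η ≢ σ → memb η S ≡ memb η S'
Pick-memb {σ = σ} hit η ne with η ≟ₛ σ in eq
... | true = ⊥-elim (ne (≟ₛ-sound η σ eq))
... | false = refl
Pick-memb (skip {x} p) η ne = cong ((η ≟ₛ x) ∨_) (Pick-memb p η ne)

module Deterministic (m e : ℕ) (D≤n : suc (suc e) ≤ suc (suc m)) where

  open BadSets m e D≤n public

  uV : Unique V
  uV = lv-unique n dd

  uL : Unique L
  uL = lv-unique n D

  χ : List Face → Face → Bool
  χ S σ = memb σ S

  odd-χ : ∀ {s} {S} → S ⊑ lv n s → ∀ τ → ∣ τ ∣ ≡ suc s → oddB (j S τ) ≡ cob₂ (χ S) τ
  odd-χ {s} {S} p τ sz = trans (cong oddB (trans (∑-memb p (lv-unique n s) _) (∑-cong (lv n s) (λ σ → *-comm (bit (memb σ S)) _)))) (odd-cob₂ (χ S) s τ sz)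

  -- Least cardinality in the coset of F₂-coboundaries. The competitors are given by arbitrary
  -- Boolean functions, so no representation by lists interferes.
  CM : List Face → Set
  CM S = ∀ (g : Face → Bool) → length S ≤ ∑ V (λ σ → bit (χ S σ xor cob₂ g σ))

  -- For every vertex v the contraction of the coboundary lies in the coset, so it has at least |S|
  -- members. Summed over v, each odd face is counted at most `D` times.
  CM-expansion : ∀ S → S ⊑ V → CM S → n * length S ≤ D * ∑ L (λ τ → bit (odd S τ))
  CM-expansion S S⊑ cm = begin
    n * length S ≡⟨ trans (cong (_* length S) (sym (length-vs n))) (sym (∑-const (vs n) (length S))) ⟩
    ∑ (vs n) (λ _ → length S) ≤⟨ ∑-mono (vs n) (λ v → cm (ι v (χ S))) ⟩
    ∑ (vs n) (λ v → ∑ V (λ σ → bit (χ S σ xor cob₂ (ι v (χ S)) σ))) ≡⟨ ∑-cong (vs n) (λ v → trans (∑-cong V (λ σ → cong bit (homotopy v (χ S) σ))) (∑-*1 V _)) ⟩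
    ∑ (vs n) (λ v → ∑ V (λ σ → bit (ι v (cob₂ (χ S)) σ) * 1)) ≡⟨ ι-sum n dd (cob₂ (χ S)) (λ _ → 1) ⟩
    ∑ L (λ η → bit (cob₂ (χ S) η) * ∑ V (λ σ → bit (subᵇ σ η) * 1)) ≤⟨ ∑-mono∈ L (λ η mη → *-mono-≤ (≤-reflexive (cong bit (sym (odd-χ S⊑ η (lv-size n D mη))))) (≤-trans (≤-reflexive (sym (∑-*1 V _))) (facetsV η mη))) ⟩
    ∑ L (λ η → bit (odd S η) * D) ≡⟨ trans (∑-cong L (λ η → *-comm (bit (odd S η)) D)) (∑-* L D _) ⟩
    D * ∑ L (λ τ → bit (odd S τ)) ∎
    where open ≤-Reasoning

  -- Deleting σ lowers the cardinality of `S` by one and that of any translate by at most one.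
  CM-Pick : ∀ {σ S' S} → Pick σ S' S → S ⊑ V → CM S → CM S'
  CM-Pick {σ} {S'} {S} p S⊑ cm g = +-cancelʳ-≤ 1 _ _ (begin
    length S' + 1 ≡⟨ trans (+-comm (length S') 1) (sym (Pick-length p)) ⟩
    length S ≤⟨ cm g ⟩
    ∑ V (λ η → bit (χ S η xor cob₂ g η)) ≤⟨ ∑-mono V point ⟩
    ∑ V (λ η → bit (χ S' η xor cob₂ g η) + bit (η ≟ₛ σ)) ≡⟨ ∑-+ V _ _ ⟩
    ∑ V (λ η → bit (χ S' η xor cob₂ g η)) + ∑ V (λ η → bit (η ≟ₛ σ)) ≤⟨ +-monoʳ-≤ _ (once V uV) ⟩
    ∑ V (λ η → bit (χ S' η xor cob₂ g η)) + 1 ∎)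
    where
    open ≤-Reasoning
    point : ∀ η → bit (χ S η xor cob₂ g η) ≤ bit (χ S' η xor cob₂ g η) + bit (η ≟ₛ σ)
    point η with η ≟ₛ σ in eq
    ... | true = ≤-trans (bit≤1 _) (m≤n+m 1 _)
    ... | false = ≤-reflexive (trans (cong (λ b → bit (b xor cob₂ g η)) (Pick-memb p η (λ { refl → contra (trans (sym eq) (≟ₛ-refl η)) }))) (sym (+-identityʳ _)))
      where contra : false ≢ true
            contra ()
    once : ∀ M → Unique M → ∑ M (λ η → bit (η ≟ₛ σ)) ≤ 1
    once [] _ = z≤n
    once (x ∷ M) (u ∷ us) with x ≟ₛ σ in eq
    ... | false = once M us
    ... | true = ≤-reflexive (cong suc (∑-zero M off))
      where off : ∀ η → η ∈ M → bit (η ≟ₛ σ) ≡ 0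
            off η mη with η ≟ₛ σ in eq'
            ... | false = refl
            ... | true = ⊥-elim (All.lookup u mη (trans (≟ₛ-sound x σ eq) (sym (≟ₛ-sound η σ eq'))))

  Good : List Face → Set
  Good T = T ⊑ L × (∀ σ → σ ∈ V → 1 ≤ degT T σ)

  -- Deleting σ flips the parity of exactly the faces through σ.
  flip : ∀ {σ S' S} → Pick σ S' S → ∀ τ → bit (odd S' τ) + bit (subᵇ σ τ) * bit (odd S τ) ≡ bit (odd S τ) + ev S σ τ
  flip {σ} {S'} {S} p τ rewrite Pick-∑ p (λ σ → bit (subᵇ σ τ)) with subᵇ σ τ
  ... | false = refl
  ... | true rewrite oddB-suc (j S' τ) with oddB (j S' τ)
  ...   | true = refl
  ...   | false = refl

  -- A violated S stays violated when a member covered evenly fewer than k/3 times is deleted.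
  descend : ∀ k Ts → length Ts ≡ k → All Good Ts → ∀ {σ S' S} → Pick σ S' S → S ⊑ V → ¬ (k ≤ 3 * evs S Ts σ) → b * xs S Ts < ns S Ts → b * xs S' Ts < ns S' Ts
  descend k Ts len good {σ} {S'} {S} p S⊑ few lt = by (b * xs S' Ts <? ns S' Ts)
    where
    open ≤-Reasoning
    o = ∑ Ts (λ T → ∑ T (λ τ → bit (subᵇ σ τ) * bit (odd S τ)))
    ee = evs S Ts σ
    b' = 8 * D * 2 ^ D
    eq1 : xs S' Ts + o ≡ xs S Ts + ee
    eq1 = trans (sym (∑-+ Ts _ _)) (trans (∑-cong Ts (λ T → trans (sym (∑-+ T _ _)) (trans (∑-cong T (flip p)) (∑-+ T _ _)))) (∑-+ Ts _ _))
    eq2 : ns S Ts ≡ degs Ts σ + ns S' Ts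
    eq2 = trans (∑-cong Ts (λ T → trans (∑-cong T (λ τ → Pick-∑ p (λ σ → bit (subᵇ σ τ)))) (∑-+ T _ _))) (∑-+ Ts _ _)
    eq3 : degs Ts σ ≡ o + ee
    eq3 = trans (∑-cong Ts (λ T → trans (∑-cong T (λ τ → sp (bit (subᵇ σ τ)) (odd S τ))) (∑-+ T _ _))) (∑-+ Ts _ _)
      where sp : ∀ x c → x ≡ x * bit c + x * bit (not c)
            sp x true = sym (trans (cong₂ _+_ (*-identityʳ x) (*-zeroʳ x)) (+-identityʳ x))
            sp x false = sym (cong₂ _+_ (*-zeroʳ x) (*-identityʳ x))
    k≤ : k ≤ o + ee
    k≤ = subst₂ _≤_ (trans (trans (∑-const Ts 1) (*-identityʳ _)) len) eq3 (∑-mono∈ Ts (λ T mT → proj₂ (All.lookup good mT) σ (⊑-∈ S⊑ (Pick-∈ p))))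
    -- Every tree has a face through σ, so o + ee ≥ k > 3·ee.
    2e<o : 2 * ee < o
    2e<o = +-cancelʳ-< ee _ _ (begin-strict
      2 * ee + ee ≡⟨ r ee ⟩
      3 * ee <⟨ ≰⇒> few ⟩
      k ≤⟨ k≤ ⟩
      o + ee ∎)
      where r : ∀ x → 2 * x + x ≡ 3 * x
            r = ringℕ
    by : Dec (b * xs S' Ts < ns S' Ts) → b * xs S' Ts < ns S' Ts
    by (yes q) = q
    -- The deletion lowers `xs` by o - ee, more than o/2, and `ns` by o + ee, less than 3·o/2. A
    -- factor b of at least 3 therefore keeps the inequality strict.
    by (no ¬q) = ⊥-elim (<-irrefl refl (begin-strict
      b' * o + b * (xs S Ts) + o <⟨ +-monoˡ-< o (+-monoʳ-< (b' * o) lt) ⟩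
      b' * o + ns S Ts + o ≡⟨ cong (λ z → b' * o + z + o) (trans eq2 (cong (_+ ns S' Ts) eq3)) ⟩
      b' * o + (o + ee + ns S' Ts) + o ≤⟨ +-monoˡ-≤ o (+-monoʳ-≤ (b' * o) (+-monoʳ-≤ (o + ee) (≮⇒≥ ¬q))) ⟩
      b' * o + (o + ee + b * xs S' Ts) + o ≡⟨ r1 b' o ee (xs S' Ts) ⟩
      b * (xs S' Ts + o) + ee + o ≡⟨ cong (λ z → b * z + ee + o) eq1 ⟩
      b * (xs S Ts + ee) + ee + o ≡⟨ r2 b' (xs S Ts) ee o ⟩
      (b' * ee + 2 * ee) + b * xs S Ts + o ≤⟨ +-monoˡ-≤ o (+-monoˡ-≤ (b * xs S Ts) (begin
        b' * ee + 2 * ee ≤⟨ +-monoʳ-≤ (b' * ee) (*-monoˡ-≤ ee 2≤b') ⟩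
        b' * ee + b' * ee ≡⟨ r3 b' ee ⟩
        b' * (2 * ee) ≤⟨ *-monoʳ-≤ b' (<⇒≤ 2e<o) ⟩
        b' * o ∎)) ⟩
      b' * o + b * xs S Ts + o ∎))
      where
      2≤b' : 2 ≤ b'
      2≤b' = ≤-trans (s≤s (s≤s z≤n)) (≤-trans (m≤m*n 8 D) (m≤m*n (8 * D) (2 ^ D) {{m^n≢0 2 D}}))
      r1 : ∀ b' o e x → b' * o + (o + e + suc b' * x) + o ≡ suc b' * (x + o) + e + o
      r1 = ringℕ
      r2 : ∀ b' x e o → suc b' * (x + e) + e + o ≡ (b' * e + 2 * e) + suc b' * x + o
      r2 = ringℕ
      r3 : ∀ b' e → b' * e + b' * e ≡ b' * (2 * e)
      r3 = ringℕ

  -- Induction on the cardinality. The empty set has no incidences and cannot satisfy the strict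
  -- violation, so the deletions stop at a nonempty set.
  find-bad : ∀ k Ts → length Ts ≡ k → All Good Ts → ∀ l S → length S ≡ l → S ⊑ V → CM S → b * xs S Ts < ns S Ts → Σ (List Face) λ S* → S* ⊑ V × Bad k S* Ts
  find-bad k Ts len good l S lenS S⊑ cm lt with search (λ σ → k ≤? 3 * evs S Ts σ) S
  find-bad k Ts len good l [] lenS S⊑ cm lt | inj₁ al = ⊥-elim (n≮0 (<-≤-trans lt (≤-reflexive (∑-zero Ts (λ T _ → ∑-0 T)))))
  find-bad k Ts len good l S@(_ ∷ _) lenS S⊑ cm lt | inj₁ al = S , S⊑ , (s≤s z≤n , CM-expansion S S⊑ cm) , lt , al
  find-bad k Ts len good zero [] lenS S⊑ cm lt | inj₂ (σ , () , few)
  find-bad k Ts len good (suc l) S lenS S⊑ cm lt | inj₂ (σ , mσ , few) = let S' , p = ∈-Pick mσ in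
    find-bad k Ts len good l S' (suc-injective (trans (sym (Pick-length p)) lenS)) (⊑-trans (Pick-⊑ p) S⊑) (CM-Pick p S⊑ cm) (descend k Ts len good p S⊑ few lt)

  no-bad : ∀ k Ts → length Ts ≡ k → All Good Ts → E3 k Ts ≡ 0 → ∀ S → S ⊑ V → CM S → ns S Ts ≤ b * xs S Ts
  no-bad k Ts len good e3 S S⊑ cm with ns S Ts ≤? b * xs S Ts
  ... | yes le = le
  ... | no nle = let S* , p , bd = find-bad k Ts len good (length S) S refl S⊑ cm (≰⇒> nle) in
    ⊥-elim (ind?≡0 (bad? k S* Ts) (∑≡0 (sublists V) _ e3 S* (⊑-sublists p)) bd)

  -- The probabilistic bounds count faces with multiplicity in the trees, whereas expansion counts
  -- them once. Without overloaded faces the two sums of a nonnegative function differ by a factor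
  -- of at most `D`.
  module Union (Ts : List (List Face)) (K : List Face) (K⊑ : K ⊑ L) (Ts⊑ : ∀ T → T ∈ Ts → T ⊑ L)
    (K-sub : ∀ τ → τ ∈ L → bit (memb τ K) ≤ mult τ Ts) (K-sup : ∀ T → T ∈ Ts → ∀ τ → τ ∈ L → memb τ T ≡ true → memb τ K ≡ true) (e2 : E2 Ts ≡ 0) where

    ∑Ts : ∀ h → ∑ Ts (λ T → ∑ T h) ≡ ∑ L (λ τ → mult τ Ts * h τ)
    ∑Ts h = begin-equality
      ∑ Ts (λ T → ∑ T h) ≡⟨ ∑-cong∈ Ts (λ T mT → ∑-memb (Ts⊑ T mT) uL h) ⟩
      ∑ Ts (λ T → ∑ L (λ τ → bit (memb τ T) * h τ)) ≡⟨ ∑-swap Ts L (λ T τ → bit (memb τ T) * h τ) ⟩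
      ∑ L (λ τ → ∑ Ts (λ T → bit (memb τ T) * h τ)) ≡⟨ ∑-cong L (λ τ → trans (∑-cong Ts (λ T → *-comm (bit (memb τ T)) (h τ))) (trans (∑-* Ts (h τ) _) (*-comm (h τ) _))) ⟩
      ∑ L (λ τ → mult τ Ts * h τ) ∎
      where open ≤-Reasoning

    K≤ : ∀ h → ∑ K h ≤ ∑ Ts (λ T → ∑ T h)
    K≤ h = begin
      ∑ K h ≡⟨ ∑-memb K⊑ uL h ⟩
      ∑ L (λ τ → bit (memb τ K) * h τ) ≤⟨ ∑-mono∈ L (λ τ mτ → *-monoˡ-≤ (h τ) (K-sub τ mτ)) ⟩
      ∑ L (λ τ → mult τ Ts * h τ) ≡⟨ ∑Ts h ⟨
      ∑ Ts (λ T → ∑ T h) ∎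
      where open ≤-Reasoning

    ≤K : ∀ h → ∑ Ts (λ T → ∑ T h) ≤ D * ∑ K h
    ≤K h = begin
      ∑ Ts (λ T → ∑ T h) ≡⟨ ∑Ts h ⟩
      ∑ L (λ τ → mult τ Ts * h τ) ≤⟨ ∑-mono∈ L (λ τ mτ → *-monoˡ-≤ (h τ) (mb τ mτ)) ⟩
      ∑ L (λ τ → D * bit (memb τ K) * h τ) ≡⟨ trans (∑-cong L (λ τ → *-assoc D (bit (memb τ K)) (h τ))) (∑-* L D _) ⟩
      D * ∑ L (λ τ → bit (memb τ K) * h τ) ≡⟨ cong (D *_) (sym (∑-memb K⊑ uL h)) ⟩
      D * ∑ K h ∎
      where
      open ≤-Reasoning
      mb : ∀ τ → τ ∈ L → mult τ Ts ≤ D * bit (memb τ K)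
      mb τ mτ with memb τ K in eq
      ... | true = ≤-trans (≮⇒≥ (ind?≡0 (D <? mult τ Ts) (∑≡0 L _ e2 τ mτ))) (≤-reflexive (sym (*-identityʳ D)))
      ... | false = ≤-trans (≤-reflexive (∑-zero Ts (λ T mT → z T mT))) z≤n
        where z : ∀ T → T ∈ Ts → bit (memb τ T) ≡ 0
              z T mT with memb τ T in eq'
              ... | false = refl
              ... | true = ⊥-elim (contra (trans (sym eq) (K-sup T mT τ mτ eq')))
                where contra : false ≢ true
                      contra ()

    degK-∑ : ∀ σ → degK K σ ≡ ∑ K (λ τ → bit (subᵇ σ τ))
    degK-∑ σ = trans (countB-∑ (λ τ → σ ⊆ᵇ τ) K) (∑-cong K (λ τ → cong bit (⊆ᵇ≡subᵇ σ τ)))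

    degK≤degs : ∀ σ → degK K σ ≤ degs Ts σ
    degK≤degs σ = ≤-trans (≤-reflexive (degK-∑ σ)) (K≤ _)

    degs≤degK : ∀ σ → degs Ts σ ≤ D * degK K σ
    degs≤degK σ = ≤-trans (≤K _) (≤-reflexive (cong (D *_) (sym (degK-∑ σ))))

    degK-self : ∀ τ → τ ∈ K → 1 ≤ degK K τ
    degK-self τ mτ = subst (1 ≤_) (sym (degK-∑ τ)) (go mτ)
      where go : ∀ {M} → τ ∈ M → 1 ≤ ∑ M (λ τ' → bit (subᵇ τ τ'))
            go (here refl) = ≤-trans (≤-reflexive (cong bit (sym (subᵇ-refl τ)))) (m≤m+n _ _)
            go (there {x} m) = ≤-trans (go m) (m≤n+m _ (bit (subᵇ τ x)))

    Dsum-bfilter : ∀ (p : Face → Bool) M → Dsum K (bfilter p M) ≡ ∑ M (λ σ → bit (p σ) * degK K σ)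
    Dsum-bfilter p M = trans (sum-map (bfilter p M) (degK K)) (∑-bfilter p M (degK K))

    module Cochain (p q : ℕ) where
      open Expansion n dd K p q

      level-low : ∀ s → s ≤ dd → lev s ≡ lv n s
      level-low s le = trans (cong (λ b → if b then K else sizeLevel n s) (ne s (suc dd) (s≤s le))) (sizeLevel≡lv n s)
        where ne : ∀ s t → s < t → (s ≡ᵇ t) ≡ false
              ne zero (suc t) _ = refl
              ne (suc s) (suc t) (s≤s lt) = ne s t lt

      level-top : lev (suc dd) ≡ K
      level-top = cong (λ b → if b then K else sizeLevel n (suc dd)) (same (suc dd))
        where same : ∀ k → (k ≡ᵇ k) ≡ true
              same zero = refl
              same (suc k) = same k

      odd-list : ∀ {s} {F} → F ⊑ lv n s → ∀ τ → ∣ τ ∣ ≡ suc s → oddB (countB (λ σ → σ ⊆ᵇ τ) F) ≡ cob₂ (χ F) τ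
      odd-list {s} {F} F⊑ τ sz = trans (cong oddB (trans (countB-∑ (λ σ → σ ⊆ᵇ τ) F) (∑-cong F (λ σ → cong bit (⊆ᵇ≡subᵇ σ τ))))) (odd-χ F⊑ τ sz)

      shift : List Face → (Face → Bool) → Face → Bool
      shift F g σ = χ F σ xor cob₂ g σ

      -- Any Boolean function on the level below gives a competitor for the minimum: its support is
      -- one of the enumerated lists, and its list coboundary agrees with `cob₂`.
      minD≤ : ∀ s → s < dd → ∀ F → (g : Face → Bool) → minD (suc s) F ≤ Dsum K (bfilter (shift F g) (lv n (suc s)))
      minD≤ s lt F g = foldr⊓≤ (Dsum K F) (map (Dsum K) (coset (suc s) F)) (MemP.∈-map⁺ (Dsum K) (subst (_∈ coset (suc s) F) eq (MemP.∈-map⁺ (λ g → plusC (lev (suc s)) F (δ (lev (suc s)) g)) mem)))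
        where
        G : List Face
        G = bfilter g (lv n s)
        G⊑ : G ⊑ lv n s
        G⊑ = sublists-⊑ _ _ (bfilter-sublist g (lv n s))
        mem : G ∈ sublists (lev s)
        mem = subst (λ z → G ∈ sublists z) (sym (level-low s (<⇒≤ lt))) (bfilter-sublist g (lv n s))
        eq : plusC (lev (suc s)) F (δ (lev (suc s)) G) ≡ bfilter (shift F g) (lv n (suc s))
        eq = trans (cong (λ z → plusC z F (δ z G)) (level-low (suc s) lt)) (bfilter-cong∈ (lv n (suc s)) (λ σ mσ → cong (memb σ F xor_)
          (trans (memb-bfilter _ (lv n (suc s)) mσ) (trans (odd-list G⊑ σ (lv-size n (suc s) mσ)) (cob₂-level s (λ ρ sz → memb-bfilter g (lv n s) (size⇒∈lv ρ sz)) σ (lv-size n (suc s) mσ))))))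

      -- The representative minimises cardinality rather than the degree-weighted norm, so that the
      -- choice does not depend on the trees. Its weighted norm still bounds `minD` from above, and
      -- its odd faces are those of `F`.
      top-level : ∀ k → length Ts ≡ k → All Good Ts → E3 k Ts ≡ 0 → ∀ F → F ⊑ V → minD dd F ≤ b * D * Dsum K (δ (lev (suc dd)) F)
      top-level k len good e3 F F⊑ = begin
        minD dd F ≤⟨ minD≤ e (n<1+n e) F g₀ ⟩
        Dsum K A ≡⟨ trans (sum-map A (degK K)) (∑-cong A degK-∑) ⟩
        ∑ A (λ σ → ∑ K (λ τ → bit (subᵇ σ τ))) ≡⟨ ∑-swap A K (λ σ τ → bit (subᵇ σ τ)) ⟩
        ∑ K (j A) ≤⟨ K≤ (j A) ⟩
        ns A Ts ≤⟨ no-bad k Ts len good e3 A A⊑ cm ⟩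
        b * xs A Ts ≤⟨ *-monoʳ-≤ b (≤K (λ τ → bit (odd A τ))) ⟩
        b * (D * ∑ K (λ τ → bit (odd A τ))) ≡⟨ *-assoc b D (∑ K (λ τ → bit (odd A τ))) ⟨
        b * D * ∑ K (λ τ → bit (odd A τ)) ≤⟨ *-monoʳ-≤ (b * D) (≤-trans (∑-mono∈ K point) (≤-reflexive (sym (trans (cong (λ z → Dsum K (δ z F)) level-top) (Dsum-bfilter _ K))))) ⟩
        b * D * Dsum K (δ (lev (suc dd)) F) ∎
        where
        open ≤-Reasoning
        size : (Face → Bool) → ℕ
        size g = ∑ V (λ σ → bit (shift F g σ))
        best = argmin∈ (λ G → size (χ G)) (bfilter-sublist (λ _ → true) (lv n e))
        G₀ = proj₁ best
        g₀ = χ G₀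
        A = bfilter (shift F g₀) V
        A⊑ : A ⊑ V
        A⊑ = sublists-⊑ _ _ (bfilter-sublist (shift F g₀) V)
        lenA : length A ≡ size g₀
        lenA = countB-∑ (shift F g₀) V
        χA : ∀ σ → ∣ σ ∣ ≡ dd → χ A σ ≡ shift F g₀ σ
        χA σ sz = memb-bfilter (shift F g₀) V (size⇒∈lv σ sz)
        cm : CM A
        cm g = begin
          length A ≡⟨ lenA ⟩
          size g₀ ≤⟨ proj₂ (proj₂ best) G₁ (bfilter-sublist g₁ (lv n e)) ⟩
          size (χ G₁) ≡⟨ ∑-cong∈ V (λ σ mσ → cong bit (trans (cong (χ F σ xor_) (trans (cob₂-level e (λ ρ sz → memb-bfilter g₁ (lv n e) (size⇒∈lv ρ sz)) σ (lv-size n dd mσ)) (cob₂-xor g₀ g σ)))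
              (trans (sym (BoolP.xor-assoc (χ F σ) (cob₂ g₀ σ) (cob₂ g σ))) (cong (_xor cob₂ g σ) (sym (χA σ (lv-size n dd mσ))))))) ⟩
          ∑ V (λ σ → bit (χ A σ xor cob₂ g σ)) ∎
          where
          g₁ : Face → Bool
          g₁ σ = g₀ σ xor g σ
          G₁ = bfilter g₁ (lv n e)
        point : ∀ τ → τ ∈ K → bit (odd A τ) ≤ bit (oddB (countB (λ σ → σ ⊆ᵇ τ) F)) * degK K τ
        point τ mτ = ≤-trans (≤-reflexive (trans (cong bit same) (sym (*-identityʳ _)))) (*-monoʳ-≤ (bit (oddB (countB (λ σ → σ ⊆ᵇ τ) F))) (degK-self τ mτ))
          where
          sz = lv-size n D (⊑-∈ K⊑ mτ)
          same : odd A τ ≡ oddB (countB (λ σ → σ ⊆ᵇ τ) F)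
          same = trans (odd-χ A⊑ τ sz) (trans (cob₂-level dd χA τ sz) (trans (cob₂-xor (χ F) (cob₂ g₀) τ) (trans (cong (cob₂ (χ F) τ xor_) (cob₂-cob₂ g₀ τ)) (trans (BoolP.xor-identityʳ _) (sym (odd-list F⊑ τ sz))))))

      -- The power of 2 comes from n ≤ 2·(n - dd), and the factorial from bounding a binomial
      -- coefficient below by a power.
      C₂ C₁ : ℕ
      C₂ = 2 ^ dd * dd !
      C₁ = D * suc (2 * D) * (C₂ * D * D)

      -- Every face of dimension d-1 lies in a top face of each tree, while a top face contains at
      -- most `D` of them. Counting the (d-1)-faces through η therefore bounds the degree of η from
      -- below.
      low-deg : 2 * dd ≤ n → All Good Ts → ∀ s i → suc s + i ≡ dd → ∀ η → ∣ η ∣ ≡ suc s → length Ts * n ^ i ≤ C₂ * D * D * degK K η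
      low-deg 2d≤n good s i eq η sz = begin
        length Ts * n ^ i ≡⟨ ∑-const Ts (n ^ i) ⟨
        ∑ Ts (λ _ → n ^ i) ≤⟨ ∑-mono∈ Ts (λ T mT → each T (All.lookup good mT)) ⟩
        ∑ Ts (λ T → C₂ * D * degT T η) ≡⟨ ∑-* Ts (C₂ * D) _ ⟩
        C₂ * D * degs Ts η ≤⟨ *-monoʳ-≤ (C₂ * D) (degs≤degK η) ⟩
        C₂ * D * (D * degK K η) ≡⟨ *-assoc (C₂ * D) D (degK K η) ⟨
        C₂ * D * D * degK K η ∎
        where
        open ≤-Reasoning
        i≤dd : i ≤ dd
        i≤dd = subst (i ≤_) eq (m≤n+m i (suc s))
        half : n ≤ 2 * (n ∸ dd)
        half = begin
          n ≡⟨ m+n∸n≡m n n ⟨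
          n + n ∸ n ≤⟨ ∸-monoʳ-≤ (n + n) 2d≤n ⟩
          n + n ∸ 2 * dd ≡⟨ cong (_∸ 2 * dd) (cong (n +_) (sym (+-identityʳ n))) ⟩
          2 * n ∸ 2 * dd ≡⟨ *-distribˡ-∸ 2 n dd ⟨
          2 * (n ∸ dd) ∎
        cV = ∑ V (λ σ → bit (subᵇ η σ))
        count : n ^ i ≤ C₂ * cV
        count = begin
          n ^ i ≤⟨ ^-monoˡ-≤ i half ⟩
          (2 * (n ∸ dd)) ^ i ≡⟨ ^-* 2 (n ∸ dd) i ⟩
          2 ^ i * (n ∸ dd) ^ i ≡⟨ cong (λ z → 2 ^ i * z ^ i) (trans (cong (n ∸_) (sym eq)) (sym (∸-+-assoc n (suc s) i))) ⟩
          2 ^ i * (n ∸ suc s ∸ i) ^ i ≤⟨ *-mono-≤ (^-monoʳ-≤ 2 i≤dd) (^≤C (n ∸ suc s) i) ⟩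
          2 ^ dd * (i ! * ((n ∸ suc s) C i)) ≤⟨ *-monoʳ-≤ (2 ^ dd) (*-monoˡ-≤ ((n ∸ suc s) C i) (factorial-mono i≤dd)) ⟩
          2 ^ dd * (dd ! * ((n ∸ suc s) C i)) ≡⟨ *-assoc (2 ^ dd) (dd !) ((n ∸ suc s) C i) ⟨
          C₂ * ((n ∸ suc s) C i) ≡⟨ cong (C₂ *_) (sym (trans (cong (λ z → ∑ (lv n z) (λ σ → bit (subᵇ η σ))) (sym eq)) (cofaces-C η (suc s) i sz))) ⟩
          C₂ * cV ∎
        each : ∀ T → Good T → n ^ i ≤ C₂ * D * degT T η
        each T (T⊑ , dpos) = ≤-trans count (≤-trans (*-monoʳ-≤ C₂ (begin
          cV ≤⟨ ∑-mono∈ V (λ σ mσ → ≤-trans (≤-reflexive (sym (*-identityʳ _))) (*-monoʳ-≤ (bit (subᵇ η σ)) (dpos σ mσ))) ⟩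
          ∑ V (λ σ → bit (subᵇ η σ) * degT T σ) ≡⟨ trans (∑-cong V (λ σ → sym (∑-* T (bit (subᵇ η σ)) _))) (∑-swap V T (λ σ τ → bit (subᵇ η σ) * bit (subᵇ σ τ))) ⟩
          ∑ T (λ τ → ∑ V (λ σ → bit (subᵇ η σ) * bit (subᵇ σ τ))) ≤⟨ ∑-mono∈ T (λ τ mτ → begin
              ∑ V (λ σ → bit (subᵇ η σ) * bit (subᵇ σ τ)) ≤⟨ ∑-mono V (λ σ → tr σ τ) ⟩
              ∑ V (λ σ → bit (subᵇ η τ) * bit (subᵇ σ τ)) ≡⟨ ∑-* V (bit (subᵇ η τ)) _ ⟩
              bit (subᵇ η τ) * ∑ V (λ σ → bit (subᵇ σ τ)) ≤⟨ *-monoʳ-≤ (bit (subᵇ η τ)) (facetsV τ (⊑-∈ T⊑ mτ)) ⟩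
              bit (subᵇ η τ) * D ≡⟨ *-comm (bit (subᵇ η τ)) D ⟩
              D * bit (subᵇ η τ) ∎) ⟩
          ∑ T (λ τ → D * bit (subᵇ η τ)) ≡⟨ ∑-* T D _ ⟩
          D * degT T η ∎)) (≤-reflexive (sym (*-assoc C₂ D (degT T η)))))
          where
          tr : ∀ σ τ → bit (subᵇ η σ) * bit (subᵇ σ τ) ≤ bit (subᵇ η τ) * bit (subᵇ σ τ)
          tr σ τ with subᵇ η σ in e₁ | subᵇ σ τ in e₂
          ... | false | _ = z≤n
          ... | true | false = ≤-reflexive (sym (*-zeroʳ (bit (subᵇ η τ))))
          ... | true | true = ≤-reflexive (cong (λ z → bit z * 1) (sym (subᵇ-trans η σ τ e₁ e₂)))

      -- A facet σ of η has degree at most of order k·n^(i+1), and η has degree at least of order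
      -- k·n^i. The lost factor n is regained by averaging the cone bound over all n vertices.
      low-level : 2 * dd ≤ n → ∀ k → length Ts ≡ k → All Good Ts → E1 k Ts ≡ 0 → ∀ s → suc s < dd → ∀ F → F ⊑ lv n (suc s) →
        minD (suc s) F ≤ C₁ * Dsum K (δ (lev (suc (suc s))) F)
      low-level 2d≤n k len good e1 s lt F F⊑ = *-cancel-pos n _ _ (s≤s z≤n) (begin
        n * minD (suc s) F ≡⟨ trans (cong (_* minD (suc s) F) (sym (length-vs n))) (sym (∑-const (vs n) (minD (suc s) F))) ⟩
        ∑ (vs n) (λ _ → minD (suc s) F) ≤⟨ ∑-mono (vs n) (λ v → ≤-trans (minD≤ s (<-trans (n<1+n s) lt) F (ι v (χ F))) (≤-reflexive (trans (Dsum-bfilter _ (lv n (suc s))) (∑-cong (lv n (suc s)) (λ σ → cong (λ z → bit z * degK K σ) (homotopy v (χ F) σ)))))) ⟩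
        ∑ (vs n) (λ v → ∑ (lv n (suc s)) (λ σ → bit (ι v X σ) * degK K σ)) ≡⟨ ι-sum n (suc s) X (degK K) ⟩
        ∑ (lv n (suc (suc s))) (λ η → bit (X η) * ∑ (lv n (suc s)) (λ σ → bit (subᵇ σ η) * degK K σ)) ≤⟨ ∑-mono∈ (lv n (suc (suc s))) (λ η mη → ≤-trans (*-monoʳ-≤ (bit (X η)) (inner η mη)) (≤-reflexive (r1 (bit (X η)) (n * C₁) (degK K η)))) ⟩
        ∑ (lv n (suc (suc s))) (λ η → n * C₁ * (bit (X η) * degK K η)) ≡⟨ ∑-* (lv n (suc (suc s))) (n * C₁) _ ⟩
        n * C₁ * ∑ (lv n (suc (suc s))) (λ η → bit (X η) * degK K η) ≡⟨ cong (n * C₁ *_) (sym (trans (cong (λ z → Dsum K (δ z F)) (level-low (suc (suc s)) lt)) (trans (Dsum-bfilter _ (lv n (suc (suc s)))) (∑-cong∈ (lv n (suc (suc s))) (λ η mη → cong (λ z → bit z * degK K η) (odd-list F⊑ η (lv-size n _ mη))))))) ⟩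
        n * C₁ * Dsum K (δ (lev (suc (suc s))) F) ≡⟨ *-assoc n C₁ (Dsum K (δ (lev (suc (suc s))) F)) ⟩
        n * (C₁ * Dsum K (δ (lev (suc (suc s))) F)) ∎)
        where
        open ≤-Reasoning
        X = cob₂ (χ F)
        i = dd ∸ suc (suc s)
        eqi : suc (suc s) + i ≡ dd
        eqi = m+[n∸m]≡n lt
        eqs : dd ∸ suc i ≡ suc s
        eqs = trans (cong (_∸ suc i) (trans (sym eqi) (trans (cong suc (sym (+-suc s i))) refl))) (m+n∸n≡m (suc s) (suc i))
        i<dd : i < dd
        i<dd = subst (i <_) eqi (s≤s (m≤n+m i (suc s)))
        r1 : ∀ x c y → x * (c * y) ≡ c * (x * y)
        r1 = ringℕ
        r2 : ∀ D k n p → D * (suc (2 * D) * k * (n * p)) ≡ n * (D * suc (2 * D)) * (k * p)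
        r2 = ringℕ
        r3 : ∀ n a c y → n * a * (c * y) ≡ n * (a * c) * y
        r3 = ringℕ
        small : ∀ σ → σ ∈ lv n (suc s) → degK K σ ≤ suc (2 * D) * k * n ^ suc i
        small σ mσ = ≤-trans (degK≤degs σ) (≮⇒≥ (ind?≡0 (big? k i σ Ts) (∑≡0 (lv n (dd ∸ suc i)) _ (∑≡0 (upTo dd) _ e1 i (MemP.∈-upTo⁺ i<dd)) σ (subst (λ z → σ ∈ lv n z) (sym eqs) mσ))))
        inner : ∀ η → η ∈ lv n (suc (suc s)) → ∑ (lv n (suc s)) (λ σ → bit (subᵇ σ η) * degK K σ) ≤ n * C₁ * degK K η
        inner η mη = begin
          ∑ (lv n (suc s)) (λ σ → bit (subᵇ σ η) * degK K σ) ≤⟨ ∑-mono∈ (lv n (suc s)) (λ σ mσ → ≤-trans (*-monoʳ-≤ (bit (subᵇ σ η)) (small σ mσ)) (≤-reflexive (*-comm (bit (subᵇ σ η)) _))) ⟩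
          ∑ (lv n (suc s)) (λ σ → suc (2 * D) * k * n ^ suc i * bit (subᵇ σ η)) ≡⟨ trans (∑-* (lv n (suc s)) (suc (2 * D) * k * n ^ suc i) _) (*-comm (suc (2 * D) * k * n ^ suc i) _) ⟩
          ∑ (lv n (suc s)) (λ σ → bit (subᵇ σ η)) * (suc (2 * D) * k * n ^ suc i) ≤⟨ *-monoˡ-≤ (suc (2 * D) * k * n ^ suc i) (≤-trans (facets≤ η (suc s) (lv-size n _ mη)) (≤-trans lt (n≤1+n dd))) ⟩
          D * (suc (2 * D) * k * n ^ suc i) ≡⟨ r2 D k n (n ^ i) ⟩
          n * (D * suc (2 * D)) * (k * n ^ i) ≤⟨ *-monoʳ-≤ (n * (D * suc (2 * D))) (subst (λ z → z * n ^ i ≤ C₂ * D * D * degK K η) len (low-deg 2d≤n good (suc s) i eqi η (lv-size n _ mη))) ⟩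
          n * (D * suc (2 * D)) * (C₂ * D * D * degK K η) ≡⟨ r3 n (D * suc (2 * D)) (C₂ * D * D) (degK K η) ⟩
          n * C₁ * degK K η ∎

    -- The sum serves the top level and the lower levels alike. The factor D^D absorbs the ratio of
    -- the two binomial normalisations, of which one is at most D^D and the other at least 1.
    qᵈ : ℕ
    qᵈ = D ^ D * (b * D + D * suc (2 * D) * (2 ^ dd * dd ! * D * D))

    expanding : 2 * dd ≤ n → ∀ k → length Ts ≡ k → All Good Ts → E1 k Ts ≡ 0 → E3 k Ts ≡ 0 → Expansion.expands n dd K 1 qᵈ ≡ true
    expanding 2d≤n k len good e1 e3 = all-true _ (map suc (upTo dd)) (λ s' ms → per s' (MemP.∈-map⁻ suc ms))
      where
      open Expansion n dd K 1 qᵈ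
      open Cochain 1 qᵈ
      q₁ = D * suc (2 * D) * (2 ^ dd * dd ! * D * D)
      q₀ = b * D + q₁
      bound : ∀ s → s < dd → ∀ F → F ⊑ lv n (suc s) → minD (suc s) F ≤ q₀ * Dsum K (δ (lev (suc (suc s))) F)
      bound s lt F F⊑ with m≤n⇒m<n∨m≡n lt
      ... | inj₁ lt' = ≤-trans (low-level 2d≤n k len good e1 s lt' F F⊑) (*-monoˡ-≤ (Dsum K (δ (lev (suc (suc s))) F)) (m≤n+m q₁ (b * D)))
      ... | inj₂ refl = ≤-trans (top-level k len good e3 F F⊑) (*-monoˡ-≤ (Dsum K (δ (lev (suc (suc s))) F)) (m≤m+n (b * D) q₁))
      C-pos : ∀ s → s < D → 1 ≤ D C s
      C-pos s lt with D C s in eq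
      ... | suc _ = s≤s z≤n
      ... | zero = ⊥-elim (n≮0 (<-≤-trans (m^n>0 (D ∸ s) {{>-nonZero (m<n⇒0<n∸m lt)}} s) (≤-trans (^≤C D s) (≤-reflexive (trans (cong (s ! *_) eq) (*-zeroʳ (s !)))))))
      ok : ∀ s → s < dd → ∀ F → F ∈ sublists (lev (suc s)) → okC (suc s) F ≡ true
      ok s lt F mF = trans (cong (inB (suc s) F ∨_) (≤⇒≤ᵇ≡true (begin
        1 * (D C suc (suc s)) * minD (suc s) F ≤⟨ *-mono-≤ (≤-trans (≤-reflexive (*-identityˡ _)) (≤-trans (C≤^ D (suc (suc s))) (^-monoʳ-≤ D (s≤s lt)))) (bound s lt F (subst (F ⊑_) (level-low (suc s) lt) (sublists-⊑ _ F mF))) ⟩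
        D ^ D * (q₀ * X) ≡⟨ *-assoc (D ^ D) q₀ X ⟨
        qᵈ * X ≡⟨ cong (_* X) (sym (*-identityʳ qᵈ)) ⟩
        qᵈ * 1 * X ≤⟨ *-monoˡ-≤ X (*-monoʳ-≤ qᵈ (C-pos (suc s) (s≤s lt))) ⟩
        qᵈ * (D C suc s) * X ∎))) (BoolP.∨-zeroʳ (inB (suc s) F))
        where open ≤-Reasoning
              X = Dsum K (δ (lev (suc (suc s))) F)
      per : ∀ s' → ∃ (λ s → s ∈ upTo dd × s' ≡ suc s) → all (okC s') (sublists (lev s')) ≡ true
      per .(suc s) (s , ms , refl) = all-true (okC (suc s)) (sublists (lev (suc s))) (ok s (MemP.∈-upTo⁻ ms))

-- Passage to probabilities and to the limit.

module Conclusion (m e : ℕ) (D≤n : suc (suc e) ≤ suc (suc m)) (w : List (Subset (suc (suc m))) → ℕ) (hw : IsDetWeight (suc (suc m)) (suc e) w) where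

  open Deterministic m e D≤n

  private
    complexes : dComplexes n dd ≡ sublists L
    complexes = cong sublists (sizeLevel≡lv n D)

    cases : ∀ T → T ∈ sublists L → _
    cases T mT = hw T (subst (T ∈_) (sym complexes) mT)

  w≡wgt : ∀ T → T ∈ sublists L → w T ≡ wgt T
  w≡wgt T mT = Homology.weight (suc m) e T (sublists-⊑ L T mT) (w T) (cases T mT)

  -- Nonzero weight excludes the second alternative of `IsDetWeight`, so the homology is finite and
  -- `degree-pos` applies.
  ok-good : ∀ {T} → Ok T → Good T
  ok-good {T} (mT , nz) = T⊑ , λ σ mσ → by σ mσ (cases T mT)
    where
    T⊑ = sublists-⊑ L T mT
    by : ∀ σ → σ ∈ V → _ → 1 ≤ degT T σ
    by σ mσ (inj₂ (_ , w0)) = ⊥-elim (nz (trans (sym (w≡wgt T mT)) w0))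
    by σ mσ (inj₁ (k , _ , ho , _)) with degT T σ in eq
    ... | suc _ = s≤s z≤n
    ... | zero = ⊥-elim (Homology.degree-pos (suc m) e T T⊑ k ho σ (lv-size n dd mσ) D≤n (λ τ mτ →
            trans (sym (sgn-Row σ τ (trans (lv-size n D (⊑-∈ T⊑ mτ)) (cong suc (sym (lv-size n dd mσ)))))) (cong (λ b → if b then sgn τ σ else 0ℤ) (off (subᵇ σ τ) (∑≡0 T _ eq τ mτ)))))
      where off : ∀ b → bit b ≡ 0 → b ≡ false
            off false _ = refl

  union : List Face → List (List Face) → List Face
  union A₀ [] = A₀
  union A₀ (T ∷ Ts) = union (unionD n dd A₀ T) Ts

  private
    memb-unionD : ∀ A B τ → τ ∈ L → memb τ (unionD n dd A B) ≡ memb τ A ∨ memb τ B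
    memb-unionD A B τ mτ = memb-bfilter _ (sizeLevel n D) (subst (τ ∈_) (sym (sizeLevel≡lv n D)) mτ)

    unionD-⊑ : ∀ A B → unionD n dd A B ⊑ L
    unionD-⊑ A B = subst (unionD n dd A B ⊑_) (sizeLevel≡lv n D) (sublists-⊑ _ _ (bfilter-sublist _ (sizeLevel n D)))

    union-⊑ : ∀ A₀ Ts → A₀ ⊑ L → union A₀ Ts ⊑ L
    union-⊑ A₀ [] p = p
    union-⊑ A₀ (T ∷ Ts) p = union-⊑ _ Ts (unionD-⊑ A₀ T)

    union-sub : ∀ A₀ Ts τ → τ ∈ L → bit (memb τ (union A₀ Ts)) ≤ bit (memb τ A₀) + mult τ Ts
    union-sub A₀ [] τ mτ = m≤m+n _ 0
    union-sub A₀ (T ∷ Ts) τ mτ = ≤-trans (union-sub (unionD n dd A₀ T) Ts τ mτ) (≤-trans (+-monoˡ-≤ (mult τ Ts) (≤-trans (≤-reflexive (cong bit (memb-unionD A₀ T τ mτ))) (or≤ (memb τ A₀) (memb τ T)))) (≤-reflexive (+-assoc (bit (memb τ A₀)) _ _)))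
      where or≤ : ∀ a b → bit (a ∨ b) ≤ bit a + bit b
            or≤ true b = s≤s z≤n
            or≤ false b = ≤-refl

    union-A₀ : ∀ A₀ Ts τ → τ ∈ L → memb τ A₀ ≡ true → memb τ (union A₀ Ts) ≡ true
    union-A₀ A₀ [] τ mτ h = h
    union-A₀ A₀ (T ∷ Ts) τ mτ h = union-A₀ _ Ts τ mτ (trans (memb-unionD A₀ T τ mτ) (cong (_∨ memb τ T) h))

    union-sup : ∀ A₀ Ts T → T ∈ Ts → ∀ τ → τ ∈ L → memb τ T ≡ true → memb τ (union A₀ Ts) ≡ true
    union-sup A₀ (T ∷ Ts) .T (here refl) τ mτ h = union-A₀ _ Ts τ mτ (trans (memb-unionD A₀ T τ mτ) (trans (cong (memb τ A₀ ∨_) h) (BoolP.∨-zeroʳ (memb τ A₀))))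
    union-sup A₀ (T' ∷ Ts) T (there mT) τ mτ h = union-sup _ Ts T mT τ mτ h

    []⊑ : ∀ {A : Set} (M : List A) → [] ⊑ M
    []⊑ [] = nil
    []⊑ (x ∷ M) = drop ([]⊑ M)

  good : ℕ → List (List Face) → ℕ
  good q Ts = bit (Expansion.expands n dd (union [] Ts) 1 q)

  goodWeight-Ex : ∀ q k A₀ → goodWeight n dd 1 q w k A₀ ≡ Ex k (λ Ts → bit (Expansion.expands n dd (union A₀ Ts) 1 q))
  goodWeight-Ex q zero A₀ with Expansion.expands n dd A₀ 1 q
  ... | true = refl
  ... | false = refl
  goodWeight-Ex q (suc k) A₀ = trans (sum-map (dComplexes n dd) _) (trans (cong (λ z → ∑ z (λ T → w T * goodWeight n dd 1 q w k (unionD n dd A₀ T))) complexes)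
    (∑-cong∈ (sublists L) (λ T mT → cong₂ _*_ (w≡wgt T mT) (goodWeight-Ex q k (unionD n dd A₀ T)))))

  q* : ℕ
  q* = D ^ D * (b * D + D * suc (2 * D) * (2 ^ dd * dd ! * D * D))

  dichotomy : 2 * dd ≤ n → ∀ k Ts → length Ts ≡ k → All Ok Ts → 1 ≤ good q* Ts + (E1 k Ts + (E2 Ts + E3 k Ts))
  dichotomy 2d≤n k Ts len ok = by (E1 k Ts ≟ 0) (E2 Ts ≟ 0) (E3 k Ts ≟ 0)
    where
    Goal = 1 ≤ good q* Ts + (E1 k Ts + (E2 Ts + E3 k Ts))
    by : Dec (E1 k Ts ≡ 0) → Dec (E2 Ts ≡ 0) → Dec (E3 k Ts ≡ 0) → Goal
    by (no p) _ _ = ≤-trans (n≢0⇒n>0 p) (≤-trans (m≤m+n (E1 k Ts) (E2 Ts + E3 k Ts)) (m≤n+m _ (good q* Ts)))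
    by (yes _) (no p) _ = ≤-trans (n≢0⇒n>0 p) (≤-trans (m≤m+n (E2 Ts) (E3 k Ts)) (≤-trans (m≤n+m _ (E1 k Ts)) (m≤n+m _ (good q* Ts))))
    by (yes _) (yes _) (no p) = ≤-trans (n≢0⇒n>0 p) (≤-trans (m≤n+m (E3 k Ts) (E2 Ts)) (≤-trans (m≤n+m _ (E1 k Ts)) (m≤n+m _ (good q* Ts))))
    by (yes e1) (yes e2) (yes e3) = ≤-trans (≤-reflexive (cong bit (sym
          (Union.expanding Ts (union [] Ts) (union-⊑ [] Ts ([]⊑ L)) (λ T mT → proj₁ (ok-good (All.lookup ok mT))) (union-sub [] Ts) (union-sup [] Ts) e2 2d≤n k len (All.map ok-good ok) e1 e3)))) (m≤m+n (good q* Ts) _)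

  c : ℕ → ℕ
  c k = dd * D ^ D + 4 ^ (D * k) + 4

  num : ℕ → ℕ
  num k = probNum n dd 1 q* w k

  den : ∀ k → probDen n dd k ≡ Z ^ k
  den k = trans (cong (n ^_) (*-comm k (m C dd))) (trans (sym (^-*-assoc n (m C dd) k)) (cong (_^ k) (sym (Kalai.kalai m e))))

  -- The total mass Z^k is at most the good mass plus `B`, and n·B ≤ c(k)·Z^k. Hence n ≥ (ε +
  -- 1)·c(k) makes the failure probability at most 1/(ε + 1).
  conclusion : ∀ k → kᵈ ≤ k → ∀ ε → suc ε * c k ≤ n → 2 * dd ≤ n →
    (ε * probDen n dd k ≤ suc ε * num k) × (suc ε * num k ≤ suc (suc ε) * probDen n dd k)
  conclusion k le ε big 2d≤n =
    subst₂ (λ x y → ε * x ≤ suc ε * y) (sym (den k)) (sym (goodWeight-Ex q* k [])) lower ,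
    subst₂ (λ x y → suc ε * y ≤ suc (suc ε) * x) (sym (den k)) (sym (goodWeight-Ex q* k [])) upper
    where
    open ≤-Reasoning
    G B : ℕ
    G = Ex k (good q*)
    B = Ex k (E1 k) + (Ex k E2 + Ex k (E3 k))
    1≤k : 1 ≤ k
    1≤k = ≤-trans (s≤s z≤n) le
    total : Z ^ k ≤ G + B
    total = begin
      Z ^ k ≡⟨ Ex-1 k ⟨
      Ex k (λ _ → 1) ≤⟨ Ex-mono k (dichotomy 2d≤n k) ⟩
      Ex k (λ Ts → good q* Ts + (E1 k Ts + (E2 Ts + E3 k Ts))) ≡⟨ trans (Ex-+ k (good q*) _) (cong (G +_) (trans (Ex-+ k (E1 k) _) (cong (Ex k (E1 k) +_) (Ex-+ k E2 (E3 k))))) ⟩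
      G + B ∎
    nB : n * B ≤ c k * Z ^ k
    nB = begin
      n * B ≡⟨ r n (Ex k (E1 k)) (Ex k E2) (Ex k (E3 k)) ⟩
      n * Ex k (E1 k) + n * Ex k E2 + n * Ex k (E3 k) ≤⟨ +-mono-≤ (+-mono-≤ (E1-bound k 1≤k) (E2-bound k)) (E3-bound k le) ⟩
      dd * D ^ D * Z ^ k + 4 ^ (D * k) * Z ^ k + 4 * Z ^ k ≡⟨ r2 (dd * D ^ D) (4 ^ (D * k)) (Z ^ k) ⟩
      c k * Z ^ k ∎
      where r : ∀ n a b c → n * (a + (b + c)) ≡ n * a + n * b + n * c
            r = ringℕ
            r2 : ∀ a b z → a * z + b * z + 4 * z ≡ (a + b + 4) * z
            r2 = ringℕ
    small : suc ε * B ≤ Z ^ k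
    small = *-cancel-pos (c k) _ _ (≤-trans (s≤s z≤n) (m≤n+m 4 (dd * D ^ D + 4 ^ (D * k)))) (begin
      c k * (suc ε * B) ≡⟨ r (c k) (suc ε) B ⟩
      suc ε * c k * B ≤⟨ *-monoˡ-≤ B big ⟩
      n * B ≤⟨ nB ⟩
      c k * Z ^ k ∎)
      where r : ∀ a b x → a * (b * x) ≡ b * a * x
            r = ringℕ
    lower : ε * Z ^ k ≤ suc ε * G
    lower = +-cancelˡ-≤ (Z ^ k) _ _ (begin
      suc ε * Z ^ k ≤⟨ *-monoʳ-≤ (suc ε) total ⟩
      suc ε * (G + B) ≡⟨ *-distribˡ-+ (suc ε) G B ⟩
      suc ε * G + suc ε * B ≤⟨ +-monoʳ-≤ (suc ε * G) small ⟩
      suc ε * G + Z ^ k ≡⟨ +-comm (suc ε * G) (Z ^ k) ⟩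
      Z ^ k + suc ε * G ∎)
    upper : suc ε * G ≤ suc (suc ε) * Z ^ k
    upper = ≤-trans (*-monoʳ-≤ (suc ε) (≤-trans (Ex-mono k (λ Ts _ _ → bit≤1 _)) (≤-reflexive (Ex-1 k)))) (*-monoˡ-≤ (Z ^ k) (n≤1+n (suc ε)))

theorem1 : (d : ℕ) → 1 ≤ d →
    (W : (n : ℕ) → List (Subset n) → ℕ) → (∀ n → IsDetWeight n d (W n)) →
    Σ ℕ λ kd → Σ ℕ λ p → Σ ℕ λ q → 1 ≤ p × 1 ≤ q ×
    (∀ k → kd ≤ k → ∀ e → Σ ℕ λ N → ∀ n → N ≤ n →
    (e * probDen n d k ≤ suc e * probNum n d p q (W n) k) ×
    (suc e * probNum n d p q (W n) k ≤ suc (suc e) * probDen n d k))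
theorem1 (suc e) _ W hW = kd , 1 , q , ≤-refl , 1≤q , λ k le ε → N k ε , λ n → main k le ε n
  where
  D = suc (suc e)
  b = suc (8 * D * 2 ^ D)
  -- These repeat `kᵈ` and `q*`, which are defined in modules indexed by the number of vertices
  -- although their values depend on the dimension alone.
  kd = (4 * (12 * (D * D * D) + 5) + 3 * D) * D
  q = D ^ D * (b * D + D * suc (2 * D) * (2 ^ suc e * suc e ! * D * D))
  1≤q : 1 ≤ q
  1≤q = *-mono-≤ (m^n>0 D D) (s≤s z≤n)
  c : ℕ → ℕ
  c k = suc e * D ^ D + 4 ^ (D * k) + 4
  N : ℕ → ℕ → ℕ
  -- The first summand gives `D` ≤ n and the room used in `low-deg`; the second makes the error at
  -- most 1/(ε + 1).
  N k ε = 2 * D + suc ε * c k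
  main : ∀ k → kd ≤ k → ∀ ε n → N k ε ≤ n →
    (ε * probDen n (suc e) k ≤ suc ε * probNum n (suc e) 1 q (W n) k) × (suc ε * probNum n (suc e) 1 q (W n) k ≤ suc (suc ε) * probDen n (suc e) k)
  main k le ε zero ()
  main k le ε (suc zero) (s≤s ())
  main k le ε n@(suc (suc m)) big = Conclusion.conclusion m e D≤n (W n) (hW n) k le ε (≤-trans (m≤n+m _ (2 * D)) big) 2d≤n
    where
    2D≤n : 2 * D ≤ n
    2D≤n = ≤-trans (m≤m+n (2 * D) _) big
    D≤n : D ≤ n
    D≤n = ≤-trans (m≤m+n D (D + 0)) 2D≤n
    2d≤n : 2 * suc e ≤ n
    2d≤n = ≤-trans (*-monoʳ-≤ 2 (n≤1+n (suc e))) 2D≤n
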